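{- Let $m$ and $n$ be positive integers, and put $\kappa := m + 2n-1$ and $n':=2n-1$. Then \begin{align*} &\sum_{s_*}\mathcal{B}_{m,n'}(s_*;q^{n'})\left(\prod_{i=1}^{m-1}(-q^{n-1/2};q^{n-1/2})_{s_{i}^{(0)}-s_{i+1}^{(0)}}\right)q^{\mathcal{A}_{m,n'}(s_*)+\frac{1}{2}s^{(0)}} \\ &\qquad = \frac{(q^\kappa;q^\kappa)_\infty^n}{(q;q)_\infty^{n-1}(q^{1/2};q^{1/2})_\infty} \prod_{i=1}^n\theta(q^{i+m/2-1/2};q^\kappa) \prod_{1 \leq i < j \leq n}\theta(q^{j-i},q^{i+j-2};q^\kappa), \end{align*} where the sum ranges over all families of integers $s_i^{(j)}$ ($1\le i\le m$, $0\le j\le n'-1$) with $s_1^{(j)}\ge\cdots\ge s_m^{(j)}$ for each $j$ and $s_i^{(j)}\ge s_i^{(j+1)}$ for $0\le j\le n'-1$ (where $s_i^{(n')}=0$).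
   Context: Notation: for $k\ge 0$ an integer, $(a;p)_k=(1-a)(1-ap)\cdots(1-ap^{k-1})$, $(a;p)_\infty=\prod_{j\ge0}(1-ap^j)$; $\theta(a;p)=(a;p)_\infty(p/a;p)_\infty$ and $\theta(a_1,\dots,a_k;p)=\theta(a_1;p)\cdots\theta(a_k;p)$. Identities are of formal power series in $q^{1/2}$. For positive integers $M,N$ and integers $s_i^{(j)}$ ($1\le i\le M$, $0\le j\le N$), with the conventions $s_i^{(N)}=0$ for all $i$ and $s_{M+1}^{(j)}=0$ for all $j$, and $s^{(j)}:=s_1^{(j)}+\cdots+s_M^{(j)}$, define $$\mathcal{A}_{M,N}(s_*)= -\tfrac{N}{2}s^{(0)}+s^{(1)}+\cdots+s^{(N-1)}+\tfrac{N}{2}\sum_{i=1}^M\sum_{a=1}^N\big(s_i^{(a-1)}-s_i^{(a)}\big)^2,$$ $$\mathcal{B}_{M,N}(s_*;p)=\prod_{i=1}^M\prod_{a=1}^N\frac{(p;p)_{s_i^{(a-1)}-s_{i+1}^{(a)}}}{(p;p)_{s_i^{(a-1)}-s_i^{(a)}}\,(p;p)_{s_i^{(a)}-s_{i+1}^{(a)}}}\ \prod_{i=1}^M\frac{1}{(p;p)_{s_i^{(0)}-s_{i+1}^{(0)}}}.$$ -}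

module Defs where

open import Data.Nat as ℕ using (ℕ; zero; suc; _∸_; _≤ᵇ_; _≡ᵇ_; _<?_)
open import Data.Integer as ℤ using (ℤ; +_; -[1+_])
open import Data.Bool using (Bool; true; false; if_then_else_; _∧_)
open import Data.List using (List; []; _∷_; map; foldr; upTo; concatMap; filterᵇ)
open import Data.Fin using (Fin; fromℕ<)
import Data.Fin as Fin
open import Relation.Nullary using (yes; no)

-- Formal power series in t = q^{1/2} with integer coefficients,
-- represented by their coefficient sequences.

Series : Set
Series = ℕ → ℤ

sumℤ : List ℤ → ℤ
sumℤ = foldr ℤ._+_ (+ 0)

_⊛_ : Series → Series → Series
(f ⊛ g) K = sumℤ (map (λ i → f i ℤ.* g (K ∸ i)) (upTo (suc K)))

infixl 7 _⊛_

_⊕_ : Series → Series → Series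
(f ⊕ g) K = f K ℤ.+ g K

oneS : Series
oneS zero    = + 1
oneS (suc _) = + 0

monoS : ℤ → ℕ → Series
monoS c e K = if K ≡ᵇ e then c else + 0

prodS : List Series → Series
prodS = foldr _⊛_ oneS

powS : Series → ℕ → Series
powS f zero    = oneS
powS f (suc k) = f ⊛ powS f k

shiftZ : ℤ → Series → Series
shiftZ e F K with (+ K) ℤ.- e
... | + k      = F k
... | -[1+ _ ] = + 0

-- Multiplicative inverse of a series f with f 0 = 1:
-- b 0 = 1,  b j = - Σ_{i=1}^{j} f i · b (j - i).
-- invCoeffs f K j is b j for every j ≤ K.
invCoeffs : Series → ℕ → (ℕ → ℤ)
invCoeffs f zero    j = if j ≡ᵇ 0 then + 1 else + 0
invCoeffs f (suc K) j =
  if j ≤ᵇ K then invCoeffs f K j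
  else ℤ.- sumℤ (map (λ i → f (suc i) ℤ.* invCoeffs f K (K ∸ i)) (upTo (suc K)))

invS : Series → Series
invS f K = invCoeffs f K K

poch : ℤ → ℕ → ℕ → ℕ → Series
poch c α β k = prodS (map (λ j → oneS ⊕ monoS (ℤ.- c) (α ℕ.+ j ℕ.* β)) (upTo k))

-- (c t^α ; t^β)_∞ for β ≥ 1: factors with j ≥ K+1 have exponent > K,
-- so the coefficient of t^K equals that of the first K+1 factors.
pochInf : ℤ → ℕ → ℕ → Series
pochInf c α β K = poch c α β (suc K) K

-- θ(t^α ; t^β) = (t^α; t^β)_∞ (t^{β-α}; t^β)_∞   (used with α ≤ β)
theta : ℕ → ℕ → Series
theta α β = pochInf (+ 1) α β ⊛ pochInf (+ 1) (β ∸ α) β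

-- Families s_i^{(j)}, 0-indexed: i < M (paper's i-1), j < N.
Fam : ℕ → ℕ → Set
Fam M N = Fin M → Fin N → ℕ

-- extension by the conventions s_i^{(N)} = 0, s_{M+1}^{(j)} = 0
ext : ∀ {M N} → Fam M N → ℕ → ℕ → ℕ
ext {M} {N} s i j with i <? M | j <? N
... | yes p | yes q = s (fromℕ< p) (fromℕ< q)
... | _     | _     = 0

funs : ∀ {A : Set} (k : ℕ) → List A → List (Fin k → A)
funs zero    xs = (λ ()) ∷ []
funs (suc k) xs =
  concatMap (λ x → map (λ g → λ { Fin.zero → x ; (Fin.suc i) → g i }) (funs k xs)) xs

allB : List ℕ → (ℕ → Bool) → Bool
allB xs p = foldr (λ x b → p x ∧ b) true xs

valid : ∀ {M N} → Fam M N → Bool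
valid {M} {N} s =
  allB (upTo M) (λ i → allB (upTo N) (λ j →
    (ext s (suc i) j ≤ᵇ ext s i j) ∧ (ext s i (suc j) ≤ᵇ ext s i j)))

colSum : ∀ {M N} → Fam M N → ℕ → ℕ
colSum {M} s j = foldr ℕ._+_ 0 (map (λ i → ext s i j) (upTo M))

twoA : ∀ {M N} → Fam M N → ℤ
twoA {M} {N} s =
    ℤ.- ((+ N) ℤ.* (+ colSum s 0))
  ℤ.+ (+ 2) ℤ.* sumℤ (map (λ j → + colSum s (suc j)) (upTo (N ∸ 1)))
  ℤ.+ (+ N) ℤ.* sumℤ (map (λ i → sumℤ (map (λ a →
          let d = (+ ext s i a) ℤ.- (+ ext s i (suc a)) in d ℤ.* d)
        (upTo N))) (upTo M))

qp : ℕ → ℕ → Series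
qp π k = poch (+ 1) π π k

calB : ∀ {M N} → ℕ → Fam M N → Series
calB {M} {N} π s =
  prodS (concatMap (λ i → map (λ a →
      qp π (ext s i a ∸ ext s (suc i) (suc a))
        ⊛ invS (qp π (ext s i a ∸ ext s i (suc a)) ⊛ qp π (ext s i (suc a) ∸ ext s (suc i) (suc a))))
    (upTo N)) (upTo M))
  ⊛ prodS (map (λ i → invS (qp π (ext s i 0 ∸ ext s (suc i) 0))) (upTo M))

n′ : ℕ → ℕ
n′ n = 2 ℕ.* n ∸ 1

summand : (m n : ℕ) → Fam m (n′ n) → Series
summand m n s =
  shiftZ (twoA s ℤ.+ (+ colSum s 0))
    (calB (2 ℕ.* n′ n) s
      ⊛ prodS (map (λ i → poch (ℤ.- (+ 1)) (n′ n) (n′ n) (ext s i 0 ∸ ext s (suc i) 0))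
                   (upTo (m ∸ 1))))

lhsPartial : (m n B K : ℕ) → ℤ
lhsPartial m n B K =
  sumℤ (map (λ s → summand m n s K)
            (filterᵇ valid (funs m (funs (n′ n) (upTo (suc B))))))

rhs : (m n : ℕ) → Series
rhs m n =
  (powS (pochInf (+ 1) (2 ℕ.* κ) (2 ℕ.* κ)) n
    ⊛ prodS (map (λ i′ → theta (2 ℕ.* i′ ℕ.+ m ℕ.+ 1) (2 ℕ.* κ)) (upTo n))
    ⊛ prodS (concatMap (λ j′ → map (λ i′ →
         theta (2 ℕ.* (j′ ∸ i′)) (2 ℕ.* κ) ⊛ theta (2 ℕ.* (i′ ℕ.+ j′)) (2 ℕ.* κ))
        (upTo j′)) (upTo n)))
  ⊛ invS (powS (pochInf (+ 1) 2 2) (n ∸ 1) ⊛ pochInf (+ 1) 1 1)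
  where κ = m ℕ.+ n′ n

module Submission where

-- Read the left-hand side column by column: each column of s contributes a sum of lattice-path (q-boson) weights, and modulo a
-- high power of q the whole sum becomes a bounded Littlewood sum Σ_λ P_λ(x; t) over λ with parts at most m, in finitely many
-- variables filling 2n-1 progressions of difference 2n-1. Such a sum equals a sum over the sign changes of the variables (after
-- Macdonald), in which for these specialised variables only few sign patterns survive. The surviving terms form a Laplace
-- expansion of a determinant whose transpose belongs to the parameters with m moved into the base; there the sum collapses to a
-- single product, which is the right-hand side. Identities of power series are obtained in a ring of Laurent series as
-- congruences modulo q^(J/2) for each J.
open import Algebra.Solver.Ring.AlmostCommutativeRing using (AlmostCommutativeRing; _-Raw-AlmostCommutative⟶_)
open import Data.Nat as ℕ using (ℕ; zero; suc; _≤_; _<_; s≤s; z≤n) renaming (_+_ to _+n_; _*_ to _*n_)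
open import Data.Integer as ℤ using (ℤ; +_; -[1+_]) renaming (_+_ to _+z_; _*_ to _*z_; _-_ to _-z_; -_ to -z_)
import Data.Integer.Properties as Z
import Data.Nat.Properties as N
open import Relation.Binary.PropositionalEquality as E using (_≡_; cong; cong₂; subst) renaming (refl to rfl)
open import Data.Maybe using (Maybe; just; nothing)
open import Relation.Nullary using (yes; no)
open import Relation.Binary.Definitions using (WeaklyDecidable)
open import Algebra.Bundles using (CommutativeRing; RawRing)
open import Level using (0ℓ)
Ring : Set₁
Ring = CommutativeRing 0ℓ 0ℓ
module RingSolver(R : Ring)where
 open CommutativeRing R hiding (zero)
 open import Algebra.Properties.Ring ring using (-‿distribˡ-*; -‿distribʳ-*; -0#≈0#; -‿+-comm; -‿involutive)
 open import Relation.Binary.Reasoning.Setoid setoid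
 -- Evaluates 0 and 1 to 0# and 1# on the nose, so that solver constants match hand-written goals.
 natR : ℕ → Carrier
 natR 0 = 0#
 natR 1 = 1#
 natR(suc(suc n)) = 1# + natR(suc n)
 natR-suc : ∀ n → natR(suc n) ≈ 1# + natR n
 natR-suc zero = sym(+-identityʳ 1#)
 natR-suc(suc n) = refl
 natR-+ : ∀ m n → natR(m +n n) ≈ natR m + natR n
 natR-+ zero n = sym(+-identityˡ _)
 natR-+ (suc m)n = begin _ ≈⟨ natR-suc(m +n n) ⟩ _ ≈⟨ +-congˡ(natR-+ m n) ⟩ _ ≈⟨ sym(+-assoc _ _ _) ⟩ _ ≈⟨ +-congʳ(sym(natR-suc m)) ⟩ _ ∎
 natR-* : ∀ m n → natR(m *n n) ≈ natR m * natR n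
 natR-* zero n = sym(zeroˡ _)
 natR-* (suc m)n = begin _ ≈⟨ natR-+ n(m *n n) ⟩ _ ≈⟨ +-cong(sym(*-identityˡ _))(natR-* m n) ⟩ _ ≈⟨ sym(distribʳ _ _ _) ⟩ _ ≈⟨ *-congʳ(sym
  (natR-suc m)) ⟩ _ ∎
 intR : ℤ → Carrier
 intR(+ n) = natR n
 intR -[1+ n ] = - natR(suc n)
 intR-neg : ∀ i → intR(-z i) ≈ - intR i
 intR-neg(+ zero) = sym -0#≈0#
 intR-neg(+ suc n) = refl
 intR-neg -[1+ n ] = sym(-‿involutive _)
 intR-⊖ : ∀ m n → intR(m ℤ.⊖ n) ≈ natR m - natR n
 intR-⊖ m zero = begin intR(m ℤ.⊖ 0) ≡⟨ cong intR(Z.⊖-≥ {m}{0}z≤n) ⟩ natR m ≈⟨ sym(+-identityʳ _) ⟩ natR m + 0# ≈⟨ +-congˡ(sym -0#≈0#) ⟩ natR m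
  - 0# ∎
 intR-⊖ zero(suc n) = begin _ ≈⟨ sym(+-identityˡ _) ⟩ _ ∎
 intR-⊖ (suc m)(suc n) = begin intR(suc m ℤ.⊖ suc n) ≡⟨ cong intR(Z.[1+m]⊖[1+n]≡m⊖n m n) ⟩ intR(m ℤ.⊖ n) ≈⟨ intR-⊖ m n ⟩ natR m - natR n ≈⟨
  +-congʳ(sym(+-identityˡ _)) ⟩ 0# + natR m - natR n ≈⟨ +-congʳ(+-congʳ(sym(-‿inverseʳ 1#))) ⟩ 1# - 1# + natR m - natR n ≈⟨ +-congʳ(+-assoc _ _
  _) ⟩ 1# + (- 1# + natR m) - natR n ≈⟨ +-congʳ(+-congˡ(+-comm _ _)) ⟩ 1# + (natR m - 1#) - natR n ≈⟨ +-congʳ(sym(+-assoc _ _ _)) ⟩ 1# + natR m -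
  1# - natR n ≈⟨ +-assoc _ _ _ ⟩ 1# + natR m + (- 1# - natR n) ≈⟨ +-cong(sym(natR-suc m))(-‿+-comm _ _) ⟩ natR(suc m) - (1# + natR n) ≈⟨ +-congˡ
  (-‿cong(sym(natR-suc n))) ⟩ natR(suc m) - natR(suc n) ∎
 intR-+ : ∀ i j → intR(i +z j) ≈ intR i + intR j
 intR-+ (+ m)(+ n) = natR-+ m n
 intR-+ (+ m) -[1+ n ] = intR-⊖ m(suc n)
 intR-+ -[1+ m ](+ n) = trans(intR-⊖ n(suc m))(+-comm _ _)
 intR-+ -[1+ m ] -[1+ n ] = begin - natR(suc(suc(m +n n))) ≡⟨ cong(λ k → - natR(suc k))(E.sym(N.+-suc m n)) ⟩ - natR(suc m +n suc n) ≈⟨ -‿cong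
  (natR-+ (suc m)(suc n)) ⟩ - (natR(suc m) + natR(suc n)) ≈⟨ sym(-‿+-comm _ _) ⟩ - natR(suc m) - natR(suc n) ∎
 intR-*⁺ : ∀ m j → intR(+ m *z j) ≈ natR m * intR j
 intR-*⁺ m(+ n) = trans(reflexive(cong intR(E.sym(Z.pos-* m n))))(natR-* m n)
 intR-*⁺ m -[1+ n ] = begin intR(+ m *z -[1+ n ]) ≡⟨ cong intR(E.sym(Z.neg-distribʳ-* (+ m)(+ suc n))) ⟩ intR(-z(+ m *z + suc n)) ≈⟨ intR-neg(+
  m *z + suc n) ⟩ - intR(+ m *z + suc n) ≈⟨ -‿cong(trans(reflexive(cong intR(E.sym(Z.pos-* m(suc n)))))(natR-* m(suc n))) ⟩ - (natR m * natR
  (suc n)) ≈⟨ -‿distribʳ-* _ _ ⟩ natR m * - natR(suc n) ∎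
 intR-* : ∀ i j → intR(i *z j) ≈ intR i * intR j
 intR-* (+ m)j = intR-*⁺ m j
 intR-* -[1+ m ] j = begin intR(-[1+ m ] *z j) ≡⟨ cong intR(E.sym(Z.neg-distribˡ-* (+ suc m)j)) ⟩ intR(-z(+ suc m *z j)) ≈⟨ intR-neg(+ suc m *z
  j) ⟩ - intR(+ suc m *z j) ≈⟨ -‿cong(intR-*⁺ (suc m)j) ⟩ - (natR(suc m) * intR j) ≈⟨ -‿distribˡ-* _ _ ⟩ - natR(suc m) * intR j ∎
 almost : AlmostCommutativeRing 0ℓ 0ℓ
 almost = record{ isAlmostCommutativeRing = record{ isCommutativeSemiring = isCommutativeSemiring ; -‿cong = -‿cong ; -‿*-distribˡ = λ x y → sym
  (-‿distribˡ-* x y) ; -‿+-comm = -‿+-comm } }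
 ℤ-raw : RawRing 0ℓ 0ℓ
 ℤ-raw = CommutativeRing.rawRing Z.+-*-commutativeRing
 intR-morphism : ℤ-raw -Raw-AlmostCommutative⟶ almost
 intR-morphism = record{ ⟦_⟧ = intR ; +-homo = intR-+ ; *-homo = intR-* ; -‿homo = intR-neg ; 0-homo = refl ; 1-homo = refl }
 intR≟ : WeaklyDecidable(λ i j → intR i ≈ intR j)
 intR≟ i j with i ℤ.≟ j
 ... | yes rfl = just refl
 ... | no _ = nothing
 open import Algebra.Solver.Ring ℤ-raw almost intR-morphism intR≟ public using (Polynomial; solve; _:=_; _:+_; _:*_; _:-_; :-_; con; _:^_)
 𝟎 𝟏 𝟐 : ∀ {n} → Polynomial n
 𝟎 = con(+ 0)
 𝟏 = con(+ 1)
 𝟐 = con(+ 2)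
open import Data.List using (List; []; _∷_; _++_; map; length; concatMap)
open import Data.List.Relation.Unary.All as All using (All; []; _∷_)
open import Data.List.Relation.Binary.Permutation.Propositional as P using (_↭_; prep; swap; ↭-refl; ↭-sym; ↭-trans)
open import Data.List.Relation.Binary.Permutation.Propositional.Properties using (shift)
module Sums(R : Ring)where
 open CommutativeRing R hiding (zero) renaming (Carrier to |R|; *-congˡ to *ˡ; *-congʳ to *ʳ; +-congˡ to +ˡ; +-congʳ to +ʳ; *-identityˡ to 1*; *-cong
  to *c; +-cong to +c; trans to infixr 1 _·_)
 open RingSolver R
 infixr 8 _^ᵣ_
 _^ᵣ_ : |R| → ℕ → |R|
 x ^ᵣ zero = 1#
 x ^ᵣ suc n = x * x ^ᵣ n
 ^ᵣ-cong : ∀ {x y}n → x ≈ y → x ^ᵣ n ≈ y ^ᵣ n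
 ^ᵣ-cong zero e = refl
 ^ᵣ-cong(suc n)e = *c e(^ᵣ-cong n e)
 ^ᵣ-+ : ∀ x m n → x ^ᵣ(m +n n) ≈ x ^ᵣ m * x ^ᵣ n
 ^ᵣ-+ x zero n = sym(1* _)
 ^ᵣ-+ x(suc m)n = *ˡ(^ᵣ-+ x m n) · sym(*-assoc _ _ _)
 ^ᵣ-* : ∀ x y n → (x * y) ^ᵣ n ≈ x ^ᵣ n * y ^ᵣ n
 ^ᵣ-* x y zero = sym(1* _)
 ^ᵣ-* x y(suc n) = *ˡ(^ᵣ-* x y n) · solve 4(λ a b c d → (a :* b) :* (c :* d) := (a :* c) :* (b :* d))refl x y _ _
 +-interchange : ∀ a b c d → (a + b) + (c + d) ≈ (a + c) + (b + d)
 +-interchange = solve 4(λ a b c d → (a :+ b) :+ (c :+ d) := (a :+ c) :+ (b :+ d))refl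
 *-interchange : ∀ a b c d → (a * b) * (c * d) ≈ (a * c) * (b * d)
 *-interchange = solve 4(λ a b c d → (a :* b) :* (c :* d) := (a :* c) :* (b :* d))refl
 module _{A : Set}where
  ∏ : (A → |R|) → List A → |R|
  ∏ φ [] = 1#
  ∏ φ(x ∷ xs) = φ x * ∏ φ xs
  ∑ : (A → |R|) → List A → |R|
  ∑ φ [] = 0#
  ∑ φ(x ∷ xs) = φ x + ∑ φ xs
  ∏-cong-All : ∀ {φ ψ xs} → All(λ x → φ x ≈ ψ x)xs → ∏ φ xs ≈ ∏ ψ xs
  ∏-cong-All [] = refl
  ∏-cong-All(p ∷ ps) = *c p(∏-cong-All ps)
  ∏-cong : ∀ {φ ψ} → (∀ x → φ x ≈ ψ x) → ∀ xs → ∏ φ xs ≈ ∏ ψ xs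
  ∏-cong e xs = ∏-cong-All(All.universal e xs)
  ∏-++ : ∀ φ xs ys → ∏ φ(xs ++ ys) ≈ ∏ φ xs * ∏ φ ys
  ∏-++ φ [] ys = sym(1* _)
  ∏-++ φ(x ∷ xs)ys = *ˡ(∏-++ φ xs ys) · sym(*-assoc _ _ _)
  ∏-↭ : ∀ φ{xs ys} → xs ↭ ys → ∏ φ xs ≈ ∏ φ ys
  ∏-↭ φ P.refl = refl
  ∏-↭ φ(prep x p) = *ˡ(∏-↭ φ p)
  ∏-↭ φ(swap x y p) = *ˡ(*ˡ(∏-↭ φ p)) · solve 3(λ a b c → a :* (b :* c) := b :* (a :* c))refl _ _ _
  ∏-↭ φ(P.trans p q) = ∏-↭ φ p · ∏-↭ φ q
  ∏-* : ∀ φ ψ xs → ∏ (λ x → φ x * ψ x)xs ≈ ∏ φ xs * ∏ ψ xs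
  ∏-* φ ψ [] = sym(1* _)
  ∏-* φ ψ(x ∷ xs) = *ˡ(∏-* φ ψ xs) · *-interchange _ _ _ _
  ∏-1 : ∀ xs → ∏ (λ _ → 1#)xs ≈ 1#
  ∏-1 [] = refl
  ∏-1(x ∷ xs) = 1* _ · ∏-1 xs
  ∏-const : ∀ c xs → ∏ (λ _ → c)xs ≈ c ^ᵣ length xs
  ∏-const c [] = refl
  ∏-const c(x ∷ xs) = *ˡ(∏-const c xs)
  ∑-cong-All : ∀ {φ ψ xs} → All(λ x → φ x ≈ ψ x)xs → ∑ φ xs ≈ ∑ ψ xs
  ∑-cong-All [] = refl
  ∑-cong-All(p ∷ ps) = +c p(∑-cong-All ps)
  ∑-cong : ∀ {φ ψ} → (∀ x → φ x ≈ ψ x) → ∀ xs → ∑ φ xs ≈ ∑ ψ xs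
  ∑-cong e xs = ∑-cong-All(All.universal e xs)
  ∑-++ : ∀ φ xs ys → ∑ φ(xs ++ ys) ≈ ∑ φ xs + ∑ φ ys
  ∑-++ φ [] ys = sym(+-identityˡ _)
  ∑-++ φ(x ∷ xs)ys = +ˡ(∑-++ φ xs ys) · sym(+-assoc _ _ _)
  ∑-+ : ∀ φ ψ xs → ∑ (λ x → φ x + ψ x)xs ≈ ∑ φ xs + ∑ ψ xs
  ∑-+ φ ψ [] = sym(+-identityˡ _)
  ∑-+ φ ψ(x ∷ xs) = +ˡ(∑-+ φ ψ xs) · +-interchange _ _ _ _
  ∑-*ˡ : ∀ c φ xs → ∑ (λ x → c * φ x)xs ≈ c * ∑ φ xs
  ∑-*ˡ c φ [] = sym(zeroʳ _)
  ∑-*ˡ c φ(x ∷ xs) = +ˡ(∑-*ˡ c φ xs) · sym(distribˡ _ _ _)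
  ∑-0 : ∀ xs → ∑ (λ _ → 0#)xs ≈ 0#
  ∑-0 [] = refl
  ∑-0(x ∷ xs) = +-identityˡ _ · ∑-0 xs
  pairs : (A → A → |R|) → List A → |R|
  pairs γ [] = 1#
  pairs γ(x ∷ xs) = ∏ (γ x)xs * pairs γ xs
  cross : (A → A → |R|) → List A → List A → |R|
  cross γ hs rs = ∏ (λ h → ∏ (γ h)rs)hs
  cross-[]ʳ : ∀ γ hs → cross γ hs [] ≈ 1#
  cross-[]ʳ γ hs = ∏-1 hs
  cross-∷ʳ : ∀ γ hs x rs → cross γ hs(x ∷ rs) ≈ ∏ (λ h → γ h x)hs * cross γ hs rs
  cross-∷ʳ γ hs x rs = ∏-* (λ h → γ h x)(λ h → ∏ (γ h)rs)hs
  cross-++ʳ : ∀ γ hs xs ys → cross γ hs(xs ++ ys) ≈ cross γ hs xs * cross γ hs ys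
  cross-++ʳ γ hs xs ys = ∏-cong(λ h → ∏-++ (γ h)xs ys)hs · ∏-* _ _ hs
  cross-++ˡ : ∀ γ xs ys rs → cross γ(xs ++ ys)rs ≈ cross γ xs rs * cross γ ys rs
  cross-++ˡ γ xs ys rs = ∏-++ _ xs ys
  cross-↭ : ∀ γ{hs hs' rs rs'} → hs ↭ hs' → rs ↭ rs' → cross γ hs rs ≈ cross γ hs' rs'
  cross-↭ γ{hs}p q = ∏-cong(λ h → ∏-↭ (γ h)q)hs · ∏-↭ _ p
  pairs-↭ : ∀ γ → (∀ x y → γ x y ≈ γ y x) → ∀ {xs ys} → xs ↭ ys → pairs γ xs ≈ pairs γ ys
  pairs-↭ γ s P.refl = refl
  pairs-↭ γ s(prep x p) = *c(∏-↭ (γ x)p)(pairs-↭ γ s p)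
  pairs-↭ γ s(swap{xs = xs}{ys = ys}x y p) = *c(*c(s x y)(∏-↭ (γ x)p))(*c(∏-↭ (γ y)p)(pairs-↭ γ s p))
   · solve 4(λ a b c d → (a :* b) :* (c :* d) := (a :* c) :* (b :* d))refl _ _ _ _
  pairs-↭ γ s(P.trans p q) = pairs-↭ γ s p · pairs-↭ γ s q
  pairs-++ : ∀ γ xs ys → pairs γ(xs ++ ys) ≈ pairs γ xs * pairs γ ys * cross γ xs ys
  pairs-++ γ [] ys = solve 1(λ a → a := 𝟏 :* a :* 𝟏)refl _
  pairs-++ γ(x ∷ xs)ys = *c(∏-++ (γ x)xs ys)(pairs-++ γ xs ys) · solve 5(λ a b c d e → (a :* b) :* (c :* d :* e) := a :* c :* d :* (b :* e))
   refl _ _ _ _ _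
  Split : Set
  Split = List A → List A → |R|
  -- The sum of F h r over all ways of splitting a list into a sublist h and its complement r.
  spl : List A → Split → |R|
  spl [] F = F [] []
  spl(x ∷ xs)F = spl xs(λ h r → F(x ∷ h)r) + spl xs(λ h r → F h(x ∷ r))
  spl-cong : ∀ {F G}xs → (∀ h r → xs ↭ h ++ r → F h r ≈ G h r) → spl xs F ≈ spl xs G
  spl-cong [] e = e [] [] ↭-refl
  spl-cong(x ∷ xs)e = +c(spl-cong xs(λ h r p → e(x ∷ h)r(prep x p)))(spl-cong xs(λ h r p → e h(x ∷ r)(↭-trans(prep x p)(↭-sym(shift x h
   r)))))
  spl-cong' : ∀ {F G}xs → (∀ h r → F h r ≈ G h r) → spl xs F ≈ spl xs G
  spl-cong' xs e = spl-cong xs(λ h r _ → e h r)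
  spl-+ : ∀ F G xs → spl xs(λ h r → F h r + G h r) ≈ spl xs F + spl xs G
  spl-+ F G [] = refl
  spl-+ F G(x ∷ xs) = +c(spl-+ _ _ xs)(spl-+ _ _ xs) · +-interchange _ _ _ _
  spl-*ˡ : ∀ c F xs → spl xs(λ h r → c * F h r) ≈ c * spl xs F
  spl-*ˡ c F [] = refl
  spl-*ˡ c F(x ∷ xs) = +c(spl-*ˡ c _ xs)(spl-*ˡ c _ xs) · sym(distribˡ _ _ _)
  spl-0 : ∀ {F}xs → (∀ h r → xs ↭ h ++ r → F h r ≈ 0#) → spl xs F ≈ 0#
  spl-0 [] e = e [] [] ↭-refl
  spl-0(x ∷ xs)e = +c(spl-0 xs(λ h r p → e(x ∷ h)r(prep x p)))(spl-0 xs(λ h r p → e h(x ∷ r)(↭-trans(prep x p)(↭-sym(shift x h r))))) ·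
   +-identityˡ _
  Respects : Split → Set
  Respects F = ∀ {h h' r r'} → h ↭ h' → r ↭ r' → F h r ≈ F h' r'
  spl-↭ : ∀ {F} → Respects F → ∀ {xs ys} → xs ↭ ys → spl xs F ≈ spl ys F
  spl-↭ ρ P.refl = refl
  spl-↭ ρ(prep x p) = +c(spl-↭ (λ q r → ρ(prep x q)r)p)(spl-↭ (λ q r → ρ q(prep x r))p)
  spl-↭ {F}ρ(swap{xs = xs}{ys = ys}x y p) = +c(+c(spl-cong' xs(λ h r → ρ(swap x y ↭-refl) ↭-refl))refl)(+c refl(spl-cong' xs(λ h r → ρ
   ↭-refl(swap x y ↭-refl)))) · +-interchange _ _ _ _ · +c(+c(spl-↭ (λ q r → ρ(prep y(prep x q))r)p)(spl-↭ (λ q r → ρ(prep y q)(prep x r))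
   p))(+c(spl-↭ (λ q r → ρ(prep x q)(prep y r))p)(spl-↭ (λ q r → ρ q(prep y(prep x r)))p))where
   a : Split → List A → |R|
   a G zs = spl zs G
  spl-↭ ρ(P.trans p q) = spl-↭ ρ p · spl-↭ ρ q
  spl-++ : ∀ F xs ys → spl(xs ++ ys)F ≈ spl xs(λ h r → spl ys(λ h' r' → F(h ++ h')(r ++ r')))
  spl-++ F [] ys = refl
  spl-++ F(x ∷ xs)ys = +c(spl-++ _ xs ys)(spl-++ _ xs ys)
  spl-assoc : ∀ (F : List A → List A → List A → |R|)xs → spl xs(λ h r → spl h(λ k h' → F k h' r)) ≈ spl xs(λ k r → spl r(λ h' r' → F k h' r'))
  spl-assoc F [] = refl
  spl-assoc F(x ∷ xs) = +c(spl-+ _ _ xs)refl · +c(+c(spl-assoc _ xs)(spl-assoc _ xs))(spl-assoc _ xs) · +-assoc _ _ _ · +ˡ(sym(spl-+ _ _ xs))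
  pick : List A → (A → List A → |R|) → |R|
  pick [] F = 0#
  pick(x ∷ xs)F = F x xs + pick xs(λ y ys → F y(x ∷ ys))
  pick-cong : ∀ {F G}xs → (∀ y ys → xs ↭ y ∷ ys → F y ys ≈ G y ys) → pick xs F ≈ pick xs G
  pick-cong [] e = refl
  pick-cong(x ∷ xs)e = +c(e x xs ↭-refl)(pick-cong xs(λ y ys p → e y(x ∷ ys)(↭-trans(prep x p)(swap x y ↭-refl))))
  pick-+ : ∀ F G xs → pick xs(λ y ys → F y ys + G y ys) ≈ pick xs F + pick xs G
  pick-+ F G [] = sym(+-identityˡ _)
  pick-+ F G(x ∷ xs) = +ˡ(pick-+ _ _ xs) · +-interchange _ _ _ _
  pick-*ˡ : ∀ c F xs → pick xs(λ y ys → c * F y ys) ≈ c * pick xs F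
  pick-*ˡ c F [] = sym(zeroʳ _)
  pick-*ˡ c F(x ∷ xs) = +ˡ(pick-*ˡ c _ xs) · sym(distribˡ _ _ _)
  -- Moving one element from the left part to the right part.
  spl-pick : ∀ (F : List A → A → List A → |R|)xs → spl xs(λ h r → pick h(λ y h' → F h' y r)) ≈ spl xs(λ h r → pick r(λ y r' → F h y r'))
  spl-pick F [] = refl
  spl-pick F(x ∷ xs) = +c(spl-+ _ _ xs)refl · +c(+ˡ(spl-pick _ xs))(spl-pick _ xs)
   · solve 3(λ a b c → (a :+ b) :+ c := b :+ (a :+ c))refl _ _ _ · +ˡ(sym(spl-+ _ _ xs))
  pick-split : ∀ (F : List A → A → List A → |R|)xs → pick xs(λ y ys → spl ys(λ h r → F h y r)) ≈ spl xs(λ h r → pick h(λ y h' → F h' y r))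
  pick-split F [] = refl
  pick-split F(x ∷ xs) = +ˡ(pick-+ _ _ xs) · (+ˡ(+c(pick-split _ xs)(pick-split _ xs)) · sym(+-assoc _ _ _)) · +ʳ(sym(spl-+ _ _ xs))
 ∏-map : ∀ {A B : Set}(φ : B → |R|)(f : A → B)xs → ∏ φ(map f xs) ≈ ∏ (λ x → φ(f x))xs
 ∏-map φ f [] = refl
 ∏-map φ f(x ∷ xs) = *ˡ(∏-map φ f xs)
 ∑-map : ∀ {A B : Set}(φ : B → |R|)(f : A → B)xs → ∑ φ(map f xs) ≈ ∑ (λ x → φ(f x))xs
 ∑-map φ f [] = refl
 ∑-map φ f(x ∷ xs) = +ˡ(∑-map φ f xs)
 ∑-concatMap : ∀ {A B : Set}(φ : B → |R|)(f : A → List B)xs → ∑ φ(concatMap f xs) ≈ ∑ (λ x → ∑ φ(f x))xs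
 ∑-concatMap φ f [] = refl
 ∑-concatMap φ f(x ∷ xs) = ∑-++ φ(f x)_ · +ˡ(∑-concatMap φ f xs)
 ∑-swap : ∀ {A B : Set}(φ : A → B → |R|)xs ys → ∑ (λ x → ∑ (φ x)ys)xs ≈ ∑ (λ y → ∑ (λ x → φ x y)xs)ys
 ∑-swap φ [] ys = sym(∑-0 ys)
 ∑-swap φ(x ∷ xs)ys = +ˡ(∑-swap φ xs ys) · sym(∑-+ _ _ ys)
 ∏-swap : ∀ {A B : Set}(φ : A → B → |R|)xs ys → ∏ (λ x → ∏ (φ x)ys)xs ≈ ∏ (λ y → ∏ (λ x → φ x y)xs)ys
 ∏-swap φ [] ys = sym(∏-1 ys)
 ∏-swap φ(x ∷ xs)ys = *ˡ(∏-swap φ xs ys) · sym(∏-* _ _ ys)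
 -- Σ_{r+k=N} φ r k
 conv : ℕ → (ℕ → ℕ → |R|) → |R|
 conv zero φ = φ 0 0
 conv(suc N)φ = φ 0(suc N) + conv N(λ r k → φ(suc r)k)
 conv-cong : ∀ N{φ ψ} → (∀ r k → r +n k ≡ N → φ r k ≈ ψ r k) → conv N φ ≈ conv N ψ
 conv-cong zero e = e 0 0 rfl
 conv-cong(suc N)e = +c(e 0(suc N)rfl)(conv-cong N(λ r k p → e(suc r)k(cong suc p)))
 conv-+ : ∀ N φ ψ → conv N(λ r k → φ r k + ψ r k) ≈ conv N φ + conv N ψ
 conv-+ zero φ ψ = refl
 conv-+ (suc N)φ ψ = +ˡ(conv-+ N _ _) · +-interchange _ _ _ _
 conv-*ˡ : ∀ N c φ → conv N(λ r k → c * φ r k) ≈ c * conv N φ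
 conv-*ˡ zero c φ = refl
 conv-*ˡ(suc N)c φ = +ˡ(conv-*ˡ N c _) · sym(distribˡ _ _ _)
 conv-last : ∀ N φ → conv(suc N)φ ≈ conv N(λ r k → φ r(suc k)) + φ(suc N)0
 conv-last zero φ = refl
 conv-last(suc N)φ = +ˡ(conv-last N(λ r k → φ(suc r)k)) · sym(+-assoc _ _ _)
 conv-flip : ∀ N φ → conv N φ ≈ conv N(λ r k → φ k r)
 conv-flip zero φ = refl
 conv-flip(suc N)φ = +ˡ(conv-flip N _) · +-comm _ _ · sym(conv-last N(λ r k → φ k r))
 conv-assoc : ∀ N(φ : ℕ → ℕ → ℕ → |R|) → conv N(λ r k → conv r(λ a b → φ a b k)) ≈ conv N(λ a s → conv s(λ b k → φ a b k))
 conv-assoc zero φ = refl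
 conv-assoc(suc N)φ = +ˡ(conv-+ N _ _) · sym(+-assoc _ _ _) · +ˡ(conv-assoc N(λ a → φ(suc a)))
 -- Σ_{r+k=N, r≥1} φ r k
 conv⁺ : ℕ → (ℕ → ℕ → |R|) → |R|
 conv⁺ zero φ = 0#
 conv⁺ (suc N)φ = conv N(λ r k → φ(suc r)k)
 conv-head : ∀ N φ → conv N φ ≈ φ 0 N + conv⁺ N φ
 conv-head zero φ = sym(+-identityʳ _)
 conv-head(suc N)φ = refl
 conv⁺-cong : ∀ N{φ ψ} → (∀ r k → suc r +n k ≡ N → φ(suc r)k ≈ ψ(suc r)k) → conv⁺ N φ ≈ conv⁺ N ψ
 conv⁺-cong zero e = refl
 conv⁺-cong(suc N)e = conv-cong N(λ r k p → e r k(cong suc p))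
 conv⁺-+ : ∀ N φ ψ → conv⁺ N(λ r k → φ r k + ψ r k) ≈ conv⁺ N φ + conv⁺ N ψ
 conv⁺-+ zero φ ψ = sym(+-identityˡ _)
 conv⁺-+ (suc N)φ ψ = conv-+ N _ _
 conv⁺-*ˡ : ∀ N c φ → conv⁺ N(λ r k → c * φ r k) ≈ c * conv⁺ N φ
 conv⁺-*ˡ zero c φ = sym(zeroʳ c)
 conv⁺-*ˡ(suc N)c φ = conv-*ˡ N c _
open import Data.Vec using (Vec; []; _∷_; zipWith) renaming (map to vmap)
open import Data.List.Relation.Unary.AllPairs as AllPairs using (AllPairs; []; _∷_)
open import Data.Product using (Σ; _,_)
module Polynomials(R : Ring)where
 open CommutativeRing R hiding (zero) renaming (Carrier to |R|; *-congˡ to *ˡ; *-congʳ to *ʳ; +-congˡ to +ˡ; +-congʳ to +ʳ; *-identityˡ to 1*; -‿cong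
  to -ᶜ; *-cong to *c; +-cong to +c; trans to infixr 1 _·_)
 open RingSolver R
 Regular : |R| → Set
 Regular a = ∀ y → a * y ≈ 0# → y ≈ 0#
 Regular-cong : ∀ {a b} → a ≈ b → Regular a → Regular b
 Regular-cong e ρ y z = ρ y(*ʳ e · z)
 reg-* : ∀ {a b} → Regular a → Regular b → Regular(a * b)
 reg-* ρ σ y z = σ y(ρ _(sym(*-assoc _ _ _) · z))
 invertible⇒reg : ∀ {a b} → a * b ≈ 1# → Regular a
 invertible⇒reg{a}{b}e y z = sym(1* y) · *ʳ(sym e) · solve 3(λ a b y → a :* b :* y := b :* (a :* y))refl a b y · *ˡ z · zeroʳ b
 x-y≈0⇒x≈y : ∀ {x y} → x - y ≈ 0# → x ≈ y
 x-y≈0⇒x≈y{x}{y}e = solve 2(λ x y → x := (x :- y) :+ y)refl x y · +ʳ e · +-identityˡ y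
 x≈y⇒x-y≈0 : ∀ {x y} → x ≈ y → x - y ≈ 0#
 x≈y⇒x-y≈0{x}{y}e = +ʳ e · -‿inverseʳ y
 reg-cancel : ∀ {a x y} → Regular a → a * x ≈ a * y → x ≈ y
 reg-cancel{a}{x}{y}ρ e = x-y≈0⇒x≈y(ρ(x - y)(solve 3(λ a x y → a :* (x :- y) := a :* x :- a :* y)refl a x y · x≈y⇒x-y≈0 e))
 eval : ∀ {n} → Vec |R| n → |R| → |R|
 eval [] z = 0#
 eval(c ∷ cs)z = c + z * eval cs z
 add : ∀ {n} → Vec |R| n → Vec |R| n → Vec |R| n
 add = zipWith _+_
 scale : ∀ {n} → |R| → Vec |R| n → Vec |R| n
 scale a = vmap(a *_)
 snoc0 : ∀ {n} → Vec |R| n → Vec |R| (suc n)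
 snoc0 [] = 0# ∷ []
 snoc0(c ∷ cs) = c ∷ snoc0 cs
 eval-add : ∀ {n}(cs ds : Vec |R| n)z → eval(add cs ds)z ≈ eval cs z + eval ds z
 eval-add [] [] z = sym(+-identityˡ _)
 eval-add(c ∷ cs)(d ∷ ds)z = +ˡ(*ˡ(eval-add cs ds z)) · solve 5(λ c d z x y → c :+ d :+ z :* (x :+ y) := c :+ z :* x :+ (d :+ z :* y))refl c d
  z _ _
 eval-scale : ∀ {n}a(cs : Vec |R| n)z → eval(scale a cs)z ≈ a * eval cs z
 eval-scale a [] z = sym(zeroʳ a)
 eval-scale a(c ∷ cs)z = +ˡ(*ˡ(eval-scale a cs z)) · solve 4(λ a c z x → a :* c :+ z :* (a :* x) := a :* (c :+ z :* x))refl a c z _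
 eval-snoc0 : ∀ {n}(cs : Vec |R| n)z → eval(snoc0 cs)z ≈ eval cs z
 eval-snoc0 [] z = +ˡ(zeroʳ z) · +-identityˡ 0#
 eval-snoc0(c ∷ cs)z = +ˡ(*ˡ(eval-snoc0 cs z))
 IsPoly : ℕ → (|R| → |R|) → Set
 IsPoly d φ = Σ(Vec |R| (suc d))λ cs → ∀ z → φ z ≈ eval cs z
 poly-const : ∀ c → IsPoly 0(λ _ → c)
 poly-const c = c ∷ [] , λ z → sym(+ˡ(zeroʳ z) · +-identityʳ c)
 poly-+ : ∀ {d φ ψ} → IsPoly d φ → IsPoly d ψ → IsPoly d(λ z → φ z + ψ z)
 poly-+ (cs , e)(ds , e') = add cs ds , λ z → _·_(+c(e z)(e' z))(sym(eval-add cs ds z))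
 poly-scale : ∀ {d φ}a → IsPoly d φ → IsPoly d(λ z → a * φ z)
 poly-scale a(cs , e) = scale a cs , λ z → _·_(*ˡ(e z))(sym(eval-scale a cs z))
 poly-linear : ∀ {d φ}a b → IsPoly d φ → IsPoly(suc d)(λ z → (a + b * z) * φ z)
 poly-linear{φ = φ}a b(cs , e) = add(scale a(snoc0 cs))(0# ∷ scale b cs) , λ z → ((*ˡ(e z))
  · (solve 4(λ a b z x → (a :+ b :* z) :* x := a :* x :+ (𝟎 :+ z :* (b :* x)))refl a b z _) · (+c(*ˡ(sym(eval-snoc0 cs z))
  · sym(eval-scale a(snoc0 cs)z))(+ˡ(*ˡ(sym(eval-scale b cs z))))) · (sym(eval-add(scale a(snoc0 cs))(0# ∷ scale b cs)z)))
 poly-cong : ∀ {d φ ψ} → (∀ z → φ z ≈ ψ z) → IsPoly d φ → IsPoly d ψ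
 poly-cong h(cs , e) = cs , λ z → _·_(sym(h z))(e z)
 quot : ∀ {n} → Vec |R| (suc n) → |R| → Vec |R| n
 quot(c ∷ [])a = []
 quot(c ∷ d ∷ ds)a = add(d ∷ ds)(scale a(snoc0(quot(d ∷ ds)a)))
 eval-quot : ∀ {n}(cs : Vec |R| (suc n))a z → eval cs z - eval cs a ≈ (z - a) * eval(quot cs a)z
 eval-quot(c ∷ [])a z = solve 3(λ c a z → (c :+ z :* 𝟎) :- (c :+ a :* 𝟎) := (z :- a) :* 𝟎)refl c a z
 eval-quot(c ∷ ds@(_ ∷ _))a z = solve 5(λ c z a x y → c :+ z :* x :- (c :+ a :* y) := (z :- a) :* x :+ a :* (x :- y))refl c z a _ _
  · +ˡ(*ˡ(eval-quot ds a z)) · solve 4(λ z a x y → (z :- a) :* x :+ a :* ((z :- a) :* y) := (z :- a) :* (x :+ a :* y))refl z a _ _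
  · *ˡ(+ˡ(*ˡ(sym(eval-snoc0(quot ds a)z)) · sym(eval-scale a(snoc0(quot ds a))z))) · *ˡ(sym(eval-add ds(scale a(snoc0(quot ds a)))z))
 eval-vanish : ∀ {n}(cs : Vec |R| n)(as : List |R|) → length as E.≡ n → AllPairs(λ a b → Regular(b - a))as → All(λ a → eval cs a ≈ 0#)as → ∀ z
  → eval cs z ≈ 0#
 eval-vanish [] [] l _ _ z = refl
 eval-vanish(c ∷ cs)(a ∷ as)rfl(ρ ∷ ρs)(v ∷ vs)z = factor z · *ˡ(eval-vanish q as rfl ρs(transfer as ρ vs)z) · zeroʳ _ where
  q = quot(c ∷ cs)a
  factor : ∀ z → eval(c ∷ cs)z ≈ (z - a) * eval q z
  factor z = solve 1(λ x → x := x :- 𝟎)refl _ · +ˡ(-ᶜ(sym v)) · eval-quot(c ∷ cs)a z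
  transfer : ∀ bs → All(λ b → Regular(b - a))bs → All(λ b → eval(c ∷ cs)b ≈ 0#)bs → All(λ b → eval q b ≈ 0#)bs
  transfer [] [] [] = []
  transfer(b ∷ bs)(r ∷ rs)(w ∷ ws) = r(eval q b)(sym(factor b) · w) ∷ transfer bs rs ws
 -- A polynomial function of degree at most d with d + 1 zeros at regular mutual distance vanishes.
 poly-vanish : ∀ {d φ} → IsPoly d φ → (as : List |R|) → length as E.≡ suc d → AllPairs(λ a b → Regular(b - a))as → All(λ a → φ a ≈ 0#)as → ∀ z →
  φ z ≈ 0#
 poly-vanish(cs , e)as l ρ v z = e z · eval-vanish cs as l ρ(All.map(λ{a}w → _·_(sym(e a))w)v)z
open import Data.Integer.Tactic.RingSolver using () renaming (solve-∀ to ringℤ)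
open import Relation.Binary.PropositionalEquality using (_≢_)
-- A ring with the powers of an invertible element T 1, none of whose non-trivial powers is 1 modulo a zero divisor.
record Char(R : Ring) : Set where
 open CommutativeRing R hiding (zero)
 field
  T : ℤ → Carrier
  T-+ : ∀ a b → T(a +z b) ≈ T a * T b
  T-0 : T(+ 0) ≈ 1#
  ι : ℤ → Carrier
  ι-law : ∀ a → a ≢ + 0 → (1# - T a) * ι a ≈ 1#
module CharProperties(R : Ring)(χ : Char R)where
 open CommutativeRing R hiding (zero) renaming (Carrier to |R|; +-congˡ to +ˡ; +-congʳ to +ʳ; -‿cong to -ᶜ; reflexive to rfx; trans to infixr 1 _·_)
 open Char χ
 open RingSolver R
 open Polynomials R
 open Sums R
 infix 9 ⟦_⟧
 ⟦_⟧ : ℤ → |R|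
 ⟦ a ⟧ = 1# - T a
 T-cong : ∀ {a b} → a ≡ b → T a ≈ T b
 T-cong e = rfx(cong T e)
 ⟦⟧-cong : ∀ {a b} → a ≡ b → ⟦ a ⟧ ≈ ⟦ b ⟧
 ⟦⟧-cong e = rfx(cong ⟦_⟧ e)
 ⟦0⟧ : ∀ {a} → a ≡ + 0 → ⟦ a ⟧ ≈ 0#
 ⟦0⟧ rfl = +ˡ(-ᶜ T-0) · -‿inverseʳ 1#
 T-inv : ∀ a → T a * T(-z a) ≈ 1#
 T-inv a = sym(T-+ a(-z a)) · T-cong(Z.+-inverseʳ a) · T-0
 T-invˡ : ∀ a → T(-z a) * T a ≈ 1#
 T-invˡ a = *-comm _ _ · T-inv a
 T-reg : ∀ a → Regular(T a)
 T-reg a = invertible⇒reg(T-inv a)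
 ⟦⟧-reg : ∀ {a} → a ≢ + 0 → Regular ⟦ a ⟧
 ⟦⟧-reg{a}p = invertible⇒reg(ι-law a p)
 T-diff : ∀ a b → T b - T a ≈ T b * ⟦ a -z b ⟧
 T-diff a b = +ˡ(-ᶜ(T-cong(eq a b) · T-+ b(a -z b))) · solve 2(λ x y → x :- x :* y := x :* (𝟏 :- y))refl _ _ where
  eq : ∀ a b → a ≡ b +z(a -z b)
  eq = ringℤ
 a-b≡0⇒a≡b : ∀ a b → a -z b ≡ + 0 → a ≡ b
 a-b≡0⇒a≡b a b = Z.i-j≡0⇒i≡j a b
 T-diff-reg : ∀ {a b} → a ≢ b → Regular(T b - T a)
 T-diff-reg{a}{b}p = Regular-cong(sym(T-diff a b))(reg-* (T-reg b)(⟦⟧-reg(λ e → p(a-b≡0⇒a≡b a b e))))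
 ⟦neg⟧ : ∀ a → ⟦ -z a ⟧ ≈ - (T(-z a) * ⟦ a ⟧)
 ⟦neg⟧ a = +ʳ(sym(T-invˡ a)) · solve 2(λ x y → x :* y :- x := :- (x :* (𝟏 :- y)))refl _ _
open import Data.List.Relation.Binary.Permutation.Propositional.Properties using (All-resp-↭)
module Kernel(R : Ring)(χ : Char R)(D : ℤ)where
 open CommutativeRing R hiding (zero) renaming (Carrier to |R|; *-congˡ to *ˡ; *-congʳ to *ʳ; +-congˡ to +ˡ; +-congʳ to +ʳ; -‿cong to -ᶜ; *-cong to
  *c; +-cong to +c; trans to infixr 1 _·_)
 open Char χ
 open RingSolver R
 open Polynomials R
 open Sums R
 open CharProperties R χ
 Dist : List ℤ → Set
 Dist = AllPairs _≢_
 P : |R|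
 P = T D
 -- f a b = (x - P y) / (x - y) for x = T a and y = T b.
 f : ℤ → ℤ → |R|
 f a b = ⟦ D +z b -z a ⟧ * ι(b -z a)
 -- γ c b = (1 - P) z / (x - z) and γ′ c b = (1 - P) x / (x - z) for z = T c and x = T b.
 γ γ' : ℤ → ℤ → |R|
 γ c b = (P - 1#) * ι(b -z c)
 γ' c b = γ c b + (1# - P)
 T-split : ∀ a b → T b ≈ T a * T(b -z a)
 T-split a b = T-cong(eq a b) · T-+ a(b -z a)where
  eq : ∀ a b → b ≡ a +z(b -z a)
  eq = ringℤ
 ι-law' : ∀ {a b} → a ≢ b → ⟦ b -z a ⟧ * ι(b -z a) ≈ 1#
 ι-law'{a}{b}p = ι-law(b -z a)(λ e → p(E.sym(a-b≡0⇒a≡b b a e)))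
 f-law : ∀ {a b} → a ≢ b → (T a - T b) * f a b ≈ T a - P * T b
 f-law{a}{b}p = *ʳ(+ˡ(-ᶜ(T-split a b))) · solve 4(λ x u n i → (x :- x :* u) :* (n :* i) := x :* n :* ((𝟏 :- u) :* i))refl _ _ _ _
  · *c(*ˡ(+ˡ(-ᶜ(T-cong(Z.+-assoc D b(-z a)) · T-+ D _))))(ι-law' p) · solve 3(λ x u p → x :* (𝟏 :- p :* u) :* 𝟏 := x :- p :* (x :* u))refl _
  _ _ · +ˡ(-ᶜ(*ˡ(sym(T-split a b))))where
  u = T(b -z a)
 γ-law : ∀ {c b} → c ≢ b → (T b - T c) * γ c b ≈ (1# - P) * T c
 γ-law{c}{b}p = *ʳ(+ʳ(T-split c b)) · solve 4(λ x u q i → (x :* u :- x) :* ((q :- 𝟏) :* i) := (𝟏 :- q) :* x :* ((𝟏 :- u) :* i))refl _ _ _ _ ·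
  *ˡ(ι-law' p) · *-identityʳ _ where
  u = T(b -z c)
 γ'-law : ∀ {c b} → c ≢ b → (T b - T c) * γ' c b ≈ (1# - P) * T b
 γ'-law{c}{b}p = distribˡ _ _ _ · +ʳ(γ-law p) · solve 3(λ q x z → (𝟏 :- q) :* z :+ (x :- z) :* (𝟏 :- q) := (𝟏 :- q) :* x)refl P(T b)(T c)
 γγ' : ∀ {c b} → c ≢ b → T c * γ' c b ≈ T b * γ c b
 γγ'{c}{b}p = reg-cancel(T-diff-reg{c}{b}p)(solve 3(λ d c g → d :* (c :* g) := c :* (d :* g))refl _ _ _ · *ˡ(γ'-law p)
  · solve 3(λ c q b → c :* (q :* b) := b :* (q :* c))refl _ _ _ · *ˡ(sym(γ-law p))
  · solve 3(λ b d g → b :* (d :* g) := d :* (b :* g))refl _ _ _)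
 -- A function δ c b with numerator (1 - P) ν and denominator x - z, where ν is either z or x.
 record Pole(δ : ℤ → ℤ → |R|)(ρ ρ' : |R|) : Set where
  field
   left : ∀ {c x y} → c ≢ x → c ≢ y → y ≢ x → δ c x * f y x ≈ f y c * δ c x - δ c y * δ y x
   right : ∀ {c x y} → c ≢ x → c ≢ y → y ≢ x → δ c x * f x y ≈ f c y * δ c x + δ c y * δ y x
   left0 : ∀ {c y} → c ≢ y → f y c ≈ ρ + δ c y
   right0 : ∀ {c y} → c ≢ y → f c y ≈ ρ' - δ c y
 private
  module Scalars{c x y : ℤ}(p : c ≢ x)(q : c ≢ y)(r : y ≢ x)where
   r' : x ≢ y
   r' e = r(E.sym e)
   q' : y ≢ c
   q' e = q(E.sym e)
   Z X Y : |R|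
   Z = T c
   X = T x
   Y = T y
   den : Regular((X - Z) * ((Y - X) * (Y - Z)))
   den = reg-* (T-diff-reg p)(reg-* (T-diff-reg{x}{y}r')(T-diff-reg{c}{y}q))
   leftZ : ∀ u w s(ν μ : |R|) → (X - Z) * u ≈ (1# - P) * ν → (Y - Z) * w ≈ (1# - P) * ν → (X - Y) * s ≈ (1# - P) * μ → ν * ((Y - P * X) * (Y - Z) -
    (Y - P * Z) * (Y - X)) ≈ ν * ((1# - P) * μ * (X - Z)) → u * f y x ≈ f y c * u - w * s
   leftZ u w s ν μ lu lw ls final = reg-cancel den(solve 5(λ a b c u v → a :* (b :* c) :* (u :* v) := (a :* u) :* (b :* v) :* c)refl _ _ _ _ _
    · *ʳ(*c lu(f-law r)) · solve 5(λ q n x y z → (𝟏 :- q) :* n :* (y :- q :* x) :* (y :- z) := (𝟏 :- q) :* (n :* ((y :- q :* x) :* (y :- z) :- (y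
    :- q :* z) :* (y :- x)) :+ n :* ((y :- q :* z) :* (y :- x))))refl P ν X Y Z · *ˡ(+ʳ final)
    · solve 6(λ q n m x y z → (𝟏 :- q) :* (n :* ((𝟏 :- q) :* m :* (x :- z)) :+ n :* ((y :- q :* z) :* (y :- x))) := ((𝟏 :- q) :* n) :* (y :- q :* z)
    :* (y :- x) :+ ((𝟏 :- q) :* n) :* ((𝟏 :- q) :* m) :* (x :- z))refl P ν μ X Y Z
    · +c(*ʳ(*c(sym lu)(sym(f-law q'))))(*ʳ(*c(sym lw)(sym ls))) · solve 7(λ x y z u w s v → ((x :- z) :* u) :* ((y :- z) :* v) :* (y :- x)
    :+ ((y :- z) :* w) :* ((x :- y) :* s) :* (x :- z) := (x :- z) :* ((y :- x) :* (y :- z)) :* (v :* u :- w :* s))refl X Y Z u w s(f y c))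
   rightZ : ∀ u w s(ν μ : |R|) → (X - Z) * u ≈ (1# - P) * ν → (Y - Z) * w ≈ (1# - P) * ν → (X - Y) * s ≈ (1# - P) * μ → ν * ((X - P * Y) * (Z - Y) -
    (Z - P * Y) * (X - Y)) ≈ ν * (- ((1# - P) * μ * (X - Z))) → u * f x y ≈ f c y * u + w * s
   rightZ u w s ν μ lu lw ls final = reg-cancel den(solve 5(λ x y z u v → (x :- z) :* ((y :- x) :* (y :- z)) :* (u :* v) := ((x :- z) :* u) :* ((x
    :- y) :* v) :* (z :- y))refl X Y Z _ _ · *ʳ(*c lu(f-law r')) · solve 5(λ q n x y z → (𝟏 :- q) :* n :* (x :- q :* y) :* (z :- y) := (𝟏 :- q) :*
    (n :* ((x :- q :* y) :* (z :- y) :- (z :- q :* y) :* (x :- y)) :+ n :* ((z :- q :* y) :* (x :- y))))refl P ν X Y Z · *ˡ(+ʳ final)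
    · solve 6(λ q n m x y z → (𝟏 :- q) :* (n :* (:- ((𝟏 :- q) :* m :* (x :- z))) :+ n :* ((z :- q :* y) :* (x :- y))) := ((𝟏 :- q) :* n) :* (z :- q
    :* y) :* (x :- y) :- ((𝟏 :- q) :* n) :* ((𝟏 :- q) :* m) :* (x :- z))refl P ν μ X Y Z
    · +c(*ʳ(*c(sym lu)(sym(f-law q))))(-ᶜ(*ʳ(*c(sym lw)(sym ls))))
    · solve 7(λ x y z u w s v → ((x :- z) :* u) :* ((z :- y) :* v) :* (x :- y) :- ((y :- z) :* w) :* ((x :- y) :* s) :* (x :- z) := (x :- z) :* ((y
    :- x) :* (y :- z)) :* (v :* u :+ w :* s))refl X Y Z u w s(f c y))
   poly1 : ∀ ν → ν * ((Y - P * X) * (Y - Z) - (Y - P * Z) * (Y - X)) ≈ ν * ((1# - P) * Y * (X - Z))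
   poly1 ν = solve 5(λ n q x y z → n :* ((y :- q :* x) :* (y :- z) :- (y :- q :* z) :* (y :- x)) := n :* ((𝟏 :- q) :* y :* (x :- z)))refl ν P X Y Z
   poly2 : ∀ ν → ν * ((X - P * Y) * (Z - Y) - (Z - P * Y) * (X - Y)) ≈ ν * (- ((1# - P) * Y * (X - Z)))
   poly2 ν = solve 5(λ n q x y z → n :* ((x :- q :* y) :* (z :- y) :- (z :- q :* y) :* (x :- y)) := n :* (:- ((𝟏 :- q) :* y :* (x :- z))))refl ν P X
    Y Z
  one : ∀ {c y} → c ≢ y → f y c ≈ 1# + γ c y
  one{c}{y}p = reg-cancel(T-diff-reg{c}{y}p)(f-law(λ e → p(E.sym e))
   · solve 3(λ q y z → y :- q :* z := (y :- z) :+ (𝟏 :- q) :* z)refl _ _ _ · +c(sym(*-identityʳ _))(sym(γ-law p)) · sym(distribˡ _ _ _))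
  two : ∀ {c y} → c ≢ y → f c y ≈ P - γ c y
  two{c}{y}p = reg-cancel(T-diff-reg{c}{y}p)(solve 3(λ y z v → (y :- z) :* v := :- ((z :- y) :* v))refl _ _ _ · -ᶜ(f-law p)
   · solve 3(λ q y z → :- (z :- q :* y) := (y :- z) :* q :- (𝟏 :- q) :* z)refl _ _ _ · +ˡ(-ᶜ(sym(γ-law p)))
   · solve 3(λ d q g → d :* q :- d :* g := d :* (q :- g))refl _ _ _)
 pole : Pole γ 1# P
 pole = record{left = λ{c}{x}{y}p q r → let open Scalars p q r in leftZ(γ c x)(γ c y)(γ y x)Z Y(γ-law p)(γ-law q)(γ-law r)(poly1 Z);
  right = λ{c}{x}{y}p q r → let open Scalars p q r in rightZ(γ c x)(γ c y)(γ y x)Z Y(γ-law p)(γ-law q)(γ-law r)(poly2 Z); left0 = one;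
  right0 = two}
 private
  γ'≈ : ∀ {c x} → c ≢ x → γ' c x ≈ T(x -z c) * γ c x
  γ'≈ {c}{x}p = reg-cancel(T-reg c)(γγ' p · *ʳ(T-split c x) · *-assoc _ _ _)
  chain : ∀ {c x y} → c ≢ x → c ≢ y → y ≢ x → T(x -z c) * (γ c y * γ y x) ≈ γ' c y * γ' y x
  chain{c}{x}{y}p q r = *ʳ(T-cong(eq x y c) · T-+ _ _) · *-interchange _ _ _ _ · *c(sym(γ'≈ q))(sym(γ'≈ r))where
   eq : ∀ x y c → x -z c ≡ (y -z c) +z(x -z y)
   eq = ringℤ
 pole' : Pole γ' P 1#
 pole' = record{left = λ{c}{x}{y}p q r → ((*ʳ(γ'≈ p)) · (*-assoc _ _ _) · (*ˡ(Pole.left pole p q r))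
  · (solve 4(λ t f g s → t :* (f :* g :- s) := f :* (t :* g) :- t :* s)refl _ _ _ _)
  · (+c(*ˡ(sym(γ'≈ p)))(-ᶜ(chain p q r)))); right = λ{c}{x}{y}p q r → ((*ʳ(γ'≈ p)) · (*-assoc _ _ _) · (*ˡ(Pole.right pole p q r))
  · (solve 4(λ t f g s → t :* (f :* g :+ s) := f :* (t :* g) :+ t :* s)refl _ _ _ _)
  · (+c(*ˡ(sym(γ'≈ p)))(chain p q r))); left0 = λ{c}{y}p → _·_(one p)(solve 2(λ g q → 𝟏 :+ g := q :+ (g :+ (𝟏 :- q)))refl _ P); right0 = λ
  {c}{y}p → _·_(two p)(solve 2(λ g q → q :- g := 𝟏 :- (g :+ (𝟏 :- q)))refl _ P)}
 module Expansion{δ ρ ρ'}(π : Pole δ ρ ρ')where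
  open Pole π
  expandˡ : ∀ {c}S → All(c ≢_)S → Dist S → pick S(λ j S' → δ c j * ∏ (λ i → f i j)S') ≈ ∏ (λ i → f i c)S - ρ ^ᵣ length S
  expandˡ [] _ _ = sym(-‿inverseʳ 1#)
  expandˡ{c}(y ∷ S)(p ∷ ps)(u ∷ us) = +ˡ(pick-cong S λ j S' e → step(All.head(All-resp-↭ e ps))(All.head(All-resp-↭ e u)))
   · +ˡ(pick-+ _ _ S · +c(pick-*ˡ _ _ S)(pick-*ˡ _ _ S)) · +ˡ(+c(*ˡ(expandˡ S ps us))(*ˡ(expandˡ S u us)))
   · solve 5(λ d y f c r → d :* y :+ (f :* (c :- r) :+ (:- d) :* (y :- r)) := f :* c :- (f :- d) :* r)refl _ _ _ _ _
   · +ˡ(-ᶜ(*ʳ(+ʳ(left0 p) · solve 2(λ a b → a :+ b :- b := a)refl _ _)))where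
   Πy = ∏ (λ i → f i y)S
   Πc = ∏ (λ i → f i c)S
   r = ρ ^ᵣ length S
   step : ∀ {j q} → c ≢ j → y ≢ j → δ c j * (f y j * q) ≈ f y c * (δ c j * q) + (- δ c y) * (δ y j * q)
   step{j}{q}cj yj = sym(*-assoc _ _ _) · *ʳ(left cj p yj) · solve 5(λ a b c d q → (a :* b :- c :* d) :* q := a :* (b :* q) :+ (:- c) :* (d :*
    q))refl _ _ _ _ _
  expandʳ : ∀ {c}S → All(c ≢_)S → Dist S → pick S(λ j S' → δ c j * ∏ (f j)S') ≈ ρ' ^ᵣ length S - ∏ (f c)S
  expandʳ [] _ _ = sym(-‿inverseʳ 1#)
  expandʳ{c}(y ∷ S)(p ∷ ps)(u ∷ us) = +ˡ(pick-cong S λ j S' e → step(All.head(All-resp-↭ e ps))(All.head(All-resp-↭ e u)))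
   · +ˡ(pick-+ _ _ S · +c(pick-*ˡ _ _ S)(pick-*ˡ _ _ S)) · +ˡ(+c(*ˡ(expandʳ S ps us))(*ˡ(expandʳ S u us)))
   · solve 5(λ d y f c r → d :* y :+ (f :* (r :- c) :+ d :* (r :- y)) := (f :+ d) :* r :- f :* c)refl _ _ _ _ _ · +ʳ(*ʳ(+ʳ(right0 p)
   · solve 2(λ a b → a :- b :+ b := a)refl _ _))where
   Πy = ∏ (f y)S
   Πc = ∏ (f c)S
   r = ρ' ^ᵣ length S
   step : ∀ {j q} → c ≢ j → y ≢ j → δ c j * (f j y * q) ≈ f c y * (δ c j * q) + δ c y * (δ y j * q)
   step{j}{q}cj yj = sym(*-assoc _ _ _) · *ʳ(right cj p yj) · solve 5(λ a b c d q → (a :* b :+ c :* d) :* q := a :* (b :* q) :+ c :* (d :* q))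
    refl _ _ _ _ _
open import Data.Product using (_×_; proj₁; proj₂)
open import Data.List.Properties using (length-++)
import Data.List.Relation.Unary.All.Properties as Allₚ
import Data.List.Relation.Unary.AllPairs.Properties as APₚ
open import Data.List.Relation.Binary.Permutation.Propositional.Properties using (↭-length)
module SplitSums(R : Ring)(χ : Char R)(D : ℤ)where
 open CommutativeRing R hiding (zero) renaming (Carrier to |R|; *-congˡ to *ˡ; *-congʳ to *ʳ; +-congˡ to +ˡ; +-congʳ to +ʳ; *-identityˡ to 1*; -‿cong
  to -ᶜ; *-cong to *c; +-cong to +c; reflexive to rfx; trans to infixr 1 _·_)
 open Char χ
 open RingSolver R
 open Polynomials R
 open Sums R
 open CharProperties R χ
 open Kernel R χ D
 Dist-resp-↭ : ∀ {xs ys} → xs ↭ ys → Dist xs → Dist ys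
 Dist-resp-↭ P.refl d = d
 Dist-resp-↭ (prep x p)(a ∷ d) = All-resp-↭ p a ∷ Dist-resp-↭ p d
 Dist-resp-↭ (swap x y p)((b ∷ a) ∷ (c ∷ d)) = ((λ e → b(E.sym e)) ∷ All-resp-↭ p c) ∷ (All-resp-↭ p a ∷ Dist-resp-↭ p d)
 Dist-resp-↭ (P.trans p q)d = Dist-resp-↭ q(Dist-resp-↭ p d)
 Dist-++ˡ : ∀ xs{ys} → Dist(xs ++ ys) → Dist xs
 Dist-++ˡ [] d = []
 Dist-++ˡ(x ∷ xs)(a ∷ d) = Allₚ.++⁻ˡ xs a ∷ Dist-++ˡ xs d
 Dist-++ʳ : ∀ xs{ys} → Dist(xs ++ ys) → Dist ys
 Dist-++ʳ [] d = d
 Dist-++ʳ(x ∷ xs)(a ∷ d) = Dist-++ʳ xs d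
 module _{S h r : List ℤ}(p : S ↭ h ++ r)where
  split-All : ∀ {Q : ℤ → Set} → All Q S → All Q h × All Q r
  split-All a = Allₚ.++⁻ˡ h(All-resp-↭ p a) , Allₚ.++⁻ʳ h(All-resp-↭ p a)
  split-Dist : Dist S → Dist h × Dist r
  split-Dist d = Dist-++ˡ h(Dist-resp-↭ p d) , Dist-++ʳ h(Dist-resp-↭ p d)
  split-length : length S ≡ length h +n length r
  split-length = E.trans(↭-length p)(length-++ h)
 one^ : ∀ n → 1# ^ᵣ n ≈ 1#
 one^ zero = refl
 one^ (suc n) = 1* _ · one^ n
 x∏ : List ℤ → |R|
 x∏ = ∏ T
 module Step{δ ρ ρ'}(π : Pole δ ρ ρ')where
  open Expansion π
  private
   F : (ℕ → ℕ → |R|) → ℤ → List ℤ → ℤ → List ℤ → |R|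
   F W c H i J = δ c i * ∏ (f i)J * (∏ (λ h → f h i)H * cross f H J) * W(suc(length H))(suc(length J))
  sizeStep : ∀ {c S}(W : ℕ → ℕ → |R|) → All(c ≢_)S → Dist S → spl(c ∷ S)(λ H J → cross f H J * W(length H)(length J)) ≈ spl S(λ H J → cross f
   H J * (ρ' ^ᵣ length J * W(suc(length H))(length J) + ρ ^ᵣ length H * W(length H)(suc(length J))))
  sizeStep{c}{S}W n d = +c(spl-cong S stepˡ)(spl-cong S stepʳ) · +c(spl-+ _ _ S · +ˡ(spl-*ˡ _ _ S))(spl-+ _ _ S)
   · +ˡ(+ˡ(spl-pick(F W c)S)) · solve 3(λ a b x → (a :+ (:- 𝟏) :* x) :+ (b :+ x) := a :+ b)refl _ _ _ · sym(spl-+ _ _ S)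
   · spl-cong' S(λ H J → sym(distribˡ _ _ _))where
   A B : List ℤ → List ℤ → |R|
   A H J = cross f H J * (ρ' ^ᵣ length J * W(suc(length H))(length J))
   B H J = cross f H J * (ρ ^ᵣ length H * W(length H)(suc(length J)))
   stepˡ : ∀ H J → S ↭ H ++ J → ∏ (f c)J * cross f H J * W(suc(length H))(length J) ≈ A H J + (- 1#) * pick J(λ i J' → F W c H i J')
   stepˡ H J p = solve 4(λ x k w r → x :* k :* w := k :* (r :* w) :- (k :* w) :* (r :- x))refl _ _ _(ρ' ^ᵣ length J)
    · +ˡ(-ᶜ(*ˡ(sym(expandʳ J(proj₂(split-All p n))(proj₂(split-Dist p d)))))) · +ˡ(-ᶜ(sym(pick-*ˡ _ _ J) · pick-cong J eqˡ))
    · solve 2(λ a b → a :- b := a :+ (:- 𝟏) :* b)refl _ _ where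
    w = W(suc(length H))(length J)
    eqˡ : ∀ i J' → J ↭ i ∷ J' → cross f H J * w * (δ c i * ∏ (f i)J') ≈ F W c H i J'
    eqˡ i J' q = *ʳ(*c(cross-↭ f(↭-refl{x = H})q · cross-∷ʳ f H i J')(rfx(cong(W(suc(length H)))(↭-length q))))
     · solve 3(λ a b c → a :* b :* c := c :* a :* b)refl _ _ _
   stepʳ : ∀ H J → S ↭ H ++ J → cross f H(c ∷ J) * W(length H)(suc(length J)) ≈ B H J + pick H(λ i H' → F W c H' i J)
   stepʳ H J p = *ʳ(cross-∷ʳ f H c J) · solve 4(λ x k w r → x :* k :* w := k :* (r :* w) :+ (k :* w) :* (x :- r))refl _ _ _(ρ ^ᵣ length H)
    · +ˡ(*ˡ(sym(expandˡ H(proj₁(split-All p n))(proj₁(split-Dist p d))))) · +ˡ(sym(pick-*ˡ _ _ H) · pick-cong H eqʳ)where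
    w = W(length H)(suc(length J))
    eqʳ : ∀ i H' → H ↭ i ∷ H' → cross f H J * w * (δ c i * ∏ (λ h → f h i)H') ≈ F W c H' i J
    eqʳ i H' q = *ʳ(*c(cross-↭ f q(↭-refl{x = J}))(rfx(cong(λ l → W l(suc(length J)))(↭-length q))))
     · solve 5(λ a b w d e → a :* b :* w :* (d :* e) := d :* a :* (e :* b) :* w)refl _ _ _ _ _
 module _ where
  open Expansion pole renaming (expandˡ to expandγˡ)
  open Expansion pole' renaming (expandʳ to expandγ'ʳ)
  private
   F : |R| → ℤ → List ℤ → ℤ → List ℤ → |R|
   F y c H i J = y * T i * γ c i * ∏ (f i)J * (∏ (λ h → f h i)H * cross f H J) * (x∏ H * y ^ᵣ length H)
  -- The generating function of the elementary symmetric functions.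
  ∑-elementary : ∀ y S → Dist S → spl S(λ H J → cross f H J * (x∏ H * y ^ᵣ length H)) ≈ ∏ (λ s → 1# + y * T s)S
  ∑-elementary y [] [] = solve 0(𝟏 :* (𝟏 :* 𝟏) := 𝟏)refl
  ∑-elementary y(c ∷ S)(n ∷ d) = +c(spl-cong S stepˡ)(spl-cong S stepʳ) · +c(spl-+ _ _ S · +c(spl-*ˡ _ _ S)(spl-*ˡ _ _ S))(spl-+ _ _ S)
   · +ˡ(+ˡ(spl-pick(F y c)S)) · solve 3(λ t g x → (t :* g :+ (:- 𝟏) :* x) :+ (g :+ x) := (𝟏 :+ t) :* g)refl _ _ _
   · *ˡ(∑-elementary y S d)where
   G : List ℤ → List ℤ → |R|
   G H J = cross f H J * (x∏ H * y ^ᵣ length H)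
   stepˡ : ∀ H J → S ↭ H ++ J → ∏ (f c)J * cross f H J * (T c * x∏ H * (y * y ^ᵣ length H)) ≈ (y * T c) * G H J + (- 1#) * pick J(λ i J' → F y c H i
    J')
   stepˡ H J p = solve 6(λ π k t x y w → π :* k :* (t :* x :* (y :* w)) := (y :* t) :* (k :* (x :* w)) :+ (:- 𝟏) :* ((y :* t :* (k :* (x :* w))) :*
    (𝟏 :- π)))refl _ _ _ _ _ _ · +ˡ(*ˡ(*ˡ(sym(expandγ'ʳ J(proj₂(split-All p n))(proj₂(split-Dist p d)) · +ʳ(one^ (length J))))))
    · +ˡ(*ˡ(sym(pick-*ˡ _ _ J) · pick-cong J(eqˡ(proj₂(split-All p n)))))where
    eqˡ : All(c ≢_)J → ∀ i J' → J ↭ i ∷ J' → y * T c * G H J * (γ' c i * ∏ (f i)J') ≈ F y c H i J'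
    eqˡ nJ i J' q = *ʳ(*ˡ(*ʳ(cross-↭ f(↭-refl{x = H})q · cross-∷ʳ f H i J')))
     · solve 6(λ y t k w g π → y :* t :* (k :* w) :* (g :* π) := y :* (t :* g) :* π :* k :* w)refl _ _ _ _ _ _
     · *ʳ(*ʳ(*ʳ(*ˡ(γγ'(All.head(All-resp-↭ q nJ))) · sym(*-assoc _ _ _))))
   stepʳ : ∀ H J → S ↭ H ++ J → cross f H(c ∷ J) * (x∏ H * y ^ᵣ length H) ≈ G H J + pick H(λ i H' → F y c H' i J)
   stepʳ H J p = *ʳ(cross-∷ʳ f H c J) · solve 3(λ x k w → x :* k :* w := k :* w :+ (k :* w) :* (x :- 𝟏))refl _ _ _
    · +ˡ(*ˡ(sym(expandγˡ H(proj₁(split-All p n))(proj₁(split-Dist p d)) · +ˡ(-ᶜ(one^ (length H)))))) · +ˡ(sym(pick-*ˡ _ _ H)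
    · pick-cong H eqʳ)where
    w = x∏ H * y ^ᵣ length H
    eqʳ : ∀ i H' → H ↭ i ∷ H' → G H J * (γ c i * ∏ (λ h → f h i)H') ≈ F y c H' i J
    eqʳ i H' q = *ʳ(*c(cross-↭ f q(↭-refl{x = J}))(*c(∏-↭ T q)(rfx(cong(y ^ᵣ_)(↭-length q)))))
     · solve 8(λ a b t x y w g e → (a :* b) :* ((t :* x) :* (y :* w)) :* (g :* e) := y :* t :* g :* a :* (e :* b) :* (x :* w))refl _ _ _ _ _ _ _ _
 module _(τ : |R|)(τ² : τ * τ ≈ P)where
  open Step pole renaming (sizeStep to sizeStep0)
  open Step pole' renaming (sizeStep to sizeStep∞)
  private
   ττ^ : ∀ a b → P ^ᵣ a * τ ^ᵣ b ≈ τ ^ᵣ(a +n b) * τ ^ᵣ a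
   ττ^ a b = *ʳ(^ᵣ-cong a(sym τ²) · ^ᵣ-* τ τ a) · solve 2(λ x y → (x :* x) :* y := (x :* y) :* x)refl _ _ · *ʳ(sym(^ᵣ-+ τ a b))
  -- (-τ; τ)_n
  poch⁻ : ℕ → |R|
  poch⁻ zero = 1#
  poch⁻ (suc n) = (1# + τ ^ᵣ suc n) * poch⁻ n
  -- (τ; τ²)_n
  poch² : ℕ → |R|
  poch² zero = 1#
  poch²(suc n) = poch² n * (1# - τ * P ^ᵣ n)
  ∑-τ : ∀ S → Dist S → (spl S(λ H J → cross f H J * τ ^ᵣ length J) ≈ poch⁻ (length S)) × (spl S(λ H J → cross f H J * τ ^ᵣ length H) ≈ poch⁻ (length
   S))
  ∑-τ [] [] = 1* _ , 1* _
  ∑-τ(c ∷ S)(n ∷ d)with ∑-τ S d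
  ... | right , left = goalʳ , goalˡ where
   σ σ' : |R|
   σ = spl S(λ H J → cross f H J * τ ^ᵣ length J)
   σ' = spl S(λ H J → cross f H J * τ ^ᵣ length H)
   eqʳ : ∀ H J → S ↭ H ++ J → cross f H J * (1# ^ᵣ length J * τ ^ᵣ length J + P ^ᵣ length H * τ ^ᵣ suc(length J)) ≈ cross f H J * τ ^ᵣ length J + τ
    ^ᵣ suc(length S) * (cross f H J * τ ^ᵣ length H)
   eqʳ H J p = *ˡ(+c(*ʳ(one^ (length J)))(solve 3(λ a t b → a :* (t :* b) := t :* (a :* b))refl _ _ _))
    · *ˡ(+ˡ(*ˡ(ττ^ (length H)(length J) · *ʳ(rfx(cong(τ ^ᵣ_)(E.sym(split-length{h = H}{r = J}p)))))))
    · solve 5(λ k a t s h → k :* (𝟏 :* a :+ t :* (s :* h)) := k :* a :+ (t :* s) :* (k :* h))refl _ _ _ _ _ where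
    k = cross f H J
    tj = τ ^ᵣ length J
    th = τ ^ᵣ length H
   eqˡ : ∀ H J → S ↭ H ++ J → cross f H J * (P ^ᵣ length J * τ ^ᵣ suc(length H) + 1# ^ᵣ length H * τ ^ᵣ length H) ≈ τ ^ᵣ suc(length S) * (cross f H
    J * τ ^ᵣ length J) + cross f H J * τ ^ᵣ length H
   eqˡ H J p = *ˡ(+c(solve 3(λ a t b → a :* (t :* b) := t :* (a :* b))refl _ _ _)(*ʳ(one^ (length H))))
    · *ˡ(+ʳ(*ˡ(ττ^ (length J)(length H) · *ʳ(rfx(cong(τ ^ᵣ_)(E.trans(N.+-comm(length J)(length H))(E.sym(split-length{h = H}{r = J}
    p)))))))) · solve 5(λ k a t s h → k :* (t :* (s :* a) :+ 𝟏 :* h) := (t :* s) :* (k :* a) :+ k :* h)refl _ _ _ _ _ where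
    k = cross f H J
    tj = τ ^ᵣ length J
    th = τ ^ᵣ length H
   goalʳ : spl(c ∷ S)(λ H J → cross f H J * τ ^ᵣ length J) ≈ poch⁻ (suc(length S))
   goalʳ = sizeStep∞ (λ h j → τ ^ᵣ j)n d · spl-cong S eqʳ · (spl-+ _ _ S · +ˡ(spl-*ˡ _ _ S)) · +c right(*ˡ left)
    · solve 2(λ a b → a :+ b :* a := (𝟏 :+ b) :* a)refl _ _
   goalˡ : spl(c ∷ S)(λ H J → cross f H J * τ ^ᵣ length H) ≈ poch⁻ (suc(length S))
   goalˡ = sizeStep0(λ h j → τ ^ᵣ h)n d · spl-cong S eqˡ · (spl-+ _ _ S · +ʳ(spl-*ˡ _ _ S)) · +c(*ˡ right)left
    · solve 2(λ a b → b :* a :+ a := (𝟏 :+ b) :* a)refl _ _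
  ∑-poch² : ∀ S → Dist S → spl S(λ H J → cross f H J * (poch²(length H) * τ ^ᵣ length J)) ≈ 1#
  ∑-poch² [] [] = solve 0(𝟏 :* (𝟏 :* 𝟏) := 𝟏)refl
  ∑-poch²(c ∷ S)(n ∷ d) = sizeStep∞ (λ h j → poch² h * τ ^ᵣ j)n d · spl-cong' S(λ H J → *ˡ(+ʳ(*ʳ(one^ (length J)))
   · solve 4(λ p a t j → 𝟏 :* (p :* (𝟏 :- t :* a) :* j) :+ a :* (p :* (t :* j)) := p :* j)refl(poch²(length H))(P ^ᵣ length H)τ(τ ^ᵣ length
   J))) · ∑-poch² S d
 -- (T c - P x) / (x - T c) with the pole at x = T c moved away.
 f-shift : ∀ {c k} → c ≢ k → c +z D ≢ k → f(c +z D)k * f k c ≈ P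
 f-shift{c}{k}p q = reg-cancel(reg-* (T-diff-reg{k}{c +z D}(λ e → q(E.sym e)))(T-diff-reg p))(*-interchange _ _ _ _
  · *c(f-law q)(f-law(λ e → p(E.sym e))) · *ʳ(+ʳ(T-+ c D)) · solve 3(λ c p k → (c :* p :- p :* k) :* (k :- p :* c) := (c :* p :- k) :* (k :- c)
  :* p)refl _ _ _ · *ʳ(*ʳ(+ʳ(sym(T-+ c D)))))
 γ'-shift : ∀ {c j} → c ≢ j → c +z D ≢ j → γ'(c +z D)j * f j c ≈ γ' c j
 γ'-shift{c}{j}p q = reg-cancel(reg-* (T-diff-reg q)(T-diff-reg p))(*-interchange _ _ _ _ · *c(γ'-law q)(f-law(λ e → p(E.sym e)))
  · *c(sym(γ'-law p))(+ˡ(-ᶜ(*-comm _ _ · sym(T-+ c D)))) · solve 3(λ a b c → (a :* b) :* c := c :* a :* b)refl _ _ _)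
 open Expansion pole' using (expandʳ)
 expand-shifted : ∀ {c}S → All(c ≢_)S → All(c +z D ≢_)S → Dist S → pick S(λ j S' → γ' c j * (∏ (f j)S' * ∏ (λ k → f k c)S')) ≈ ∏ (λ k → f k c)
  S - P ^ᵣ length S
 expand-shifted{c}S n n′ d = pick-cong S eq · pick-*ˡ _ _ S · *ˡ(expandʳ S n′ d) · (*ˡ(+ʳ(one^ (length S)))
  · solve 2(λ a b → a :* (𝟏 :- b) := a :- b :* a)refl _ _) · +ˡ(-ᶜ(sym(∏-* _ _ S)
  · ∏-cong-All(All.map(λ(p , q) → f-shift p q)(All.zip(n , n′))) · ∏-const P S))where
  eq : ∀ j S' → S ↭ j ∷ S' → γ' c j * (∏ (f j)S' * ∏ (λ k → f k c)S') ≈ ∏ (λ k → f k c)S * (γ'(c +z D)j * ∏ (f j)S')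
  eq j S' p = *ʳ(sym(γ'-shift(All.head(All-resp-↭ p n))(All.head(All-resp-↭ p n′))))
   · solve 4(λ a b c d → a :* b :* (c :* d) := (b :* d) :* (a :* c))refl _ _ _ _ · *ʳ(sym(∏-↭ (λ k → f k c)p))
-- The row operators of the q-boson lattice: v is a function of the occupation numbers of m sites, the
-- last site first; A z and B z let a row of weight z act, with nothing resp. one particle leaving at the end.
module RowOperators(R : Ring)(P : CommutativeRing.Carrier R)where
 open CommutativeRing R hiding (zero) renaming (Carrier to |R|; *-congˡ to *ˡ; +-congʳ to +ʳ; +-cong to +c; trans to infixr 1 _·_)
 open RingSolver R
 open Sums R
 State : ℕ → Set
 State m = Vec ℕ m → |R|
 infix 4 _≋_
 _≋_ : ∀ {m} → State m → State m → Set
 v ≋ w = ∀ ns → v ns ≈ w ns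
 A B : ∀ m → |R| → State m → State m
 enter : ∀ m → |R| → State(suc m) → State(suc m)
 A zero z v ns = v ns
 A(suc m)z v(n ∷ ns) = A m z(λ ν → v(n ∷ ν))ns + enter m z v(n ∷ ns)
 enter m z v(zero ∷ ns) = 0#
 enter m z v(suc n ∷ ns) = B m z(λ ν → v(n ∷ ν))ns
 B zero z v ns = z * v ns
 B(suc m)z v(n ∷ ns) = z * ((1# - P ^ᵣ suc n) * A m z(λ ν → v(suc n ∷ ν))ns + B m z(λ ν → v(n ∷ ν))ns)
 A-cong : ∀ m{z v w} → v ≋ w → A m z v ≋ A m z w
 B-cong : ∀ m{z v w} → v ≋ w → B m z v ≋ B m z w
 A-cong zero e ns = e ns
 A-cong(suc m)e(zero ∷ ns) = +ʳ(A-cong m(λ ν → e _)ns)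
 A-cong(suc m)e(suc n ∷ ns) = +c(A-cong m(λ ν → e _)ns)(B-cong m(λ ν → e _)ns)
 B-cong zero e ns = *ˡ(e ns)
 B-cong(suc m)e(n ∷ ns) = *ˡ(+c(*ˡ(A-cong m(λ ν → e _)ns))(B-cong m(λ ν → e _)ns))
 A-+ : ∀ m{z}v w → A m z(λ ν → v ν + w ν) ≋ (λ ν → A m z v ν + A m z w ν)
 B-+ : ∀ m{z}v w → B m z(λ ν → v ν + w ν) ≋ (λ ν → B m z v ν + B m z w ν)
 A-+ zero v w ns = refl
 A-+ (suc m)v w(zero ∷ ns) = +ʳ(A-+ m _ _ ns) · solve 2(λ a b → a :+ b :+ 𝟎 := a :+ 𝟎 :+ (b :+ 𝟎))refl _ _
 A-+ (suc m)v w(suc n ∷ ns) = +c(A-+ m _ _ ns)(B-+ m _ _ ns) · +-interchange _ _ _ _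
 B-+ zero v w ns = distribˡ _ _ _
 B-+ (suc m)v w(n ∷ ns) = *ˡ(+c(*ˡ(A-+ m _ _ ns))(B-+ m _ _ ns)) · solve 6(λ z p a b c d → z :* (p :* (a :+ b) :+ (c :+ d)) := z :* (p :* a :+
  c) :+ z :* (p :* b :+ d))refl _ _ _ _ _ _
 A-* : ∀ m{z}c v → A m z(λ ν → c * v ν) ≋ (λ ν → c * A m z v ν)
 B-* : ∀ m{z}c v → B m z(λ ν → c * v ν) ≋ (λ ν → c * B m z v ν)
 A-* zero c v ns = refl
 A-* (suc m)c v(zero ∷ ns) = +ʳ(A-* m c _ ns) · solve 2(λ a b → a :* b :+ 𝟎 := a :* (b :+ 𝟎))refl _ _
 A-* (suc m)c v(suc n ∷ ns) = +c(A-* m c _ ns)(B-* m c _ ns) · sym(distribˡ _ _ _)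
 B-* zero c v ns = solve 3(λ z c v → z :* (c :* v) := c :* (z :* v))refl _ _ _
 B-* (suc m)c v(n ∷ ns) = *ˡ(+c(*ˡ(A-* m c _ ns))(B-* m c _ ns)) · solve 5(λ z p c a b → z :* (p :* (c :* a) :+ c :* b) := c :* (z :* (p :* a
  :+ b)))refl _ _ _ _ _
 A-spl : ∀ {X : Set}m{z}(S : List X)(F : List X → List X → State m) → A m z(λ ν → spl S(λ h r → F h r ν)) ≋ (λ ν → spl S(λ h r → A m z(F h r)
  ν))
 A-spl m [] F ns = refl
 A-spl m(x ∷ S)F ns = A-+ m _ _ ns · +c(A-spl m S _ ns)(A-spl m S _ ns)
 B-spl : ∀ {X : Set}m{z}(S : List X)(F : List X → List X → State m) → B m z(λ ν → spl S(λ h r → F h r ν)) ≋ (λ ν → spl S(λ h r → B m z(F h r)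
  ν))
 B-spl m [] F ns = refl
 B-spl m(x ∷ S)F ns = B-+ m _ _ ns · +c(B-spl m S _ ns)(B-spl m S _ ns)
module HallLittlewood(R : Ring)(χ : Char R)(D : ℤ)where
 open CommutativeRing R hiding (zero) renaming (Carrier to |R|; *-congˡ to *ˡ; *-congʳ to *ʳ; +-congˡ to +ˡ; +-congʳ to +ʳ; -‿cong to -ᶜ; *-cong to
  *c; +-cong to +c; reflexive to rfx; trans to infixr 1 _·_)
 open Char χ
 open RingSolver R
 open Polynomials R
 open Sums R
 open CharProperties R χ
 open Kernel R χ D
 open SplitSums R χ D
 open RowOperators R P
 open Expansion pole using () renaming (expandˡ to expandγˡ)
 open Expansion pole' using () renaming (expandʳ to expandγ'ʳ)
 δ : ℕ → ℕ → |R|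
 δ zero zero = 1#
 δ zero(suc _) = 0#
 δ(suc _)zero = 0#
 δ(suc a)(suc b) = δ a b
 X : ℕ → List ℤ → |R|
 X k I = x∏ I ^ᵣ k
 -- The Hall–Littlewood polynomials P_λ(x; t) of the variables T a (a ∈ S), for all λ with parts at
 -- most m, as a function of the multiplicities of the parts m, …, 1.
 HL : ∀ m → List ℤ → State m
 HL zero S ns = 1#
 HL(suc m)S(n ∷ ns) = spl S(λ I Q → δ n(length I) * X(suc m)I * cross f I Q * HL m Q ns)
 Fresh : ℤ → List ℤ → Set
 Fresh c S = All(c ≢_)S × All(c +z D ≢_)S × Dist S
 Fresh-split : ∀ {c S}h r → S ↭ h ++ r → Fresh c S → Fresh c h × Fresh c r
 Fresh-split h r p(a , b , d) = (proj₁(split-All p a) , proj₁(split-All p b) , proj₁(split-Dist p d)) , (proj₂(split-All p a) , proj₂(split-All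
  p b) , proj₂(split-Dist p d))
 private
  lead : ∀ m → ℤ → List ℤ → State m
  lead m c S ns = T c ^ᵣ suc m * ∏ (f c)S * HL m S ns
  trail : ∀ m → ℤ → List ℤ → State m
  trail m c S ns = pick S(λ j S' → γ c j * ∏ (f j)S' * T j ^ᵣ suc m * HL m(c ∷ S')ns)
 A-HL : ∀ m{c S} → Fresh c S → A m(T c)(HL m S) ≋ HL m(c ∷ S)
 B-HL : ∀ m{c S} → Fresh c S → B m(T c)(HL m S) ≋ (λ ns → lead m c S ns + trail m c S ns)
 private
  expand-B : ∀ m{c S} → Fresh c S → ∀ k ns → spl S(λ I Q → δ k(suc(length I)) * X(suc m)I * cross f I Q * B m(T c)(HL m Q)ns) ≈ spl S(λ I Q
   → δ k(suc(length I)) * X(suc m)I * cross f I Q * lead m c Q ns) + spl S(λ I Q → δ k(length I) * X(suc m)I * cross f I Q * HL m(c ∷ Q)ns *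
   (∏ (λ i → f i c)I - 1#))
  expand-B m{c}{S}φ k ns = spl-cong S(λ I Q p → _·_(*ˡ(B-HL m(proj₂(Fresh-split I Q p φ))ns))(distribˡ _ _ _)) · (spl-+ _ _ S
   · +ˡ(spl-cong' S(λ I Q → _·_(sym(pick-*ˡ _ _ Q))(pick-cong Q(eq I Q))))) · +ˡ(sym(spl-pick F S))
   · +ˡ(spl-cong S(λ I Q p → _·_(pick-cong I(eq' I Q))(pick-*ˡ _ _ I · *ˡ(expandγˡ I(proj₁(proj₁(Fresh-split I Q p φ)))(proj₂(proj₂(proj₁
   (Fresh-split I Q p φ)))) · +ˡ(-ᶜ(one^ (length I)))))))where
   w : List ℤ → |R|
   w I = δ k(suc(length I)) * X(suc m)I
   F : List ℤ → ℤ → List ℤ → |R|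
   F I j Q = w I * (∏ (λ i → f i j)I * cross f I Q) * (γ c j * ∏ (f j)Q * T j ^ᵣ suc m * HL m(c ∷ Q)ns)
   eq : ∀ I Q j Q' → Q ↭ j ∷ Q' → w I * cross f I Q * (γ c j * ∏ (f j)Q' * T j ^ᵣ suc m * HL m(c ∷ Q')ns) ≈ F I j Q'
   eq I Q j Q' q = *ʳ(*ˡ(cross-↭ f(↭-refl{x = I})q · cross-∷ʳ f I j Q'))
   eq' : ∀ I Q j I' → I ↭ j ∷ I' → F I' j Q ≈ δ k(length I) * X(suc m)I * cross f I Q * HL m(c ∷ Q)ns * (γ c j * ∏ (λ i → f i j)I')
   eq' I Q j I' q = solve 8(λ d x p k g π t h → (d :* x) :* (p :* k) :* (g :* π :* t :* h) := d :* (t :* x) :* (π :* k) :* h :* (g :* p))refl _ _ _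
    _ _ _ _ _ · *ʳ(*ʳ(*c(*c(rfx(cong(δ k)(E.sym(↭-length q))))(sym(^ᵣ-* (T j)(x∏ I')(suc m))
    · ^ᵣ-cong(suc m)(sym(∏-↭ T q))))(sym(cross-↭ f q(↭-refl{x = Q})))))
  A-step : ∀ m{c S} → Fresh c S → ∀ k ns → A m(T c)(λ ν → HL(suc m)S(k ∷ ν))ns ≈ spl S(λ I Q → δ k(length I) * X(suc m)I * cross f I Q * HL
   m(c ∷ Q)ns)
  A-step m{c}{S}φ k ns = A-spl m S(λ I Q ν → δ k(length I) * X(suc m)I * cross f I Q * HL m Q ν)ns
   · spl-cong S(λ I Q p → _·_(A-* m _ _ ns)(*ˡ(A-HL m(proj₂(Fresh-split I Q p φ))ns)))
  B-step : ∀ m{c S}k ns → B m(T c)(λ ν → HL(suc m)S(k ∷ ν))ns ≈ spl S(λ I Q → δ(suc k)(suc(length I)) * X(suc m)I * cross f I Q * B m(T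
   c)(HL m Q)ns)
  B-step m{c}{S}k ns = B-spl m S(λ I Q ν → δ k(length I) * X(suc m)I * cross f I Q * HL m Q ν)ns · spl-cong' S(λ I Q → B-* m _ _ ns)
  enter-step : ∀ m{c S}k ns → enter m(T c)(HL(suc m)S)(k ∷ ns) ≈ spl S(λ I Q → δ k(suc(length I)) * X(suc m)I * cross f I Q * B m(T c)
   (HL m Q)ns)
  enter-step m{c}{S}zero ns = sym(spl-0 S(λ I Q _ → solve 3(λ a b c → 𝟎 :* a :* b :* c := 𝟎)refl _ _ _))
  enter-step m{S = S}(suc k)ns = B-step m{S = S}k ns
 A-HL zero φ ns = refl
 A-HL(suc m){c}{S}φ(n ∷ ns) = +c(A-step m φ n ns)(enter-step m{S = S}n ns · expand-B m φ n ns)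
  · solve 3(λ a b c → a :+ (b :+ c) := b :+ (a :+ c))refl _ _ _ · +c(spl-cong' S(λ I Q → eq I Q))(sym(spl-+ _ _ S)
  · spl-cong' S(λ I Q → eq' I Q))where
  G : List ℤ → List ℤ → |R|
  G I Q = δ n(length I) * X(suc m)I * cross f I Q * HL m(c ∷ Q)ns
  eq : ∀ I Q → δ n(suc(length I)) * X(suc m)I * cross f I Q * lead m c Q ns ≈ δ n(suc(length I)) * X(suc m)(c ∷ I) * (∏ (f c)Q * cross f I Q)
   * HL m Q ns
  eq I Q = solve 6(λ d x k t π h → d :* x :* k :* (t :* π :* h) := d :* (t :* x) :* (π :* k) :* h)refl _ _ _ _ _ _
   · *ʳ(*ʳ(*ˡ(sym(^ᵣ-* (T c)(x∏ I)(suc m)))))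
  eq' : ∀ I Q → G I Q + G I Q * (∏ (λ i → f i c)I - 1#) ≈ δ n(length I) * X(suc m)I * cross f I(c ∷ Q) * HL m(c ∷ Q)ns
  eq' I Q = solve 5(λ d x k h p → d :* x :* k :* h :+ d :* x :* k :* h :* (p :- 𝟏) := d :* x :* (p :* k) :* h)refl _ _ _ _ _
   · *ʳ(*ˡ(sym(cross-∷ʳ f I c Q)))
 B-HL zero{c}{S}(n , _ , d)ns = solve 2(λ t p → t :* 𝟏 := (t :* 𝟏) :* p :* 𝟏 :+ t :* (𝟏 :- p))refl _ _ · +ˡ(*ˡ(sym(expandγ'ʳ S n d
  · +ʳ(one^ (length S))))) · +ˡ(sym(pick-*ˡ _ _ S) · pick-cong S(λ j S' p → (sym(*-assoc _ _ _) · *ʳ(γγ'(All.head(All-resp-↭ p n)))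
  · solve 3(λ t g p → t :* g :* p := g :* p :* (t :* 𝟏) :* 𝟏)refl _ _ _)))
 B-HL(suc m){c}{S}φ@(n≢ , n≢' , ds)(n ∷ ns) = *ˡ(+c(*ˡ(A-step m φ(suc n)ns))(B-step m{S = S}n ns · expand-B m φ(suc n)ns))
  · *ˡ(+ʳ(sym(spl-*ˡ _ _ S) · spl-cong' S(λ I Q → weight I Q))) · *ˡ(solve 3(λ a b c → a :+ (b :+ c) := b :+ (a :+ c))refl _ _ _)
  · *ˡ(+ˡ(sym(spl-+ _ _ S) · spl-cong' S(λ I Q → solve 3(λ g p q → g :* (𝟏 :- p) :+ g :* (q :- 𝟏) := g :* (q :- p))refl _ _ _)))
  · (distribˡ _ _ _ · +c(sym(spl-*ˡ _ _ S))(sym(spl-*ˡ _ _ S))) · sym(+c part1 part2) · (+-assoc _ _ _ · +ˡ(sym(spl-+ _ _ S)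
  · spl-cong' S(λ I Q → sym(pick-+ _ _ I)))) · +c lead-eq(sym(pick-split(λ h j r → F1 h j r + F2 h j r)S) · pick-cong S trail-eq)where
  G L : List ℤ → List ℤ → |R|
  G I Q = δ(suc n)(length I) * X(suc m)I * cross f I Q * HL m(c ∷ Q)ns
  L I Q = δ n(length I) * X(suc m)I * cross f I Q * lead m c Q ns
  F1 F2 : List ℤ → ℤ → List ℤ → |R|
  F1 I j Q = γ c j * (∏ (f j)I * ∏ (f j)Q) * T j ^ᵣ suc(suc m) * (δ n(suc(length I)) * X(suc m)(c ∷ I) * (∏ (f c)Q * cross f I Q) * HL m Q ns)
  F2 I j Q = γ c j * (∏ (f j)I * ∏ (f j)Q) * T j ^ᵣ suc(suc m) * (δ n(length I) * X(suc m)I * cross f I(c ∷ Q) * HL m(c ∷ Q)ns)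
  weight : ∀ I Q → (1# - P ^ᵣ suc n) * G I Q ≈ G I Q * (1# - P ^ᵣ length I)
  weight I Q = solve 5(λ p d x k h → (𝟏 :- p) :* (d :* x :* k :* h) := (d :* (𝟏 :- p)) :* (x :* k :* h))refl _ _ _ _ _
   · *ʳ(δ-weight(suc n)(length I)) · solve 5(λ p d x k h → (d :* (𝟏 :- p)) :* (x :* k :* h) := (d :* x :* k :* h) :* (𝟏 :- p))refl _ _ _ _ _
   where
   δ-weight : ∀ a b → δ a b * (1# - P ^ᵣ a) ≈ δ a b * (1# - P ^ᵣ b)
   δ-weight zero zero = refl
   δ-weight zero(suc b) = zeroˡ _ · sym(zeroˡ _)
   δ-weight(suc a)zero = zeroˡ _ · sym(zeroˡ _)
   δ-weight(suc a)(suc b) = solve 3(λ d p q → d :* (𝟏 :- p :* q) := p :* (d :* (𝟏 :- q)) :+ d :* (𝟏 :- p))refl _ _ _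
    · +ʳ(*ˡ(δ-weight a b)) · solve 3(λ d p q → p :* (d :* (𝟏 :- q)) :+ d :* (𝟏 :- p) := d :* (𝟏 :- p :* q))refl _ _ _
  power : ∀ j I I' → I ↭ j ∷ I' → T j ^ᵣ suc(suc m) * X(suc m)I' ≈ T j * X(suc m)I
  power j I I' q = *-assoc _ _ _ · *ˡ(sym(^ᵣ-* (T j)(x∏ I')(suc m)) · ^ᵣ-cong(suc m)(sym(∏-↭ T q)))
  part1 : spl S(λ I Q → T c * L I Q * ∏ (f c)I) + spl S(λ I Q → pick I(λ j I' → F1 I' j Q)) ≈ spl S(λ I Q → T c * L I Q)
  part1 = sym(spl-+ _ _ S) · spl-cong S(λ I Q p → ((+ˡ(pick-cong I(λ j I' q → eq I Q j I' q(proj₁(proj₁(Fresh-split I Q p φ))))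
   · pick-*ˡ _ _ I)) · (+ˡ(*ˡ(expandγ'ʳ I(proj₁(proj₁(Fresh-split I Q p φ)))(proj₂(proj₂(proj₁(Fresh-split I Q p φ))))
   · +ʳ(one^ (length I))))) · (solve 2(λ a b → a :* b :+ a :* (𝟏 :- b) := a)refl _ _)))where
   eq : ∀ I Q j I' → I ↭ j ∷ I' → All(c ≢_)I → F1 I' j Q ≈ T c * L I Q * (γ' c j * ∏ (f j)I')
   eq I Q j I' q nI = *ˡ(*ʳ(*ʳ(*ˡ(^ᵣ-* (T c)(x∏ I')(suc m))))) · solve 10(λ g a b t d u x w k h → g :* (a :* b) :* t :* (d :* (u :* x) :* (w :*
    k) :* h) := (t :* x) :* g :* (d :* (b :* k) :* (u :* w :* h)) :* a)refl _ _ _ _ _ _ _ _ _ _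
    · *ʳ(*c(*ʳ(power j I I' q))(*ʳ(*c(rfx(cong(δ n)(E.sym(↭-length q))))(sym(cross-↭ f q(↭-refl{x = Q}))))))
    · solve 7(λ t x g d k l a → (t :* x) :* g :* (d :* k :* l) :* a := (t :* g) :* (d :* x :* k :* l) :* a)refl _ _ _ _ _ _ _
    · *ʳ(*ʳ(sym(γγ'(All.head(All-resp-↭ q nI))))) · solve 4(λ t g l a → (t :* g) :* l :* a := t :* l :* (g :* a))refl _ _ _ _
  part2 : spl S(λ I Q → pick I(λ j I' → F2 I' j Q)) ≈ spl S(λ I Q → T c * (G I Q * (∏ (λ i → f i c)I - P ^ᵣ length I)))
  part2 = spl-cong S(λ I Q p → let a , b , d = proj₁(Fresh-split I Q p φ)in(pick-cong I(λ j I' q → eq I Q j I' q a) · pick-*ˡ _ _ I)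
   · *ˡ(expand-shifted I a b d) · *-assoc _ _ _)where
   eq : ∀ I Q j I' → I ↭ j ∷ I' → All(c ≢_)I → F2 I' j Q ≈ T c * G I Q * (γ' c j * (∏ (f j)I' * ∏ (λ k → f k c)I'))
   eq I Q j I' q nI = *ˡ(*ʳ(*ˡ(cross-∷ʳ f I' c Q))) · solve 9(λ g a b t d x w k h → g :* (a :* b) :* t :* (d :* x :* (w :* k) :* h) := (t :* x) :*
    g :* (d :* (b :* k) :* h) :* (a :* w))refl _ _ _ _ _ _ _ _ _ · *ʳ(*c(*ʳ(power j I I' q))(*ʳ(*c(rfx(cong(δ(suc n))(E.sym(↭-length q))))
    (sym(cross-↭ f q(↭-refl{x = Q})))))) · solve 7(λ t x g d k l a → (t :* x) :* g :* (d :* k :* l) :* a := (t :* g) :* (d :* x :* k :* l) :* a)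
    refl _ _ _ _ _ _ _ · *ʳ(*ʳ(sym(γγ'(All.head(All-resp-↭ q nI))))) · solve 4(λ t g l a → (t :* g) :* l :* a := t :* l :* (g :* a))refl _ _ _
    _
  lead-eq : spl S(λ I Q → T c * L I Q * ∏ (f c)I) ≈ lead(suc m)c S(n ∷ ns)
  lead-eq = spl-cong S eq · spl-*ˡ _ _ S where
   eq : ∀ I Q → S ↭ I ++ Q → T c * L I Q * ∏ (f c)I ≈ T c ^ᵣ suc(suc m) * ∏ (f c)S * (δ n(length I) * X(suc m)I * cross f I Q * HL m Q ns)
   eq I Q p = solve 8(λ t d x k u w h a → t :* (d :* x :* k :* (u :* w :* h)) :* a := (t :* u) :* (a :* w) :* (d :* x :* k :* h))refl _ _ _ _ _ _ _
    _ · *ʳ(*ˡ(sym(∏-↭ (f c)p · ∏-++ (f c)I Q)))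
  trail-eq : ∀ j S' → S ↭ j ∷ S' → spl S'(λ I Q → F1 I j Q + F2 I j Q) ≈ γ c j * ∏ (f j)S' * T j ^ᵣ suc(suc m) * HL(suc m)(c ∷ S')(n ∷ ns)
  trail-eq j S' p = spl-cong S'(λ I Q q → _·_(sym(distribˡ _ _ _))(*ʳ(*ʳ(*ˡ(sym(∏-↭ (f j)q · ∏-++ (f j)I Q)))))) · spl-*ˡ _ _ S'
   · *ˡ(spl-+ _ _ S')
open import Data.Unit using (⊤; tt)
open import Data.Product using (∃)
open import Data.List.Properties using (length-map)
open import Data.List.Membership.Propositional using (_∈_)
open import Data.List.Relation.Unary.Any using (here; there)
open import Data.List.Membership.Propositional.Properties using (∈-∃++)
open import Data.List.Relation.Binary.Permutation.Propositional.Properties using (map⁺)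
module SignedSums(R : Ring)where
 open CommutativeRing R hiding (zero) renaming (Carrier to |R|; +-congˡ to +ˡ; +-cong to +c; reflexive to rfx; trans to infixr 1 _·_)
 open Sums R
 negs : List ℤ → List ℤ
 negs = map(λ a → -z a)
 -- The sum over all 2^n choices of signs for the entries of a list.
 sgn : List ℤ → (List ℤ → |R|) → |R|
 sgn [] F = F []
 sgn(x ∷ xs)F = sgn xs(λ cs → F(x ∷ cs)) + sgn xs(λ cs → F(-z x ∷ cs))
 Even : (ℤ → Set) → Set
 Even Q = ∀ {a} → Q a → Q(-z a)
 sgn-cong : ∀ {Q : ℤ → Set} → Even Q → ∀ {F G}xs → All Q xs → (∀ cs → All Q cs → length cs ≡ length xs → F cs ≈ G cs) → sgn xs F ≈ sgn xs G
 sgn-cong ev [] [] e = e [] [] rfl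
 sgn-cong ev(x ∷ xs)(q ∷ qs)e = +c(sgn-cong ev xs qs(λ cs r l → e(x ∷ cs)(q ∷ r)(cong ℕ.suc l)))(sgn-cong ev xs qs(λ cs r l → e(-z x ∷ cs)
  (ev q ∷ r)(cong ℕ.suc l)))where
  import Data.Nat as ℕ
 sgn-cong' : ∀ {F G}xs → (∀ cs → F cs ≈ G cs) → sgn xs F ≈ sgn xs G
 sgn-cong' xs e = sgn-cong{λ _ → ⊤}(λ _ → tt)xs(All.universal(λ _ → tt)xs)(λ cs _ _ → e cs)
 sgn-+ : ∀ F G xs → sgn xs(λ cs → F cs + G cs) ≈ sgn xs F + sgn xs G
 sgn-+ F G [] = refl
 sgn-+ F G(x ∷ xs) = +c(sgn-+ _ _ xs)(sgn-+ _ _ xs) · +-interchange _ _ _ _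
 sgn-*ˡ : ∀ c F xs → sgn xs(λ cs → c * F cs) ≈ c * sgn xs F
 sgn-*ˡ c F [] = refl
 sgn-*ˡ c F(x ∷ xs) = +c(sgn-*ˡ c _ xs)(sgn-*ˡ c _ xs) · sym(distribˡ _ _ _)
 sgn-0 : ∀ xs → sgn xs(λ _ → 0#) ≈ 0#
 sgn-0 [] = refl
 sgn-0(x ∷ xs) = +c(sgn-0 xs)(sgn-0 xs) · +-identityˡ _
 Symmetric : (List ℤ → |R|) → Set
 Symmetric F = ∀ {xs ys} → xs ↭ ys → F xs ≈ F ys
 sgn-↭ : ∀ {F} → Symmetric F → ∀ {xs ys} → xs ↭ ys → sgn xs F ≈ sgn ys F
 sgn-↭ σ P.refl = refl
 sgn-↭ σ(prep x p) = +c(sgn-↭ (λ q → σ(prep _ q))p)(sgn-↭ (λ q → σ(prep _ q))p)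
 sgn-↭ {F}σ(swap{xs = xs}{ys = ys}x y p) = +c(+c(eq x y)(eq x(-z y)))(+c(eq(-z x)y)(eq(-z x)(-z y))) · +-interchange _ _ _ _ where
  eq : ∀ a b → sgn xs(λ cs → F(a ∷ b ∷ cs)) ≈ sgn ys(λ cs → F(b ∷ a ∷ cs))
  eq a b = sgn-↭ (λ q → σ(prep _(prep _ q)))p · sgn-cong' ys(λ cs → σ(swap a b ↭-refl))
 sgn-↭ σ(P.trans p q) = sgn-↭ σ p · sgn-↭ σ q
 sgn-flip : ∀ {F} → Symmetric F → ∀ x xs → sgn(x ∷ xs)F ≈ sgn(-z x ∷ xs)F
 sgn-flip{F}σ x xs = +-comm _ _ · +ˡ(sgn-cong' xs(λ cs → rfx(cong(λ y → F(y ∷ cs))(E.sym(Z.neg-involutive x)))))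
 sgn-split : ∀ {F} → Symmetric F → ∀ xs → spl xs(λ h r → F(negs h ++ r)) ≈ sgn xs F
 sgn-split σ [] = refl
 sgn-split σ(x ∷ xs) = +-comm _ _ · +c(spl-cong' xs(λ h r → σ(shift x(negs h)r))
  · sgn-split(λ q → σ(prep x q))xs)(sgn-split(λ q → σ(prep(-z x)q))xs)
module Symm(R : Ring)(χ : Char R)(M : ℤ)where
 open CommutativeRing R hiding (zero) renaming (Carrier to |R|; *-congˡ to *ˡ; *-congʳ to *ʳ; +-congˡ to +ˡ; +-congʳ to +ʳ; *-identityˡ to 1*; -‿cong
  to -ᶜ; *-cong to *c; reflexive to rfx; trans to infixr 1 _·_)
 open Char χ
 open RingSolver R
 open Polynomials R
 open Sums R
 open SignedSums R
 open CharProperties R χ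
 open Kernel R χ (M +z M)
 open SplitSums R χ (M +z M)
 π : |R|
 π = T M
 ππ : π * π ≈ P
 ππ = sym(T-+ M M)
 g : ℤ → ℤ → |R|
 g a b = ⟦ (M +z M) +z(a +z b) ⟧ * ι(a +z b)
 g-cong : ∀ {a b c d} → a +z b ≡ c +z d → g a b ≈ g c d
 g-cong e = *c(⟦⟧-cong(cong(λ x → (M +z M) +z x)e))(rfx(cong ι e))
 g-sym : ∀ a b → g a b ≈ g b a
 g-sym a b = g-cong{a}{b}{b}{a}(Z.+-comm a b)
 f≈g : ∀ a b → f a b ≈ g(-z a)b
 f≈g a b = *c(⟦⟧-cong(eq(M +z M)a b))(rfx(cong ι(Z.+-comm b(-z a))))where
  eq : ∀ D a b → D +z b -z a ≡ D +z(-z a +z b)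
  eq = ringℤ
 s : ℤ → |R|
 s c = (1# + T(M +z c)) * ι c
 Sep : ℤ → ℤ → Set
 Sep a b = a ≢ b × a ≢ -z b
 Good : List ℤ → Set
 Good S = All(_≢ + 0)S × AllPairs Sep S
 neg-injective : ∀ {a b} → -z a ≡ -z b → a ≡ b
 neg-injective = Z.neg-injective
 neg-swap : ∀ {a b} → -z a ≡ b → a ≡ -z b
 neg-swap{a}e = E.trans(E.sym(Z.neg-involutive a))(cong(λ x → -z x)e)
 Sep-sym : ∀ {a b} → Sep a b → Sep b a
 Sep-sym(p , q) = (λ e → p(E.sym e)) , (λ e → q(neg-swap(E.sym e)))
 Sep-negˡ : ∀ {a b} → Sep a b → Sep(-z a)b
 Sep-negˡ(p , q) = (λ e → q(neg-swap e)) , (λ e → p(neg-injective e))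
 Sep-negʳ : ∀ {a b} → Sep a b → Sep a(-z b)
 Sep-negʳ{a}{b}(p , q) = q , (λ e → p(E.trans e(Z.neg-involutive b)))
 ≢0-neg : ∀ {a} → a ≢ + 0 → -z a ≢ + 0
 ≢0-neg p e = p(neg-swap e)
 Good-resp-↭ : ∀ {xs ys} → xs ↭ ys → Good xs → Good ys
 Good-resp-↭ p(a , b) = All-resp-↭ p a , go p b where
  go : ∀ {xs ys} → xs ↭ ys → AllPairs Sep xs → AllPairs Sep ys
  go P.refl d = d
  go(prep x p)(a ∷ d) = All-resp-↭ p a ∷ go p d
  go(swap x y p)((b ∷ a) ∷ (c ∷ d)) = (Sep-sym b ∷ All-resp-↭ p c) ∷ (All-resp-↭ p a ∷ go p d)
  go(P.trans p q)d = go q(go p d)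
 Good-tail : ∀ {x xs} → Good(x ∷ xs) → Good xs
 Good-tail(_ ∷ a , _ ∷ b) = a , b
 Good-flip : ∀ {x xs} → Good(x ∷ xs) → Good(-z x ∷ xs)
 Good-flip(p ∷ a , q ∷ b) = ≢0-neg p ∷ a , All.map Sep-negˡ q ∷ b
 Good⇒Dist : ∀ {xs} → Good xs → Dist xs
 Good⇒Dist(_ , b) = go b where
  go : ∀ {xs} → AllPairs Sep xs → Dist xs
  go [] = []
  go(p ∷ ps) = All.map proj₁ p ∷ go ps
 -- Multiplying the kernels g c b, f c b and f b c by d b, as polynomials in z = T c.
 u v w d : ℤ → |R| → |R|
 u b z = (1# + (- (P * T b)) * z) * (1# + (- T(-z b)) * z)
 v b z = (P + (- T(-z b)) * z) * (1# + (- T b) * z)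
 w b z = (1# + (- (P * T(-z b))) * z) * (1# + (- T b) * z)
 d b z = (1# + (- T b) * z) * (1# + (- T(-z b)) * z)
 private
  lin : ∀ a c{e} → T a * T c ≈ T e → 1# + (- T a) * T c ≈ ⟦ e ⟧
  lin a c p = solve 2(λ x z → 𝟏 :+ (:- x) :* z := 𝟏 :- x :* z)refl _ _ · +ˡ(-ᶜ p)
 d-T : ∀ c b → d b(T c) ≈ ⟦ c +z b ⟧ * ⟦ -z b +z c ⟧
 d-T c b = *c(lin b c(*-comm _ _ · sym(T-+ c b)))(lin(-z b)c(sym(T-+ (-z b)c)))
 d-T-reg : ∀ {c b} → Sep c b → Regular(d b(T c))
 d-T-reg{c}{b}(p , q) = Regular-cong(sym(d-T c b))(reg-* (⟦⟧-reg(λ e → q(sum-zero c b e)))(⟦⟧-reg(λ e → p(E.sym(a-b≡0⇒a≡b' e)))))where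
  sum-zero : ∀ a b → a +z b ≡ + 0 → a ≡ -z b
  sum-zero a b e = a-b≡0⇒a≡b a(-z b)(E.trans(cong(λ x → a +z x)(Z.neg-involutive b))e)
  a-b≡0⇒a≡b' : -z b +z c ≡ + 0 → b ≡ c
  a-b≡0⇒a≡b' e = E.sym(a-b≡0⇒a≡b c b(E.trans(Z.+-comm c(-z b))e))
 d-g : ∀ {c b} → Sep c b → d b(T c) * g c b ≈ u b(T c)
 d-g{c}{b}(p , q) = *ʳ(*ʳ(lin b c(*-comm _ _ · sym(T-+ c b)))) · solve 4(λ a y n i → a :* y :* (n :* i) := a :* i :* (n :* y))refl _ _ _ _ ·
  *ʳ(ι-law _(λ e → q(sum-zero c b e))) · 1* _ · *ʳ(+ˡ(-ᶜ(T-+ _ _ · *ˡ(T-+ c b))))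
  · *ʳ(solve 3(λ p c b → 𝟏 :- p :* (c :* b) := 𝟏 :+ (:- (p :* b)) :* c)refl _ _ _)where
  y = 1# + (- T(-z b)) * T c
  sum-zero : ∀ a b → a +z b ≡ + 0 → a ≡ -z b
  sum-zero a b e = a-b≡0⇒a≡b a(-z b)(E.trans(cong(λ x → a +z x)(Z.neg-involutive b))e)
 private
  regroup : ∀ {t t' c b F p} → t' * t ≈ 1# → (c - b) * F ≈ c - p * b → b ≈ t → (1# + (- t) * c) * (1# + (- t') * c) * F ≈ (p + (- t') * c) * (1# + (-
   t) * c)
  regroup{t}{t'}{c}{b}{F}{p}inv law e = solve 4(λ t t' c F → (𝟏 :+ (:- t) :* c) :* (𝟏 :+ (:- t') :* c) :* F := (𝟏 :+ (:- t) :* c) :* ((𝟏 :- t'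
   :* c) :* F))refl t t' c F · *ˡ(*ʳ(+ʳ(sym inv))) · solve 4(λ t t' c F → (𝟏 :+ (:- t) :* c) :* ((t' :* t :- t' :* c) :* F) := (:- t') :* (𝟏 :+
   (:- t) :* c) :* ((c :- t) :* F))refl t t' c F · *ˡ(*ʳ(+ˡ(-ᶜ(sym e))) · law · +ˡ(-ᶜ(*ˡ e)))
   · solve 4(λ t t' c p → (:- t') :* (𝟏 :+ (:- t) :* c) :* (c :- p :* t) := (p :* (t' :* t) :+ (:- t') :* c) :* (𝟏 :+ (:- t) :* c))refl t t' c p ·
   *ʳ(+ʳ(*ˡ inv · *-identityʳ p))
 d-f : ∀ {c b} → Sep c b → d b(T c) * f c b ≈ v b(T c)
 d-f{c}{b}(p , q) = regroup(T-invˡ b)(f-law p)refl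
 d-f' : ∀ {c b} → Sep c b → d b(T c) * f b c ≈ w b(T c)
 d-f'{c}{b}(p , q) = solve 4(λ t t' c F → (𝟏 :+ (:- t) :* c) :* (𝟏 :+ (:- t') :* c) :* F := (𝟏 :+ (:- t) :* c) :* ((𝟏 :- t' :* c) :* F))refl(T
  b)(T(-z b))(T c)_ · *ˡ(*ʳ(+ʳ(sym(T-invˡ b))) · solve 4(λ t t' c F → (t' :* t :- t' :* c) :* F := t' :* ((t :- c) :* F))refl _ _ _ _)
  · *ˡ(*ˡ(f-law(λ e → p(E.sym e)))) · solve 4(λ t t' c p → (𝟏 :+ (:- t) :* c) :* (t' :* (t :- p :* c)) := (t' :* t :+ (:- (p :* t')) :* c) :* (𝟏
  :+ (:- t) :* c))refl _ _ _ _ · *ʳ(+ʳ(T-invˡ b))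
 private
  at-self : ∀ b → 1# + (- T(-z b)) * T b ≈ 0#
  at-self b = solve 2(λ x z → 𝟏 :+ (:- x) :* z := 𝟏 :- x :* z)refl _ _ · +ˡ(-ᶜ(T-invˡ b)) · -‿inverseʳ 1#
  at-neg : ∀ b → 1# + (- T b) * T(-z b) ≈ 0#
  at-neg b = solve 2(λ x z → 𝟏 :+ (:- x) :* z := 𝟏 :- x :* z)refl _ _ · +ˡ(-ᶜ(T-inv b)) · -‿inverseʳ 1#
 u-self : ∀ b → u b(T b) ≈ 0#
 u-self b = *ˡ(at-self b) · zeroʳ _
 d-self : ∀ b → d b(T b) ≈ 0#
 d-self b = *ˡ(at-self b) · zeroʳ _
 v-self+w-self : ∀ b → v b(T b) + w b(T b) ≈ 0#
 v-self+w-self b = solve 3(λ p t t' → (p :+ (:- t') :* t) :* (𝟏 :+ (:- t) :* t) :+ (𝟏 :+ (:- (p :* t')) :* t) :* (𝟏 :+ (:- t) :* t) := (𝟏 :+ p) :* (𝟏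
  :+ (:- t') :* t) :* (𝟏 :+ (:- t) :* t))refl P t t' · *ʳ(*ˡ(at-self b) · zeroʳ _) · zeroˡ _ where
  t = T b
  t' = T(-z b)
 v-neg : ∀ b → v b(T(-z b)) ≈ 0#
 v-neg b = *ˡ(at-neg b) · zeroʳ _
 w-neg : ∀ b → w b(T(-z b)) ≈ 0#
 w-neg b = *ˡ(at-neg b) · zeroʳ _
 d-neg : ∀ b → d b(T(-z b)) ≈ 0#
 d-neg b = *ʳ(at-neg b) · zeroˡ _
 u≈v-at-1 : ∀ b z → z ≈ 1# → v b z ≈ u b z
 u≈v-at-1 b z e = *c(+ˡ(*ˡ e))(+ˡ(*ˡ e)) · solve 3(λ p t t' → (p :+ (:- t') :* 𝟏) :* (𝟏 :+ (:- t) :* 𝟏) := (𝟏 :+ (:- (p :* t)) :* 𝟏) :* (𝟏 :+ (:-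
  t') :* 𝟏) :+ (𝟏 :- p) :* (t :* t' :- 𝟏))refl P(T b)(T(-z b)) · +ˡ(*ˡ(+ʳ(T-inv b) · -‿inverseʳ 1#) · zeroʳ _) · +-identityʳ _
  · sym(*c(+ˡ(*ˡ e))(+ˡ(*ˡ e)))
 dbl : ℕ → ℕ
 dbl zero = zero
 dbl(suc n) = suc(suc(dbl n))
 Quadratic : (ℤ → |R| → |R|) → Set
 Quadratic q = ∀ b{e φ} → IsPoly e φ → IsPoly(suc(suc e))(λ z → q b z * φ z)
 private
  quadratic : ∀ {q : ℤ → |R| → |R|}(a1 b1 a2 b2 : ℤ → |R|) → (∀ b z → q b z ≈ (a1 b + b1 b * z) * (a2 b + b2 b * z)) → Quadratic q
  quadratic a1 b1 a2 b2 e b p = poly-cong(λ z → _·_(sym(*-assoc _ _ _))(*ʳ(sym(e b z))))(poly-linear(a1 b)(b1 b)(poly-linear(a2 b)(b2 b)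
   p))
 u-quadratic : Quadratic u
 u-quadratic = quadratic(λ _ → 1#)(λ b → - (P * T b))(λ _ → 1#)(λ b → - T(-z b))(λ _ _ → refl)
 v-quadratic : Quadratic v
 v-quadratic = quadratic(λ _ → P)(λ b → - T(-z b))(λ _ → 1#)(λ b → - T b)(λ _ _ → refl)
 w-quadratic : Quadratic w
 w-quadratic = quadratic(λ _ → 1#)(λ b → - (P * T(-z b)))(λ _ → 1#)(λ b → - T b)(λ _ _ → refl)
 d-quadratic : Quadratic d
 d-quadratic = quadratic(λ _ → 1#)(λ b → - T b)(λ _ → 1#)(λ b → - T(-z b))(λ _ _ → refl)
 poly-∏ : ∀ {q} → Quadratic q → ∀ xs → IsPoly(dbl(length xs))(λ z → ∏ (λ b → q b z)xs)
 poly-∏ Q [] = poly-const 1#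
 poly-∏ Q(x ∷ xs) = Q x(poly-∏ Q xs)
 poly-∏∏ : ∀ {q q'} → Quadratic q → Quadratic q' → ∀ h r → IsPoly(dbl(length h +n length r))(λ z → ∏ (λ b → q b z)h * ∏ (λ b → q' b z)r)
 poly-∏∏ Q Q' [] r = poly-cong(λ z → sym(1* _))(poly-∏ Q' r)
 poly-∏∏ Q Q'(x ∷ h)r = poly-cong(λ z → sym(*-assoc _ _ _))(Q x(poly-∏∏ Q Q' h r))
 poly-spl : ∀ {e : ℕ}{A : Set}(xs : List A)(F : List A → List A → |R| → |R|) → (∀ h r → xs ↭ h ++ r → IsPoly e(F h r)) → IsPoly e(λ z → spl xs(λ
  h r → F h r z))
 poly-spl [] F p = p [] [] ↭-refl
 poly-spl(x ∷ xs)F p = poly-+ (poly-spl xs _(λ h r q → p(x ∷ h)r(prep x q)))(poly-spl xs _(λ h r q → p h(x ∷ r)(↭-trans(prep x q)(↭-sym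
  (shift x h r)))))
 poly-sgn : ∀ {e : ℕ}xs(F : List ℤ → |R| → |R|) → (∀ cs → length cs ≡ length xs → IsPoly e(F cs)) → IsPoly e(λ z → sgn xs(λ cs → F cs z))
 poly-sgn [] F p = p [] rfl
 poly-sgn(x ∷ xs)F p = poly-+ (poly-sgn xs _(λ cs l → p(x ∷ cs)(cong suc l)))(poly-sgn xs _(λ cs l → p(-z x ∷ cs)(cong suc l)))
 nodes : List ℤ → List ℤ
 nodes xs = + 0 ∷ xs ++ negs xs
 -- Vanishing at 0, 1, x and 1/x for the variables x = T b with b in xs.
 vanish-at-nodes : ∀ {φ}xs → Good xs → (∀ {z w} → z ≈ w → φ z ≈ φ w) → IsPoly(suc(dbl(length xs)))φ → φ 0# ≈ 0# → φ 1# ≈ 0# → (∀ {b} → b ∈ xs → φ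
  (T b) ≈ 0# × φ(T(-z b)) ≈ 0#) → ∀ z → φ z ≈ 0#
 vanish-at-nodes{φ}xs good φ-cong poly at0 at1 atb = poly-vanish poly(0# ∷ map T(nodes xs))len(Allₚ.map⁺ (All.universal(λ c → Regular-cong
  (solve 1(λ t → t := t :- 𝟎)refl _)(T-reg c))(nodes xs)) ∷ APₚ.map⁺ (pairs⁺ (nodes-distinct good)))(at0 ∷ Allₚ.map⁺ (_·_(φ-cong T-0)at1 ∷
  Allₚ.++⁺ (All.tabulate(λ i → proj₁(atb i)))(Allₚ.map⁺ (All.tabulate(λ i → proj₂(atb i))))))where
  len : length(0# ∷ map T(nodes xs)) ≡ suc(suc(dbl(length xs)))
  len = cong suc(E.trans(length-map T(nodes xs))(cong suc(E.trans(length-++ xs)(E.trans(cong(length xs +n_)(length-map(λ a → -z a)xs))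
   (double(length xs))))))where
   double : ∀ n → n +n n ≡ dbl n
   double zero = rfl
   double(suc n) = cong suc(E.trans(N.+-suc n n)(cong suc(double n)))
  pairs⁺ : ∀ {ys} → Dist ys → AllPairs(λ a b → Regular(T b - T a))ys
  pairs⁺ [] = []
  pairs⁺ (p ∷ ps) = All.map T-diff-reg p ∷ pairs⁺ ps
  neg-distinct : ∀ {ys} → Dist ys → Dist(negs ys)
  neg-distinct [] = []
  neg-distinct(p ∷ ps) = Allₚ.map⁺ (All.map(λ q e → q(neg-injective e))p) ∷ neg-distinct ps
  nodes-distinct : ∀ {ys} → Good ys → Dist(nodes ys)
  nodes-distinct{ys}(nz , sep) = Allₚ.++⁺ (All.map(λ p e → p(E.sym e))nz)(Allₚ.map⁺ (All.map(λ p e → p(neg-swap(E.sym e)))nz)) ∷ APₚ.++⁺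
   (Good⇒Dist(nz , sep))(neg-distinct(Good⇒Dist(nz , sep)))(All.tabulate(λ{a}i → Allₚ.map⁺ (All.tabulate(λ{b}j → apart sep nz i j))))where
   apart : ∀ {ys a b} → AllPairs Sep ys → All(_≢ + 0)ys → a ∈ ys → b ∈ ys → a ≢ -z b
   apart(p ∷ ps)(z ∷ zs)(here rfl)(here rfl)e = z(self-neg _ e)where
    self-neg : ∀ a → a ≡ -z a → a ≡ + 0
    self-neg(+ zero)_ = rfl
    self-neg(+ suc n)()
    self-neg -[1+ n ]()
   apart(p ∷ ps)(z ∷ zs)(here rfl)(there j)e = proj₂(All.lookup p j)e
   apart(p ∷ ps)(z ∷ zs)(there i)(here rfl)e = proj₂(Sep-sym(All.lookup p i))e
   apart(p ∷ ps)(z ∷ zs)(there i)(there j)e = apart ps zs i j e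
 ∈⇒↭ : ∀ {b : ℤ}{xs} → b ∈ xs → ∃ λ ys → xs ↭ b ∷ ys
 ∈⇒↭ {b}i with ∈-∃++ i
 ... | ys , zs , rfl = ys ++ zs , shift b ys zs
module Evals(R : Ring)(χ : Char R)(M : ℤ)where
 open CommutativeRing R hiding (zero) renaming (Carrier to |R|; *-congˡ to *ˡ; *-congʳ to *ʳ; +-congˡ to +ˡ; +-congʳ to +ʳ; *-identityˡ to 1*; -‿cong
  to -ᶜ; *-cong to *c; +-cong to +c; reflexive to rfx; trans to infixr 1 _·_)
 open Char χ
 open RingSolver R
 open Polynomials R
 open Sums R
 open SignedSums R
 open CharProperties R χ
 open Kernel R χ (M +z M)
 open SplitSums R χ (M +z M)
 open Symm R χ M
 private
  at : (ℤ → |R| → |R|) → |R| → List ℤ → |R|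
  at q z = ∏ (λ b → q b z)
  at-cong : ∀ {q} → (∀ b{z w} → z ≈ w → q b z ≈ q b w) → ∀ {z w}xs → z ≈ w → at q z xs ≈ at q w xs
  at-cong h xs e = ∏-cong(λ b → h b e)xs
  lin-cong : ∀ a c{z w} → z ≈ w → a + c * z ≈ a + c * w
  lin-cong a c e = +ˡ(*ˡ e)
  u-cong : ∀ b{z w} → z ≈ w → u b z ≈ u b w
  u-cong b e = *c(lin-cong _ _ e)(lin-cong _ _ e)
  v-cong : ∀ b{z w} → z ≈ w → v b z ≈ v b w
  v-cong b e = *c(lin-cong _ _ e)(lin-cong _ _ e)
  w-cong : ∀ b{z w'} → z ≈ w' → w b z ≈ w b w'
  w-cong b e = *c(lin-cong _ _ e)(lin-cong _ _ e)
  d-cong : ∀ b{z w} → z ≈ w → d b z ≈ d b w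
  d-cong b e = *c(lin-cong _ _ e)(lin-cong _ _ e)
  lin-0 : ∀ a c → a + c * 0# ≈ a
  lin-0 a c = solve 2(λ a c → a :+ c :* 𝟎 := a)refl a c
  at-0 : ∀ {q}c → (∀ b → q b 0# ≈ c) → ∀ xs → at q 0# xs ≈ c ^ᵣ length xs
  at-0 c h xs = ∏-cong h xs · ∏-const c xs
  at-0-1 : ∀ {q} → (∀ b → q b 0# ≈ 1#) → ∀ xs → at q 0# xs ≈ 1#
  at-0-1{q}h xs = at-0{q}1# h xs · one^ (length xs)
  u-0 : ∀ b → u b 0# ≈ 1#
  u-0 b = *c(lin-0 _ _)(lin-0 _ _) · 1* _
  w-0 : ∀ b → w b 0# ≈ 1#
  w-0 b = *c(lin-0 _ _)(lin-0 _ _) · 1* _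
  d-0 : ∀ b → d b 0# ≈ 1#
  d-0 b = *c(lin-0 _ _)(lin-0 _ _) · 1* _
  v-0 : ∀ b → v b 0# ≈ P
  v-0 b = *c(lin-0 _ _)(lin-0 _ _) · *-identityʳ _
  ∏2-cong : ∀ {a b c e : ℤ → |R|}{xs} → All(λ x → a x * b x ≈ c x * e x)xs → ∏ a xs * ∏ b xs ≈ ∏ c xs * ∏ e xs
  ∏2-cong{xs = xs}p = sym(∏-* _ _ xs) · ∏-cong-All p · ∏-* _ _ xs
  ∏21-cong : ∀ {a b c : ℤ → |R|}{xs} → All(λ x → a x * b x ≈ c x)xs → ∏ a xs * ∏ b xs ≈ ∏ c xs
  ∏21-cong{xs = xs}p = sym(∏-* _ _ xs) · ∏-cong-All p
  ∏-split : ∀ φ{xs : List ℤ}H Q → xs ↭ H ++ Q → ∏ φ xs ≈ ∏ φ H * ∏ φ Q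
  ∏-split φ H Q p = ∏-↭ φ p · ∏-++ φ H Q
  reg-∏ : ∀ {φ : ℤ → |R|}{xs} → All(λ x → Regular(φ x))xs → Regular(∏ φ xs)
  reg-∏ [] = Regular-cong refl(invertible⇒reg(1* 1#))
  reg-∏ (p ∷ ps) = reg-* p(reg-∏ ps)
 gu≈gv : ∀ {b y} → Sep b y → g b y * u y(T(-z b)) ≈ g(-z b)y * v y(T(-z b))
 gu≈gv{b}{y}p = *ˡ(sym(d-g(Sep-negˡ p))) · *ʳ(g-cong{b}{y}{ -z(-z b)}{y}(cong(λ x → x +z y)(E.sym(Z.neg-involutive b)))
  · sym(f≈g(-z b)y)) · solve 3(λ a b c → a :* (b :* c) := c :* (b :* a))refl _ _ _ · *ˡ(d-f(Sep-negˡ p))where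
  z = T(-z b)
 private
  C : List ℤ → List ℤ → |R|
  C H Q = x∏ H * ∏ ⟦_⟧ Q * cross f H Q * pairs g H
  C-∷ˡ : ∀ b H Q → C(b ∷ H)Q ≈ C H Q * T b * (∏ (f b)Q * ∏ (g b)H)
  C-∷ˡ b H Q = solve 7(λ t x q φ k γ p → (t :* x) :* q :* (φ :* k) :* (γ :* p) := x :* q :* k :* p :* t :* (φ :* γ))refl _ _ _ _ _ _ _
  C-∷ʳ : ∀ b H Q → C H(b ∷ Q) ≈ C H Q * ⟦ b ⟧ * ∏ (λ h → f h b)H
  C-∷ʳ b H Q = *ʳ(*ˡ(cross-∷ʳ f H b Q)) · solve 6(λ x t q φ k p → x :* (t :* q) :* (φ :* k) :* p := x :* q :* k :* p :* t :* φ)refl _ _ _ _ _ _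
  C-↭ : Respects C
  C-↭ p q = *c(*c(*c(∏-↭ T p)(∏-↭ ⟦_⟧ q))(cross-↭ f p q))(pairs-↭ g g-sym p)
  bracket : List ℤ → List ℤ → |R| → |R|
  bracket H Q z = (0# + 1# * z) * (at u z H * at v z Q) + (1# + (- 1#) * z) * (at w z H * at d z Q)
  φ : List ℤ → |R| → |R|
  φ xs z = spl xs(λ H Q → C H Q * bracket H Q z) + (- pairs g xs) * ((1# + 0# * z) * at u z xs)
  bracket-↭ : ∀ z → Respects(λ H Q → C H Q * bracket H Q z)
  bracket-↭ z p q = *c(C-↭ p q)(+c(*ˡ(*c(∏-↭ _ p)(∏-↭ _ q)))(*ˡ(*c(∏-↭ _ p)(∏-↭ _ q))))
  φ-↭ : ∀ {xs ys}z → xs ↭ ys → φ xs z ≈ φ ys z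
  φ-↭ z p = +c(spl-↭ (bracket-↭ z)p)(*c(-ᶜ(pairs-↭ g g-sym p))(*ˡ(∏-↭ _ p)))
  φ-cong : ∀ xs{z z'} → z ≈ z' → φ xs z ≈ φ xs z'
  φ-cong xs e = +c(spl-cong' xs(λ H Q → *ˡ(+c(*c(lin-cong _ _ e)(*c(at-cong{u}u-cong H e)(at-cong{v}v-cong Q e)))(*c(lin-cong _ _ e)(*c
   (at-cong{w}w-cong H e)(at-cong{d}d-cong Q e))))))(*ˡ(*c(lin-cong _ _ e)(at-cong{u}u-cong xs e)))
  φ-poly : ∀ xs → IsPoly(suc(dbl(length xs)))(φ xs)
  φ-poly xs = poly-+ (poly-spl xs(λ H Q z → C H Q * bracket H Q z)(λ H Q p → poly-scale(C H Q)(poly-+ (poly-linear 0# 1#(deg H Q p(poly-∏∏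
   u-quadratic v-quadratic H Q)))(poly-linear 1#(- 1#)(deg H Q p(poly-∏∏ w-quadratic d-quadratic H Q))))))(poly-scale(- pairs g xs)(poly-linear
   1# 0#(poly-∏ u-quadratic xs)))where
   deg : ∀ H Q → xs ↭ H ++ Q → ∀ {ψ} → IsPoly(dbl(length H +n length Q))ψ → IsPoly(dbl(length xs))ψ
   deg H Q p{ψ} = subst(λ e → IsPoly(dbl e)ψ)(E.sym(split-length{h = H}{r = Q}p))
 -- Σ_λ P_λ(x; t), summed over λ by the set of variables with positive exponent.
 ∑-pairs : ∀ n S → length S ≤ n → Good S → spl S(λ H Q → x∏ H * ∏ ⟦_⟧ Q * cross f H Q * pairs g H) ≈ pairs g S
 ∑-pairs n [] _ _ = solve 0(𝟏 :* 𝟏 :* 𝟏 :* 𝟏 := 𝟏)refl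
 ∑-pairs(suc n)(a ∷ xs)(s≤s le)good@(_ , sep ∷ _) = reg-cancel(reg-∏ (All.map d-T-reg sep))(*ˡ(sym(spl-+ _ _ xs))
  · sym(spl-*ˡ _ _ xs) · spl-cong xs step · x-y≈0⇒x≈y(+ˡ(solve 2(λ p q → :- (p :* q) := (:- p) :* ((𝟏 :+ 𝟎 :* q) :* q))refl _ _)
  · +ˡ(*ˡ(*ʳ(solve 2(λ p q → 𝟏 :+ 𝟎 :* p := 𝟏 :+ 𝟎 :* q)refl _ _))) · vanish(T a)) · *ˡ(sym(∏21-cong(All.map d-g sep)))
  · solve 3(λ a b c → a :* (b :* c) := b :* (c :* a))refl _ _ _)where
  Δ = at d(T a)xs
  goodxs = Good-tail good
  step : ∀ H Q → xs ↭ H ++ Q → Δ * (C(a ∷ H)Q + C H(a ∷ Q)) ≈ C H Q * bracket H Q(T a)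
  step H Q p = *c(∏-split _ H Q p)(+c(C-∷ˡ a H Q)(C-∷ʳ a H Q)) · solve 7(λ dh dq c t φ γ ψ → (dh :* dq) :* (c :* t :* (φ :* γ) :+ c :* (𝟏 :- t)
   :* ψ) := c :* ((𝟎 :+ 𝟏 :* t) :* ((dh :* γ) :* (dq :* φ)) :+ (𝟏 :+ (:- 𝟏) :* t) :* ((dh :* ψ) :* dq)))refl _ _ _ _ _ _ _
   · *ˡ(+c(*ˡ(*c(∏21-cong(All.map d-g sepH))(∏21-cong(All.map d-f sepQ))))(*ˡ(*ʳ(∏21-cong(All.map d-f' sepH)))))where
   z = T a
   sepH = proj₁(split-All{r = Q}p sep)
   sepQ = proj₂(split-All{h = H}p sep)
  at-zero : φ xs 0# ≈ 0#
  at-zero = +c(spl-cong' xs(λ H Q → _·_(*ˡ(+c(*ʳ(lin-0 _ _) · zeroˡ _)(*c(lin-0 _ _)(*c(at-0-1{w}w-0 H)(at-0-1{d}d-0 Q)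
   · 1* 1#)) · +-identityˡ _ · 1* _))(*-identityʳ _)))(*ˡ(*c(lin-0 _ _)(at-0-1{u}u-0 xs) · 1* _))
   · +c(∑-pairs n xs le goodxs)(*-identityʳ _) · -‿inverseʳ _
  at-one : φ xs 1# ≈ 0#
  at-one = +ʳ(spl-cong xs(λ H Q p → (*ˡ(+ʳ(*ˡ(*ˡ(∏-cong(λ b → u≈v-at-1 b 1# refl)Q))))
   · solve 3(λ c x y → c :* ((𝟎 :+ 𝟏 :* 𝟏) :* x :+ (𝟏 :+ (:- 𝟏) :* 𝟏) :* y) := x :* c)refl _ _ _ · *ʳ(sym(∏-split _ H Q p)))))
   · +ʳ(spl-*ˡ _ _ xs · *ˡ(∑-pairs n xs le goodxs)) · solve 2(λ a b → a :* b :+ (:- b) :* ((𝟏 :+ 𝟎 :* 𝟏) :* a) := 𝟎)refl _ _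
  module Node{b ys}(p : xs ↭ b ∷ ys)where
   goody : Good(b ∷ ys)
   goody = Good-resp-↭ p goodxs
   sepy : All(Sep b)ys
   sepy with proj₂ goody
   ... | q ∷ _ = q
   ley : length ys ≤ n
   ley = N.≤-trans(N.n≤1+n _)(subst(_≤ n)(↭-length p)le)
   at-b : φ xs(T b) ≈ 0#
   at-b = φ-↭ z p · +c(sym(spl-+ _ _ ys) · spl-0 ys cancel)(*ˡ(*ˡ(*ʳ(u-self b) · zeroˡ _) · zeroʳ _)) · +-identityˡ _ · zeroʳ _ where
    z = T b
    cancel : ∀ H Q → ys ↭ H ++ Q → C(b ∷ H)Q * bracket(b ∷ H)Q z + C H(b ∷ Q) * bracket H(b ∷ Q)z ≈ 0#
    cancel H Q q = +c(*c(C-∷ˡ b H Q)(+ʳ(*ˡ(*ʳ(*ʳ(u-self b) · zeroˡ _)))))(*c(C-∷ʳ b H Q)(+ˡ(*ˡ(*ˡ(*ʳ(d-self b) · zeroˡ _)))))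
     · solve 12(λ c z φ γ ψ vq wb wh dq uh vb x → c :* z :* (φ :* γ) :* ((𝟎 :+ 𝟏 :* z) :* (𝟎 :* vq) :+ (𝟏 :+ (:- 𝟏) :* z) :* ((wb :* wh) :* dq)) :+ c
     :* (𝟏 :- z) :* ψ :* ((𝟎 :+ 𝟏 :* z) :* (uh :* (vb :* vq)) :+ (𝟏 :+ (:- 𝟏) :* z) :* (wh :* 𝟎)) := c :* z :* (𝟏 :- z) :* (wb :* ((γ :* wh) :* (dq :*
     φ)) :+ vb :* ((ψ :* uh) :* vq)))refl _ z _ _ _ _ _ _ _ _ _ 0# · *ˡ(+ʳ(*ˡ(*c(∏2-cong(All.map gw(proj₁(split-All{r = Q}q sepy))))
     (∏21-cong(All.map d-f(proj₂(split-All{h = H}q sepy))))))) · solve 4(λ c w v x → c :* (w :* x :+ v :* x) := c :* x :* (v :+ w))refl _ _ _ _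
     · *ˡ(v-self+w-self b) · zeroʳ _ where
     gw : ∀ {y} → Sep b y → g b y * w y z ≈ f y b * u y z
     gw{y}σ = *ˡ(sym(d-f' σ)) · solve 3(λ a b c → a :* (b :* c) := c :* (b :* a))refl _ _ _ · *ˡ(d-g σ)
   at-−b : φ xs(T(-z b)) ≈ 0#
   at-−b = φ-↭ z p · +ʳ(sym(spl-+ _ _ ys) · spl-cong ys collect) · +ʳ(spl-*ˡ _ _ ys · *ˡ(∑-pairs n ys ley(Good-tail goody)))
    · solve 5(λ u γ m p z → u :* (γ :* m) :* p :+ (:- (γ :* p)) :* ((𝟏 :+ 𝟎 :* z) :* (u :* m)) := 𝟎)refl _ _ _ _ z where
    z = T(-z b)
    E = u b z * (∏ (g b)ys * at u z ys)
    collect : ∀ H Q → ys ↭ H ++ Q → C(b ∷ H)Q * bracket(b ∷ H)Q z + C H(b ∷ Q) * bracket H(b ∷ Q)z ≈ E * C H Q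
    collect H Q q = +c(*c(C-∷ˡ b H Q)(+ˡ(*ˡ(*ʳ(*ʳ(w-neg b) · zeroˡ _)))))(*ˡ(+c(*ˡ(*ˡ(*ʳ(v-neg b)
     · zeroˡ _)))(*ˡ(*ˡ(*ʳ(d-neg b) · zeroˡ _))))) · solve 12(λ c t φ γ z ub uh vq dq c' wh x → c :* t :* (φ :* γ) :* ((𝟎 :+ 𝟏 :* z) :* ((ub :*
     uh) :* vq) :+ (𝟏 :+ (:- 𝟏) :* z) :* (𝟎 :* dq)) :+ c' :* ((𝟎 :+ 𝟏 :* z) :* (uh :* 𝟎) :+ (𝟏 :+ (:- 𝟏) :* z) :* (wh :* 𝟎)) := (t :* z) :* (ub :* ((γ
     :* uh) :* (φ :* vq)) :* c))refl _ _ _ _ z _ _ _ _ _ _ 0# · *c(T-inv b)(*ʳ(*ˡ(*ˡ(*ʳ(∏-cong(f≈g b)Q)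
     · ∏2-cong(All.map(λ σ → sym(gu≈gv σ))(proj₂(split-All{h = H}q sepy))))))) · (1* _ · *ʳ(*ˡ(*-interchange _ _ _ _)))
     · *ʳ(*ˡ(*c(sym(∏-split _ H Q q))(sym(∏-split _ H Q q))))
  vanish : ∀ z → φ xs z ≈ 0#
  vanish = vanish-at-nodes xs goodxs(φ-cong xs)(φ-poly xs)at-zero at-one(λ i → let ys , p = ∈⇒↭ i in Node.at-b p , Node.at-−b p)
 Ξ : List ℤ → |R|
 Ξ cs = ∏ s cs * pairs g cs
 Ξ-↭ : Symmetric Ξ
 Ξ-↭ p = *c(∏-↭ s p)(pairs-↭ g g-sym p)
 Ξ-∷ : ∀ b cs → Ξ(b ∷ cs) ≈ Ξ cs * (s b * ∏ (g b)cs)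
 Ξ-∷ b cs = solve 4(λ s t γ p → (s :* t) :* (γ :* p) := (t :* p) :* (s :* γ))refl _ _ _ _
 ι-neg : ∀ {b} → b ≢ + 0 → ι(-z b) ≈ - (T b * ι b)
 ι-neg{b}p = reg-cancel(⟦⟧-reg(≢0-neg p))(ι-law _(≢0-neg p) · sym(*c(T-inv b)(ι-law b p) · 1* _)
  · solve 4(λ t t' c i → t :* t' :* (c :* i) := (:- (t' :* c)) :* (:- (t :* i)))refl _ _ _ _ · *ʳ(sym(⟦neg⟧ b)))
 private
  bracket± : List ℤ → |R| → |R|
  bracket± cs z = (1# + π * z) * at u z cs + (- 1#) * ((π + 1# * z) * at v z cs)
  F : |R| → List ℤ → |R|
  F z cs = Ξ cs * bracket± cs z
  F-↭ : ∀ z → Symmetric(F z)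
  F-↭ z p = *c(Ξ-↭ p)(+c(*ˡ(∏-↭ _ p))(*ˡ(*ˡ(∏-↭ _ p))))
  ψ : List ℤ → |R| → |R|
  ψ xs z = sgn xs(F z) + (- poch² π ππ(suc(length xs))) * ((1# + (- 1#) * z) * at d z xs)
  ψ-cong : ∀ xs{z z'} → z ≈ z' → ψ xs z ≈ ψ xs z'
  ψ-cong xs e = +c(sgn-cong' xs(λ cs → *ˡ(+c(*c(lin-cong _ _ e)(at-cong{u}u-cong cs e))(*ˡ(*c(lin-cong _ _ e)(at-cong{v}v-cong cs
   e))))))(*ˡ(*c(lin-cong _ _ e)(at-cong{d}d-cong xs e)))
  ψ-poly : ∀ xs → IsPoly(suc(dbl(length xs)))(ψ xs)
  ψ-poly xs = poly-+ (poly-sgn xs(λ cs z → F z cs)(λ cs l → poly-scale(Ξ cs)(poly-+ (poly-linear 1# π(deg l(poly-∏ u-quadratic cs)))(poly-scale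
   (- 1#)(poly-linear π 1#(deg l(poly-∏ v-quadratic cs)))))))(poly-scale _(poly-linear 1#(- 1#)(poly-∏ d-quadratic xs)))where
   deg : ∀ {k l} → k ≡ l → ∀ {η} → IsPoly(dbl k)η → IsPoly(dbl l)η
   deg rfl p = p
  at-node : ∀ {b ys} → Good(b ∷ ys) → sgn(b ∷ ys)(F(T(-z b))) ≈ 0#
  at-node{b}{ys}(b≢0 ∷ _ , sep ∷ _) = sym(sgn-+ _ _ ys) · sgn-cong{Sep b}Sep-negʳ ys sep(λ cs σ _ → cancel cs σ) · sgn-0 ys where
   z = T(-z b)
   x = T b
   inv : x * z ≈ 1#
   inv = T-inv b
   sum : s b * ((1# + π * z) * u b z) + (- 1#) * (s(-z b) * ((π + 1# * z) * v(-z b)z)) ≈ 0#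
   sum = +c(*c(*ʳ(+ˡ(T-+ M b)))refl)(*ˡ(*c(*c(+ˡ(T-+ M(-z b)))(ι-neg b≢0))(*ˡ(*ʳ(+ˡ(*ʳ(-ᶜ(T-cong(Z.neg-involutive b))))))))) ·
    solve 5(λ x z i q p → (𝟏 :+ q :* x) :* i :* ((𝟏 :+ q :* z) :* ((𝟏 :+ (:- (p :* x)) :* z) :* (𝟏 :+ (:- z) :* z))) :+ (:- 𝟏) :* ((𝟏 :+ q :* z) :*
    (:- (x :* i)) :* ((q :+ 𝟏 :* z) :* ((p :+ (:- x) :* z) :* (𝟏 :+ (:- z) :* z)))) := i :* (𝟏 :+ q :* z) :* (𝟏 :- z :* z) :* ((𝟏 :+ q :* x) :* (𝟏 :-
    p :* (x :* z)) :+ (q :* x :+ x :* z) :* (p :- x :* z)))refl x z(ι b)π P · *ˡ(+c(*ˡ(+ˡ(-ᶜ(*ˡ inv))))(*c(+ˡ inv)(+ˡ(-ᶜ inv))))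
    · solve 4(λ c q x p → c :* ((𝟏 :+ q :* x) :* (𝟏 :- p :* 𝟏) :+ (q :* x :+ 𝟏) :* (p :- 𝟏)) := 𝟎)refl _ π x P
   cancel : ∀ cs → All(Sep b)cs → F z(b ∷ cs) + F z(-z b ∷ cs) ≈ 0#
   cancel cs σ = +c(*c(Ξ-∷ b cs)(+ˡ(*ˡ(*ˡ(*ʳ(v-neg b) · zeroˡ _)))))(*c(Ξ-∷ (-z b)cs)(+ʳ(*ˡ(*ʳ(u-self(-z b)) · zeroˡ _))))
    · solve 11(λ c sb γ e ub uc q sb' γ' vb vc → c :* (sb :* γ) :* (e :* (ub :* uc) :+ (:- 𝟏) :* (q :* 𝟎)) :+ c :* (sb' :* γ') :* (e :* 𝟎 :+ (:- 𝟏)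
    :* (q :* (vb :* vc))) := c :* ((sb :* (e :* ub)) :* (γ :* uc) :+ (:- 𝟏) :* (sb' :* (q :* vb)) :* (γ' :* vc)))refl _ _ _ _ _ _ _ _ _ _ _
    · *ˡ(+ˡ(*ˡ(sym(∏2-cong(All.map gu≈gv σ))))) · *ˡ(sym(distribʳ _ _ _)) · *ˡ(*ʳ sum · zeroˡ _) · zeroʳ _
  ∏-even : ∀ η → (∀ b → η(-z b) ≈ η b) → ∀ xs G → sgn xs(λ cs → ∏ η cs * G cs) ≈ ∏ η xs * sgn xs G
  ∏-even η ev [] G = refl
  ∏-even η ev(x ∷ xs)G = +c(sgn-cong' xs(λ cs → solve 3(λ a b c → a :* b :* c := b :* (a :* c))refl _ _ _) · ∏-even η ev xs _
   · *ˡ(sgn-*ˡ _ _ xs))(sgn-cong' xs(λ cs → solve 3(λ a b c → a :* b :* c := b :* (a :* c))refl _ _ _) · ∏-even η ev xs _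
   · *ˡ(sgn-*ˡ _ _ xs · *ʳ(ev x))) · solve 4(λ e p a b → p :* (e :* a) :+ p :* (e :* b) := e :* p :* (a :+ b))refl _ _ _ _
 -- The constant term identity for the hyperoctahedral symmetrization.
 ∑-Ξ : ∀ xs → Good xs → sgn xs Ξ ≈ poch² π ππ(length xs)
 ∑-Ξ [] _ = 1* 1#
 ∑-Ξ(a ∷ xs)good@(a≢0 ∷ _ , sep ∷ _) = reg-cancel(reg-* (⟦⟧-reg a≢0)(reg-∏ (All.map d-T-reg sep)))((*ˡ(sym(sgn-+ _ _ xs))
  · solve 3(λ a b c → a :* b :* c := b :* (a :* c))refl _ _ _ · *ˡ(sym(sgn-*ˡ _ _ xs))) · sym(∏-even(λ b → d b z)d-even xs _)
  · sgn-cong{Sep a}Sep-negʳ xs sep(λ cs σ _ → step cs σ) · x-y≈0⇒x≈y(+ˡ(solve 2(λ p q → :- (p :* q) := (:- p) :* q)refl _ _)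
  · vanish z) · solve 3(λ p z e → p :* ((𝟏 :+ (:- 𝟏) :* z) :* e) := (𝟏 :- z) :* e :* p)refl _ _ _)where
  z = T a
  Δ = at d z xs
  goodxs = Good-tail good
  d-even : ∀ b → d(-z b)z ≈ d b z
  d-even b = *-comm _ _ · *ʳ(+ˡ(*ʳ(-ᶜ(T-cong(Z.neg-involutive b)))))
  step : ∀ cs → All(Sep a)cs → at d z cs * (⟦ a ⟧ * (Ξ(a ∷ cs) + Ξ(-z a ∷ cs))) ≈ F z cs
  step cs σ = *ˡ(*ˡ(+c(Ξ-∷ a cs)(Ξ-∷ (-z a)cs · *ˡ(*c(*c(+ˡ(T-+ M(-z a)))(ι-neg a≢0))(∏-cong(λ c → sym(f≈g a c))cs)))))
   · solve 9(λ e n c t i γ q z' φ → e :* ((𝟏 :- n) :* (c :* ((𝟏 :+ t) :* i :* γ) :+ c :* ((𝟏 :+ q :* z') :* (:- (n :* i)) :* φ))) := c :* ((𝟏 :- n)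
   :* i) :* ((𝟏 :+ t) :* (e :* γ) :+ (:- 𝟏) :* ((q :* (n :* z') :+ 𝟏 :* n) :* (e :* φ))))refl _ z _ _ _ _ _ _ _ · *c(*ˡ(ι-law a a≢0)
   · *-identityʳ _)(+c(*c(+ˡ(T-+ M a))(∏21-cong(All.map d-g σ)))(*ˡ(*c(+ʳ(*ˡ(T-inv a) · *-identityʳ _))(∏21-cong(All.map d-f σ)))))
  at-zero : ψ xs 0# ≈ 0#
  at-zero = +c(sgn-cong{λ _ → ⊤}(λ _ → tt)xs(All.universal(λ _ → tt)xs)(λ cs _ l → (*ˡ(+c(*c(lin-0 _ _)(at-0-1{u}u-0 cs))(*ˡ(*c(lin-0
   _ _)(at-0{v}P v-0 cs · rfx(cong(P ^ᵣ_)l))))) · solve 3(λ c q p → c :* (𝟏 :* 𝟏 :+ (:- 𝟏) :* (q :* p)) := (𝟏 :- q :* p) :* c)refl _ _ _)))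
   (*ˡ(*c(lin-0 _ _)(at-0-1{d}d-0 xs) · 1* _)) · +ʳ(sgn-*ˡ _ _ xs · *ˡ(∑-Ξ xs goodxs))
   · solve 2(λ a b → a :* b :+ (:- (b :* a)) :* 𝟏 := 𝟎)refl _ _ where
   open import Data.Unit using (⊤; tt)
  at-one : ψ xs 1# ≈ 0#
  at-one = +c(sgn-cong' xs(λ cs → (*ˡ(+ˡ(*ˡ(*ˡ(∏-cong(λ b → u≈v-at-1 b 1# refl)cs))))
   · solve 3(λ c q e → c :* ((𝟏 :+ q :* 𝟏) :* e :+ (:- 𝟏) :* ((q :+ 𝟏 :* 𝟏) :* e)) := 𝟎)refl _ _ _))
   · sgn-0 xs)(solve 2(λ p e → (:- p) :* ((𝟏 :+ (:- 𝟏) :* 𝟏) :* e) := 𝟎)refl _ _) · +-identityˡ 0#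
  at-b : ∀ {b} → b ∈ xs → ψ xs(T b) ≈ 0# × ψ xs(T(-z b)) ≈ 0#
  at-b{b}i = let ys , p = ∈⇒↭ i in plus p , minus p where
   rest : ∀ {z ys} → (∃ λ c → (c ≡ b) × d c z ≈ 0#) → xs ↭ b ∷ ys → (- poch² π ππ(suc(length xs))) * ((1# + (- 1#) * z) * at d z xs) ≈ 0#
   rest(_ , rfl , e)p = *ˡ(*ˡ(∏-↭ _ p · *ʳ e · zeroˡ _) · zeroʳ _) · zeroʳ _
   minus : ∀ {ys} → xs ↭ b ∷ ys → ψ xs(T(-z b)) ≈ 0#
   minus p = +c(sgn-↭ (F-↭ _)p · at-node(Good-resp-↭ p goodxs))(rest(b , rfl , d-neg b)p) · +-identityˡ 0#
   plus : ∀ {ys} → xs ↭ b ∷ ys → ψ xs(T b) ≈ 0#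
   plus{ys}p = +c(sgn-↭ (F-↭ _)p · sgn-flip(F-↭ _)b ys · rfx(cong(λ c → sgn(-z b ∷ ys)(F(T c)))(E.sym(Z.neg-involutive b)))
    · at-node(Good-flip(Good-resp-↭ p goodxs)))(rest(b , rfl , d-self b)p) · +-identityˡ 0#
  vanish : ∀ z → ψ xs z ≈ 0#
  vanish = vanish-at-nodes xs goodxs(ψ-cong xs)(ψ-poly xs)at-zero at-one at-b
module Bounded(R : Ring)(χ : Char R)(M : ℤ)where
 open CommutativeRing R hiding (zero) renaming (Carrier to |R|; *-congˡ to *ˡ; *-congʳ to *ʳ; +-congˡ to +ˡ; *-identityˡ to 1*; *-cong to *c; trans to
  infixr 1 _·_)
 open Char χ
 open RingSolver R
 open Sums R
 open SignedSums R
 open CharProperties R χ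
 open Kernel R χ (M +z M)
 open SplitSums R χ (M +z M)
 open HallLittlewood R χ (M +z M)
 open Symm R χ M
 open Evals R χ M
 h : ℕ → |R|
 h = poch⁻ π ππ
 split-Good : ∀ {S}H Q → S ↭ H ++ Q → Good S → Good H × Good Q
 split-Good{S}H Q p good = dropʳ H(Good-resp-↭ p good) , dropˡ H(Good-resp-↭ p good)where
  dropˡ : ∀ H → Good(H ++ Q) → Good Q
  dropˡ [] g = g
  dropˡ(x ∷ H)g = dropˡ H(Good-tail g)
  dropʳ : ∀ H → Good(H ++ Q) → Good H
  dropʳ [] g = [] , []
  dropʳ(x ∷ H)(z ∷ zs , s ∷ ss)with dropʳ H(zs , ss)
  ... | a , b = z ∷ a , Allₚ.++⁻ˡ H s ∷ b where import Data.List.Relation.Unary.All.Properties as Allₚ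
 full : ℕ → List ℤ → |R|
 full zero S = 1#
 full(suc k)S = spl S(λ I Q → X(suc k)I * h(length I) * cross f I Q * full k Q)
 -- The sum of Π_{0<i<m} (-π; π)_{m_i} P_λ over all λ with parts at most m.
 bounded : ℕ → List ℤ → |R|
 bounded zero S = 1#
 bounded(suc m)S = spl S(λ I Q → X(suc m)I * 1# * cross f I Q * full m Q)
 1+πT : ℤ → |R|
 1+πT a = 1# + π * T a
 L : (List ℤ → |R|) → List ℤ → |R|
 L Y S = spl S(λ H Q → cross f H Q * x∏ H * ∏ 1+πT Q * Y H)
 L-cong : ∀ {Y Y'}S → (∀ H Q → S ↭ H ++ Q → Y H ≈ Y' H) → L Y S ≈ L Y' S
 L-cong S e = spl-cong S(λ H Q p → *ˡ(e H Q p))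
 L-full : ∀ (w : ℕ → |R|)k Y S → spl S(λ I Q → X(suc k)I * w(length I) * cross f I Q * L Y Q) ≈ L(λ H → spl H(λ I H' → X k I * w(length I) *
  cross f I H' * Y H'))S
 L-full w k Y S = spl-cong' S(λ I Q → sym(spl-*ˡ _ _ Q)) · spl-cong' S(λ I Q → spl-cong Q(λ H Q' p → eq1 I H Q' p))
  · sym(spl-assoc t S) · spl-cong' S(λ K Q' → _·_(spl-cong K(λ I H p → eq2 I H Q' p))(spl-*ˡ _ _ K))where
  c e : List ℤ → List ℤ → |R|
  c I Q = X(suc k)I * w(length I) * cross f I Q
  e H Q' = cross f H Q' * x∏ H * ∏ 1+πT Q' * Y H
  t : List ℤ → List ℤ → List ℤ → |R|
  t I H Q' = x∏ I * X k I * w(length I) * (cross f I H * cross f I Q') * (cross f H Q' * x∏ H * ∏ 1+πT Q' * Y H)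
  eq1 : ∀ I H Q'{Q} → Q ↭ H ++ Q' → c I Q * e H Q' ≈ t I H Q'
  eq1 I H Q' p = *ʳ(*ˡ(cross-↭ f(↭-refl{x = I})p · cross-++ʳ f I H Q'))
  eq2 : ∀ I H Q'{K} → K ↭ I ++ H → t I H Q' ≈ cross f K Q' * x∏ K * ∏ 1+πT Q' * (X k I * w(length I) * cross f I H * Y H)
  eq2 I H Q'{K}p = solve 9(λ x xk w a b c xh o y → x :* xk :* w :* (a :* b) :* (c :* xh :* o :* y) := (b :* c) :* (x :* xh) :* o :* (xk :* w :* a
   :* y))refl _ _ _ _ _ _ _ _ _ · *ʳ(*ʳ(*c(sym(cross-↭ f p(↭-refl{x = Q'}) · cross-++ˡ f I H Q'))(sym(∏-↭ T p · ∏-++ T I H))))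
 elementary-merge : ∀ (w : ℕ → |R|)S → Dist S → spl S(λ I Q → x∏ I * cross f I Q * spl I(λ H J → cross f H J * (w(length H) * π ^ᵣ length J))) ≈ L
  (λ H → w(length H))S
 elementary-merge w S ds = spl-cong' S(λ I Q → sym(spl-*ˡ _ _ I)) · spl-cong' S(λ I Q → spl-cong I(λ H J p → eq1 H J Q p))
  · spl-assoc t S · spl-cong S(λ H Q' q → _·_(spl-cong Q'(λ J Q p → eq2 H J Q p))(spl-*ˡ _ _ Q'
  · *ˡ(∑-elementary π Q'(proj₂(split-Dist{h = H}q ds))) · solve 4(λ a b c o → a :* b :* c :* o := a :* b :* o :* c)refl _ _ _ _))where
  c e : List ℤ → List ℤ → |R|
  c I Q = x∏ I * cross f I Q
  e H J = cross f H J * (w(length H) * π ^ᵣ length J)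
  t : List ℤ → List ℤ → List ℤ → |R|
  t H J Q = x∏ H * x∏ J * (cross f H Q * cross f J Q) * (cross f H J * (w(length H) * π ^ᵣ length J))
  eq1 : ∀ H J Q{I} → I ↭ H ++ J → c I Q * e H J ≈ t H J Q
  eq1 H J Q p = *ʳ(*c(∏-↭ T p · ∏-++ T H J)(cross-↭ f p(↭-refl{x = Q}) · cross-++ˡ f H J Q))
  eq2 : ∀ H J Q{Q'} → Q' ↭ J ++ Q → t H J Q ≈ cross f H Q' * x∏ H * w(length H) * (cross f J Q * (x∏ J * π ^ᵣ length J))
  eq2 H J Q p = solve 7(λ xh xj a b k w o → xh :* xj :* (a :* b) :* (k :* (w :* o)) := (k :* a) :* xh :* w :* (b :* (xj :* o)))refl _ _ _ _ _ _ _ ·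
   *ʳ(*ʳ(*ʳ(sym(cross-↭ f(↭-refl{x = H})p · cross-++ʳ f H J Q))))
 full-L : ∀ k S → Dist S → full(suc k)S ≈ L(full k)S
 full-L zero S ds = spl-cong S(λ I Q p → ((solve 3(λ x y k → (x :* 𝟏) :* y :* k :* 𝟏 := x :* k :* y)refl _ _ _)
  · (*ˡ(sym(proj₁(∑-τ π ππ I(proj₁(split-Dist{h = I}{r = Q}p ds)))) · spl-cong' I(λ H J → *ˡ(sym(1* _)))))))
  · elementary-merge(λ _ → 1#)S ds
 full-L(suc k)S ds = spl-cong S(λ I Q p → *ˡ(full-L k Q(proj₂(split-Dist{h = I}p ds)))) · L-full h(suc k)(full k)S
 bounded-L : ∀ m S → Dist S → bounded(suc(suc m))S ≈ L(bounded(suc m))S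
 bounded-L m S ds = spl-cong S(λ I Q p → *ˡ(full-L m Q(proj₂(split-Dist{h = I}p ds)))) · L-full(λ _ → 1#)(suc m)(full m)S
 L-Ξ : ∀ S → Good S → L Ξ S ≈ Ξ S
 L-Ξ S good = spl-cong S eq · spl-*ˡ _ _ S · *ˡ(∑-pairs(length S)S N.≤-refl good)where
  s-law : ∀ {a} → a ≢ + 0 → 1+πT a ≈ ⟦ a ⟧ * s a
  s-law{a}p = sym(*ˡ(ι-law a p) · *-identityʳ _) · *ʳ(+ˡ(sym(T-+ M a))) · solve 3(λ a b c → a :* (b :* c) := b :* (a :* c))refl _ _ _
  eq : ∀ H Q → S ↭ H ++ Q → cross f H Q * x∏ H * ∏ 1+πT Q * Ξ H ≈ ∏ s S * (x∏ H * ∏ ⟦_⟧ Q * cross f H Q * pairs g H)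
  eq H Q p = *ʳ(*ˡ(∏-cong-All(All.map s-law(proj₁(proj₂(split-Good H Q p good)))) · ∏-* _ _ Q))
   · solve 6(λ k x b sq sh p → k :* x :* (b :* sq) :* (sh :* p) := (sh :* sq) :* (x :* b :* k :* p))refl _ _ _ _ _ _ · *ʳ(sym(∏-↭ s p
   · ∏-++ s H Q))
 symm : ℕ → List ℤ → |R|
 symm m S = spl S(λ K Q → X m K * Ξ(negs K ++ Q))
 Ξ-split : ∀ K Q → Ξ(negs K ++ Q) ≈ Ξ(negs K) * (cross f K Q * Ξ Q)
 Ξ-split K Q = *c(∏-++ s(negs K)Q)(pairs-++ g(negs K)Q) · solve 5(λ a b c d e → (a :* b) :* (c :* d :* e) := (a :* c) :* (e :* (b :* d)))refl
  _ _ _ _ _ · *ˡ(*ʳ(∏-map _(λ a → -z a)K · ∏-cong(λ k → ∏-cong(λ q → sym(f≈g k q))Q)K))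
 symm-L : ∀ m S → Good S → L(symm m)S ≈ symm(suc m)S
 symm-L m S good = spl-cong' S(λ K Q' → _·_(sym(spl-*ˡ _ _ K))(spl-cong K(λ I H p → eq1 I H Q' p))) · spl-assoc t S
  · spl-cong S(λ I Q q → _·_(spl-cong Q(λ H Q' p → eq2 I H Q' p))(spl-*ˡ _ _ Q · *ˡ(L-Ξ Q(proj₂(split-Good I Q q good)))))
  · spl-cong' S(λ I Q → _·_(solve 4(λ a b c d → a :* b :* c :* d := a :* (b :* (c :* d)))refl _ _ _ _)(*ˡ(sym(Ξ-split I Q))))where
  t : List ℤ → List ℤ → List ℤ → |R|
  t I H Q' = x∏ I * x∏ H * (cross f I Q' * cross f H Q') * ∏ 1+πT Q' * (X m I * (Ξ(negs I) * (cross f I H * Ξ H)))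
  eq1 : ∀ I H Q'{K} → K ↭ I ++ H → cross f K Q' * x∏ K * ∏ 1+πT Q' * (X m I * Ξ(negs I ++ H)) ≈ t I H Q'
  eq1 I H Q' p = *c(*ʳ(*-comm _ _ · *c(∏-↭ T p · ∏-++ T I H)(cross-↭ f p(↭-refl{x = Q'}) · cross-++ˡ f I H Q')))(*ˡ(Ξ-split I H))
  eq2 : ∀ I H Q'{Q} → Q ↭ H ++ Q' → t I H Q' ≈ X(suc m)I * Ξ(negs I) * cross f I Q * (cross f H Q' * x∏ H * ∏ 1+πT Q' * Ξ H)
  eq2 I H Q' p = solve 9(λ xi xh a b o xm c k e → xi :* xh :* (a :* b) :* o :* (xm :* (c :* (k :* e))) := (xi :* xm) :* c :* (k :* a) :* (b :* xh :*
   o :* e))refl _ _ _ _ _ _ _ _ _ · *ʳ(*ˡ(sym(cross-↭ f(↭-refl{x = I})p · cross-++ʳ f I H Q')))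
 symm-0 : ∀ S → Good S → symm 0 S ≈ poch² π ππ(length S)
 symm-0 S good = spl-cong' S(λ K Q → 1* _) · sgn-split Ξ-↭ S · ∑-Ξ S good
 bounded≈symm : ∀ m S → Good S → bounded(suc m)S ≈ symm(suc m)S
 bounded≈symm zero S good = spl-cong S(λ I Q p → _·_(solve 2(λ x k → (x :* 𝟏) :* 𝟏 :* k :* 𝟏 := x :* k :* 𝟏)refl _ _)(*ˡ(sym(∑-poch² π ππ I
  (Good⇒Dist(proj₁(split-Good I Q p good))))))) · elementary-merge(poch² π ππ)S(Good⇒Dist good)
  · L-cong S(λ H Q p → sym(symm-0 H(proj₁(split-Good H Q p good)))) · symm-L 0 S good
 bounded≈symm(suc m)S good = bounded-L m S(Good⇒Dist good) · L-cong S(λ H Q p → bounded≈symm m H(proj₁(split-Good H Q p good)))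
  · symm-L(suc m)S good
record QFactorials(R : Ring)(P : CommutativeRing.Carrier R) : Set where
 open CommutativeRing R hiding (zero)
 open Sums R
 field
  F iF : ℕ → Carrier
  F-0 : F 0 ≈ 1#
  F-suc : ∀ n → F(suc n) ≈ F n * (1# - P ^ᵣ suc n)
  F-iF : ∀ n → F n * iF n ≈ 1#
-- The operators E x let the whole alphabet x, Px, P²x, … act at once.
module ColumnOperators(R : Ring)(P : CommutativeRing.Carrier R)(Q : QFactorials R P)where
 open CommutativeRing R hiding (zero) renaming (Carrier to |R|; *-congˡ to *ˡ; *-congʳ to *ʳ; +-congˡ to +ˡ; +-congʳ to +ʳ; *-identityˡ to 1*; -‿cong
  to -ᶜ; *-cong to *c; +-cong to +c; reflexive to rfx; trans to infixr 1 _·_)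
 open QFactorials Q
 open RingSolver R
 open Sums R
 open RowOperators R P
 wt : ℕ → |R| → |R|
 wt zero x = 1#
 wt(suc d)x = x * P ^ᵣ d * wt d x
 wt-cong : ∀ d{x y} → x ≈ y → wt d x ≈ wt d y
 wt-cong zero e = refl
 wt-cong(suc d)e = *c(*ʳ e)(wt-cong d e)
 wt-P : ∀ d x → wt d(P * x) ≈ P ^ᵣ d * wt d x
 wt-P zero x = sym(1* 1#)
 wt-P(suc d)x = *ˡ(wt-P d x) · solve 4(λ p x q w → p :* x :* q :* (q :* w) := p :* q :* (x :* q :* w))refl _ _ _ _
 bin : ℕ → ℕ → |R|
 bin n d = F(n +n d) * iF n * iF d
 iF-suc : ∀ n → iF(suc n) * (1# - P ^ᵣ suc n) ≈ iF n
 iF-suc n = sym(1* _) · *ʳ(sym(F-iF n)) · solve 4(λ f i j p → f :* i :* (j :* p) := f :* p :* j :* i)refl _ _ _ _ · *ʳ(*ʳ(sym(F-suc n))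
  · F-iF(suc n)) · 1* _
 iF-0 : iF 0 ≈ 1#
 iF-0 = sym(1* _) · *ʳ(sym F-0) · F-iF 0
 bin-0 : ∀ n → bin n 0 ≈ 1#
 bin-0 n = *c(*ʳ(rfx(cong F(N.+-identityʳ n))) · F-iF n)iF-0 · 1* _
 bin-suc : ∀ n d → bin n(suc d) * (1# - P ^ᵣ suc d) ≈ bin n d * (1# - P ^ᵣ suc(n +n d))
 bin-suc n d = *-assoc _ _ _ · *c(*ʳ(rfx(cong F(N.+-suc n d)) · F-suc _))(iF-suc d)
  · solve 4(λ f p i j → f :* p :* i :* j := f :* i :* j :* p)refl _ _ _ _
 E : ∀ m → ℕ → |R| → State m → State m
 E zero d x v ns = wt d x * iF d * v ns
 E(suc m)d x v(n ∷ ns) = wt d x * bin n d * conv(n +n d)(λ r k → E m r x(λ ν → v(k ∷ ν))ns)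
 E-cong : ∀ m d{x y v w} → x ≈ y → v ≋ w → E m d x v ≋ E m d y w
 E-cong zero d e h ns = *c(*ʳ(wt-cong d e))(h ns)
 E-cong(suc m)d e h(n ∷ ns) = *c(*ʳ(wt-cong d e))(conv-cong(n +n d)(λ r k _ → E-cong m r e(λ ν → h(k ∷ ν))ns))
 E-+ : ∀ m d x v w → E m d x(λ ν → v ν + w ν) ≋ (λ ns → E m d x v ns + E m d x w ns)
 E-+ zero d x v w ns = distribˡ _ _ _
 E-+ (suc m)d x v w(n ∷ ns) = *ˡ(conv-cong(n +n d)(λ r k _ → E-+ m r x(λ ν → v(k ∷ ν))(λ ν → w(k ∷ ν))ns) · conv-+ (n +n d)_ _)
  · distribˡ _ _ _
 E-* : ∀ m d x c v → E m d x(λ ν → c * v ν) ≋ (λ ns → c * E m d x v ns)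
 E-* zero d x c v ns = solve 3(λ a c v → a :* (c :* v) := c :* (a :* v))refl _ _ _
 E-* (suc m)d x c v(n ∷ ns) = *ˡ(conv-cong(n +n d)(λ r k _ → E-* m r x c(λ ν → v(k ∷ ν))ns) · conv-*ˡ(n +n d)_ _)
  · solve 3(λ a c v → a :* (c :* v) := c :* (a :* v))refl _ _ _
 E-A : ∀ m d x v → E m d(P * x)(A m x v) ≋ (λ ns → P ^ᵣ d * E m d x v ns)
 E-B : ∀ m d x v → E m d(P * x)(B m x v) ≋ (λ ns → (1# - P ^ᵣ suc d) * E m(suc d)x v ns)
 E-A zero d x v ns = *ʳ(*ʳ(wt-P d x)) · solve 4(λ p w i v → p :* w :* i :* v := p :* (w :* i :* v))refl _ _ _ _
 E-A(suc m)d x v(n ∷ ns) = *c(*ʳ(wt-P d x))(conv-cong N(λ r k _ → step r k) · conv-+ N _ _ · +ˡ(moved N) · sym(conv-+ N _ _)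
  · conv-cong N(λ r k _ → solve 2(λ p e → p :* e :+ (𝟏 :- p) :* e := e)refl _ _))
  · solve 4(λ p w i v → p :* w :* i :* v := p :* (w :* i :* v))refl _ _ _ _ where
  N = n +n d
  e b b̂ : ℕ → ℕ → |R|
  e r k = E m r x(λ ν → v(k ∷ ν))ns
  b r k = (1# - P ^ᵣ r) * e r k
  b̂ r zero = 0#
  b̂ r(suc k) = b(suc r)k
  E-0 : ∀ m d y → E m d y(λ _ → 0#) ≋ (λ _ → 0#)
  E-0 m d y ns = E-cong m d refl(λ _ → sym(zeroˡ 0#))ns · E-* m d y 0#(λ _ → 0#)ns · zeroˡ _
  step : ∀ r k → E m r(P * x)(λ ν → A(suc m)x v(k ∷ ν))ns ≈ P ^ᵣ r * e r k + b̂ r k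
  step r zero = E-+ m r(P * x)_(λ _ → 0#)ns · +c(E-A m r x _ ns)(E-0 m r _ ns)
  step r(suc k) = E-+ m r(P * x)_ _ ns · +c(E-A m r x _ ns)(E-B m r x _ ns)
  moved : ∀ N → conv N b̂ ≈ conv N b
  moved zero = sym(*ʳ(-‿inverseʳ 1#) · zeroˡ _)
  moved(suc N) = conv-last N b̂ · +-identityʳ _ · sym(+ʳ(*ʳ(-‿inverseʳ 1#) · zeroˡ _) · +-identityˡ _)
 E-B zero d x v ns = *ʳ(*c(wt-P d x)(sym(iF-suc d))) · solve 6(λ p w i q x v → p :* w :* (i :* q) :* (x :* v) := q :* (x :* p :* w :* i :* v))
  refl _ _ _ _ _ _
 E-B(suc m)d x v(n ∷ ns) = *c(*ʳ(wt-P d x))(conv-cong N(λ r k p → step r k p) · (conv-*ˡ N _ _ · *ˡ(conv-+ N _ _))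
  · *ˡ(+c(sym(conv-last N(λ r k → (P ^ᵣ r - P ^ᵣ suc N) * e r k) · +ˡ(*ʳ(-‿inverseʳ _) · zeroˡ _)
  · +-identityʳ _))(sym(+ʳ(*ʳ(-‿inverseʳ 1#) · zeroˡ _) · +-identityˡ _)))
  · *ˡ(sym(conv-+ (suc N)(λ r k → (P ^ᵣ r - P ^ᵣ suc N) * e r k)(λ r k → (1# - P ^ᵣ r) * e r k))
  · conv-cong(suc N)(λ r k _ → solve 3(λ p q e → (p :- q) :* e :+ (𝟏 :- p) :* e := (𝟏 :- q) :* e)refl(P ^ᵣ r)(P ^ᵣ suc N)(e r k))
  · conv-*ˡ(suc N)_ e)) · solve 6(λ p w b x q c → p :* w :* b :* (x :* (q :* c)) := x :* p :* w :* (b :* q) :* c)refl _ _ _ _ _ _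
  · *c(*ˡ(sym(bin-suc n d)))(rfx(cong(λ l → conv l e)(E.sym(N.+-suc n d))))
  · solve 4(λ w b q c → w :* (b :* q) :* c := q :* (w :* b :* c))refl _ _ _ _ where
  N = n +n d
  e : ℕ → ℕ → |R|
  e r k = E m r x(λ ν → v(k ∷ ν))ns
  step : ∀ r k → r +n k ≡ N → E m r(P * x)(λ ν → B(suc m)x v(k ∷ ν))ns ≈ x * ((P ^ᵣ r - P ^ᵣ suc N) * e r(suc k) + (1# - P ^ᵣ suc r) * e(suc
   r)k)
  step r k p = E-* m r(P * x)x _ ns · *ˡ(E-+ m r(P * x)_ _ ns · +c(E-* m r(P * x)_ _ ns · *ˡ(E-A m r x _ ns)
   · solve 3(λ q p e → (𝟏 :- q) :* (p :* e) := (p :- p :* q) :* e)refl _ _ _ · *ʳ(+ˡ(-ᶜ(sym(^ᵣ-+ P r(suc k))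
   · rfx(cong(P ^ᵣ_)(E.trans(N.+-suc r k)(cong suc p)))))))(E-B m r x _ ns))
open import Defs
open import Algebra.Structures using (IsCommutativeRing)
open import Data.Nat using (_∸_)
open import Data.Bool using (Bool; true; false)
open import Data.List using (applyUpTo)
open import Data.Empty using (⊥-elim)
import Data.Sum
open import Relation.Nullary using (¬_)
module FormalSeries where
 open import Data.Bool using (T)
 open E using (cong; cong₂; sym; trans; refl)
 open Sums Z.+-*-commutativeRing public using (conv)
 private module ℤS = Sums Z.+-*-commutativeRing
 infix 4 _≗_
 _≗_ : Series → Series → Set
 f ≗ g = ∀ K → f K ≡ g K
 sum< : ℕ → (ℕ → ℤ) → ℤ
 sum< zero φ = + 0
 sum< (suc n)φ = φ 0 +z sum< n(λ i → φ(suc i))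
 sumℤ-applyUpTo : ∀ (φ : ℕ → ℤ)h n → sumℤ(map φ(applyUpTo h n)) ≡ sum< n(λ i → φ(h i))
 sumℤ-applyUpTo φ h zero = refl
 sumℤ-applyUpTo φ h(suc n) = cong(λ x → φ(h 0) +z x)(sumℤ-applyUpTo φ(λ i → h(suc i))n)
 sum<-conv : ∀ K(ψ : ℕ → ℕ → ℤ) → sum< (suc K)(λ i → ψ i(K ∸ i)) ≡ conv K ψ
 sum<-conv zero ψ = Z.+-identityʳ _
 sum<-conv(suc K)ψ = cong(λ x → ψ 0(suc K) +z x)(sum<-conv K(λ r k → ψ(suc r)k))
 ⊛-conv : ∀ f g K → (f ⊛ g)K ≡ conv K(λ r k → f r *z g k)
 ⊛-conv f g K = trans(sumℤ-applyUpTo(λ i → f i *z g(K ∸ i))(λ i → i)(suc K))(sum<-conv K(λ r k → f r *z g k))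
 private
  ⊛-cong-≤ : ∀ {f f' g g'}K → (∀ j → j ≤ K → f j ≡ f' j) → (∀ j → j ≤ K → g j ≡ g' j) → (f ⊛ g)K ≡ (f' ⊛ g')K
  ⊛-cong-≤ {f}{f'}{g}{g'}K p q = trans(⊛-conv f g K)(trans(ℤS.conv-cong K(λ r k e → cong₂ _*z_(p r(subst(r ≤_)e(N.m≤m+n r k)))(q k
   (subst(k ≤_)e(N.m≤n+m k r)))))(sym(⊛-conv f' g' K)))
  ⊛-comm : ∀ f g → f ⊛ g ≗ g ⊛ f
  ⊛-comm f g K = trans(⊛-conv f g K)(trans(ℤS.conv-flip K _)(trans(ℤS.conv-cong K(λ r k _ → Z.*-comm(f k)(g r)))(sym(⊛-conv g f K))))
  ⊛-assoc : ∀ f g h → (f ⊛ g) ⊛ h ≗ f ⊛ (g ⊛ h)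
  ⊛-assoc f g h K = begin((f ⊛ g) ⊛ h)K ≡⟨ ⊛-conv(f ⊛ g)h K ⟩ conv K(λ r k → (f ⊛ g)r *z h k) ≡⟨ ℤS.conv-cong K(λ r k _ → trans(cong(λ x → x
   *z h k)(⊛-conv f g r))(trans(Z.*-comm _(h k))(trans(sym(ℤS.conv-*ˡ r(h k)_))(ℤS.conv-cong r(λ a b _ → trans(Z.*-comm(h k)_)
   (Z.*-assoc(f a)(g b)(h k))))))) ⟩ conv K(λ r k → conv r(λ a b → f a *z(g b *z h k))) ≡⟨ ℤS.conv-assoc K _ ⟩ conv K(λ a s → conv s(λ b k → f
   a *z(g b *z h k))) ≡⟨ ℤS.conv-cong K(λ a s _ → trans(ℤS.conv-*ˡ s(f a)_)(cong(λ x → f a *z x)(sym(⊛-conv g h s)))) ⟩ conv K(λ a s → f a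
   *z(g ⊛ h)s) ≡⟨ sym(⊛-conv f(g ⊛ h)K) ⟩ (f ⊛ (g ⊛ h))K ∎ where
   open E.≡-Reasoning
  conv-0 : ∀ K(φ : ℕ → ℕ → ℤ) → (∀ r k → φ r k ≡ + 0) → conv K φ ≡ + 0
  conv-0 zero φ e = e 0 0
  conv-0(suc K)φ e = trans(cong₂ _+z_(e 0(suc K))(conv-0 K _(λ r k → e(suc r)k)))refl
  ⊛-identityˡ : ∀ f → oneS ⊛ f ≗ f
  ⊛-identityˡ f K = trans(⊛-conv oneS f K)(go K)where
   go : ∀ K → conv K(λ r k → oneS r *z f k) ≡ f K
   go zero = Z.*-identityˡ(f 0)
   go(suc K) = trans(cong₂ _+z_(Z.*-identityˡ(f(suc K)))(conv-0 K _(λ r k → Z.*-zeroˡ(f k))))(Z.+-identityʳ _)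
  ⊛-distribˡ : ∀ f g h → f ⊛ (g ⊕ h) ≗ (f ⊛ g) ⊕ (f ⊛ h)
  ⊛-distribˡ f g h K = trans(⊛-conv f(g ⊕ h)K)(trans(ℤS.conv-cong K(λ r k _ → Z.*-distribˡ-+ (f r)(g k)(h k)))(trans(ℤS.conv-+ K _ _)(cong₂
   _+z_(sym(⊛-conv f g K))(sym(⊛-conv f h K)))))
 -- Opaque copies of the ring operations, which keep the type checker from unfolding convolutions.
 infixl 7 _⊠_
 infixl 6 _⊞_
 abstract
  _⊠_ _⊞_ : Series → Series → Series
  _⊠_ = _⊛_
  _⊞_ = _⊕_
  ⊟_ : Series → Series
  (⊟ f)K = -z f K
  zeroS unitS : Series
  zeroS _ = + 0
  unitS = oneS
  ⊠-def : _⊠_ ≡ _⊛_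
  ⊠-def = refl
  ⊞-def : _⊞_ ≡ _⊕_
  ⊞-def = refl
  ⊟-def : ∀ f K → (⊟ f)K ≡ -z f K
  ⊟-def f K = refl
  zeroS-def : ∀ K → zeroS K ≡ + 0
  zeroS-def K = refl
  unitS-def : unitS ≡ oneS
  unitS-def = refl
 -- Two series are equal when their coefficients of t^K agree for all K satisfying B; B = (λ _ → ⊤) and
 -- B = (_≤ K₀) give the ring of series and its truncations.
 module SeriesModulo(B : ℕ → Set)(B-↓ : ∀ {j K} → j ≤ K → B K → B j)where
  infix 4 _≈_
  record _≈_(f g : Series) : Set where
   constructor coeffs
   field coefficient : ∀ K → B K → f K ≡ g K
  open _≈_ public
  abstract
   isSeriesRing : IsCommutativeRing _≈_ _⊞_ _⊠_ ⊟_ zeroS unitS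
   isSeriesRing = record{ isRing = record{ +-isAbelianGroup = record{ isGroup = record{ isMonoid = record{ isSemigroup = record{ isMagma =
    record{ isEquivalence = record{ refl = coeffs λ _ _ → refl ; sym = λ e → coeffs λ K b → sym(coefficient e K b) ; trans = λ e e' → coeffs λ K b
    → trans(coefficient e K b)(coefficient e' K b) } ; ∙-cong = λ e e' → coeffs λ K b → cong₂ _+z_(coefficient e K b)(coefficient e' K b) } ;
    assoc = λ f g h → coeffs λ K _ → Z.+-assoc(f K)(g K)(h K) } ; identity = (λ f → coeffs λ K _ → Z.+-identityˡ(f K)) , (λ f → coeffs λ K _ →
    Z.+-identityʳ(f K)) } ; inverse = (λ f → coeffs λ K _ → Z.+-inverseˡ(f K)) , (λ f → coeffs λ K _ → Z.+-inverseʳ(f K)) ; ⁻¹-cong = λ e → coeffs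
    λ K b → cong(λ x → -z x)(coefficient e K b) } ; comm = λ f g → coeffs λ K _ → Z.+-comm(f K)(g K) } ; *-cong = λ e e' → coeffs λ K b → ⊛-cong-≤
    K(λ j l → coefficient e j(B-↓ l b))(λ j l → coefficient e' j(B-↓ l b)) ; *-assoc = λ f g h → coeffs λ K _ → ⊛-assoc f g h K ; *-identity = (λ
    f → coeffs λ K _ → ⊛-identityˡ f K) , (λ f → coeffs λ K _ → trans(⊛-comm f oneS K)(⊛-identityˡ f K)) ; distrib = (λ f g h → coeffs λ K _ →
    ⊛-distribˡ f g h K) , (λ f g h → coeffs λ K _ → trans(⊛-comm(g ⊕ h)f K)(trans(⊛-distribˡ f g h K)(cong₂ _+z_(⊛-comm f g K)(⊛-comm f h
    K)))) } ; *-comm = λ f g → coeffs λ K _ → ⊛-comm f g K }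
  seriesRing : Ring
  seriesRing = record{ isCommutativeRing = isSeriesRing }
 abstract
  -- t^e
  tpow : ℕ → Series
  tpow e = monoS(+ 1)e
  tpow-def : ∀ e → tpow e ≡ monoS(+ 1)e
  tpow-def e = refl
 shiftS : ℕ → Series → Series
 shiftS zero f K = f K
 shiftS(suc a)f zero = + 0
 shiftS(suc a)f(suc K) = shiftS a f K
 abstract
  tpow-0 : tpow 0 ≗ unitS
  tpow-0 zero = refl
  tpow-0(suc K) = refl
 abstract
  tpow-⊠ : ∀ a f → tpow a ⊠ f ≗ shiftS a f
  tpow-⊠ a f K = trans(⊛-conv(tpow a)f K)(go a K)where
   go : ∀ a K → conv K(λ r k → tpow a r *z f k) ≡ shiftS a f K
   go zero K = trans(ℤS.conv-cong K(λ r k _ → cong(λ x → x *z f k)(tpow-0 r)))(trans(sym(⊛-conv oneS f K))(⊛-identityˡ f K))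
   go(suc a)zero = Z.*-zeroˡ(f 0)
   go(suc a)(suc K) = trans(cong₂ _+z_(Z.*-zeroˡ(f(suc K)))(go a K))(Z.+-identityˡ _)
  tpow-+ : ∀ a b → tpow(a +n b) ≗ tpow a ⊠ tpow b
  tpow-+ a b K = trans(go a K)(sym(tpow-⊠ a(tpow b)K))where
   go : ∀ a K → tpow(a +n b)K ≡ shiftS a(tpow b)K
   go zero K = refl
   go(suc a)zero = refl
   go(suc a)(suc K) = go a K
 shiftS-+ : ∀ a f K → shiftS a f(a +n K) ≡ f K
 shiftS-+ zero f K = refl
 shiftS-+ (suc a)f K = shiftS-+ a f K
 shiftS-< : ∀ a f K → K < a → shiftS a f K ≡ + 0
 shiftS-< (suc a)f zero _ = refl
 shiftS-< (suc a)f(suc K)(s≤s l) = shiftS-< a f K l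
 tpow-reg : ∀ a f → tpow a ⊠ f ≗ zeroS → f ≗ zeroS
 tpow-reg a f e K = trans(sym(shiftS-+ a f K))(trans(sym(tpow-⊠ a f(a +n K)))(trans(e(a +n K))(trans(zeroS-def _)(sym(zeroS-def K)))))
 private
  T⇒≡ : ∀ {b} → T b → b ≡ true
  T⇒≡ {true}_ = refl
  ≤ᵇ-true : ∀ {m n} → m ≤ n → (m ℕ.≤ᵇ n) ≡ true
  ≤ᵇ-true p = T⇒≡ (N.≤⇒≤ᵇ p)
  ¬T⇒≡ : ∀ {b} → ¬ T b → b ≡ false
  ¬T⇒≡ {false}_ = refl
  ¬T⇒≡ {true}p = ⊥-elim(p tt)
  ≤ᵇ-false : ∀ {m n} → n < m → (m ℕ.≤ᵇ n) ≡ false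
  ≤ᵇ-false{m}{n}p = ¬T⇒≡ (λ t → N.<⇒≱ p(N.≤ᵇ⇒≤ m n t))
  invCoeffs-stable : ∀ f K j → j ≤ K → invCoeffs f K j ≡ invS f j
  invCoeffs-stable f zero zero z≤n = refl
  invCoeffs-stable f(suc K)j p with N.m≤n⇒m<n∨m≡n p
  ... | Data.Sum.inj₁(s≤s q)rewrite ≤ᵇ-true q = invCoeffs-stable f K j q
  ... | Data.Sum.inj₂ refl = refl
  invS-suc : ∀ f K → invS f(suc K) ≡ -z conv K(λ r k → f(suc r) *z invS f k)
  invS-suc f K rewrite ≤ᵇ-false{suc K}{K}N.≤-refl = cong(λ x → -z x)(trans(sumℤ-applyUpTo(λ i → f(suc i) *z invCoeffs f K(K ∸ i))(λ i → i)
   (suc K))(trans(sum<-conv K(λ r k → f(suc r) *z invCoeffs f K k))(ℤS.conv-cong K(λ r k e → cong(λ x → f(suc r) *z x)(invCoeffs-stable f K k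
   (subst(k ≤_)e(N.m≤n+m k r)))))))
 abstract
  invS-inverse : ∀ f → f 0 ≡ + 1 → f ⊠ invS f ≗ unitS
  invS-inverse f f0 K = trans(⊛-conv f(invS f)K)(go K)where
   go : ∀ K → conv K(λ r k → f r *z invS f k) ≡ oneS K
   go zero = trans(cong(λ x → x *z + 1)f0)refl
   go(suc K) = trans(cong(λ x → x +z conv K(λ r k → f(suc r) *z invS f k))(trans(cong₂ _*z_ f0(invS-suc f K))(Z.*-identityˡ _)))
    (Z.+-inverseˡ(conv K(λ r k → f(suc r) *z invS f k)))
  -- 1 / (1 - t^(n+1))
  geom : ℕ → Series
  geom n = invS(unitS ⊞ ⊟ tpow(suc n))
  geom-inverse : ∀ n → (unitS ⊞ ⊟ tpow(suc n)) ⊠ geom n ≗ unitS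
  geom-inverse n = invS-inverse(unitS ⊞ ⊟ tpow(suc n))refl
-- The total ring of fractions.
module TotalFractions(R : Ring)where
 open CommutativeRing R hiding (zero)
 open RingSolver R
 open Polynomials R
 open import Relation.Binary.Reasoning.Setoid setoid
 infix 5 _/_[_]
 record Fraction : Set where
  constructor _/_[_]
  field
   num den : Carrier
   den-reg : Regular den
 open Fraction
 infix 4 _≃_
 record _≃_(x y : Fraction) : Set where
  constructor cross-equal
  field equal : num x * den y ≈ num y * den x
 open _≃_ public
 one-reg : Regular 1#
 one-reg y e = trans(sym(*-identityˡ y))e
 emb : Carrier → Fraction
 emb x = x / 1# [ one-reg ]
 addF mulF : Fraction → Fraction → Fraction
 addF(a / b [ p ])(c / e [ q ]) = a * e + c * b / b * e [ reg-* p q ]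
 mulF(a / b [ p ])(c / e [ q ]) = a * c / b * e [ reg-* p q ]
 negF : Fraction → Fraction
 negF(a / b [ p ]) = - a / b [ p ]
 ≃-trans : ∀ {x y z} → x ≃ y → y ≃ z → x ≃ z
 ≃-trans{a / b [ _ ]}{c / e [ q ]}{g / h [ _ ]}(cross-equal p)(cross-equal r) = cross-equal(reg-cancel q(begin _ ≈⟨ solve 3(λ e a h → e :* (a
  :* h) := h :* (a :* e))refl _ _ _ ⟩ _ ≈⟨ *-congˡ p ⟩ _ ≈⟨ solve 3(λ h c b → h :* (c :* b) := b :* (c :* h))refl _ _ _ ⟩ _ ≈⟨ *-congˡ r ⟩ _ ≈⟨
  solve 3(λ b g e → b :* (g :* e) := e :* (g :* b))refl _ _ _ ⟩ _ ∎))
 addF-cong : ∀ {x x' y y'} → x ≃ x' → y ≃ y' → addF x y ≃ addF x' y'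
 addF-cong{a / b [ _ ]}{a' / b' [ _ ]}{c / e [ _ ]}{c' / e' [ _ ]}(cross-equal p)(cross-equal q) = cross-equal(begin _ ≈⟨ solve 6(λ a e c b b'
  e' → (a :* e :+ c :* b) :* (b' :* e') := (a :* b') :* (e :* e') :+ (c :* e') :* (b :* b'))refl a e c b b' e' ⟩ _ ≈⟨ +-cong(*-congʳ p)(*-congʳ q)
  ⟩ _ ≈⟨ solve 6(λ a' e c' b b' e' → (a' :* b) :* (e :* e') :+ (c' :* e) :* (b :* b') := (a' :* e' :+ c' :* b') :* (b :* e))refl a' e c' b b' e' ⟩ _
  ∎)
 mulF-cong : ∀ {x x' y y'} → x ≃ x' → y ≃ y' → mulF x y ≃ mulF x' y'
 mulF-cong{a / b [ _ ]}{a' / b' [ _ ]}{c / e [ _ ]}{c' / e' [ _ ]}(cross-equal p)(cross-equal q) = cross-equal(begin _ ≈⟨ solve 4(λ a c b' e'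
  → (a :* c) :* (b' :* e') := (a :* b') :* (c :* e'))refl a c b' e' ⟩ _ ≈⟨ *-cong p q ⟩ _ ≈⟨ solve 4(λ a b c e → (a :* b) :* (c :* e) := (a :* c) :*
  (b :* e))refl a' b c' e ⟩ _ ∎)
 fractionRing : Ring
 fractionRing = record{ Carrier = Fraction ; _≈_ = _≃_ ; _+_ = addF ; _*_ = mulF ; -_ = negF ; 0# = emb 0# ; 1# = emb 1# ; isCommutativeRing = record
  { isRing = record{ +-isAbelianGroup = record{ isGroup = record{ isMonoid = record{ isSemigroup = record{ isMagma = record{ isEquivalence =
  record{ refl = cross-equal refl ; sym = λ e → cross-equal(sym(equal e)) ; trans = ≃-trans } ; ∙-cong = addF-cong } ; assoc = λ{ (a / b [ _ ])(c
  / e [ _ ])(g / h [ _ ]) → cross-equal(solve 6(λ a b c e g h → ((a :* e :+ c :* b) :* h :+ g :* (b :* e)) :* (b :* (e :* h)) := (a :* (e :* h) :+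
  (c :* h :+ g :* e) :* b) :* ((b :* e) :* h))refl a b c e g h) } } ; identity = (λ{ (a / b [ _ ]) → cross-equal(solve 2(λ a b → (𝟎 :* b :+ a :*
  𝟏) :* b := a :* (𝟏 :* b))refl a b) }) , (λ{ (a / b [ _ ]) → cross-equal(solve 2(λ a b → (a :* 𝟏 :+ 𝟎 :* b) :* b := a :* (b :* 𝟏))refl a b) }) }
  ; inverse = (λ{ (a / b [ _ ]) → cross-equal(solve 2(λ a b → ((:- a) :* b :+ a :* b) :* 𝟏 := 𝟎 :* (b :* b))refl a b) }) , (λ{ (a / b [ _ ]) →
  cross-equal(solve 2(λ a b → (a :* b :+ (:- a) :* b) :* 𝟏 := 𝟎 :* (b :* b))refl a b) }) ; ⁻¹-cong = λ{ {a / b [ _ ]}{c / e [ _ ]}(cross-equal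
  p) → cross-equal(trans(solve 2(λ a e → (:- a) :* e := :- (a :* e))refl a e)(trans(-‿cong p)(solve 2(λ c b → :- (c :* b) := (:- c) :* b)refl
  c b))) } } ; comm = λ{ (a / b [ _ ])(c / e [ _ ]) → cross-equal(solve 4(λ a b c e → (a :* e :+ c :* b) :* (e :* b) := (c :* b :+ a :* e) :* (b
  :* e))refl a b c e) } } ; *-cong = mulF-cong ; *-assoc = λ{ (a / b [ _ ])(c / e [ _ ])(g / h [ _ ]) → cross-equal(solve 6(λ a b c e g h → ((a
  :* c) :* g) :* (b :* (e :* h)) := (a :* (c :* g)) :* ((b :* e) :* h))refl a b c e g h) } ; *-identity = (λ{ (a / b [ _ ]) → cross-equal(solve 2
  (λ a b → (𝟏 :* a) :* b := a :* (𝟏 :* b))refl a b) }) , (λ{ (a / b [ _ ]) → cross-equal(solve 2(λ a b → (a :* 𝟏) :* b := a :* (b :* 𝟏))refl a b)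
  }) ; distrib = (λ{ (a / b [ _ ])(c / e [ _ ])(g / h [ _ ]) → cross-equal(solve 6(λ a b c e g h → (a :* (c :* h :+ g :* e)) :* ((b :* e) :* (b
  :* h)) := ((a :* c) :* (b :* h) :+ (a :* g) :* (b :* e)) :* (b :* (e :* h)))refl a b c e g h) }) , (λ{ (a / b [ _ ])(c / e [ _ ])(g / h [ _ ]) →
  cross-equal(solve 6(λ a b c e g h → ((c :* h :+ g :* e) :* a) :* ((e :* b) :* (h :* b)) := ((c :* a) :* (h :* b) :+ (g :* a) :* (e :* b)) :* ((e
  :* h) :* b))refl a b c e g h) }) } ; *-comm = λ{ (a / b [ _ ])(c / e [ _ ]) → cross-equal(solve 4(λ a b c e → (a :* c) :* (e :* b) := (c :* a)
  :* (b :* e))refl a b c e) } } }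
 emb-cong : ∀ {x y} → x ≈ y → emb x ≃ emb y
 emb-cong e = cross-equal(*-congʳ e)
 emb-injective : ∀ {x y} → emb x ≃ emb y → x ≈ y
 emb-injective(cross-equal e) = trans(sym(*-identityʳ _))(trans e(*-identityʳ _))
 emb-+ : ∀ x y → emb(x + y) ≃ addF(emb x)(emb y)
 emb-+ x y = cross-equal(solve 2(λ x y → (x :+ y) :* (𝟏 :* 𝟏) := (x :* 𝟏 :+ y :* 𝟏) :* 𝟏)refl x y)
 emb-* : ∀ x y → emb(x * y) ≃ mulF(emb x)(emb y)
 emb-* x y = cross-equal(solve 2(λ x y → (x :* y) :* (𝟏 :* 𝟏) := (x :* y) :* 𝟏)refl x y)
 emb-neg : ∀ x → emb(- x) ≃ negF(emb x)
 emb-neg x = cross-equal refl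
module Laurent where
 open FormalSeries
 module Exact = SeriesModulo(λ _ → ⊤)(λ _ b → b)
 𝕊 : Ring
 𝕊 = Exact.seriesRing
 -- Series up to and including the coefficient of t^K.
 module Mod(K : ℕ) = SeriesModulo(_≤ K)(λ p q → N.≤-trans p q)
 module 𝕊R = CommutativeRing 𝕊
 open Polynomials 𝕊 using (Regular)
 exact : ∀ {f g} → f ≗ g → f 𝕊R.≈ g
 exact e = Exact.coeffs λ K _ → e K
 pointwise : ∀ {f g} → f 𝕊R.≈ g → f ≗ g
 pointwise e K = Exact.coefficient e K tt
 tpow-Regular : ∀ a → Regular(tpow a)
 tpow-Regular a f e = exact(tpow-reg a f(pointwise e))
 open TotalFractions 𝕊 public
 𝕃 : Ring
 𝕃 = fractionRing
 private module L = CommutativeRing 𝕃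
 -- Powers of t with integer exponents.
 T𝕃 : ℤ → Fraction
 T𝕃(+ n) = emb(tpow n)
 T𝕃 -[1+ n ] = unitS / tpow(suc n) [ tpow-Regular(suc n) ]
 ι𝕃 : ℤ → Fraction
 ι𝕃(+ zero) = emb zeroS
 ι𝕃(+ suc n) = emb(geom n)
 ι𝕃 -[1+ n ] = emb(⊟ (tpow(suc n) ⊠ geom n))
 private
  open RingSolver 𝕊
  tpow-+' : ∀ a b → tpow(a +n b)𝕊R.≈ tpow a 𝕊R.* tpow b
  tpow-+' a b = exact(tpow-+ a b)
  T-⊖ : ∀ m n → T𝕃(m ℤ.⊖ n) ≃ (tpow m / tpow n [ tpow-Regular n ])
  T-⊖ m zero = L.trans(L.reflexive(cong T𝕃(Z.⊖-≥ {m}{0}z≤n)))(cross-equal(𝕊R.*-congˡ(exact tpow-0)))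
  T-⊖ zero(suc n) = cross-equal(𝕊R.*-congʳ(𝕊R.sym(exact tpow-0)))
  T-⊖ (suc m)(suc n) = L.trans(L.reflexive(cong T𝕃(Z.[1+m]⊖[1+n]≡m⊖n m n)))(L.trans(T-⊖ m n)(cross-equal(begin _ ≈⟨ 𝕊R.*-congˡ(tpow-+' 1 n) ⟩
   _ ≈⟨ solve 3(λ a b c → a :* (b :* c) := (b :* a) :* c)𝕊R.refl(tpow m)(tpow 1)(tpow n) ⟩ _ ≈⟨ 𝕊R.*-congʳ(𝕊R.sym(tpow-+' 1 m)) ⟩ _ ∎)))where
   open import Relation.Binary.Reasoning.Setoid 𝕊R.setoid
  T-hom : ∀ a b → T𝕃(a +z b) ≃ mulF(T𝕃 a)(T𝕃 b)
  T-hom(+ m)(+ n) = L.trans(emb-cong(tpow-+' m n))(emb-* _ _)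
  T-hom(+ m) -[1+ n ] = L.trans(T-⊖ m(suc n))(cross-equal(solve 2(λ a b → a :* (𝟏 :* b) := (a :* 𝟏) :* b)𝕊R.refl(tpow m)(tpow(suc n))))
  T-hom -[1+ m ](+ n) = L.trans(T-⊖ n(suc m))(cross-equal(solve 2(λ a b → a :* (b :* 𝟏) := (𝟏 :* a) :* b)𝕊R.refl(tpow n)(tpow(suc m))))
  T-hom -[1+ m ] -[1+ n ] = cross-equal(𝕊R.trans(𝕊R.*-congˡ(𝕊R.sym(tpow-+'(suc m)(suc n))))(𝕊R.trans(𝕊R.*-congˡ(𝕊R.reflexive(cong(λ k →
   tpow(suc k))(N.+-suc m n))))(𝕊R.*-congʳ(𝕊R.sym(𝕊R.*-identityˡ unitS)))))
  ι-inverse : ∀ a → a ≢ + 0 → mulF(addF(emb unitS)(negF(T𝕃 a)))(ι𝕃 a) ≃ emb unitS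
  ι-inverse(+ zero)p = ⊥-elim(p rfl)
  ι-inverse(+ suc n)p = cross-equal(begin _ ≈⟨ solve 2(λ t g → ((𝟏 :* 𝟏 :+ (:- t) :* 𝟏) :* g) :* 𝟏 := ((𝟏 :+ :- t) :* g) :* 𝟏)𝕊R.refl(tpow(suc
   n))(geom n) ⟩ _ ≈⟨ 𝕊R.*-congʳ(exact(geom-inverse n)) ⟩ _ ≈⟨ solve 0(𝟏 :* 𝟏 := 𝟏 :* ((𝟏 :* 𝟏) :* 𝟏))𝕊R.refl ⟩ _ ∎)where
   open import Relation.Binary.Reasoning.Setoid 𝕊R.setoid
  ι-inverse -[1+ n ] p = cross-equal(begin _ ≈⟨ solve 2(λ t g → ((𝟏 :* t :+ (:- 𝟏) :* 𝟏) :* (:- (t :* g))) :* 𝟏 := ((𝟏 :+ :- t) :* g) :* t)𝕊R.refl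
   t(geom n) ⟩ _ ≈⟨ 𝕊R.*-congʳ(exact(geom-inverse n)) ⟩ _ ≈⟨ solve 1(λ t → 𝟏 :* t := 𝟏 :* ((𝟏 :* t) :* 𝟏))𝕊R.refl t ⟩ _ ∎)where
   open import Relation.Binary.Reasoning.Setoid 𝕊R.setoid
   t = tpow(suc n)
 laurent : Char 𝕃
 laurent = record{ T = T𝕃 ; T-+ = T-hom ; T-0 = emb-cong(exact tpow-0) ; ι = ι𝕃 ; ι-law = ι-inverse }
module ChainSteps(R : Ring)(χ : Char R)(M : ℤ)where
 open CommutativeRing R hiding (zero) renaming (Carrier to |R|; *-congˡ to *ˡ; *-congʳ to *ʳ; +-congˡ to +ˡ; +-congʳ to +ʳ; *-identityˡ to 1*; -‿cong
  to -ᶜ; *-cong to *c; +-cong to +c; trans to infixr 1 _·_)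
 open Char χ
 open RingSolver R
 open Polynomials R
 open Sums R
 open SignedSums R
 open CharProperties R χ
 open Kernel R χ ( M +z M ) using (P)
 open Symm R χ M hiding (u; v; w; d)
 open Evals R χ M
 D : ℤ
 D = M +z M
 run : ℤ → ℕ → List ℤ
 run a zero = []
 run a(suc l) = a ∷ run(a +z D)l
 Γ : ℤ → List ℤ → |R|
 Γ e = ∏ (g e)
 -- Not a multiple of 2M.
 record Off(x : ℤ) : Set where
  constructor off
  field avoid : ∀ z → x +z D *z z ≢ + 0
 open Off public
 Off-≢0 : ∀ {x} → Off x → x ≢ + 0
 Off-≢0{x}(off o)e = o(+ 0)(E.trans(cong(λ w → x +z w)(Z.*-zeroʳ D))(E.trans(Z.+-identityʳ x)e))
 Off-shift : ∀ {x}w → Off x → Off(x +z D *z w)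
 Off-shift{x}w(off o) = off λ z e → o(w +z z)(E.trans(eq x D w z)e)where
  eq : ∀ x D w z → x +z D *z(w +z z) ≡ x +z D *z w +z D *z z
  eq = ringℤ
 Off-neg : ∀ {x} → Off x → Off(-z x)
 Off-neg{x}(off o) = off λ z e → o(-z z)(E.trans(eq x D z)(cong(λ w → -z w)e))where
  eq : ∀ x D z → x +z D *z(-z z) ≡ -z(-z x +z D *z z)
  eq = ringℤ
 Off-via : ∀ {x y}w → Off x → y ≡ x +z D *z w → Off y
 Off-via{x}w o rfl = Off-shift{x}w o
 Γ-run : ∀ e s l → (∀ (j : ℕ) → j < l → e +z s +z D *z + j ≢ + 0) → Γ e(run s l) * ⟦ e +z s ⟧ ≈ ⟦ e +z s +z D *z + l ⟧
 Γ-run e s zero nz = 1* _ · ⟦⟧-cong(eq e s D)where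
  eq : ∀ e s D → e +z s ≡ e +z s +z D *z + 0
  eq = ringℤ
 Γ-run e s(suc l)nz = solve 4(λ n i p x → (n :* i) :* p :* x := (x :* i) :* (p :* n))refl _ _ _ _
  · *c(ι-law _(λ z → nz 0(s≤s z≤n)(E.trans(eq0(e +z s)D)z)))(*ˡ(⟦⟧-cong(eq1 e s D)))
  · *ˡ(Γ-run e(s +z D)l(λ j j< z → nz(suc j)(s≤s j<)(E.trans(eq2 e s D(+ j))z))) · 1* _ · ⟦⟧-cong(E.sym(eq2 e s D(+ l)))where
  eq0 : ∀ x D → x +z D *z + 0 ≡ x
  eq0 = ringℤ
  eq1 : ∀ e s D → D +z(e +z s) ≡ e +z(s +z D)
  eq1 = ringℤ
  eq2 : ∀ e s D j → e +z s +z D *z(+ 1 +z j) ≡ e +z(s +z D) +z D *z j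
  eq2 = ringℤ
 X : ℤ → |R|
 X e = T e + T(-z e)
 X-neg : ∀ e → X(-z e) ≈ X e
 X-neg e = +-comm _ _ · +ʳ(T-cong(Z.neg-involutive e))
 bracket-product : ∀ e w → ⟦ e +z w ⟧ * ⟦ e -z w ⟧ ≈ T e * (X e - X w)
 bracket-product e w = *c(+ˡ(-ᶜ(T-+ e w)))(+ˡ(-ᶜ(T-+ e(-z w)))) · solve 3(λ e w w' → (𝟏 :- e :* w) :* (𝟏 :- e :* w') := 𝟏 :+ e :* e :* (w :*
  w') :- e :* (w :+ w'))refl _ _ _ · +ʳ(+c(sym(T-inv e))(*ˡ(T-inv w) · *-identityʳ _))
  · solve 3(λ e e' x → e :* e' :+ e :* e :- e :* x := e :* (e :+ e' :- x))refl _ _ _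
 1+T-reg : ∀ {e} → e +z e ≢ + 0 → Regular(1# + T e)
 1+T-reg{e}p y z = ⟦⟧-reg p y(*ʳ(+ˡ(-ᶜ(T-+ e e))) · solve 2(λ t y → (𝟏 :- t :* t) :* y := (𝟏 :- t) :* ((𝟏 :+ t) :* y))refl _ _ · *ˡ z
  · zeroʳ _)
 ⟦double⟧ : ∀ e → ⟦ e +z e ⟧ ≈ ⟦ e ⟧ * (1# + T e)
 ⟦double⟧ e = +ˡ(-ᶜ(T-+ e e)) · solve 1(λ t → 𝟏 :- t :* t := (𝟏 :- t) :* (𝟏 :+ t))refl _
 s-law : ∀ {e} → e ≢ + 0 → s e * ⟦ e ⟧ ≈ 1# + T(M +z e)
 s-law{e}p = solve 3(λ a b c → a :* b :* c := a :* (c :* b))refl _ _ _ · *ˡ(ι-law e p) · *-identityʳ _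
 s-neg-law : ∀ {e} → e ≢ + 0 → s(-z e) * ⟦ e ⟧ ≈ - (T e * (1# + T(M -z e)))
 s-neg-law{e}p = *ˡ(⟦⟧-cong(E.sym(Z.neg-involutive e)) · ⟦neg⟧ (-z e)) · solve 3(λ a b c → a :* (:- (b :* c)) := :- (b :* (a :* c)))refl _ _ _
  · -ᶜ(*c(T-cong(Z.neg-involutive e))(s-law(≢0-neg p)))
 Ξ-flip : ∀ y C → Ξ(-z y ∷ C) * (s y * Γ y C) ≈ Ξ(y ∷ C) * (s(-z y) * Γ(-z y)C)
 Ξ-flip y C = *ʳ(Ξ-∷ (-z y)C) · solve 3(λ a b c → a :* b :* c := a :* c :* b)refl _ _ _ · *ʳ(sym(Ξ-∷ y C))
 y≡ : ℤ → ℤ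
 y≡ v = M +z(v +z v)
 -- The effect on Ξ of flipping the sign of the first element y = M + 2v of a chain.
 module Flip(v : ℤ)(y≢0 : y≡ v ≢ + 0)(2y≢0 : (v +z v) +z D +z((v +z v) +z D) ≢ + 0)where
  y v₊ v₋ : ℤ
  y = y≡ v
  v₊ = (v +z v) +z D
  v₋ = -z(v +z v)
  M+y : M +z y ≡ v₊
  M+y = eq M v where
   eq : ∀ M v → M +z(M +z(v +z v)) ≡ (v +z v) +z(M +z M)
   eq = ringℤ
  M-y : M -z y ≡ v₋
  M-y = eq M v where
   eq : ∀ M v → M -z(M +z(v +z v)) ≡ -z(v +z v)
   eq = ringℤ
  s-reg : Regular(s y)
  s-reg = λ z e → 1+T-reg{v₊}2y≢0 z(*ʳ(+ˡ(T-cong(E.sym M+y)) · sym(s-law y≢0))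
   · solve 3(λ a b c → a :* b :* c := b :* (a :* c))refl _ _ _ · *ˡ e · zeroʳ _)
  s-ratio : s(-z y) * (⟦ v₊ +z v₊ ⟧ * ⟦ v₋ ⟧) ≈ - (T y * (s y * (⟦ v₋ +z v₋ ⟧ * ⟦ v₊ ⟧)))
  s-ratio = reg-cancel(⟦⟧-reg y≢0)(solve 4(λ a b c d → a :* (b :* (c :* d)) := b :* a :* (c :* d))refl _ _ _ _ · *c(s-neg-law y≢0
   · -ᶜ(*ˡ(+ˡ(T-cong M-y))))(*ʳ(⟦double⟧ v₊)) · solve 5(λ t a b c d → (:- (t :* a)) :* (b :* c :* d) := :- (t :* (c :* ((d :* a) :* b))))refl _
   _ _ _ _ · -ᶜ(*ˡ(*c(+ˡ(T-cong(E.sym M+y)) · sym(s-law y≢0))(*ʳ(sym(⟦double⟧ v₋)))))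
   · solve 4(λ t a b c → :- (t :* (a :* b :* c)) := b :* (:- (t :* (a :* c))))refl _ _ _ _)
  flip : ∀ C{κ H₊ H₋ U₊ U₋} → Regular κ → Regular ⟦ v₊ ⟧ → Regular ⟦ v₋ ⟧ → κ * Γ y C * ⟦ v₊ +z v₊ ⟧ * U₊ ≈ ⟦ v₊ ⟧ * H₊ → κ * Γ(-z y)C * ⟦ v₋ +z v₋
   ⟧ * U₋ ≈ ⟦ v₋ ⟧ * H₋ → Ξ(-z y ∷ C) * H₊ * U₋ ≈ - (T y * (Ξ(y ∷ C) * H₋ * U₊))
  flip C{κ}{H₊}{H₋}{U₊}{U₋}ρκ ρ₊ ρ₋ h₊ h₋ = reg-cancel(reg-* s-reg(reg-* ρ₊ ρ₋))(solve 6(λ s p m x h u → s :* (p :* m) :* (x :* h :* u) := x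
   :* s :* (p :* h) :* u :* m)refl _ _ _ _ _ _ · *ʳ(*ʳ(*ˡ(sym h₊))) · solve 8(λ x s k a p u w m → x :* s :* (k :* a :* p :* u) :* w :* m := (x :*
   (s :* a)) :* (k :* u :* w) :* (p :* m))refl _ _ _ _ _ _ _ _ · *ʳ(*ʳ(Ξ-flip y C))
   · solve 8(λ x s a k u w p m → (x :* (s :* a)) :* (k :* u :* w) :* (p :* m) := (s :* (p :* m)) :* (x :* a :* k :* u :* w))refl _ _ _ _ _ _ _ _ ·
   *ʳ s-ratio · solve 9(λ t s q p x a k u w → (:- (t :* (s :* (q :* p)))) :* (x :* a :* k :* u :* w) := :- (t :* (s :* p :* (x :* (k :* a :* q :* w)
   :* u))))refl _ _ _ _ _ _ _ _ _ · -ᶜ(*ˡ(*ˡ(*ʳ(*ˡ h₋)))) · solve 7(λ t s p x m h u → :- (t :* (s :* p :* (x :* (m :* h) :* u))) := s :* (p :*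
   m) :* (:- (t :* (x :* h :* u))))refl _ _ _ _ _ _ _)where
   Ξ' = Ξ(-z y ∷ C)
   Ξ0 = Ξ(y ∷ C)
open import Data.Sum using (inj₁; inj₂)
open import Data.List.Relation.Binary.Permutation.Propositional using (↭-reflexive)
open import Data.List.Relation.Binary.Permutation.Propositional.Properties using (++⁺ʳ)
module ConfigSteps(R : Ring)(χ : Char R)(M : ℤ)(J : ℕ)where
 open CommutativeRing R hiding (zero) renaming (Carrier to |R|; *-congˡ to *ˡ; *-congʳ to *ʳ; +-congˡ to +ˡ; *-identityˡ to 1*; -‿cong to -ᶜ; *-cong
  to *c; reflexive to rfx; trans to infixr 1 _·_)
 open Char χ
 open RingSolver R
 open Polynomials R
 open Sums R
 open SignedSums R
 open CharProperties R χ
 open Symm R χ M hiding (u; v; w; d)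
 open Evals R χ M
 open ChainSteps R χ M
 -- A pair of chains with index i: the configuration obtained from the runs starting at M + 2i and
 -- M - 2i by flipping signs, where b - J elements have been moved from the first to the second run.
 record Pair : Set where
  constructor pair
  field
   i : ℤ
   b a : ℕ
 open Pair public
 infix 9 _∣_
 _∣_ : ℤ → ℕ → ℤ
 i ∣ b = i +z M *z(+ b -z + J)
 v : Pair → ℤ
 v p = i p ∣ b p
 w : Pair → ℤ
 w p = v p +z v p
 conf : Pair → List ℤ
 conf p = run(M +z w p)(a p) ++ run(M -z w p)(b p)
 Balanced : Pair → Set
 Balanced p = + a p ≡ + J +z + J -z + b p
 v0 w0 : ℕ → ℤ
 v0 k = M *z + k
 w0 k = v0 k +z v0 k
 conf0 : ℕ → ℕ → List ℤ
 conf0 k l = run(M -z w0 k)k ++ run(M +z w0 k)l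
 Balanced0 : ℕ → ℕ → Set
 Balanced0 k l = + l ≡ + J -z + k
 confs : List Pair → List ℤ
 confs = concatMap conf
 -- The end factors of a pair with index i, seen from e - M.
 η : ℤ → ℤ → |R|
 η e i = ⟦ e +z D *z + J +z(i +z i) ⟧ * ⟦ e +z D *z + J -z(i +z i) ⟧
 private
  off-j : ∀ {x l} → Off x → ∀ (j : ℕ) → j < l → x +z D *z + j ≢ + 0
  off-j o j _ = avoid o(+ j)
 Γ-conf : ∀ e p → Balanced p → Off(e +z w p) → Off(e -z w p) → Γ(e -z M)(conf p) * (T e * (X e - X(w p))) ≈ η e(i p)
 Γ-conf e p bal o₊ o₋ = *c(∏-++ (g e')(run _(a p))_)(sym(bracket-product e(w p))) · (*-interchange _ _ _ _
  · *c(*ˡ(⟦⟧-cong(E.sym eq₊)))(*ˡ(⟦⟧-cong(E.sym eq₋)))) · *c(Γ-run e' _(a p)(off-j(subst Off(E.sym eq₊)o₊)))(Γ-run e' _(b p)(off-j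
  (subst Off(E.sym eq₋)o₋))) · *c(⟦⟧-cong(E.trans(cong(λ x → e' +z(M +z w p) +z D *z x)bal)(end₊ e M(i p)(+ b p)(+ J))))(⟦⟧-cong(end₋ e
  M(i p)(+ b p)(+ J)))where
  e' = e -z M
  eq₊ : e' +z(M +z w p) ≡ e +z w p
  eq₊ = lem e M(w p)where
   lem : ∀ e M w → e -z M +z(M +z w) ≡ e +z w
   lem = ringℤ
  eq₋ : e' +z(M -z w p) ≡ e -z w p
  eq₋ = lem e M(w p)where
   lem : ∀ e M w → e -z M +z(M -z w) ≡ e -z w
   lem = ringℤ
  end₊ : ∀ e M i b J → e -z M +z(M +z(i +z M *z(b -z J) +z(i +z M *z(b -z J)))) +z(M +z M) *z(J +z J -z b) ≡ e +z(M +z M) *z J +z(i +z i)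
  end₊ = ringℤ
  end₋ : ∀ e M i b J → e -z M +z(M -z(i +z M *z(b -z J) +z(i +z M *z(b -z J)))) +z(M +z M) *z b ≡ e +z(M +z M) *z J -z(i +z i)
  end₋ = ringℤ
 Γ-conf0 : ∀ e k l → Balanced0 k l → Off(e +z w0 k) → Off(e -z w0 k) → Γ(e -z M)(conf0 k l) * (T e * (X e - X(w0 k))) ≈ ⟦ e ⟧ * ⟦ e +z D *z + J ⟧
 Γ-conf0 e k l bal o₊ o₋ = *c(∏-++ (g e')(run _ k)_)(sym(bracket-product e(w0 k)) · *-comm _ _) · (*-interchange _ _ _ _
  · *c(*ˡ(⟦⟧-cong(E.sym eq₋)))(*ˡ(⟦⟧-cong(E.sym eq₊)))) · *c(Γ-run e' _ k(off-j(subst Off(E.sym eq₋)o₋)))(Γ-run e' _ l(off-j(subst Off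
  (E.sym eq₊)o₊))) · *c(⟦⟧-cong(end₋ e M(+ k)))(⟦⟧-cong(E.trans(cong(λ x → e' +z(M +z w0 k) +z D *z x)bal)(end₊ e M(+ k)(+ J))))where
  e' = e -z M
  eq₊ : e' +z(M +z w0 k) ≡ e +z w0 k
  eq₊ = lem e M(w0 k)where
   lem : ∀ e M w → e -z M +z(M +z w) ≡ e +z w
   lem = ringℤ
  eq₋ : e' +z(M -z w0 k) ≡ e -z w0 k
  eq₋ = lem e M(w0 k)where
   lem : ∀ e M w → e -z M +z(M -z w) ≡ e -z w
   lem = ringℤ
  end₊ : ∀ e M k J → e -z M +z(M +z(M *z k +z M *z k)) +z(M +z M) *z(J -z k) ≡ e +z(M +z M) *z J
  end₊ = ringℤ
  end₋ : ∀ e M k → e -z M +z(M -z(M *z k +z M *z k)) +z(M +z M) *z k ≡ e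
  end₋ = ringℤ
 -- T e (X e - X w), whose zeros are the poles of Γ (e - M).
 ξ : ℤ → ℤ → |R|
 ξ e w = T e * (X e - X w)
 Γ-confs : ∀ e ps → All Balanced ps → All(λ p → Off(e +z w p) × Off(e -z w p))ps → Γ(e -z M)(confs ps) * ∏ (λ p → ξ e(w p))ps ≈ ∏ (λ p → η e
  (i p))ps
 Γ-confs e [] _ _ = 1* _
 Γ-confs e(p ∷ ps)(β ∷ βs)((o₊ , o₋) ∷ os) = *ʳ(∏-++ (g(e -z M))(conf p)(confs ps)) · *-interchange _ _ _ _
  · *c(Γ-conf e p β o₊ o₋)(Γ-confs e ps βs os)
 -- The end factors met by a pair with index i at distance l from the end of its chain.
 φ : ℤ → List ℤ → ℕ → |R|
 φ i is l = ⟦ e ⟧ * ∏ (λ i′ → ⟦ e +z(i′ +z i′) ⟧ * ⟦ e -z(i′ +z i′) ⟧)is where e = (i +z i) +z D *z + l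
 inds : List Pair → List ℤ
 inds = map i
 module _(D≢0 : D ≢ + 0)where
  D*≢0 : ∀ {x} → x ≢ + 0 → D *z x ≢ + 0
  D*≢0{x}p e with Z.i*j≡0⇒i≡0∨j≡0 D e
  ... | inj₁ q = D≢0 q
  ... | inj₂ q = p q
  D+D*≢0 : ∀ {l : ℕ}(j : ℕ) → j < l → D +z D *z + j ≢ + 0
  D+D*≢0 j _ e = D*≢0{+ suc j}(λ())(E.trans(lem D(+ j))e)where
   lem : ∀ D j → D *z(+ 1 +z j) ≡ D +z D *z j
   lem = ringℤ
  D-reg : Regular ⟦ D ⟧
  D-reg = ⟦⟧-reg D≢0
  Apart : ℤ → ℤ → Set
  Apart i i′ = Off((i +z i) +z(i′ +z i′)) × Off((i +z i) -z(i′ +z i′))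
  -- Moving one element of the pair with index i, next to the central chain and the pairs ps.
  pair-step : ∀ i b a k l ps → Balanced(pair i b(suc a)) → Balanced0 k l → All Balanced ps → Off(i +z i) → Off((i +z i) +z(i +z i)) → All(λ p →
   Apart i(Pair.i p))ps → let p = pair i b(suc a); p' = pair i(suc b)a; C = conf0 k l ++ confs ps; ws = w0 k ∷ map w ps in Ξ(conf p' ++ C) * φ i
   (i ∷ inds ps)(suc b) * ∏ (ξ(-z w p))ws ≈ - (T(M +z w p) * (Ξ(conf p ++ C) * φ(-z i)(i ∷ inds ps)(suc a) * ∏ (ξ(w p'))ws))
  pair-step i b a k l ps bal bal0 bals o2 o4 os = *ʳ(*ʳ(Ξ-↭ perm')) · F.flip(own ++ C)D-reg ρ₊ ρ₋ hyp₊ hyp₋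
   · -ᶜ(*ˡ(*c(*ʳ(rfx(cong(λ s → Ξ(y ∷ (run s a ++ run(M -z w p)b) ++ C))(E.sym start≡))))(∏-cong(λ x → rfx(cong(λ e → ξ e x)v₊≡))ws)))
   where
   p = pair i b(suc a)
   p' = pair i(suc b)a
   C = conf0 k l ++ confs ps
   ws = w0 k ∷ map w ps
   k' = + b -z + J
   lem-off : ∀ i M k → (i +z M *z k) +z(i +z M *z k) ≡ (i +z i) +z(M +z M) *z k
   lem-off = ringℤ
   w-off : Off(w p)
   w-off = Off-via k' o2(lem-off i M k')
   v₊-off : Off(w p +z D)
   v₊-off = Off-via(+ 1)w-off(lem(w p)D)where
    lem : ∀ w D → w +z D ≡ w +z D *z + 1
    lem = ringℤ
   2w-off : Off(w p +z w p)
   2w-off = Off-via(k' +z k')o4(lem i M k')where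
    lem : ∀ i M k → ((i +z M *z k) +z(i +z M *z k)) +z((i +z M *z k) +z(i +z M *z k)) ≡ ((i +z i) +z(i +z i)) +z(M +z M) *z(k +z k)
    lem = ringℤ
   2v₊-off : Off((w p +z D) +z(w p +z D))
   2v₊-off = Off-via(+ 2)2w-off(lem(w p)D)where
    lem : ∀ w D → (w +z D) +z(w +z D) ≡ w +z w +z D *z + 2
    lem = ringℤ
   y-nz : y≡ (v p) ≢ + 0
   y-nz e = avoid 2w-off(+ 1)(E.trans(lem M(w p))(cong₂ _+z_ e e))where
    lem : ∀ M w → w +z w +z(M +z M) *z + 1 ≡ (M +z w) +z(M +z w)
    lem = ringℤ
   module F = Flip(v p)y-nz(Off-≢0{(w p +z D) +z(w p +z D)}2v₊-off)
   open F using (y; v₊; v₋)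
   ρ₊ : Regular ⟦ v₊ ⟧
   ρ₊ = ⟦⟧-reg(Off-≢0 v₊-off)
   ρ₋ : Regular ⟦ v₋ ⟧
   ρ₋ = ⟦⟧-reg(Off-≢0{ -z w p}(Off-neg w-off))
   v₊≡ : v₊ ≡ w p'
   v₊≡ = lem i M(+ b)(+ J)where
    lem : ∀ i M b J → (i +z M *z(b -z J)) +z(i +z M *z(b -z J)) +z(M +z M) ≡ (i +z M *z(+ 1 +z b -z J)) +z(i +z M *z(+ 1 +z b -z J))
    lem = ringℤ
   H₊ = φ i(i ∷ inds ps)(suc b)
   H₋ = φ(-z i)(i ∷ inds ps)(suc a)
   U₊ = ∏ (ξ(w p'))ws
   U₊' = ∏ (ξ v₊)ws
   U₋ = ∏ (ξ v₋)ws
   own = run(M +z w p')a ++ run(M -z w p)b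
   start≡ : M +z w p +z D ≡ M +z w p'
   start≡ = E.trans(Z.+-assoc M(w p)D)(cong(λ x → M +z x)v₊≡)
   -y≡ : M -z w p' ≡ -z y
   -y≡ = E.trans(cong(λ x → M -z x)(E.sym v₊≡))(lem M(w p))where
    lem : ∀ M w → M -z(w +z(M +z M)) ≡ -z(M +z w)
    lem = ringℤ
   next : M -z w p' +z D ≡ M -z w p
   next = E.trans(cong(λ x → M -z x +z D)(E.sym v₊≡))(lem M(w p)D)where
    lem : ∀ M w D → M -z(w +z D) +z D ≡ M -z w
    lem = ringℤ
   perm' : conf p' ++ C ↭ -z y ∷ own ++ C
   perm' = ++⁺ʳ C(↭-trans(↭-reflexive(cong₂(λ x z → run(M +z w p')a ++ x ∷ run z b) -y≡ next))(shift(-z y)(run(M +z w p')a)(run(M -z w p)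
    b)))
   -- The two ends of the chains with index i.
   N₊ N₋ : |R|
   N₊ = ⟦ y +z(M +z w p') +z D *z + a ⟧ * ⟦ y +z(M -z w p) +z D *z + b ⟧
   N₋ = ⟦ -z y +z(M +z w p') +z D *z + a ⟧ * ⟦ -z y +z(M -z w p) +z D *z + b ⟧
   yy₊ : y +z(M +z w p') ≡ v₊ +z v₊
   yy₊ = E.trans(cong(λ x → y +z(M +z x))(E.sym v₊≡))(lem M(w p))where
    lem : ∀ M w → (M +z w) +z(M +z(w +z(M +z M))) ≡ (w +z(M +z M)) +z(w +z(M +z M))
    lem = ringℤ
   yd₊ : y +z(M -z w p) ≡ D
   yd₊ = lem M(w p)where
    lem : ∀ M w → (M +z w) +z(M -z w) ≡ M +z M
    lem = ringℤ
   yd₋ : -z y +z(M +z w p') ≡ D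
   yd₋ = E.trans(cong(λ x → -z y +z(M +z x))(E.sym v₊≡))(lem M(w p))where
    lem : ∀ M w → -z(M +z w) +z(M +z(w +z(M +z M))) ≡ M +z M
    lem = ringℤ
   yy₋ : -z y +z(M -z w p) ≡ v₋ +z v₋
   yy₋ = lem M(w p)where
    lem : ∀ M w → -z(M +z w) +z(M -z w) ≡ -z w +z -z w
    lem = ringℤ
   2v₋-off : Off(v₋ +z v₋)
   2v₋-off = subst Off(Z.neg-distrib-+ (w p)(w p))(Off-neg 2w-off)
   own₊ : ⟦ D ⟧ * Γ y own * ⟦ v₊ +z v₊ ⟧ ≈ N₊
   own₊ = *c(*c(⟦⟧-cong(E.sym yd₊))(∏-++ (g y)(run _ a)_))(⟦⟧-cong(E.sym yy₊))
    · solve 4(λ d α β x → d :* (α :* β) :* x := (α :* x) :* (β :* d))refl _ _ _ _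
    · *c(Γ-run y _ a(off-j(subst Off(E.sym yy₊)2v₊-off)))(Γ-run y _ b(λ j j< → subst(λ x → x +z D *z + j ≢ + 0)(E.sym yd₊)(D+D*≢0 j j<)))
   own₋ : ⟦ D ⟧ * Γ(-z y)own * ⟦ v₋ +z v₋ ⟧ ≈ N₋
   own₋ = *c(*c(⟦⟧-cong(E.sym yd₋))(∏-++ (g(-z y))(run _ a)_))(⟦⟧-cong(E.sym yy₋))
    · solve 4(λ d α β x → d :* (α :* β) :* x := (α :* d) :* (β :* x))refl _ _ _ _
    · *c(Γ-run(-z y)_ a(λ j j< → subst(λ x → x +z D *z + j ≢ + 0)(E.sym yd₋)(D+D*≢0 j j<)))(Γ-run(-z y)_ b(off-j(subst Off(E.sym yy₋)
    2v₋-off)))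
   away : ∀ {q} → Apart i(Pair.i q) → Off(w p +z w q) × Off(w p -z w q)
   away{q}(o₊ , o₋) = Off-via(k' +z kq)o₊ (lem₊ i(Pair.i q)M k' kq) , Off-via(k' -z kq)o₋ (lem₋ i(Pair.i q)M k' kq)where
    kq = + Pair.b q -z + J
    lem₊ : ∀ i j M k l → ((i +z M *z k) +z(i +z M *z k)) +z((j +z M *z l) +z(j +z M *z l)) ≡ ((i +z i) +z(j +z j)) +z(M +z M) *z(k +z l)
    lem₊ = ringℤ
    lem₋ : ∀ i j M k l → ((i +z M *z k) +z(i +z M *z k)) -z((j +z M *z l) +z(j +z M *z l)) ≡ ((i +z i) -z(j +z j)) +z(M +z M) *z(k -z l)
    lem₋ = ringℤ
   away0 : Off(w p +z w0 k) × Off(w p -z w0 k)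
   away0 = Off-via(k' +z + k)o2(lem₊ i M k'(+ k)) , Off-via(k' -z + k)o2(lem₋ i M k'(+ k))where
    lem₊ : ∀ i M k l → ((i +z M *z k) +z(i +z M *z k)) +z(M *z l +z M *z l) ≡ (i +z i) +z(M +z M) *z(k +z l)
    lem₊ = ringℤ
    lem₋ : ∀ i M k l → ((i +z M *z k) +z(i +z M *z k)) -z(M *z l +z M *z l) ≡ (i +z i) +z(M +z M) *z(k -z l)
    lem₋ = ringℤ
   up : ∀ {x} → Off(w p +z x) × Off(w p -z x) → Off(v₊ +z x) × Off(v₊ -z x)
   up{x}(o₊ , o₋) = Off-via(+ 1)o₊ (lem₊ (w p)x D) , Off-via(+ 1)o₋ (lem₋ (w p)x D)where
    lem₊ : ∀ w x D → (w +z D) +z x ≡ (w +z x) +z D *z + 1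
    lem₊ = ringℤ
    lem₋ : ∀ w x D → (w +z D) -z x ≡ (w -z x) +z D *z + 1
    lem₋ = ringℤ
   down : ∀ {x} → Off(w p +z x) × Off(w p -z x) → Off(v₋ +z x) × Off(v₋ -z x)
   down{x}(o₊ , o₋) = subst Off(lem₋ (w p)x)(Off-neg o₋) , subst Off(lem₊ (w p)x)(Off-neg o₊)where
    lem₊ : ∀ w x → -z(w +z x) ≡ -z w -z x
    lem₊ = ringℤ
    lem₋ : ∀ w x → -z(w -z x) ≡ -z w +z x
    lem₋ = ringℤ
   rest : ∀ e → Off(e +z w0 k) × Off(e -z w0 k) → All(λ q → Off(e +z w q) × Off(e -z w q))ps → Γ(e -z M)C * ∏ (ξ e)ws ≈ ⟦ e ⟧ * ⟦ e +z D *z +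
    J ⟧ * ∏ (λ q → η e(Pair.i q))ps
   rest e(o₊ , o₋)oss = *c(∏-++ (g(e -z M))(conf0 k l)(confs ps))(*ˡ(∏-map(ξ e)w ps)) · *-interchange _ _ _ _
    · *c(Γ-conf0 e k l bal0 o₊ o₋)(Γ-confs e ps bals oss)
   y₊ : v₊ -z M ≡ y
   y₊ = lem M(w p)where
    lem : ∀ M w → w +z(M +z M) -z M ≡ M +z w
    lem = ringℤ
   y₋ : v₋ -z M ≡ -z y
   y₋ = lem M(w p)where
    lem : ∀ M w → -z w -z M ≡ -z(M +z w)
    lem = ringℤ
   ∏-inds : ∀ e → ∏ (λ i′ → ⟦ e +z(i′ +z i′) ⟧ * ⟦ e -z(i′ +z i′) ⟧)(inds ps) ≈ ∏ (λ q → ⟦ e +z(Pair.i q +z Pair.i q) ⟧ * ⟦ e -z(Pair.i q +z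
    Pair.i q) ⟧)ps
   ∏-inds e = ∏-map _ Pair.i ps
   e₊ e₋ : ℤ
   e₊ = (i +z i) +z D *z + suc b
   e₋ = (-z i +z -z i) +z D *z + suc a
   end₊ : v₊ +z D *z + J ≡ e₊
   end₊ = lem i M(+ b)(+ J)where
    lem : ∀ i M b J → (i +z M *z(b -z J)) +z(i +z M *z(b -z J)) +z(M +z M) +z(M +z M) *z J ≡ (i +z i) +z(M +z M) *z(+ 1 +z b)
    lem = ringℤ
   end₋ : v₋ +z D *z + J ≡ e₋
   end₋ = E.trans(lem i M(+ b)(+ J))(cong(λ x → (-z i +z -z i) +z D *z x)(E.sym bal))where
    lem : ∀ i M b J → -z((i +z M *z(b -z J)) +z(i +z M *z(b -z J))) +z(M +z M) *z J ≡ (-z i +z -z i) +z(M +z M) *z(J +z J -z b)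
    lem = ringℤ
   a≡ : + a ≡ + J +z + J -z + b -z + 1
   a≡ = E.trans(lem(+ a))(cong(λ x → x -z + 1)bal)where
    lem : ∀ a → a ≡ + 1 +z a -z + 1
    lem = ringℤ
   N₊≈ : N₊ ≈ ⟦ e₊ +z(i +z i) ⟧ * ⟦ e₊ -z(i +z i) ⟧
   N₊≈ = *c(⟦⟧-cong(E.trans(cong₂(λ x z → x +z D *z z)yy₊ a≡)(lem1 i M(+ b)(+ J))))(⟦⟧-cong(E.trans(cong(λ x → x +z D *z + b)yd₊)(lem2 i
    D(+ b))))where
    lem1 : ∀ i M b J → ((i +z M *z(b -z J)) +z(i +z M *z(b -z J)) +z(M +z M)) +z((i +z M *z(b -z J)) +z(i +z M *z(b -z J)) +z(M +z M)) +z(M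
     +z M) *z(J +z J -z b -z + 1) ≡ (i +z i) +z(M +z M) *z(+ 1 +z b) +z(i +z i)
    lem1 = ringℤ
    lem2 : ∀ i D b → D +z D *z b ≡ (i +z i) +z D *z(+ 1 +z b) -z(i +z i)
    lem2 = ringℤ
   N₋≈ : N₋ ≈ ⟦ e₋ +z(i +z i) ⟧ * ⟦ e₋ -z(i +z i) ⟧
   N₋≈ = *c(⟦⟧-cong(E.trans(cong(λ x → x +z D *z + a)yd₋)(lem2 i D(+ a))))(⟦⟧-cong(E.trans(cong(λ x → x +z D *z + b)yy₋)(E.trans(lem1 i
    M(+ b)(+ J))(cong(λ x → (-z i +z -z i) +z D *z x -z(i +z i))(E.sym bal)))))where
    lem1 : ∀ i M b J → (-z((i +z M *z(b -z J)) +z(i +z M *z(b -z J)))) +z(-z((i +z M *z(b -z J)) +z(i +z M *z(b -z J)))) +z(M +z M) *z b ≡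
     (-z i +z -z i) +z(M +z M) *z(J +z J -z b) -z(i +z i)
    lem1 = ringℤ
    lem2 : ∀ i D a → D +z D *z a ≡ (-z i +z -z i) +z D *z(+ 1 +z a) +z(i +z i)
    lem2 = ringℤ
   finish : ∀ {e e' c N}y' → e -z M ≡ y' → e +z D *z + J ≡ e' → ⟦ D ⟧ * Γ y' own * ⟦ e +z e ⟧ ≈ N → N ≈ ⟦ e' +z(i +z i) ⟧ * ⟦ e' -z(i +z i) ⟧ → Γ
    (e -z M)C * ∏ (ξ e)ws ≈ ⟦ e ⟧ * ⟦ e +z D *z + J ⟧ * ∏ (λ q → η e(Pair.i q))ps → c ≡ e' → ⟦ D ⟧ * Γ y'(own ++ C) * ⟦ e +z e ⟧ * ∏ (ξ e)ws ≈ ⟦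
    e ⟧ * (⟦ c ⟧ * ∏ (λ i′ → ⟦ c +z(i′ +z i′) ⟧ * ⟦ c -z(i′ +z i′) ⟧)(i ∷ inds ps))
   finish{e}{N = N}y' rfl rfl h1 h2 h3 rfl = *ʳ(*ʳ(*ˡ(∏-++ (g y')own C)))
    · solve 5(λ d o c x u → d :* (o :* c) :* x :* u := (d :* o :* x) :* (c :* u))refl _ _ _ _ _ · *c(h1 · h2)h3
    · solve 4(λ n e c p → n :* (e :* c :* p) := e :* (c :* (n :* p)))refl _ _ _ _ · *ˡ(*ˡ(*ˡ(sym(∏-inds c))))where
    c = e +z D *z + J
   hyp₊ : ⟦ D ⟧ * Γ y(own ++ C) * ⟦ v₊ +z v₊ ⟧ * U₊' ≈ ⟦ v₊ ⟧ * H₊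
   hyp₊ = finish y y₊ end₊ own₊ N₊≈ (rest v₊ (up away0)(All.map(λ{q}o → up(away{q}o))os))rfl
   hyp₋ : ⟦ D ⟧ * Γ(-z y)(own ++ C) * ⟦ v₋ +z v₋ ⟧ * U₋ ≈ ⟦ v₋ ⟧ * H₋
   hyp₋ = finish(-z y)y₋ end₋ own₋ N₋≈ (rest v₋ (down away0)(All.map(λ{q}o → down(away{q}o))os))rfl
  module CentralStep(k l : ℕ)(ps : List Pair)(bal0 : Balanced0 k(suc l))(bals : All Balanced ps)(os : All(λ p → Off(Pair.i p +z Pair.i p))ps)
   where
   C : List ℤ
   C = confs ps
   ws : List ℤ
   ws = map w ps
   y v₊ v₋ : ℤ
   y = M +z w0 k
   v₊ = w0 k +z D
   v₋ = -z w0 k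
   own : List ℤ
   own = run(M -z w0 k)k ++ run(y +z D)l
   v₊≡ : w0(suc k) ≡ v₊
   v₊≡ = lem M(+ k)where
    lem : ∀ M k → M *z(+ 1 +z k) +z M *z(+ 1 +z k) ≡ M *z k +z M *z k +z(M +z M)
    lem = ringℤ
   before : conf0 k(suc l) ++ C ↭ y ∷ own ++ C
   before = ++⁺ʳ C(shift y(run(M -z w0 k)k)(run(y +z D)l))
   after : conf0(suc k)l ++ C ↭ -z y ∷ own ++ C
   after = ↭-reflexive(cong₂ _++_(cong₂ _++_(cong₂(λ x z → x ∷ run z k)e1 e2)(cong(λ x → run x l)e3))rfl)where
    e1 : M -z w0(suc k) ≡ -z y
    e1 = E.trans(cong(λ x → M -z x)v₊≡)(lem M(w0 k))where
     lem : ∀ M w → M -z(w +z(M +z M)) ≡ -z(M +z w)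
     lem = ringℤ
    e2 : M -z w0(suc k) +z D ≡ M -z w0 k
    e2 = E.trans(cong(λ x → M -z x +z D)v₊≡)(lem M(w0 k)D)where
     lem : ∀ M w D → M -z(w +z D) +z D ≡ M -z w
     lem = ringℤ
    e3 : M +z w0(suc k) ≡ y +z D
    e3 = E.trans(cong(λ x → M +z x)v₊≡)(E.sym(Z.+-assoc M(w0 k)D))
   w0-away : ∀ {p} → Off(Pair.i p +z Pair.i p) → (Off(v₊ +z w p) × Off(v₊ -z w p)) × (Off(v₋ +z w p) × Off(v₋ -z w p))
   w0-away{p}o = (Off-via(kp +z + k +z + 1)o(lem1 M(Pair.i p)kp(+ k)) , Off-via(+ k +z + 1 -z kp)(Off-neg o)(lem2 M(Pair.i p)kp(+ k))) ,
    (Off-via(kp -z + k)o(lem3 M(Pair.i p)kp(+ k)) , Off-via(-z kp -z + k)(Off-neg o)(lem4 M(Pair.i p)kp(+ k)))where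
    kp = + Pair.b p -z + J
    lem1 : ∀ M i l k → (M *z k +z M *z k +z(M +z M)) +z((i +z M *z l) +z(i +z M *z l)) ≡ (i +z i) +z(M +z M) *z(l +z k +z + 1)
    lem1 = ringℤ
    lem2 : ∀ M i l k → (M *z k +z M *z k +z(M +z M)) -z((i +z M *z l) +z(i +z M *z l)) ≡ -z(i +z i) +z(M +z M) *z(k +z + 1 -z l)
    lem2 = ringℤ
    lem3 : ∀ M i l k → -z(M *z k +z M *z k) +z((i +z M *z l) +z(i +z M *z l)) ≡ (i +z i) +z(M +z M) *z(l -z k)
    lem3 = ringℤ
    lem4 : ∀ M i l k → -z(M *z k +z M *z k) -z((i +z M *z l) +z(i +z M *z l)) ≡ -z(i +z i) +z(M +z M) *z(-z l -z k)
    lem4 = ringℤ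
   rest : ∀ e y' → e -z M ≡ y' → All(λ q → Off(e +z w q) × Off(e -z w q))ps → Γ y' C * ∏ (ξ e)ws ≈ ∏ (λ q → η e(Pair.i q))ps
   rest e _ rfl o = *ˡ(∏-map(ξ e)w ps) · Γ-confs e ps bals o
   -- The end factors, in the form occurring in φ.
   ends : ∀ e c → e +z D *z + J ≡ c → ⟦ c ⟧ * ∏ (λ q → η e(Pair.i q))ps ≈ ⟦ c ⟧ * ∏ (λ i′ → ⟦ c +z(i′ +z i′) ⟧ * ⟦ c -z(i′ +z i′) ⟧)(inds ps)
   ends e _ rfl = *ˡ(sym(∏-map _ Pair.i ps))
   c₊ c₋ : ℤ
   c₊ = + 0 +z D *z + (J +n suc k)
   c₋ = + 0 +z D *z + suc l
   end₊ : v₊ +z D *z + J ≡ c₊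
   end₊ = lem M(+ k)(+ J)where
    lem : ∀ M k J → M *z k +z M *z k +z(M +z M) +z(M +z M) *z J ≡ + 0 +z(M +z M) *z(J +z(+ 1 +z k))
    lem = ringℤ
   end₋ : v₋ +z D *z + J ≡ c₋
   end₋ = E.trans(lem M(+ k)(+ J))(cong(λ x → + 0 +z D *z x)(E.sym bal0))where
    lem : ∀ M k J → -z(M *z k +z M *z k) +z(M +z M) *z J ≡ + 0 +z(M +z M) *z(J -z k)
    lem = ringℤ
   l≡ : + l ≡ + J -z + k -z + 1
   l≡ = E.trans(lem(+ l))(cong(λ x → x -z + 1)bal0)where
    lem : ∀ a → a ≡ + 1 +z a -z + 1
    lem = ringℤ
   y₊ : v₊ -z M ≡ y
   y₊ = lem M(w0 k)where
    lem : ∀ M w → w +z(M +z M) -z M ≡ M +z w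
    lem = ringℤ
   y₋ : v₋ -z M ≡ -z y
   y₋ = lem M(w0 k)where
    lem : ∀ M w → -z w -z M ≡ -z(M +z w)
    lem = ringℤ
   yy₊ : y +z(y +z D) ≡ v₊ +z v₊
   yy₊ = lem M(w0 k)where
    lem : ∀ M w → (M +z w) +z(M +z w +z(M +z M)) ≡ (w +z(M +z M)) +z(w +z(M +z M))
    lem = ringℤ
   yd₋ : -z y +z(y +z D) ≡ D
   yd₋ = lem y D where
    lem : ∀ y D → -z y +z(y +z D) ≡ D
    lem = ringℤ
   far₊ : y +z(y +z D) +z D *z + l ≡ c₊
   far₊ = E.trans(cong(λ x → y +z(y +z D) +z D *z x)l≡)(lem M(+ k)(+ J))where
    lem : ∀ M k J → (M +z(M *z k +z M *z k)) +z(M +z(M *z k +z M *z k) +z(M +z M)) +z(M +z M) *z(J -z k -z + 1) ≡ + 0 +z(M +z M) *z(J +z(+ 1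
     +z k))
    lem = ringℤ
   far₋ : -z y +z(y +z D) +z D *z + l ≡ c₋
   far₋ = E.trans(cong(λ x → x +z D *z + l)yd₋)(lem D(+ l))where
    lem : ∀ D l → D +z D *z l ≡ + 0 +z D *z(+ 1 +z l)
    lem = ringℤ
   D2≢0 : ∀ (x : ℕ)z → D *z + suc x ≡ z → z ≢ + 0
   D2≢0 x z rfl = D*≢0{+ suc x}(λ())
   nz₊ : ∀ (j : ℕ) → j < l → y +z(y +z D) +z D *z + j ≢ + 0
   nz₊ j _ = D2≢0(k +n(k +n suc j))_(lem M(+ k)(+ j))where
    lem : ∀ M k j → (M +z M) *z(+ 1 +z(k +z(k +z(+ 1 +z j)))) ≡ (M +z(M *z k +z M *z k)) +z(M +z(M *z k +z M *z k) +z(M +z M)) +z(M +z M) *z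
     j
    lem = ringℤ
   nz₋ : ∀ (j : ℕ) → j < l → -z y +z(y +z D) +z D *z + j ≢ + 0
   nz₋ j j< e = D+D*≢0 j j< (E.trans(cong(λ x → x +z D *z + j)(E.sym yd₋))e)
   2y≢0 : v₊ +z v₊ ≢ + 0
   2y≢0 = D2≢0(k +n suc k)_(lem M(+ k))where
    lem : ∀ M k → (M +z M) *z(+ 1 +z(k +z(+ 1 +z k))) ≡ (M *z k +z M *z k +z(M +z M)) +z(M *z k +z M *z k +z(M +z M))
    lem = ringℤ
   y≢0 : y ≢ + 0
   y≢0 e = D2≢0(k +n k)_(lem M(+ k))(cong₂ _+z_ e e)where
    lem : ∀ M k → (M +z M) *z(+ 1 +z(k +z k)) ≡ (M +z(M *z k +z M *z k)) +z(M +z(M *z k +z M *z k))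
    lem = ringℤ
   v₊-reg : Regular ⟦ v₊ ⟧
   v₊-reg = ⟦⟧-reg(D2≢0 k _(lem M(+ k)))where
    lem : ∀ M k → (M +z M) *z(+ 1 +z k) ≡ M *z k +z M *z k +z(M +z M)
    lem = ringℤ
   module F = Flip(v0 k)y≢0 2y≢0
   φ₊ φ₋ U₊ U₋ : |R|
   φ₊ = φ(+ 0)(inds ps)(J +n suc k)
   φ₋ = φ(+ 0)(inds ps)(suc l)
   U₊ = ∏ (ξ(w0(suc k)))ws
   U₋ = ∏ (ξ(-z w0 k))ws
   U₊≈ : ∏ (ξ v₊)ws ≈ U₊
   U₊≈ = ∏-cong(λ x → rfx(cong(λ e → ξ e x)(E.sym v₊≡)))ws
  -- Moving one element of the central chain.
  central-step : ∀ k l ps → Balanced0(suc k)(suc l) → All Balanced ps → All(λ p → Off(Pair.i p +z Pair.i p))ps → let C = confs ps; ws = map w ps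
   in Ξ(conf0(suc(suc k))l ++ C) * φ(+ 0)(inds ps)(J +n suc(suc k)) * ∏ (ξ(-z w0(suc k)))ws ≈ - (T(M +z w0(suc k)) * (Ξ(conf0(suc k)
   (suc l) ++ C) * φ(+ 0)(inds ps)(suc l) * ∏ (ξ(w0(suc(suc k))))ws))
  central-step k' l ps bal0 bals os = *ʳ(*ʳ(Ξ-↭ after)) · F.flip(own ++ C)D-reg v₊-reg v₋-reg hyp₊ hyp₋
   · -ᶜ(*ˡ(*c(*ʳ(Ξ-↭ (↭-sym before)))U₊≈))where
   k = suc k'
   open CentralStep k l ps bal0 bals os
   v₋-reg : Regular ⟦ v₋ ⟧
   v₋-reg = ⟦⟧-reg(≢0-neg(D2≢0 k' _(lem M(+ k'))))where
    lem : ∀ M k → (M +z M) *z(+ 1 +z k) ≡ M *z(+ 1 +z k) +z M *z(+ 1 +z k)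
    lem = ringℤ
   yd₊ : y +z(M -z w0 k) ≡ D
   yd₊ = lem M(w0 k)where
    lem : ∀ M w → (M +z w) +z(M -z w) ≡ M +z M
    lem = ringℤ
   yy₋ : -z y +z(M -z w0 k) ≡ v₋ +z v₋
   yy₋ = lem M(w0 k)where
    lem : ∀ M w → -z(M +z w) +z(M -z w) ≡ -z w +z -z w
    lem = ringℤ
   near₊ : y +z(M -z w0 k) +z D *z + k ≡ v₊
   near₊ = lem M(+ k)where
    lem : ∀ M k → (M +z(M *z k +z M *z k)) +z(M -z(M *z k +z M *z k)) +z(M +z M) *z k ≡ M *z k +z M *z k +z(M +z M)
    lem = ringℤ
   near₋ : -z y +z(M -z w0 k) +z D *z + k ≡ v₋
   near₋ = lem M(+ k)where
    lem : ∀ M k → -z(M +z(M *z k +z M *z k)) +z(M -z(M *z k +z M *z k)) +z(M +z M) *z k ≡ -z(M *z k +z M *z k)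
    lem = ringℤ
   nz : ∀ (j : ℕ) → j < k → -z y +z(M -z w0 k) +z D *z + j ≢ + 0
   nz j j< e with N.m≤n⇒∃[o]m+o≡n(N.<⇒≤ j<)
   ... | zero , q = N.<-irrefl(E.trans(E.sym(N.+-identityʳ j))q)j<
   ... | suc o , q = D2≢0(o +n k)(-z z)(E.trans(cong(λ x → D *z(+ 1 +z(+ o +z x)))k≡)(E.trans(lem M(+ j)(+ o))(cong(λ x → -z(-z(M +z
    (M *z x +z M *z x)) +z(M -z(M *z x +z M *z x)) +z D *z + j))(E.sym k≡))))(cong(λ x → -z x)e)where
    z = -z y +z(M -z w0 k) +z D *z + j
    k≡ : + k ≡ + j +z(+ 1 +z + o)
    k≡ = cong +_(E.sym q)
    lem : ∀ M j o → (M +z M) *z(+ 1 +z(o +z(j +z(+ 1 +z o)))) ≡ -z(-z(M +z(M *z(j +z(+ 1 +z o)) +z M *z(j +z(+ 1 +z o)))) +z(M -z(M *z(j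
     +z(+ 1 +z o)) +z M *z(j +z(+ 1 +z o)))) +z(M +z M) *z j)
    lem = ringℤ
   hyp₊ : ⟦ D ⟧ * Γ y(own ++ C) * ⟦ v₊ +z v₊ ⟧ * ∏ (ξ v₊)ws ≈ ⟦ v₊ ⟧ * φ₊
   hyp₊ = *ʳ(*c(*c(⟦⟧-cong(E.sym yd₊))(∏-++ (g y)own C · *ʳ(∏-++ (g y)(run _ k)_)))(⟦⟧-cong(E.sym yy₊)))
    · solve 6(λ d α β c x u → d :* (α :* β :* c) :* x :* u := (α :* d) :* ((β :* x) :* (c :* u)))refl _ _ _ _ _ _
    · *c(Γ-run y _ k(λ j j< → subst(λ x → x +z D *z + j ≢ + 0)(E.sym yd₊)(D+D*≢0 j j<)) · ⟦⟧-cong near₊)(*c(Γ-run y _ l nz₊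
    · ⟦⟧-cong far₊)(rest v₊ y y₊ (All.map(λ{q}o → proj₁(w0-away{q}o))os))) · *ˡ(ends v₊ c₊ end₊)
   hyp₋ : ⟦ D ⟧ * Γ(-z y)(own ++ C) * ⟦ v₋ +z v₋ ⟧ * U₋ ≈ ⟦ v₋ ⟧ * φ₋
   hyp₋ = *ʳ(*c(*c(⟦⟧-cong(E.sym yd₋))(∏-++ (g(-z y))own C · *ʳ(∏-++ (g(-z y))(run _ k)_)))(⟦⟧-cong(E.sym yy₋)))
    · solve 6(λ d α β c x u → d :* (α :* β :* c) :* x :* u := (α :* x) :* ((β :* d) :* (c :* u)))refl _ _ _ _ _ _
    · *c(Γ-run(-z y)_ k nz · ⟦⟧-cong near₋)(*c(Γ-run(-z y)_ l nz₋ · ⟦⟧-cong far₋)(rest v₋ (-z y)y₋ (All.map(λ{q}o → proj₂(w0-away{q}o))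
    os))) · *ˡ(ends v₋ c₋ end₋)
  -- The first move picks up a factor 2, since the two signs of the central coordinate coincide at 0.
  central-step0 : ∀ l ps → Balanced0 0(suc l) → All Balanced ps → All(λ p → Off(Pair.i p +z Pair.i p))ps → let C = confs ps; ws = map w ps in Ξ
   (conf0 1 l ++ C) * φ(+ 0)(inds ps)(J +n 1) * ∏ (ξ(-z w0 0))ws ≈ - ((1# + 1#) * (T(M +z w0 0) * (Ξ(conf0 0(suc l) ++ C) * φ(+ 0)(inds ps)
   (suc l) * ∏ (ξ(w0 1))ws)))
  central-step0 l ps bal0 bals os = reg-cancel(reg-* F.s-reg(⟦⟧-reg y≢0))(*ˡ(*ʳ(*c(Ξ-↭ after)(sym hyp₊)))
   · solve 7(λ s y x γ p u u' → s :* y :* (x :* (γ :* p :* u) :* u') := (x :* (s :* γ)) :* (p :* (y :* (u :* u'))))refl _ _ _ _ _ _ _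
   · *ʳ(Ξ-flip y(own ++ C)) · solve 7(λ x s γ p y u u' → (x :* (s :* γ)) :* (p :* (y :* (u :* u'))) := (s :* y) :* p :* (x :* γ :* u :* u'))refl _
   _ _ _ _ _ _ · *ʳ(*c(s-neg-law y≢0 · -ᶜ(*ˡ(+ˡ(T-cong M-y · T-0))))(⟦double⟧ v₊ · *c(⟦⟧-cong v₊D)(+ˡ(T-cong(E.sym F.M+y))
   · sym(s-law y≢0)))) · solve 9(λ t d s y x γ u u' z → (:- (t :* 𝟐)) :* (d :* (s :* y)) :* (x :* γ :* u :* u') := s :* y :* (:- (𝟐 :* (t :* (x :*
   (γ :* d :* u') :* u)))))refl _ _ _ _ _ _ _ _ 0# · *ˡ(-ᶜ(*ˡ(*ˡ(*c(*c(Ξ-↭ (↭-sym before))hyp₋)U₊≈)))))where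
   open CentralStep 0 l ps bal0 bals os
   Ξ' = Ξ(-z y ∷ own ++ C)
   Ξ0 = Ξ(y ∷ own ++ C)
   M-y : M -z y ≡ + 0
   M-y = lem M where
    lem : ∀ M → M -z(M +z(M *z + 0 +z M *z + 0)) ≡ + 0
    lem = ringℤ
   v₊D : v₊ ≡ D
   v₊D = lem M where
    lem : ∀ M → M *z + 0 +z M *z + 0 +z(M +z M) ≡ M +z M
    lem = ringℤ
   hyp₊ : Γ y(own ++ C) * ⟦ v₊ +z v₊ ⟧ * ∏ (ξ v₊)ws ≈ φ₊
   hyp₊ = *ʳ(*c(∏-++ (g y)own C)(⟦⟧-cong(E.sym yy₊))) · solve 4(λ o c x u → o :* c :* x :* u := (o :* x) :* (c :* u))refl _ _ _ _
    · *c(Γ-run y _ l nz₊ · ⟦⟧-cong far₊)(rest v₊ y y₊ (All.map(λ{q}o → proj₁(w0-away{q}o))os)) · ends v₊ c₊ end₊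
   hyp₋ : Γ(-z y)(own ++ C) * ⟦ D ⟧ * U₋ ≈ φ₋
   hyp₋ = *ʳ(*c(∏-++ (g(-z y))own C)(⟦⟧-cong(E.sym yd₋))) · solve 4(λ o c x u → o :* c :* x :* u := (o :* x) :* (c :* u))refl _ _ _ _
    · *c(Γ-run(-z y)_ l nz₋ · ⟦⟧-cong far₋)(rest v₋ (-z y)y₋ (All.map(λ{q}o → proj₂(w0-away{q}o))os)) · ends v₋ c₋ end₋
open import Data.List.Properties using (map-++; ++-assoc; map-∘; map-id)
open import Data.List.Relation.Binary.Permutation.Propositional.Properties using (shifts; ++⁺ˡ)
module ConfigWeights(R : Ring)(χ : Char R)(M : ℤ)(J : ℕ)where
 open CommutativeRing R hiding (zero) renaming (Carrier to |R|; *-congˡ to *ˡ; *-congʳ to *ʳ; +-congʳ to +ʳ; *-identityˡ to 1*; -‿cong to -ᶜ; *-cong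
  to *c; reflexive to rfx; trans to infixr 1 _·_)
 open Char χ
 open RingSolver R
 open Polynomials R
 open Sums R
 open CharProperties R χ
 open Evals R χ M
 open ChainSteps R χ M
 open ConfigSteps R χ M J
 open import Relation.Binary.Reasoning.Setoid setoid
 δ : ℤ → ℤ → |R|
 δ x y = X x - X y
 V : List ℤ → |R|
 V = pairs δ
 -1^ : ℕ → |R|
 -1^ n = (- 1#) ^ᵣ n
 -1^-reg : ∀ n → Regular(-1^ n)
 -1^-reg zero = invertible⇒reg(1* 1#)
 -1^-reg(suc n) = reg-* (invertible⇒reg(solve 0((:- 𝟏) :* (:- 𝟏) := 𝟏)refl))(-1^-reg n)
 V-front : ∀ xs x ys → V(xs ++ x ∷ ys) ≈ -1^ (length xs) * (∏ (δ x)(xs ++ ys) * V(xs ++ ys))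
 V-front [] x ys = sym(1* _)
 V-front(z ∷ xs)x ys = *c(∏-↭ (δ z)(shift x xs ys))(V-front xs x ys) · solve 6(λ a b p s d v → (a :- b) :* p :* (s :* (d :* v)) := (:- 𝟏) :* s
  :* ((b :- a) :* d :* (p :* v)))refl _ _ _ _ _ _
 -- The power of t attached to a chain with index i when k elements have been moved.
 e² : ℤ → ℤ → ℤ
 e² i k = M *z k *z k +z(i +z i) *z k
 odd : ℕ → ℤ
 odd r = + 1 +z + r +z + r
 mono : ℕ → ℤ → ℤ → |R|
 mono r i k = T(odd r *z e² i k)
 T-^ : ∀ c r → T c ^ᵣ r ≈ T(c *z + r)
 T-^ c zero = sym(T-cong(Z.*-zeroʳ c) · T-0)
 T-^ c(suc r) = *ˡ(T-^ c r) · sym(T-+ c(c *z + r)) · T-cong(lem c(+ r))where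
  lem : ∀ c r → c +z c *z r ≡ c *z(+ 1 +z r)
  lem = ringℤ
 mono-step : ∀ r i k → let u = (i +z M *z k) +z(i +z M *z k); u' = u +z D in T(M +z u) * (T u * T u') ^ᵣ r * mono r i k ≈ mono r i(k +z + 1)
 mono-step r i k = *ʳ(*ˡ(^ᵣ-cong r(sym(T-+ u u')) · T-^ (u +z u')r)) · (*ʳ(sym(T-+ _ _)) · sym(T-+ _ _)) · T-cong(lem M i k(+ r))where
  u = (i +z M *z k) +z(i +z M *z k)
  u' = u +z D
  lem : ∀ M i k r → M +z((i +z M *z k) +z(i +z M *z k)) +z(((i +z M *z k) +z(i +z M *z k)) +z(((i +z M *z k) +z(i +z M *z k)) +z(M +z M))) *z r
   +z(+ 1 +z r +z r) *z(M *z k *z k +z(i +z i) *z k) ≡ (+ 1 +z r +z r) *z(M *z(k +z + 1) *z(k +z + 1) +z(i +z i) *z(k +z + 1))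
  lem = ringℤ
 -- Φ₁ = φ₁ φ₂ ⋯ φ_b, the total contribution of the ends.
 Φ : ℤ → List ℤ → ℕ → |R|
 Φ i is zero = 1#
 Φ i is(suc l) = Φ i is l * φ i is(suc l)
 φ-↭ : ∀ {i is is'}l → is ↭ is' → φ i is l ≈ φ i is' l
 φ-↭ l p = *ˡ(∏-↭ _ p)
 Φ-↭ : ∀ {i is is'}l → is ↭ is' → Φ i is l ≈ Φ i is' l
 Φ-↭ {i}zero p = refl
 Φ-↭ {i}(suc l)p = *c(Φ-↭ {i}l p)(φ-↭ {i}(suc l)p)
 W : ℤ → List ℤ → |R|
 W u ws = ∏ (δ u)ws
 ∏-ξ⁺ : ∀ u ws → ∏ (ξ u)ws ≈ T u ^ᵣ length ws * W u ws
 ∏-ξ⁺ u ws = ∏-* (λ _ → T u)(δ u)ws · *ʳ(∏-const(T u)ws)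
 ∏-ξ⁻ : ∀ u ws → ∏ (ξ(-z u))ws * T u ^ᵣ length ws ≈ W u ws
 ∏-ξ⁻ u ws = *c(∏-ξ⁺ (-z u)ws)refl · solve 3(λ a b c → a :* b :* c := (a :* c) :* b)refl _ _ _ · *c(sym(^ᵣ-* _ _(length ws))
  · ^ᵣ-cong(length ws)(T-invˡ u) · one(length ws))(∏-cong(λ x → +ʳ(X-neg u))ws) · 1* _ where
  one : ∀ n → 1# ^ᵣ n ≈ 1#
  one zero = refl
  one(suc n) = 1* _ · one n
 -- Turns a step for Ξ into a relation between weights.
 transfer : ∀ {Z Z' H H' c}r i k ws → length ws ≡ r → let u = (i +z M *z k) +z(i +z M *z k); u' = u +z D in Z' * H' * ∏ (ξ(-z u))ws ≈ - (c * (T(M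
  +z u) * (Z * H * ∏ (ξ u')ws))) → Z' * H' * (mono r i k * W u ws) ≈ - (c * (Z * H * (mono r i(k +z + 1) * W u' ws)))
 transfer{Z}{Z'}{H}{H'}{c}_ i k ws rfl h = *ˡ(*ˡ(sym(∏-ξ⁻ u ws))) · solve 4(λ z m x t → z :* (m :* (x :* t)) := (z :* x) :* (m :* t))refl _
  _ _ _ · *ʳ(h · -ᶜ(*ˡ(*ˡ(*ˡ(∏-ξ⁺ u' ws))))) · solve 7(λ c y z t' w m t → (:- (c :* (y :* (z :* (t' :* w))))) :* (m :* t) := :- (c :* (z :* (y
  :* (t :* t') :* m :* w))))refl _ _ _ _ _ _ _ · -ᶜ(*ˡ(*ˡ(*ʳ(*ʳ(*ˡ(sym(^ᵣ-* _ _ r))) · mono-step r i k))))where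
  r = length ws
  u = (i +z M *z k) +z(i +z M *z k)
  u' = u +z D
 module _(D≢0 : D ≢ + 0)where
  Apart' : ℤ → ℤ → Set
  Apart' = Apart D≢0
  Adm : List ℤ → Set
  Adm is = All(λ i → Off(i +z i) × Off((i +z i) +z(i +z i)))is × AllPairs Apart' is
  Apart-sym : ∀ {i j} → Apart' i j → Apart' j i
  Apart-sym{i}{j}(p , q) = subst Off(Z.+-comm(i +z i)(j +z j))p , subst Off(lem(i +z i)(j +z j))(Off-neg q)where
   lem : ∀ a b → -z(a -z b) ≡ b -z a
   lem = ringℤ
  Adm-↭ : ∀ {is js} → is ↭ js → Adm is → Adm js
  Adm-↭ p(a , b) = All-resp-↭ p a , go p b where
   go : ∀ {xs ys} → xs ↭ ys → AllPairs Apart' xs → AllPairs Apart' ys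
   go P.refl d = d
   go(prep x p)(a ∷ d) = All-resp-↭ p a ∷ go p d
   go(swap x y p)((b ∷ a) ∷ (c ∷ d)) = (Apart-sym{x}{y}b ∷ All-resp-↭ p c) ∷ (All-resp-↭ p a ∷ go p d)
   go(P.trans p q)d = go q(go p d)
  δ-reg : ∀ {x y} → Off(x +z y) → Off(x -z y) → Regular(δ x y)
  δ-reg{x}{y}p q z e = reg-* (⟦⟧-reg(Off-≢0 p))(⟦⟧-reg(Off-≢0 q))z(*ʳ(bracket-product x y) · (*-assoc _ _ _ · *ˡ e) · zeroʳ _)
  W-reg : ∀ u ws → All(λ x → Off(u +z x) × Off(u -z x))ws → Regular(W u ws)
  W-reg u [] [] = invertible⇒reg(1* 1#)
  W-reg u(x ∷ ws)((p , q) ∷ os) = reg-* (δ-reg p q)(W-reg u ws os)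
  w-off : ∀ p → Off(i p +z i p) → Off(w p)
  w-off p o = Off-via(+ b p -z + J)o(lem M(i p)(+ b p -z + J))where
   lem : ∀ M i k → (i +z M *z k) +z(i +z M *z k) ≡ (i +z i) +z(M +z M) *z k
   lem = ringℤ
  w0-apart : ∀ k p → Off(i p +z i p) → Off(w0 k +z w p) × Off(w0 k -z w p)
  w0-apart k p o = Off-via(+ k)(w-off p o)(lem1 M(+ k)(w p)) , Off-via(+ k)(Off-neg(w-off p o))(lem2 M(+ k)(w p))where
   lem1 : ∀ M k w → M *z k +z M *z k +z w ≡ w +z(M +z M) *z k
   lem1 = ringℤ
   lem2 : ∀ M k w → M *z k +z M *z k -z w ≡ -z w +z(M +z M) *z k
   lem2 = ringℤ
  w-apart : ∀ p q → Apart'(i p)(i q) → Off(w p +z w q) × Off(w p -z w q)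
  w-apart p q(o1 , o₂) = Off-via(kp +z kq)o1(lem1 M(i p)(i q)kp kq) , Off-via(kp -z kq)o₂(lem2 M(i p)(i q)kp kq)where
   kp = + b p -z + J
   kq = + b q -z + J
   lem1 : ∀ M i j k l → ((i +z M *z k) +z(i +z M *z k)) +z((j +z M *z l) +z(j +z M *z l)) ≡ ((i +z i) +z(j +z j)) +z(M +z M) *z(k +z l)
   lem1 = ringℤ
   lem2 : ∀ M i j k l → ((i +z M *z k) +z(i +z M *z k)) -z((j +z M *z l) +z(j +z M *z l)) ≡ ((i +z i) -z(j +z j)) +z(M +z M) *z(k -z l)
   lem2 = ringℤ
  ws-of : ℕ → List Pair → List ℤ
  ws-of k ps = w0 k ∷ map w ps
  V-reg : ∀ k ps → Adm(inds ps) → Regular(V(ws-of k ps))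
  V-reg k ps(o , ap) = reg-* (W-reg(w0 k)(map w ps)(Allₚ.map⁺ (All.map(λ{p}(o , _) → w0-apart k p o)(Allₚ.map⁻ o))))(go ps ap)where
   go : ∀ ps → AllPairs Apart'(inds ps) → Regular(V(map w ps))
   go [] [] = invertible⇒reg(1* 1#)
   go(p ∷ ps)(a ∷ as) = reg-* (W-reg(w p)(map w ps)(Allₚ.map⁺ (All.map(λ{q} → w-apart p q)(Allₚ.map⁻ a))))(go ps as)
  multiplicity : ℕ → |R|
  multiplicity zero = 1#
  multiplicity(suc k) = 1# + 1#
  -- The product of Ξ and the end factors.
  Θ : ℕ → ℕ → List Pair → |R|
  Θ k l ps = Ξ(conf0 k l ++ confs ps) * (Φ(+ 0)(inds ps)l * Φ(+ 0)(inds ps)(J +n k)) * ∏ (λ p → Φ(-z i p)(inds ps)(a p) * Φ(i p)(inds ps)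
   (b p))ps
  sign : ℕ → ℤ → ℕ → ℤ → |R|
  sign r i b k = -1^ b * mono r i k
  Λ : ℕ → List Pair → |R|
  Λ k ps = sign(length ps)(+ 0)k(+ k) * ∏ (λ p → sign(length ps)(i p)(b p)(+ b p -z + J))ps * V(ws-of k ps)
  sign-reg : ∀ r i b k → Regular(sign r i b k)
  sign-reg r i b k = reg-* (-1^-reg b)(T-reg _)
  Λ-reg : ∀ k ps → Adm(inds ps) → Regular(Λ k ps)
  Λ-reg k ps o = reg-* (reg-* (sign-reg(length ps)(+ 0)k(+ k))(go ps))(V-reg k ps o)where
   go : ∀ qs → Regular(∏ (λ p → sign(length ps)(i p)(b p)(+ b p -z + J))qs)
   go [] = invertible⇒reg(1* 1#)
   go(p ∷ qs) = reg-* (sign-reg(length ps)(i p)(b p)(+ b p -z + J))(go qs)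
  private
   cancel : ∀ {A B C a b c m} → Regular b → A * b ≈ B * a → B * c ≈ m * (C * b) → A * c ≈ m * (C * a)
   cancel{A}{B}{C}{a}{b}{c}{m}ρ h1 h2 = reg-cancel ρ(solve 3(λ b A c → b :* (A :* c) := (A :* b) :* c)refl _ _ _ · *ʳ h1
    · solve 3(λ B a c → (B :* a) :* c := (B :* c) :* a)refl _ _ _ · *ʳ h2 · solve 4(λ m C b a → m :* (C :* b) :* a := b :* (m :* (C :* a)))refl _
    _ _ _)
  central-Λ-step : ∀ {m}k l ps → Balanced0 k(suc l) → All Balanced ps → Adm(inds ps) → (let ws = map w ps in Ξ(conf0(suc k)l ++ confs ps) * φ(+
   0)(inds ps)(J +n suc k) * ∏ (ξ(-z w0 k))ws ≈ - (m * (T(M +z w0 k) * (Ξ(conf0 k(suc l) ++ confs ps) * φ(+ 0)(inds ps)(suc l) * ∏ (ξ(w0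
   (suc k)))ws)))) → Θ(suc k)l ps * Λ k ps ≈ m * (Θ k(suc l)ps * Λ(suc k)ps)
  central-Λ-step{m}k l ps bal0 bals o h = *ʳ(*ʳ(*ˡ(*ˡ(rfx(cong(Φ(+ 0)is)(N.+-suc J k))
   · *ˡ(rfx(cong(φ(+ 0)is)(E.sym(N.+-suc J k)))))))) · solve 10(λ z a b h e s m S x v → z :* (a :* (b :* h)) :* e :* (s :* m :* S :* (x :* v))
   := (z :* h :* (m :* x)) :* (a :* b :* e :* s :* S :* v))refl Z' Φl(Φ(+ 0)is(J +n k))H' E(-1^ k)(mono r(+ 0)(+ k))S(W(w0 k)ws)(V ws)
   · *ʳ main · solve 11(λ c z h m x a b e s S v → (:- (c :* (z :* h :* (m :* x)))) :* (a :* b :* e :* s :* S :* v) := c :* (z :* ((a :* h) :* b) :* e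
   :* ((:- 𝟏) :* s :* m :* S :* (x :* v))))refl m Z H _ _ Φl _ E(-1^ k)S(V ws)where
   is = inds ps
   ws = map w ps
   r = length ps
   Z = Ξ(conf0 k(suc l) ++ confs ps)
   Z' = Ξ(conf0(suc k)l ++ confs ps)
   H = φ(+ 0)is(suc l)
   H' = φ(+ 0)is(J +n suc k)
   Φl = Φ(+ 0)is l
   E = ∏ (λ p → Φ(-z i p)is(a p) * Φ(i p)is(b p))ps
   S = ∏ (λ p → sign r(i p)(b p)(+ b p -z + J))ps
   u0 : ∀ k → w0 k ≡ (+ 0 +z M *z + k) +z(+ 0 +z M *z + k)
   u0 k = cong₂ _+z_(E.sym(Z.+-identityˡ(M *z + k)))(E.sym(Z.+-identityˡ(M *z + k)))
   u1 : w0(suc k) ≡ w0 k +z D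
   u1 = lem M(+ k)where
    lem : ∀ M k → M *z(+ 1 +z k) +z M *z(+ 1 +z k) ≡ M *z k +z M *z k +z(M +z M)
    lem = ringℤ
   main : Z' * H' * (mono r(+ 0)(+ k) * W(w0 k)ws) ≈ - (m * (Z * H * (mono r(+ 0)(+ suc k) * W(w0(suc k))ws)))
   main = *ˡ(*ˡ(rfx(cong(λ x → W x ws)(u0 k)))) · transfer{Z}{Z'}{H}{H'}{m}r(+ 0)(+ k)ws(length-map w ps)(*ˡ(rfx(cong(λ x → ∏ (ξ
    (-z x))ws)(E.sym(u0 k)))) · h · -ᶜ(*ˡ(*c(T-cong(cong(λ x → M +z x)(u0 k)))(*ˡ(rfx(cong(λ x → ∏ (ξ x)ws)(E.trans u1(cong(λ x → x
    +z D)(u0 k))))))))) · -ᶜ(*ˡ(*ˡ(*c(rfx(cong(mono r(+ 0))(Z.+-comm(+ k)(+ 1))))(rfx(cong(λ x → W x ws)(E.sym(E.trans u1(cong(λ x →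
    x +z D)(u0 k)))))))))
  offs : ∀ ps → Adm(inds ps) → All(λ p → Off(i p +z i p))ps
  offs ps(o , _) = All.map proj₁(Allₚ.map⁻ o)
  central-move : ∀ k l ps → k +n l ≡ J → All Balanced ps → Adm(inds ps) → Θ k l ps * Λ 0 ps ≈ multiplicity k * (Θ 0 J ps * Λ k ps)
  central-move zero l ps rfl bals o = sym(1* _)
  central-move(suc k)l ps e bals o = go k e where
   bal0 : ∀ k → suc k +n l ≡ J → Balanced0 k(suc l)
   bal0 k rfl = lem(+ k)(+ l)where
    lem : ∀ k l → + 1 +z l ≡ + 1 +z k +z l -z k
    lem = ringℤ
   go : ∀ k → suc k +n l ≡ J → Θ(suc k)l ps * Λ 0 ps ≈ (1# + 1#) * (Θ 0 J ps * Λ(suc k)ps)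
   go zero e@rfl = central-Λ-step 0 l ps(bal0 0 e)bals o(central-step0 D≢0 l ps(bal0 0 e)bals(offs ps o))
   go(suc k)e = cancel(Λ-reg(suc k)ps o)(central-Λ-step(suc k)l ps(bal0(suc k)e)bals o(central-step D≢0 k l ps(bal0(suc k)e)bals
    (offs ps o) · -ᶜ(sym(1* _))) · 1* _)(central-move(suc k)(suc l)ps(E.trans(N.+-suc(suc k)l)e)bals o)
  module PairMoves(k l : ℕ)(bal0 : Balanced0 k l)where
   Rel : List Pair → List Pair → Set
   Rel ps qs = Θ k l ps * Λ k qs ≈ Θ k l qs * Λ k ps
   Rel-trans : ∀ {ps qs rs} → Adm(inds qs) → Rel ps qs → Rel qs rs → Rel ps rs
   Rel-trans{ps}{qs}o p q = cancel(Λ-reg k qs o)p(q · sym(1* _)) · 1* _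
   confs-↭ : ∀ {ps qs} → ps ↭ qs → confs ps ↭ confs qs
   confs-↭ P.refl = ↭-refl
   confs-↭ (prep p e) = ++⁺ˡ(conf p)(confs-↭ e)
   confs-↭ (swap p q e) = ↭-trans(shifts(conf p)(conf q))(++⁺ˡ(conf q)(++⁺ˡ(conf p)(confs-↭ e)))
   confs-↭ (P.trans e e') = ↭-trans(confs-↭ e)(confs-↭ e')
   Θ-↭ : ∀ {ps qs} → ps ↭ qs → Θ k l ps ≈ Θ k l qs
   Θ-↭ {ps}{qs}e = *c(*c(Ξ-↭ (++⁺ˡ(conf0 k l)(confs-↭ e)))(*c(Φ-↭ {+ 0}l e')(Φ-↭ {+ 0}(J +n k)e')))(∏-↭ _ e
    · ∏-cong(λ p → *c(Φ-↭ { -z i p}(a p)e')(Φ-↭ {i p}(b p)e'))qs)where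
    e' = map⁺ i e
   Λ-front : ∀ ps p qs → Λ k(ps ++ p ∷ qs) ≈ -1^ (length ps) * Λ k(p ∷ ps ++ qs)
   Λ-front ps p qs = *c(rfx(cong(λ r → S r(ps ++ p ∷ qs))(↭-length(shift p ps qs))) · *ˡ(∏-↭ _(shift p ps qs)))V-eq
    · solve 3(λ a b c → a :* (b :* c) := b :* (a :* c))refl _ _ _ where
    S : ℕ → List Pair → |R|
    S r rs = sign r(+ 0)k(+ k) * ∏ (λ p → sign r(i p)(b p)(+ b p -z + J))rs
    U = w0 k ∷ map w(ps ++ qs)
    V-eq : V(ws-of k(ps ++ p ∷ qs)) ≈ -1^ (length ps) * V(ws-of k(p ∷ ps ++ qs))
    V-eq = begin V(w0 k ∷ map w(ps ++ p ∷ qs)) ≈⟨ rfx(cong(λ x → V(w0 k ∷ x))(map-++ w ps(p ∷ qs))) ⟩ V(w0 k ∷ map w ps ++ w p ∷ map w qs) ≈⟨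
     V-front(w0 k ∷ map w ps)(w p)(map w qs) ⟩ -1^ (suc(length(map w ps))) * (∏ (δ(w p))(w0 k ∷ map w ps ++ map w qs) * V(w0 k ∷ map w ps ++
     map w qs)) ≈⟨ *c(rfx(cong(λ x → -1^ (suc x))(length-map w ps)))(rfx(cong(λ x → ∏ (δ(w p))(w0 k ∷ x) * V(w0 k ∷ x))(E.sym(map-++ w ps
     qs)))) ⟩ -1^ (suc(length ps)) * (∏ (δ(w p))U * V U) ≈⟨ solve 2(λ s x → (:- 𝟏) :* s :* x := s :* ((:- 𝟏) :* 𝟏 :* x))refl _ _ ⟩ -1^ (length
     ps) * (-1^ 1 * (∏ (δ(w p))U * V U)) ≈⟨ *ˡ(sym(V-front(w0 k ∷ [])(w p)(map w(ps ++ qs)))) ⟩ -1^ (length ps) * V(ws-of k(p ∷ ps ++ qs)) ∎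
   step : ∀ i b a qs → Balanced(pair i b(suc a)) → All Balanced qs → Adm(i ∷ inds qs) → Rel(pair i(suc b)a ∷ qs)(pair i b(suc a) ∷ qs)
   step i b a qs bal bals o@((o2 , o4) ∷ _ , ap ∷ _) = begin Θ k l(p' ∷ qs) * Λ k(p ∷ qs) ≈⟨ *c(*ʳ(*ʳ(Ξ-↭ (shifts(conf0 k l)(conf p')))))(*ˡ
    (V-front(w0 k ∷ [])(w p)(map w qs))) ⟩ Ξ(conf p' ++ C) * F * ((Φa * (Φb * φ i is(suc b))) * E) * (sg * (-1^ b * mono(suc r)i kb * G) * (-1^
    1 * (W(w p)ws * V ws))) ≈⟨ solve 13(λ z f a β h e s t m g c x v → z :* f :* ((a :* (β :* h)) :* e) :* (s :* (t :* m :* g) :* (c :* (x :* v)))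
    := (z :* h :* (m :* x)) :* (f :* a :* β :* e :* s :* t :* g :* c :* v))refl _ F Φa Φb _ E sg(-1^ b)_ G(-1^ 1)_(V ws) ⟩ Ξ(conf p' ++ C) * φ
    i is(suc b) * (mono(suc r)i kb * W(w p)ws) * K ≈⟨ *ʳ main ⟩ - (1# * (Ξ(conf p ++ C) * φ(-z i)is(suc a) * (mono(suc r)i kb' * W(w p')
    ws))) * K ≈⟨ solve 13(λ z f a β h e s t m g c x v → (:- (𝟏 :* (z :* h :* (m :* x)))) :* (f :* a :* β :* e :* s :* t :* g :* c :* v) := z :* f :*
    (((a :* h) :* β) :* e) :* (s :* ((:- 𝟏) :* t :* m :* g) :* (c :* (x :* v))))refl _ F Φa Φb _ E sg(-1^ b)_ G(-1^ 1)_(V ws) ⟩ Ξ(conf p ++ C)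
    * F * (((Φa * φ(-z i)is(suc a)) * Φb) * E) * (sg * (-1^ (suc b) * mono(suc r)i kb' * G) * (-1^ 1 * (W(w p')ws * V ws))) ≈⟨ *c(*ʳ(*ʳ(Ξ-↭
    (↭-sym(shifts(conf0 k l)(conf p))))))(*ˡ(sym(V-front(w0 k ∷ [])(w p')(map w qs)))) ⟩ Θ k l(p ∷ qs) * Λ k(p' ∷ qs) ∎ where
    p = pair i b(suc a)
    p' = pair i(suc b)a
    is = i ∷ inds qs
    r = length qs
    C = conf0 k l ++ confs qs
    ws = ws-of k qs
    F = Φ(+ 0)is l * Φ(+ 0)is(J +n k)
    Φa = Φ(-z i)is a
    Φb = Φ i is b
    E = ∏ (λ p → Φ(-z Pair.i p)is(Pair.a p) * Φ(Pair.i p)is(Pair.b p))qs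
    sg = sign(suc r)(+ 0)k(+ k)
    G = ∏ (λ p → sign(suc r)(Pair.i p)(Pair.b p)(+ Pair.b p -z + J))qs
    K = F * Φa * Φb * E * sg * -1^ b * G * -1^ 1 * V ws
    kb kb' : ℤ
    kb = + b -z + J
    kb' = + suc b -z + J
    lenws : length ws ≡ suc r
    lenws = cong suc(length-map w qs)
    k+1 : kb +z + 1 ≡ kb'
    k+1 = lem(+ b)(+ J)where
     lem : ∀ b J → b -z J +z + 1 ≡ + 1 +z b -z J
     lem = ringℤ
    u' : w p +z D ≡ w p'
    u' = lem i M(+ b)(+ J)where
     lem : ∀ i M b J → (i +z M *z(b -z J)) +z(i +z M *z(b -z J)) +z(M +z M) ≡ (i +z M *z(+ 1 +z b -z J)) +z(i +z M *z(+ 1 +z b -z J))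
     lem = ringℤ
    main : Ξ(conf p' ++ C) * φ i is(suc b) * (mono(suc r)i kb * W(w p)ws) ≈ - (1# * (Ξ(conf p ++ C) * φ(-z i)is(suc a) * (mono(suc r)i kb'
     * W(w p')ws)))
    main = transfer{Ξ(conf p ++ C)}{Ξ(conf p' ++ C)}{φ(-z i)is(suc a)}{φ i is(suc b)}{1#}(suc r)i kb ws lenws(pair-step D≢0 i b a k l qs
     bal bal0 bals o2 o4(Allₚ.map⁻ ap) · -ᶜ(*ˡ(*ˡ(rfx(cong(λ x → ∏ (ξ x)ws)(E.sym u')))) · sym(1* _)))
     · -ᶜ(*ˡ(*ˡ(*c(rfx(cong(mono(suc r)i)k+1))(rfx(cong(λ x → W x ws)u')))))
   balanced : ∀ {i b a} → b +n a ≡ J +n J → Balanced(pair i b a)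
   balanced{i}{b}{a}e = E.trans(lem(+ b)(+ a))(cong(λ x → x -z + b)(cong +_ e))where
    lem : ∀ b a → a ≡ b +z a -z b
    lem = ringℤ
   base : ℤ → Pair
   base i = pair i J J
   Sum : Pair → Set
   Sum p = b p +n a p ≡ J +n J
   sums-balanced : ∀ {ps} → All Sum ps → All Balanced ps
   sums-balanced = All.map(λ{p}e → balanced{i p}e)
   to-zero : ∀ i b a qs → b +n a ≡ J +n J → All Balanced qs → Adm(i ∷ inds qs) → Rel(pair i b a ∷ qs)(pair i 0(J +n J) ∷ qs)
   to-zero i zero a qs rfl bals o = refl
   to-zero i(suc b)a qs e bals o = Rel-trans{qs = pair i b(suc a) ∷ qs}o(step i b a qs(balanced{i}e')bals o)(to-zero i b(suc a)qs e' bals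
    o)where
    e' = E.trans(N.+-suc b a)e
   to-base : ∀ p qs → Sum p → All Balanced qs → Adm(i p ∷ inds qs) → Rel(p ∷ qs)(base(i p) ∷ qs)
   to-base(pair i b a)qs e bals o = Rel-trans{qs = pair i 0(J +n J) ∷ qs}o(to-zero i b a qs e bals o)(sym(to-zero i J J qs rfl bals o))
   at-position : ∀ ps p qs → Sum p → All Balanced(ps ++ qs) → Adm(inds(ps ++ p ∷ qs)) → Rel(ps ++ p ∷ qs)(ps ++ base(i p) ∷ qs)
   at-position ps p qs e bals o = *c(Θ-↭ (shift p ps qs))(Λ-front ps p° qs) · solve 3(λ a b c → a :* (b :* c) := b :* (a :* c))refl _ _ _
    · *ˡ(to-base p(ps ++ qs)e bals(Adm-↭ (map⁺ i(shift p ps qs))o)) · solve 3(λ a b c → b :* (a :* c) := a :* (b :* c))refl _ _ _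
    · *c(Θ-↭ (↭-sym(shift p° ps qs)))(sym(Λ-front ps p qs))where
    p° = base(i p)
   bases : List Pair → List Pair
   bases = map(λ p → base(i p))
   all-to-base : ∀ ps qs → All Balanced ps → All Sum qs → Adm(inds(ps ++ qs)) → Rel(ps ++ qs)(ps ++ bases qs)
   all-to-base ps [] bp sq o = refl
   all-to-base ps(p ∷ qs)bp(e ∷ sq)o = Rel-trans{qs = ps ++ base(i p) ∷ qs}o'(at-position ps p qs e(Allₚ.++⁺ bp(sums-balanced sq))o)
    (E.subst₂ Rel(++-assoc ps _ qs)(++-assoc ps _(bases qs))(all-to-base(ps ++ base(i p) ∷ [])qs(Allₚ.++⁺ bp(balanced{i p}rfl ∷ []))sq
    (subst Adm(cong inds(E.sym(++-assoc ps _ qs)))o')))where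
    o' : Adm(inds(ps ++ base(i p) ∷ qs))
    o' = subst Adm(E.trans(map-++ i ps(p ∷ qs))(E.sym(map-++ i ps(base(i p) ∷ qs))))o
  base-pairs : List ℤ → List Pair
  base-pairs = map(λ i → pair i J J)
  -- All configurations have the same ratio Θ / Λ, up to the multiplicity.
  ΘΛ : ∀ k l ps → k +n l ≡ J → All(λ p → b p +n a p ≡ J +n J)ps → Adm(inds ps) → Θ k l ps * Λ 0(base-pairs(inds ps)) ≈ multiplicity k * (Θ 0 J
   (base-pairs(inds ps)) * Λ k ps)
  ΘΛ k l ps e ss o = cancel(Λ-reg k ps° o°)(subst(λ qs → Θ k l ps * Λ k qs ≈ Θ k l qs * Λ k ps)(map-∘ ps)(all-to-base [] ps [] ss o))
   (central-move k l ps° e bals° o°)where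
   bal0 : Balanced0 k l
   bal0 = E.trans(lem(+ k)(+ l))(cong(λ x → x -z + k)(cong +_ e))where
    lem : ∀ k l → l ≡ k +z l -z k
    lem = ringℤ
   open PairMoves k l bal0
   ps° = base-pairs(inds ps)
   o° : Adm(inds ps°)
   o° = subst Adm(E.trans(E.sym(map-id(inds ps)))(map-∘ (inds ps)))o
   bals° : All Balanced ps°
   bals° = Allₚ.map⁺ (All.universal(λ i → balanced{i}rfl)(inds ps))
open import Data.List.Properties using (++-identityʳ)
open import Data.List.Membership.Propositional.Properties using (∈-++⁺ˡ; ∈-++⁺ʳ)
open import Data.List.Relation.Binary.Permutation.Propositional.Properties using (++⁺; ++-comm)
module ConfigSums(R : Ring)(χ : Char R)(M : ℤ)(J : ℕ)where
 open CommutativeRing R hiding (zero) renaming (Carrier to |R|; *-congˡ to *ˡ; *-congʳ to *ʳ; +-congˡ to +ˡ; +-congʳ to +ʳ; *-identityˡ to 1*; *-cong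
  to *c; +-cong to +c; reflexive to rfx; trans to infixr 1 _·_)
 open Char χ
 open RingSolver R
 open Polynomials R
 open Sums R
 open SignedSums R
 open CharProperties R χ
 open SplitSums R χ (M +z M)
 open HallLittlewood R χ ( M +z M ) using (X)
 open Symm R χ M hiding (u; v; w; d)
 open Evals R χ M
 open Bounded R χ M using (symm)
 open ChainSteps R χ M hiding (X)
 open ConfigSteps R χ M J
 open ConfigWeights R χ M J hiding (V; W)
 -- The sum over all pairs with index i, in the order of increasing |b - J|.
 ∑ₚ : ℤ → (Pair → |R|) → |R|
 ∑ₚ i G = G(pair i J J) + conv⁺ J(λ c r → G(pair i(J +n c)r) + G(pair i r(J +n c)))
 Total : Pair → Set
 Total p = b p +n a p ≡ J +n J
 private
  total1 : ∀ c r → c +n r ≡ J → (J +n c) +n r ≡ J +n J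
  total1 c r rfl = N.+-assoc(c +n r)c r
  total2 : ∀ c r → c +n r ≡ J → r +n(J +n c) ≡ J +n J
  total2 c r e = E.trans(N.+-comm r _)(total1 c r e)
 ∑ₚ-cong : ∀ j{G H} → (∀ p → i p ≡ j → Total p → G p ≈ H p) → ∑ₚ j G ≈ ∑ₚ j H
 ∑ₚ-cong i e = +c(e _ rfl rfl)(conv⁺-cong J(λ r k p → +c(e _ rfl(total1(suc r)k p))(e _ rfl(total2(suc r)k p))))
 ∑ₚ-+ : ∀ i G H → ∑ₚ i(λ p → G p + H p) ≈ ∑ₚ i G + ∑ₚ i H
 ∑ₚ-+ i G H = +ˡ(conv⁺-cong J(λ _ _ _ → +-interchange _ _ _ _) · conv⁺-+ J _ _) · +-interchange _ _ _ _
 ∑ₚ-*ˡ : ∀ i c G → ∑ₚ i(λ p → c * G p) ≈ c * ∑ₚ i G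
 ∑ₚ-*ˡ i c G = +ˡ(conv⁺-cong J(λ _ _ _ → sym(distribˡ _ _ _)) · conv⁺-*ˡ J c _) · sym(distribˡ _ _ _)
 ∑ₚ* : List ℤ → (List Pair → |R|) → |R|
 ∑ₚ* [] G = G []
 ∑ₚ* (i ∷ is)G = ∑ₚ i(λ p → ∑ₚ* is(λ ps → G(p ∷ ps)))
 ∑ₚ*-cong : ∀ is{G H} → (∀ ps → inds ps ≡ is → All Total ps → G ps ≈ H ps) → ∑ₚ* is G ≈ ∑ₚ* is H
 ∑ₚ*-cong [] e = e [] rfl []
 ∑ₚ*-cong(i ∷ is)e = ∑ₚ-cong i(λ p q t → ∑ₚ*-cong is(λ ps qs ts → e(p ∷ ps)(cong₂ _∷_ q qs)(t ∷ ts)))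
 ∑ₚ*-*ˡ : ∀ is c G → ∑ₚ* is(λ ps → c * G ps) ≈ c * ∑ₚ* is G
 ∑ₚ*-*ˡ [] c G = refl
 ∑ₚ*-*ˡ(i ∷ is)c G = ∑ₚ-cong i(λ p _ _ → ∑ₚ*-*ˡ is c(λ ps → G(p ∷ ps))) · ∑ₚ-*ˡ i c(λ p → ∑ₚ* is(λ ps → G(p ∷ ps)))
 run-++ : ∀ a c l → run a(c +n l) ≡ run a c ++ run(a +z D *z + c)l
 run-++ a zero l = cong(λ x → run x l)(lem a D)where
  lem : ∀ a D → a ≡ a +z D *z + 0
  lem = ringℤ
 run-++ a(suc c)l = cong(a ∷_)(E.trans(run-++ (a +z D)c l)(cong(λ x → run(a +z D)c ++ run x l)(lem a D(+ c))))where
  lem : ∀ a D c → a +z D +z D *z c ≡ a +z D *z(+ 1 +z c)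
  lem = ringℤ
 negs-run : ∀ a c → negs(run a c) ↭ run(D -z a -z D *z + c)c
 negs-run a zero = ↭-refl
 negs-run a(suc c) = ↭-trans(prep(-z a)(negs-run(a +z D)c))(↭-trans(++-comm(-z a ∷ [])(run x c))(↭-reflexive(E.trans(cong₂(λ y z → run y
  c ++ z ∷ [])(lem1 a D(+ c))(lem2 a D(+ c)))(E.trans(E.sym(run-++ x' c 1))(cong(run x')(N.+-comm c 1))))))where
  x = D -z(a +z D) -z D *z + c
  x' = D -z a -z D *z + suc c
  lem1 : ∀ a D c → D -z(a +z D) -z D *z c ≡ D -z a -z D *z(+ 1 +z c)
  lem1 = ringℤ
  lem2 : ∀ a D c → -z a ≡ D -z a -z D *z(+ 1 +z c) +z D *z c
  lem2 = ringℤ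
 x∏-run : ∀ a c → x∏ (run a c) ≈ T((a -z M) *z + c +z M *z + c *z + c)
 x∏-run a zero = sym(T-cong(lem a M) · T-0)where
  lem : ∀ a M → (a -z M) *z + 0 +z M *z + 0 *z + 0 ≡ + 0
  lem = ringℤ
 x∏-run a(suc c) = *ˡ(x∏-run(a +z D)c) · sym(T-+ _ _) · T-cong(lem a M(+ c))where
  lem : ∀ a M c → a +z((a +z(M +z M) -z M) *z c +z M *z c *z c) ≡ (a -z M) *z(+ 1 +z c) +z M *z(+ 1 +z c) *z(+ 1 +z c)
  lem = ringℤ
 weight : ℕ → ℤ → ℤ → |R|
 weight m i k = T(e² i k *z + m)
 X-run : ∀ m i c → X m(run(M +z(i +z i))c) ≈ weight m i(+ c)
 X-run m i c = ^ᵣ-cong m(x∏-run _ c · T-cong(lem M i(+ c))) · T-^ _ m where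
  lem : ∀ M i c → (M +z(i +z i) -z M) *z c +z M *z c *z c ≡ M *z c *z c +z(i +z i) *z c
  lem = ringℤ
 X-++ : ∀ m h h' → X m(h ++ h') ≈ X m h * X m h'
 X-++ m h h' = ^ᵣ-cong m(∏-++ T h h') · ^ᵣ-* _ _ m
 -- Functions vanishing on lists with two elements whose sum is -2M, such as Ξ: here g vanishes.
 record Vanishing(H : List ℤ → |R|) : Set where
  field
   symmetric : Symmetric H
   vanish : ∀ y z B → y +z z ≡ -z D → H(y ∷ z ∷ B) ≈ 0#
 open Vanishing
 Vanishing-Ξ : ∀ A → Vanishing(λ B → Ξ(A ++ B))
 symmetric(Vanishing-Ξ A)p = Ξ-↭ (++⁺ˡ A p)
 vanish(Vanishing-Ξ A)y z B e = Ξ-↭ (shifts A(y ∷ z ∷ [])) · Ξ-∷ y(z ∷ (A ++ B))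
  · *ˡ(*ˡ(*ʳ(*ʳ(⟦0⟧ (E.trans(cong(λ x → D +z x)e)(Z.+-inverseʳ D))) · zeroˡ _) · zeroˡ _) · zeroʳ _) · zeroʳ _
 Vanishing-∑ : ∀ is{H : List Pair → List ℤ → |R|} → (∀ ps → Vanishing(H ps)) → Vanishing(λ B → ∑ₚ* is(λ ps → H ps B))
 symmetric(Vanishing-∑ is V)p = ∑ₚ*-cong is(λ ps _ _ → symmetric(V ps)p)
 vanish(Vanishing-∑ is V)y z B e = ∑ₚ*-cong is(λ ps _ _ → _·_(vanish(V ps)y z B e)(sym(zeroˡ 0#))) · ∑ₚ*-*ˡ is 0#(λ _ → 0#) · zeroˡ _
 vanish-∈ : ∀ {H} → Vanishing H → ∀ {y z}K Q → y ∈ K → z ∈ Q → y -z z ≡ D → H(negs K ++ Q) ≈ 0#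
 vanish-∈ V{y}{z}K Q p q e with ∈⇒↭ p | ∈⇒↭ q
 ... | K' , k | Q' , r = symmetric V(↭-trans(++⁺ (map⁺ _ k)r)(shifts(-z y ∷ negs K')(z ∷ []){Q'}))
  · vanish V z(-z y)(negs K' ++ Q')(E.trans(lem y z)(cong(λ x → -z x)e))where
  lem : ∀ y z → z +z(-z y) ≡ -z(y -z z)
  lem = ringℤ
 vanish-∈∈ : ∀ {H} → Vanishing H → ∀ {y z}K K' Q → y ∈ K → z ∈ K' → y +z z ≡ D → H(negs(K ++ K') ++ Q) ≈ 0#
 vanish-∈∈ V{y}{z}K K' Q p q e with ∈⇒↭ p | ∈⇒↭ q
 ... | K1 , k | K2 , l = symmetric V(++⁺ʳ Q(map⁺ (λ a → -z a)(↭-trans(++⁺ k l)(prep y(shift z K1 K2)))))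
  · vanish V(-z y)(-z z)_(E.trans(lem y z)(cong(λ x → -z x)e))where
  lem : ∀ y z → (-z y) +z(-z z) ≡ -z(y +z z)
  lem = ringℤ
 Chained : (List ℤ → List ℤ → |R|) → Set
 Chained F = ∀ y K Q → y ∈ Q → y +z D ∈ K → F K Q ≈ 0#
 sum-stuck : ∀ l b F → Chained F → (∀ K Q → b ∈ K → F K Q ≈ 0#) → spl(run b l)F ≈ F [](run b l)
 sum-stuck zero b F ch z = refl
 sum-stuck(suc l)b F ch z = +c(spl-0(run(b +z D)l)(λ K Q _ → z(b ∷ K)Q(here rfl)))(sum-stuck l(b +z D)(λ K Q → F K(b ∷ Q))(λ y K Q p q
  → ch y K(b ∷ Q)(there p)q)(λ K Q p → ch b K(b ∷ Q)(here rfl)p)) · +-identityˡ _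
 sum-run : ∀ l a F → Chained F → spl(run a l)F ≈ conv l(λ c r → F(run a c)(run(a +z D *z + c)r))
 sum-run zero a F ch = refl
 sum-run(suc l)a F ch = +-comm _ _ · +c(sum-stuck l(a +z D)(λ K Q → F K(a ∷ Q))(λ y K Q p q → ch y K(a ∷ Q)(there p)q)(λ K Q p → ch a K(a
  ∷ Q)(here rfl)p) · rfx(cong(λ x → F [](run x(suc l)))(lem0 a D)))(sum-run l(a +z D)(λ K Q → F(a ∷ K)Q)(λ y K Q p q → ch y(a ∷ K)Q p
  (there q)) · conv-cong l(λ c r _ → rfx(cong(λ x → F(run a(suc c))(run x r))(lem a D(+ c)))))where
  lem0 : ∀ a D → a ≡ a +z D *z + 0
  lem0 = ringℤ
  lem : ∀ a D c → a +z D +z D *z c ≡ a +z D *z(+ 1 +z c)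
  lem = ringℤ
 sum-runs : ∀ l a a' F → a +z a' ≡ D → Chained F → (∀ K K' Q → a ∈ K → a' ∈ K' → F(K ++ K')Q ≈ 0#) → spl(run a l ++ run a' l)F ≈ F [](run a l ++
  run a' l) + conv⁺ l(λ c r → F(run a c)(run(a +z D *z + c)r ++ run a' l) + F(run a' c)(run a l ++ run(a' +z D *z + c)r))
 sum-runs l a a' F e ch z = spl-++ F(run a l)(run a' l) · sum-run l a F1(λ y K Q p q → spl-0(run a' l)(λ K' Q' _ → ch y(K ++ K')(Q ++ Q')
  (∈-++⁺ˡ p)(∈-++⁺ˡ q))) · conv-head l _ · +c(rfx(cong(λ x → F1 [](run x l))(lem0 a D))
  · first)(conv⁺-cong l(λ c r _ → second c(run(a +z D *z + suc c)r))) · +-assoc _ _ _ · +ˡ(+-comm _ _ · sym(conv⁺-+ l _ _))where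
  F1 : List ℤ → List ℤ → |R|
  F1 h r = spl(run a' l)(λ h' r' → F(h ++ h')(r ++ r'))
  lem0 : ∀ a D → a +z D *z + 0 ≡ a
  lem0 = ringℤ
  chained : ∀ h r → Chained(λ h' r' → F(h ++ h')(r ++ r'))
  chained h r y K Q p q = ch y(h ++ K)(r ++ Q)(∈-++⁺ʳ r p)(∈-++⁺ʳ h q)
  first : F1 [](run a l) ≈ F [](run a l ++ run a' l) + conv⁺ l(λ c r → F(run a' c)(run a l ++ run(a' +z D *z + c)r))
  first = sum-run l a' _(chained [](run a l)) · conv-head l _ · +ʳ(rfx(cong(λ x → F [](run a l ++ run x l))(lem0 a' D)))
  second : ∀ c r → F1(run a(suc c))r ≈ F(run a(suc c))(r ++ run a' l)
  second c r = sum-stuck l a' _(chained(run a(suc c))r)(λ K Q p → z(run a(suc c))K(r ++ Q)(here rfl)p)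
   · rfx(cong(λ x → F x(r ++ run a' l))(++-identityʳ _))
 Vanishing-chained : ∀ {H} → Vanishing H → ∀ m → Chained(λ K Q → X m K * H(negs K ++ Q))
 Vanishing-chained V m y K Q p q = *ˡ(vanish-∈ V K Q q p(lem y D)) · zeroʳ _ where
  lem : ∀ y D → y +z D -z y ≡ D
  lem = ringℤ
 weightₚ : ℕ → Pair → |R|
 weightₚ m p = weight m(i p)(+ b p -z + J)
 chain-pair : ℤ → List ℤ
 chain-pair i = run(M +z(i +z i))J ++ run(M -z(i +z i))J
 private
  moved : ∀ a s c r l → c +n r ≡ l → s ≡ (D -z a) -z D *z + c → negs(run a c) ++ run(a +z D *z + c)r ++ run(D -z a)l ↭ run(a +z D *z + c)r ++
   run s(l +n c)
  moved a s c r l e rfl = ↭-trans(shifts(negs(run a c))(run(a +z D *z + c)r))(++⁺ˡ(run(a +z D *z + c)r)(↭-trans(++⁺ʳ(run(D -z a)l)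
   (negs-run a c))(↭-reflexive(E.trans(cong(λ x → run s c ++ run x l)(lem a D(+ c)))(E.trans(E.sym(run-++ s c l))(cong(run s)(N.+-comm c
   l)))))))where
   lem : ∀ a D c → D -z a ≡ D -z a -z D *z c +z D *z c
   lem = ringℤ
 sum-chain-pair : ∀ {H} → Vanishing H → ∀ m i → spl(chain-pair i)(λ K Q → X m K * H(negs K ++ Q)) ≈ ∑ₚ i(λ p → weightₚ m p * H(conf p))
 sum-chain-pair{H}V m i = sum-runs J(M +z ii)(M -z ii)F(lem-a M ii)(Vanishing-chained V m)(λ K K' Q p q → _·_(*ˡ(vanish-∈∈ V K K' Q p q
  (lem-a M ii)))(zeroʳ _)) · +c centre(conv⁺-cong J(λ c r e → +c(up(suc c)r e)(down(suc c)r e)))where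
  ii = i +z i
  F : List ℤ → List ℤ → |R|
  F K Q = X m K * H(negs K ++ Q)
  lem-a : ∀ M ii → (M +z ii) +z(M -z ii) ≡ M +z M
  lem-a = ringℤ
  X-[] : X m [] ≈ weightₚ m(pair i J J)
  X-[] = (^ᵣ-cong m(sym T-0) · T-^ (+ 0)m) · T-cong(cong(λ x → x *z + m)(lem M i(+ J)))where
   lem : ∀ M i J → + 0 ≡ M *z(J -z J) *z(J -z J) +z(i +z i) *z(J -z J)
   lem = ringℤ
  centre : F [](chain-pair i) ≈ weightₚ m(pair i J J) * H(conf(pair i J J))
  centre = *c X-[](rfx(cong₂(λ x y → H(run(M +z x)J ++ run(M -z y)J))(lem M i(+ J))(lem M i(+ J))))where
   lem : ∀ M i J → i +z i ≡ (i +z M *z(J -z J)) +z(i +z M *z(J -z J))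
   lem = ringℤ
  up : ∀ c r → c +n r ≡ J → F(run(M +z ii)c)(run(M +z ii +z D *z + c)r ++ run(M -z ii)J) ≈ weightₚ m(pair i(J +n c)r) * H(conf(pair i(J
   +n c)r))
  up c r e = *c(X-run m i c · T-cong(cong(λ k → e² i k *z + m)(lem-k(+ J)(+ c))))(symmetric V(↭-trans(↭-reflexive(cong(λ x → negs(run(M
   +z ii)c) ++ run(M +z ii +z D *z + c)r ++ run x J)(lem0 M ii)))(↭-trans(moved(M +z ii)(M -z w(pair i(J +n c)r))c r J e(lem1 M i(+ J)
   (+ c)))(↭-reflexive(cong(λ x → run x r ++ run(M -z w(pair i(J +n c)r))(J +n c))(lem2 M i(+ J)(+ c)))))))where
   lem-k : ∀ J c → c ≡ J +z c -z J
   lem-k = ringℤ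
   lem0 : ∀ M ii → M -z ii ≡ M +z M -z(M +z ii)
   lem0 = ringℤ
   lem1 : ∀ M i J c → M -z((i +z M *z(J +z c -z J)) +z(i +z M *z(J +z c -z J))) ≡ (M +z M) -z(M +z(i +z i)) -z(M +z M) *z c
   lem1 = ringℤ
   lem2 : ∀ M i J c → M +z(i +z i) +z(M +z M) *z c ≡ M +z((i +z M *z(J +z c -z J)) +z(i +z M *z(J +z c -z J)))
   lem2 = ringℤ
  down : ∀ c r → c +n r ≡ J → F(run(M -z ii)c)(run(M +z ii)J ++ run(M -z ii +z D *z + c)r) ≈ weightₚ m(pair i r(J +n c)) * H(conf(pair i r
   (J +n c)))
  down c r e = *c(rfx(cong(λ x → X m(run(M +z x)c))(lem-ii i)) · X-run m(-z i)c
   · T-cong(cong(λ k → k *z + m)(E.trans(lem-e M i(+ c))(cong(e² i) -c))))(symmetric V(↭-trans(++⁺ˡ(negs(run(M -z ii)c))(++-comm(run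
   (M +z ii)J)(run(M -z ii +z D *z + c)r)))(↭-trans(↭-reflexive(cong(λ x → negs(run(M -z ii)c) ++ run(M -z ii +z D *z + c)r ++ run x J)
   (lem0 M ii)))(↭-trans(moved(M -z ii)(M +z w(pair i r(J +n c)))c r J e(E.trans(cong(λ k → M +z((i +z M *z k) +z(i +z M *z k)))(E.sym
   -c))(lem1 M i(+ c))))(↭-trans(↭-reflexive(cong(λ x → run x r ++ run(M +z w(pair i r(J +n c)))(J +n c))(E.trans(lem2 M i(+ c))(cong(λ
   k → M -z((i +z M *z k) +z(i +z M *z k))) -c))))(++-comm(run(M -z w(pair i r(J +n c)))r)(run(M +z w(pair i r(J +n c)))(J +n c))))))))
   where
   lem-ii : ∀ i → -z(i +z i) ≡ -z i +z -z i
   lem-ii = ringℤ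
   -c : -z(+ c) ≡ + r -z + J
   -c = E.trans(lem(+ c)(+ r))(cong(λ x → + r -z x)(cong +_ e))where
    lem : ∀ c r → -z c ≡ r -z(c +z r)
    lem = ringℤ
   lem-e : ∀ M i c → M *z c *z c +z(-z i +z -z i) *z c ≡ M *z(-z c) *z(-z c) +z(i +z i) *z(-z c)
   lem-e = ringℤ
   lem0 : ∀ M ii → M +z ii ≡ M +z M -z(M -z ii)
   lem0 = ringℤ
   lem1 : ∀ M i c → M +z((i +z M *z(-z c)) +z(i +z M *z(-z c))) ≡ (M +z M) -z(M -z(i +z i)) -z(M +z M) *z c
   lem1 = ringℤ
   lem2 : ∀ M i c → M -z(i +z i) +z(M +z M) *z c ≡ M -z((i +z M *z(-z c)) +z(i +z M *z(-z c)))
   lem2 = ringℤ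
 weights : ℕ → List Pair → |R|
 weights m = ∏ (weightₚ m)
 sum-chain-pairs : ∀ m is A → spl(concatMap chain-pair is)(λ K Q → X m K * Ξ(A ++ negs K ++ Q)) ≈ ∑ₚ* is(λ ps → weights m ps * Ξ(A ++ confs ps))
 sum-chain-pairs m [] A = *ʳ(one m)where
  one : ∀ n → 1# ^ᵣ n ≈ 1#
  one zero = refl
  one(suc n) = 1* _ · one n
 sum-chain-pairs m(i ∷ is)A = spl-++ _(chain-pair i)C · spl-cong'(chain-pair i)(λ h r → _·_(spl-cong' C(λ h' r' → _·_(*c(X-++ m h h')(Ξ-↭
  (rearrange h r h' r')))(*-assoc _ _ _)))(spl-*ˡ(X m h)_ C)) · spl-cong'(chain-pair i)(λ h r → *ˡ(sum-chain-pairs m is(A ++ negs h ++ r))) ·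
  sum-chain-pair V m i · ∑ₚ-cong i(λ p _ _ → _·_(sym(∑ₚ*-*ˡ is(weightₚ m p)(λ ps → weights m ps * Ξ((A ++ conf p) ++ confs ps))))(∑ₚ*-cong is
  (λ ps _ _ → _·_(sym(*-assoc _ _ _))(*ˡ(Ξ-↭ (↭-reflexive(++-assoc A(conf p)(confs ps))))))))where
  C = concatMap chain-pair is
  H : List ℤ → |R|
  H B = ∑ₚ* is(λ ps → weights m ps * Ξ((A ++ B) ++ confs ps))
  V : Vanishing H
  V = Vanishing-∑ is(λ ps → record{symmetric = λ p → *ˡ(Ξ-↭ (++⁺ʳ(confs ps)(++⁺ˡ A p))); vanish = λ y z B e → _·_(*ˡ(Ξ-↭ (↭-reflexive(++-assoc
   A(y ∷ z ∷ B)(confs ps))) · vanish(Vanishing-Ξ A)y z(B ++ confs ps)e))(zeroʳ _)})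
  rearrange : ∀ h r h' r' → A ++ negs(h ++ h') ++ (r ++ r') ↭ (A ++ negs h ++ r) ++ negs h' ++ r'
  rearrange h r h' r' = ↭-trans(++⁺ˡ A(↭-trans(↭-reflexive(E.trans(cong(_++ (r ++ r'))(map-++ _ h h'))(++-assoc(negs h)(negs h')_)))
   (↭-trans(++⁺ˡ(negs h)(shifts(negs h')r))(↭-reflexive(E.sym(++-assoc(negs h)r _))))))(↭-reflexive(E.sym(++-assoc A(negs h ++ r)_)))
 elements : List ℤ → List ℤ
 elements is = run M J ++ concatMap chain-pair is
 -- Only configurations contribute to the sum over all signs.
 symm-elements : ∀ m is → symm m(elements is) ≈ conv J(λ k l → weight m(+ 0)(+ k) * ∑ₚ* is(λ ps → weights m ps * Ξ(conf0 k l ++ confs ps)))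
 symm-elements m is = spl-++ _(run M J)C · spl-cong'(run M J)(λ h r → _·_(spl-cong' C(λ h' r' → _·_(*c(X-++ m h h')(Ξ-↭ (rearrange h r h'
  r')))(*-assoc _ _ _)))(spl-*ˡ(X m h)_ C · *ˡ(sum-chain-pairs m is(negs h ++ r)))) · sum-run J M _(Vanishing-chained V m)
  · conv-cong J(λ k l _ → *c(rfx(cong(λ x → X m(run x k))(E.sym(Z.+-identityʳ M)))
  · X-run m(+ 0)k)(symmetric V(++⁺ (↭-trans(negs-run M k)(↭-reflexive(cong(λ x → run x k)(lem1 M(+ k)))))(↭-reflexive(cong(λ x → run x l)
  (lem2 M(+ k)))))))where
  C = concatMap chain-pair is
  H : List ℤ → |R|
  H B = ∑ₚ* is(λ ps → weights m ps * Ξ(B ++ confs ps))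
  V : Vanishing H
  V = Vanishing-∑ is(λ ps → record{symmetric = λ p → *ˡ(Ξ-↭ (++⁺ʳ(confs ps)p)); vanish = λ y z B e → _·_(*ˡ(vanish(Vanishing-Ξ [])y z(B ++
   confs ps)e))(zeroʳ _)})
  rearrange : ∀ h r h' r' → negs(h ++ h') ++ (r ++ r') ↭ (negs h ++ r) ++ negs h' ++ r'
  rearrange h r h' r' = ↭-trans(↭-reflexive(E.trans(cong(_++ (r ++ r'))(map-++ _ h h'))(++-assoc(negs h)(negs h')_)))(↭-trans(++⁺ˡ(negs h)
   (shifts(negs h')r))(↭-reflexive(E.sym(++-assoc(negs h)r _))))
  lem1 : ∀ M k → (M +z M) -z M -z(M +z M) *z k ≡ M -z(M *z k +z M *z k)
  lem1 = ringℤ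
  lem2 : ∀ M k → M +z(M +z M) *z k ≡ M +z(M *z k +z M *z k)
  lem2 = ringℤ
module Laplace(R : Ring)where
 open CommutativeRing R hiding (zero) renaming (Carrier to |R|; *-congˡ to *ˡ; +-congˡ to +ˡ; +-congʳ to +ʳ; *-identityˡ to 1*; -‿cong to -ᶜ; *-cong
  to *c; +-cong to +c; trans to infixr 1 _·_)
 open RingSolver R
 open Polynomials R
 open Sums R
 module _{B : Set}where
  -- The alternating sum of F c cs over the ways of removing an element c from a list.
  alt : List B → (B → List B → |R|) → |R|
  alt [] F = 0#
  alt(c ∷ cs)F = F c cs - alt cs(λ d ds → F d(c ∷ ds))
  alt-cong : ∀ {F G}cs → (∀ c cs → F c cs ≈ G c cs) → alt cs F ≈ alt cs G
  alt-cong [] e = refl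
  alt-cong(c ∷ cs)e = +c(e c cs)(-ᶜ(alt-cong cs(λ d ds → e d(c ∷ ds))))
  alt-+ : ∀ F G cs → alt cs(λ c ds → F c ds + G c ds) ≈ alt cs F + alt cs G
  alt-+ F G [] = sym(+-identityˡ _)
  alt-+ F G(c ∷ cs) = +ˡ(-ᶜ(alt-+ _ _ cs)) · solve 4(λ a b c d → a :+ b :- (c :+ d) := a :- c :+ (b :- d))refl _ _ _ _
  alt-*ˡ : ∀ k F cs → alt cs(λ c ds → k * F c ds) ≈ k * alt cs F
  alt-*ˡ k F [] = sym(zeroʳ k)
  alt-*ˡ k F(c ∷ cs) = +ˡ(-ᶜ(alt-*ˡ k _ cs)) · solve 3(λ k a b → k :* a :- k :* b := k :* (a :- b))refl _ _ _
  alt-- : ∀ F G cs → alt cs(λ c ds → F c ds - G c ds) ≈ alt cs F - alt cs G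
  alt-- F G cs = alt-cong cs(λ _ _ → +ˡ(sym(neg _))) · alt-+ F _ cs · +ˡ(alt-*ˡ(- 1#)G cs · neg _)where
   neg : ∀ x → (- 1#) * x ≈ - x
   neg = solve 1(λ x → (:- 𝟏) :* x := :- x)refl
  alt-alt : ∀ (F : B → B → List B → |R|)cs → alt cs(λ c cs → alt cs(λ d ds → F c d ds)) ≈ - alt cs(λ c cs → alt cs(λ d ds → F d c ds))
  alt-alt F [] = solve 0(𝟎 := :- 𝟎)refl
  alt-alt F(c ∷ cs) = +ˡ(-ᶜ(alt-- _ _ cs)) · +ˡ(-ᶜ(+ˡ(-ᶜ(alt-alt(λ d e es → F d e(c ∷ es))cs))))
   · solve 3(λ a b e → a :- (b :- (:- e)) := :- (b :- (a :- e)))refl _ _ _ · -ᶜ(+ˡ(-ᶜ(sym(alt-- _ _ cs))))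
  alt-alt-0 : ∀ (F : B → B → List B → |R|) → (∀ c d ds → F c d ds ≈ F d c ds) → ∀ cs → alt cs(λ c cs → alt cs(λ d ds → F c d ds)) ≈ 0#
  alt-alt-0 F s [] = refl
  alt-alt-0 F s(c ∷ cs) = +ˡ(-ᶜ(alt-- _ _ cs)) · +c(alt-cong cs(λ d ds → s c d ds))(-ᶜ(+ˡ(-ᶜ(alt-alt-0(λ d e es → F d e(c ∷ es))(λ d e es
   → s d e(c ∷ es))cs)))) · solve 1(λ a → a :- (a :- 𝟎) := 𝟎)refl _
 alt-swap : ∀ {A B : Set}(F : A → List A → B → List B → |R|)rs cs → alt rs(λ r rs → alt cs(λ c cs → F r rs c cs)) ≈ alt cs(λ c cs → alt rs(λ r
  rs → F r rs c cs))
 alt-swap F [] cs = sym(alt-cong cs(λ _ _ → sym(zeroˡ 0#)) · alt-*ˡ 0#(λ _ _ → 0#)cs · zeroˡ _)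
 alt-swap F(r ∷ rs)cs = +ˡ(-ᶜ(alt-swap(λ q qs → F q(r ∷ qs))rs cs)) · sym(alt-- _ _ cs)
 module _{B : Set}where
  det : List(B → |R|) → List B → |R|
  det [] [] = 1#
  det [](c ∷ cs) = 0#
  det(φ ∷ φs)cs = alt cs(λ c ds → φ c * det φs ds)
  det-∈ : ∀ {A : Set}(e : A → B → |R|){r}rs cs → r ∈ rs → det(map e(r ∷ rs))cs ≈ 0#
  det-∈ e{r}(_ ∷ rs)cs(here rfl) = alt-cong cs(λ _ ds → sym(alt-*ˡ _ _ ds))
   · alt-alt-0(λ c d ds → e r c * (e r d * det(map e rs)ds))(λ c d ds → solve 3(λ a b x → a :* (b :* x) := b :* (a :* x))refl _ _ _)cs
  det-∈ e{r}(q ∷ rs)cs(there p) = alt-cong cs(λ _ ds → sym(alt-*ˡ _ _ ds)) · alt-alt _ cs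
   · -ᶜ(alt-cong cs(λ c ds → _·_(alt-cong ds(λ d es → solve 3(λ a b x → a :* (b :* x) := b :* (a :* x))refl _ _ _))(alt-*ˡ _ _ ds
   · *ˡ(det-∈ e rs ds p) · zeroʳ _ · sym(zeroˡ 0#)))) · -ᶜ(alt-*ˡ 0#(λ _ _ → 0#)cs · zeroˡ _) · solve 0(:- 𝟎 := 𝟎)refl
 det-column : ∀ {A B : Set}(e : A → B → |R|)rs c cs → det(map e rs)(c ∷ cs) ≈ alt rs(λ r qs → e r c * det(map e qs)cs)
 det-column e [] c cs = refl
 det-column e(r ∷ rs)c cs = +ˡ(-ᶜ(alt-cong cs(λ d ds → _·_(*ˡ(det-column e rs c ds))(sym(alt-*ˡ _ _ rs))) · sym(alt-swap _ rs cs)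
  · alt-cong rs(λ q qs → _·_(alt-cong cs(λ _ _ → solve 3(λ a b x → a :* (b :* x) := b :* (a :* x))refl _ _ _))(alt-*ˡ _ _ cs))))
 det-transpose : ∀ {A B : Set}(e : A → B → |R|)rs cs → det(map e rs)cs ≈ det(map(λ c r → e r c)cs)rs
 det-transpose e [] [] = refl
 det-transpose e(r ∷ rs) [] = refl
 det-transpose e rs(c ∷ cs) = det-column e rs c cs · alt-cong rs(λ r qs → *ˡ(det-transpose e qs cs))
 record Linear{A : Set}(S : (A → |R|) → |R|) : Set where
  field
   S-cong : ∀ {φ ψ} → (∀ a → φ a ≈ ψ a) → S φ ≈ S ψ
   S-+ : ∀ φ ψ → S(λ a → φ a + ψ a) ≈ S φ + S ψ
   S-*ˡ : ∀ c φ → S(λ a → c * φ a) ≈ c * S φ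
  S-alt : ∀ {B : Set}(F : A → B → List B → |R|)cs → S(λ a → alt cs(F a)) ≈ alt cs(λ c ds → S(λ a → F a c ds))
  S-alt F [] = S-cong(λ _ → sym(zeroˡ 0#)) · S-*ˡ 0#(λ _ → 0#) · zeroˡ _
  S-alt F(c ∷ cs) = S-cong(λ a → +ˡ(sym(neg _))) · S-+ _ _ · +ˡ(S-*ˡ(- 1#)_ · neg _ · -ᶜ(S-alt(λ a d ds → F a d(c ∷ ds))cs))where
   neg : ∀ x → (- 1#) * x ≈ - x
   neg = solve 1(λ x → (:- 𝟏) :* x := :- x)refl
  det-linear : ∀ {B : Set}(β : A → |R|)(row : A → B → |R|)φs ψs cs → S(λ a → β a * det(φs ++ row a ∷ ψs)cs) ≈ det(φs ++ (λ c → S(λ a → β a *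
   row a c)) ∷ ψs)cs
  det-linear β row [] ψs cs = S-cong(λ a → sym(alt-*ˡ _ _ cs)) · S-alt _ cs
   · alt-cong cs(λ c ds → _·_(S-cong(λ a → solve 3(λ a b x → a :* (b :* x) := x :* (a :* b))refl _ _ _))(S-*ˡ _ _ · *-comm _ _))
  det-linear β row(φ ∷ φs)ψs cs = S-cong(λ a → sym(alt-*ˡ _ _ cs)) · S-alt _ cs
   · alt-cong cs(λ c ds → _·_(S-cong(λ a → solve 3(λ a b x → a :* (b :* x) := b :* (a :* x))refl _ _ _))(S-*ˡ _ _
   · *ˡ(det-linear β row φs ψs ds)))
 -- Polynomial functions of degree at most d with leading coefficient c.
 Lead : ℕ → |R| → (|R| → |R|) → Set
 Lead zero c f = ∀ x → f x ≈ c
 Lead(suc d)c f = ∃ λ g → ∃ λ a → Lead d c g × (∀ x → f x ≈ x * g x + a)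
 lead-cong : ∀ d{c c' f f'} → c ≈ c' → (∀ x → f' x ≈ f x) → Lead d c f → Lead d c' f'
 lead-cong zero e h l x = h x · l x · e
 lead-cong(suc d)e h(g , a , l , k) = g , a , lead-cong d e(λ _ → refl)l , λ x → _·_(h x)(k x)
 lead-+ : ∀ d{c c' f f'} → Lead d c f → Lead d c' f' → Lead d(c + c')(λ x → f x + f' x)
 lead-+ zero l l' x = +c(l x)(l' x)
 lead-+ (suc d)(g , a , l , k)(g' , a' , l' , k') = _ , a + a' , lead-+ d l l' , λ x → _·_(+c(k x)(k' x))(solve 5(λ x g a g' a' → x :* g :+ a
  :+ (x :* g' :+ a') := x :* (g :+ g') :+ (a :+ a'))refl _ _ _ _ _)
 lead-* : ∀ d{c f}y → Lead d c f → Lead d(y * c)(λ x → y * f x)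
 lead-* zero y l x = *ˡ(l x)
 lead-* (suc d)y(g , a , l , k) = _ , y * a , lead-* d y l , λ x → _·_(*ˡ(k x))(solve 4(λ y x g a → y :* (x :* g :+ a) := x :* (y :* g) :+ y :*
  a)refl _ _ _ _)
 lead-raise : ∀ d{c f} → Lead d c f → Lead(suc d)0# f
 lead-raise zero{c}l = (λ _ → 0#) , c , (λ _ → refl) , λ x → _·_(l x)(solve 2(λ x c → c := x :* 𝟎 :+ c)refl _ _)
 lead-raise(suc d)(g , a , l , k) = g , a , lead-raise d l , k
 lead-x : ∀ d{c f} → Lead d c f → Lead(suc d)c(λ x → x * f x)
 lead-x d{f = f}l = f , 0# , l , λ x → sym(+-identityʳ _)
 lead-- : ∀ d{c f f'} → Lead d c f → Lead d 0# f' → Lead d c(λ x → f x - f' x)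
 lead-- d l l' = lead-cong d(solve 1(λ c → c :+ (:- 𝟏) :* 𝟎 := c)refl _)(λ x → solve 2(λ a b → a :- b := a :+ (:- 𝟏) :* b)refl _ _)(lead-+ d l
  (lead-* d(- 1#)l'))
 lead-quot : ∀ d{c f} → Lead(suc d)c f → ∀ y → ∃ λ h → Lead d c h × (∀ x → f x - f y ≈ (x - y) * h x)
 lead-quot zero(g , a , l , k)y = g , l , λ x → _·_(+c(k x)(-ᶜ(k y · +ʳ(*ˡ(l y
  · sym(l x))))))(solve 4(λ x y g a → x :* g :+ a :- (y :* g :+ a) := (x :- y) :* g)refl _ _ _ _)
 lead-quot(suc d)(g , a , l , k)y with lead-quot d l y
 ... | h , m , q = (λ x → g x + y * h x) , lead-cong(suc d)(solve 2(λ c y → c :+ y :* 𝟎 := c)refl _ _)(λ _ → refl)(lead-+ (suc d)l(lead-* (suc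
  d)y(lead-raise d m))) , λ x → ((+c(k x)(-ᶜ(k y))) · (solve 5(λ x y g g' a → x :* g :+ a :- (y :* g' :+ a) := (x :- y) :* g :+ y :* (g :- g'))
  refl _ _ _ _ _) · (+ˡ(*ˡ(q x))) · (solve 4(λ x y g h → (x :- y) :* g :+ y :* ((x :- y) :* h) := (x :- y) :* (g :+ y :* h))refl _ _ _ _))
 lead-roots : ∀ as{c f} → Lead(length as)c f → All(λ a → f a ≈ 0#)as → AllPairs(λ a b → Regular(b - a))as → ∀ x → f x ≈ ∏ (λ a → x - a)as * c
 lead-roots [] l _ _ x = l x · sym(1* _)
 lead-roots(a ∷ as){c}{f}l(z ∷ zs)(r ∷ rs)x with lead-quot(length as)l a
 ... | h , m , q = factor x · *ˡ(lead-roots as m(go as zs r)rs x) · sym(*-assoc _ _ _)where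
  factor : ∀ x → f x ≈ (x - a) * h x
  factor x = solve 1(λ a → a := a :- 𝟎)refl _ · +ˡ(-ᶜ(sym z)) · q x
  go : ∀ bs → All(λ b → f b ≈ 0#)bs → All(λ b → Regular(b - a))bs → All(λ b → h b ≈ 0#)bs
  go [] [] [] = []
  go(b ∷ bs)(e ∷ es)(r ∷ rs) = r(h b)(sym(factor b) · e) ∷ go bs es rs
open import Data.Integer using (∣_∣)
down down⁺ : ℕ → List ℤ
down zero = []
down(suc r) = + r ∷ down r
down⁺ zero = []
down⁺ (suc r) = + suc r ∷ down⁺ r
down-snoc : ∀ r → down(suc r) ≡ down⁺ r ++ + 0 ∷ []
down-snoc zero = rfl
down-snoc(suc r) = cong(+ suc r ∷_)(down-snoc r)
length-down⁺ : ∀ r → length(down⁺ r) ≡ r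
length-down⁺ zero = rfl
length-down⁺ (suc r) = cong suc(length-down⁺ r)
module Traces(R : Ring)(χ : Char R)where
 open CommutativeRing R hiding (zero) renaming (Carrier to |R|; *-congˡ to *ˡ; *-congʳ to *ʳ; *-identityˡ to 1*; -‿cong to -ᶜ; *-cong to *c; +-cong to
  +c; reflexive to rfx; trans to infixr 1 _·_)
 open Char χ
 open RingSolver R
 open Polynomials R
 open Sums R
 open CharProperties R χ
 open ChainSteps R χ ( + 0 ) using (X)
 open Laplace R
 trace : ℕ → |R| → |R|
 trace zero x = 1# + 1#
 trace(suc zero)x = x
 trace(suc(suc n))x = x * trace(suc n)x - trace n x
 top : ℕ → |R|
 top zero = 1# + 1#
 top(suc n) = 1#
 trace-lead : ∀ n → Lead n(top n)(trace n)
 trace-lead zero x = refl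
 trace-lead(suc zero) = (λ _ → 1#) , 0# , (λ _ → refl) , λ x → solve 1(λ x → x := x :* 𝟏 :+ 𝟎)refl x
 trace-lead(suc(suc n)) = lead-- (suc(suc n))(lead-x(suc n)(trace-lead(suc n)))(lead-raise(suc n)(lead-raise n(trace-lead n)))
 trace-X : ∀ w n → X(w *z + n) ≈ trace n(X w)
 trace-X w zero = +c(T-cong(Z.*-zeroʳ w) · T-0)(T-cong(cong(λ x → -z x)(Z.*-zeroʳ w)) · T-0)
 trace-X w(suc zero) = rfx(cong X(Z.*-identityʳ w))
 trace-X w(suc(suc n)) = sym(+c(*ˡ(sym(trace-X w(suc n))))(-ᶜ(sym(trace-X w n)))
  · solve 6(λ a b c d e f → (a :+ b) :* (c :+ d) :- (e :+ f) := (a :* c :+ b :* d) :+ ((b :* c :- e) :+ (a :* d :- f)))refl _ _ _ _ _ _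
  · +c(+c(merge(lem1 w(+ n)))(merge(lem2 w(+ n))))(+c(x≈y⇒x-y≈0(merge(lem3 w(+ n))))(x≈y⇒x-y≈0(merge(lem4 w(+ n))))
  · +-identityʳ _) · +-identityʳ _)where
  u = w *z + n
  v = w *z + suc n
  merge : ∀ {a b c} → a +z b ≡ c → T a * T b ≈ T c
  merge e = sym(T-+ _ _) · T-cong e
  lem1 : ∀ w n → w +z w *z(+ 1 +z n) ≡ w *z(+ 1 +z(+ 1 +z n))
  lem1 = ringℤ
  lem2 : ∀ w n → -z w +z(-z(w *z(+ 1 +z n))) ≡ -z(w *z(+ 1 +z(+ 1 +z n)))
  lem2 = ringℤ
  lem3 : ∀ w n → -z w +z w *z(+ 1 +z n) ≡ w *z n
  lem3 = ringℤ
  lem4 : ∀ w n → w +z(-z(w *z(+ 1 +z n))) ≡ -z(w *z n)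
  lem4 = ringℤ
 lead-alt : ∀ d(P : ℤ → |R| → |R|)(K : ℤ → List ℤ → |R|)cs → All(λ j → Lead d 0#(P j))cs → Lead d 0#(λ x → alt cs(λ j ds → P j x * K j ds))
 lead-alt d P K [] [] = lead-cong d(zeroˡ 0#)(λ _ → refl)(go d)where
  go : ∀ d → Lead d(0# * 0#)(λ _ → 0#)
  go zero x = sym(zeroˡ _)
  go(suc d) = (λ _ → 0#) , 0# , go d , λ x → solve 1(λ x → 𝟎 := x :* 𝟎 :+ 𝟎)refl x
 lead-alt d P K(c ∷ cs)(l ∷ ls) = lead-- d(lead-cong d(zeroʳ _)(λ _ → *-comm _ _)(lead-* d(K c cs)l))(lead-alt d P(λ j ds → K j(c ∷ ds))cs
  ls)
 below : ∀ r → All(λ j → Lead r 0#(trace ∣ j ∣))(down r)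
 below zero = []
 below(suc r) = lead-raise r(trace-lead r) ∷ All.map(λ{j}l → lead-raise r{f = trace ∣ j ∣}l)(below r)
 row : ℤ → ℤ → |R|
 row w j = X(w *z j)
 row-trace : ∀ w r → All(λ j → row w j ≈ trace ∣ j ∣ (X w))(down r)
 row-trace w zero = []
 row-trace w(suc r) = trace-X w r ∷ row-trace w r
 alt-All : ∀ {F G : ℤ → List ℤ → |R|}{cs} → All(λ c → ∀ ds → F c ds ≈ G c ds)cs → alt cs F ≈ alt cs G
 alt-All [] = refl
 alt-All(e ∷ es) = +c(e _)(-ᶜ(alt-All(All.map(λ h ds → h(_ ∷ ds))es)))
 double : ℕ → |R|
 double zero = 1#
 double(suc _) = 1# + 1#
 vandermonde : ∀ ws → AllPairs(λ w w' → Regular(X w' - X w))ws → det(map row ws)(down(length ws)) ≈ pairs(λ x y → X x - X y)ws * double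
  (length ws)
 vandermonde [] _ = sym(1* _)
 vandermonde(w ∷ ws)(a ∷ as) = alt-All(All.map(λ e ds → *ʳ{det(map row ws)ds}e)(row-trace w(suc r)))
  · lead-roots(map X ws)(subst(λ n → Lead n(top r * d)f)(E.sym(length-map X ws))lead)zeros(APₚ.map⁺ as)(X w)
  · *c(∏-map _ X ws)(*ˡ(vandermonde ws as)) · solve 4(λ a t p d → a :* (t :* (p :* d)) := (a :* p) :* (t :* d))refl _ _ _ _ · *ˡ(td r)where
  r = length ws
  d = det(map row ws)(down r)
  f : |R| → |R|
  f x = alt(down(suc r))(λ j ds → trace ∣ j ∣ x * det(map row ws)ds)
  td : ∀ r → top r * double r ≈ 1# + 1#
  td zero = *-identityʳ _
  td(suc r) = 1* _
  lead : Lead r(top r * d)f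
  lead = lead-- r(lead-cong r(*-comm _ _)(λ _ → *-comm _ _)(lead-* r d(trace-lead r)))(lead-alt r(λ j → trace ∣ j ∣)(λ j ds → det(map row ws)
   (+ r ∷ ds))(down r)(below r))
  zeros : All(λ a → f a ≈ 0#)(map X ws)
  zeros = Allₚ.map⁺ (All.tabulate(λ{v}v∈ → _·_(alt-All(All.map(λ e ds → *ʳ{det(map row ws)ds}(sym e))(row-trace v(suc r))))(det-∈ row ws
   (down(suc r))v∈)))
module ConfigDeterminants(R : Ring)(χ : Char R)(J : ℕ)where
 open CommutativeRing R hiding (zero) renaming (Carrier to |R|; *-congˡ to *ˡ; *-congʳ to *ʳ; +-congˡ to +ˡ; *-identityˡ to 1*; *-cong to *c; +-cong
  to +c; reflexive to rfx; trans to infixr 1 _·_)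
 open Char χ
 open RingSolver R
 open Polynomials R
 open Sums R
 open CharProperties R χ
 open Laplace R
 open Traces R χ
 module Rows(M : ℤ)(m r : ℕ)where
  open ChainSteps R χ M
  open ConfigSteps R χ M J
  open ConfigWeights R χ M J
  open ConfigSums R χ M J
  is : List ℤ
  is = down⁺ r
  mult : ℕ → |R|
  mult zero = 1#
  mult(suc _) = 1# + 1#
  central : ℕ → |R|
  central k = mult k * weight m(+ 0)(+ k) * (-1^ k * mono r(+ 0)(+ k))
  lateral : Pair → |R|
  lateral p = weightₚ m p * (-1^ (b p) * mono r(i p)(+ b p -z + J))
  ∑0 : (ℕ → |R|) → |R|
  ∑0 φ = conv J(λ k _ → φ k)
  total : |R|
  total = ∑0(λ k → ∑ₚ* is(λ ps → central k * ∏ lateral ps * V(w0 k ∷ map w ps)))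
  entry : ℤ → ℤ → |R|
  entry(+ zero)j = -1^ J * ∑0(λ k → central k * row(w0 k)j)
  entry i j = ∑ₚ i(λ p → lateral p * row(w p)j)
  linear0 : Linear ∑0
  linear0 = record{S-cong = λ e → conv-cong J(λ k _ _ → e k); S-+ = λ φ ψ → conv-+ J _ _; S-*ˡ = λ c φ → conv-*ˡ J c _}
  linearₚ : ∀ i → Linear(∑ₚ i)
  linearₚ i = record{S-cong = λ e → ∑ₚ-cong i(λ p _ _ → e p); S-+ = ∑ₚ-+ i; S-*ˡ = ∑ₚ-*ˡ i}
  open Linear
  entryₚ : ℤ → ℤ → |R|
  entryₚ i j = ∑ₚ i(λ p → lateral p * row(w p)j)
  det-lateral : ∀ φs is ψs cs → ∑ₚ* is(λ ps → ∏ lateral ps * det(φs ++ map(λ p → row(w p))ps ++ ψs)cs) ≈ det(φs ++ map entryₚ is ++ ψs)cs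
  det-lateral φs [] ψs cs = 1* _
  det-lateral φs(i ∷ is)ψs cs = ∑ₚ-cong i(λ p _ _ → _·_(∑ₚ*-cong is(λ ps _ _ → _·_(*-assoc _ _ _)(*ˡ(*ˡ(rfx(cong(λ x → det x cs)(E.sym
   (++-assoc φs(row(w p) ∷ [])_))))))))(∑ₚ*-*ˡ is(lateral p)(λ ps → ∏ lateral ps * det((φs ++ row(w p) ∷ []) ++ map(λ p → row(w p))ps ++
   ψs)cs) · *ˡ(det-lateral(φs ++ row(w p) ∷ [])is ψs cs · rfx(cong(λ x → det x cs)(++-assoc φs(row(w p) ∷ [])_)))))
   · det-linear(linearₚ i)lateral(λ p → row(w p))φs _ cs
  map-entry : ∀ s → map entryₚ(down⁺ s) ≡ map entry(down⁺ s)
  map-entry zero = rfl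
  map-entry(suc s) = cong(entryₚ(+ suc s) ∷_)(map-entry s)
  module _(D≢0 : D ≢ + 0)(adm : Adm D≢0 is)where
   separated : ∀ k ps → Adm D≢0(inds ps) → AllPairs(λ x y → Regular(X y - X x))(map w ps ++ w0 k ∷ [])
   separated k ps adm = APₚ.++⁺ (APₚ.map⁺ (AllPairs.map(λ{p}{q}o → reg(w q)(w p)(w-apart D≢0 q p(Apart-sym D≢0{i p}{i q}o)))(APₚ.map⁻
    (proj₂ adm))))([] ∷ [])(Allₚ.map⁺ (All.map(λ{p}o → reg(w0 k)(w p)(w0-apart D≢0 k p o) ∷ [])(offs D≢0 ps adm)))where
    reg : ∀ x y → Off(x +z y) × Off(x -z y) → Regular(X x - X y)
    reg x y(o , o') = δ-reg D≢0{x}{y}o o'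
   determinant : -1^ J * (-1^ r * (1# + 1#)) * total ≈ det(map entry(down(suc r)))(down(suc r))
   determinant = (sym(S-*ˡ linear0 _ _) · S-cong linear0(λ k → _·_(sym(∑ₚ*-*ˡ is _ _))(∑ₚ*-cong is(λ ps e _ → one k ps e)
    · ∑ₚ*-*ˡ is(-1^ J * central k)(λ ps → ∏ lateral ps * det(map(λ p → row(w p))ps ++ row(w0 k) ∷ [])cs))))
    · S-cong linear0(λ k → *ˡ(det-lateral [] is(row(w0 k) ∷ [])cs · rfx(cong(λ x → det(x ++ row(w0 k) ∷ [])cs)(map-entry r))))
    · det-linear linear0(λ k → -1^ J * central k)(λ k → row(w0 k))(map entry is) [] cs
    · last(map entry is)(λ j → _·_(S-cong linear0(λ k → *-assoc _ _ _))(S-*ˡ linear0 _ _))cs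
    · rfx(cong(λ x → det x cs)(E.trans(E.sym(map-++ entry is(+ 0 ∷ [])))(cong(map entry)(E.sym(down-snoc r)))))where
    cs = down(suc r)
    last : ∀ φs{φ ψ : ℤ → |R|} → (∀ j → φ j ≈ ψ j) → ∀ cs → det(φs ++ φ ∷ [])cs ≈ det(φs ++ ψ ∷ [])cs
    last [] e cs = alt-cong cs(λ c ds → *ʳ(e c))
    last(x ∷ φs)e cs = alt-cong cs(λ c ds → *ˡ(last φs e ds))
    one : ∀ k ps → inds ps ≡ is → -1^ J * (-1^ r * (1# + 1#)) * (central k * ∏ lateral ps * V(w0 k ∷ map w ps)) ≈ -1^ J * central k * (∏ lateral ps *
     det(map(λ p → row(w p))ps ++ row(w0 k) ∷ [])cs)
    one k ps e = solve 6(λ a b c d e f → a :* (b :* c) :* (d :* e :* f) := a :* d :* (e :* (b :* f :* c)))refl _ _ _ _ _ _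
     · *ˡ(*ˡ(*c front(rfx(E.sym(cong double lens))))) · *ˡ(*ˡ(sym(vandermonde(map w ps ++ w0 k ∷ [])(separated k ps(subst(Adm D≢0)(E.sym
     e)adm))))) · *ˡ(*ˡ(rfx(cong₂ det rows(cong down lens))))where
     lenps : length(map w ps) ≡ r
     lenps = E.trans(length-map w ps)(E.trans(E.sym(length-map i ps))(E.trans(cong length e)(length-down⁺ r)))
     lens : length(map w ps ++ w0 k ∷ []) ≡ suc r
     lens = E.trans (Data.List.Properties.length-++ (map w ps)) (E.trans (N.+-comm _ 1) (cong suc lenps)) where import Data.List.Properties
     rows : map row(map w ps ++ w0 k ∷ []) ≡ map(λ p → row(w p))ps ++ row(w0 k) ∷ []
     rows = E.trans (map-++ row (map w ps) _) (cong (_++ row (w0 k) ∷ []) (E.sym (map-∘ ps))) where open import Data.List.Properties using (map-∘)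
     front : -1^ r * V(w0 k ∷ map w ps) ≈ V(map w ps ++ w0 k ∷ [])
     front = sym(V-front(map w ps)(w0 k) [] · *c(rfx(cong -1^ lenps))(rfx(cong(λ x → ∏ (δ(w0 k))x * V x)(++-identityʳ(map w ps)))))
 -- The parameters (2r+1, m) and (2r+1+m, 0) give matrices which are transposed to each other.
 module Duality(m r : ℕ)where
  o κ : ℤ
  o = + 1 +z + r +z + r
  κ = o +z + m
  module A = Rows o m r
  module B = Rows κ 0 r
  private
   module WA = ConfigWeights R χ o J
   module WB = ConfigWeights R χ κ J
   module CA = ConfigSteps R χ o J
   module CB = ConfigSteps R χ κ J
   module SA = ConfigSums R χ o J
   module SB = ConfigSums R χ κ J
  open WA using (-1^)
  -1²^ : ∀ c n → -1^ (n +n c +n c) ≈ -1^ n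
  -1²^ c n = rfx(cong -1^ (N.+-assoc n c c)) · ^ᵣ-+ (- 1#)n(c +n c) · *ˡ(^ᵣ-+ (- 1#)c c · sym(^ᵣ-* (- 1#)(- 1#)c) · go c)
   · *-identityʳ _ where
   go : ∀ c → ((- 1#) * (- 1#)) ^ᵣ c ≈ 1#
   go zero = refl
   go(suc c) = *ˡ(go c) · solve 0((:- 𝟏) :* (:- 𝟏) :* 𝟏 := 𝟏)refl
  sign-pair : ∀ c n → c +n n ≡ J → -1^ (J +n c) ≈ -1^ n
  sign-pair c n rfl = rfx(cong(λ x → -1^ (x +n c))(N.+-comm c n)) · -1²^ c n
  product : ∀ s a b c → T a * (s * T b) * (T c + T(-z c)) ≈ s * (T(a +z b +z c) + T(a +z b -z c))
  product s a b c = solve 5(λ a s b c d → a :* (s :* b) :* (c :+ d) := s :* (a :* b :* c :+ a :* b :* d))refl _ _ _ _ _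
   · *ˡ(+c(merge c)(merge(-z c)))where
   merge : ∀ c → T a * T b * T c ≈ T(a +z b +z c)
   merge c = *ʳ(sym(T-+ a b)) · sym(T-+ _ c)
  crossed : ∀ {s s' a b c d a' b' c' d'} → s ≈ s' → a ≡ a' → b ≡ d' → c ≡ c' → d ≡ b' → s * (T a + T b) + s' * (T c + T d) ≈ s * (T a' + T b') + s' *
   (T c' + T d')
  crossed e rfl rfl rfl rfl = +ˡ(*ʳ(sym e)) · solve 5(λ s a b c d → s :* (a :+ b) :+ s :* (c :+ d) := s :* (a :+ d) :+ s :* (c :+ b))refl _ _ _ _
   _ · +ˡ(*ʳ e)
  private
   kk : ℕ → ℤ
   kk b = + b -z + J
   vA vB : ℤ → ℕ → ℤ
   vA x b = x +z o *z kk b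
   vB x b = x +z κ *z kk b
   exA exB : ℤ → ℤ → ℤ
   exA x k = (o *z k *z k +z(x +z x) *z k) *z + m +z o *z(o *z k *z k +z(x +z x) *z k)
   exB x k = (κ *z k *z k +z(x +z x) *z k) *z + 0 +z o *z(κ *z k *z k +z(x +z x) *z k)
   prodA : ∀ x b y → T(WA.e² x(kk b) *z + m) * (-1^ b * T(o *z WA.e² x(kk b))) * (T((vA x b +z vA x b) *z y) + T(-z((vA x b +z vA x b) *z y)))
    ≈ -1^ b * (T(exA x(kk b) +z(vA x b +z vA x b) *z y) + T(exA x(kk b) -z(vA x b +z vA x b) *z y))
   prodA x b y = product _ _ _ _
   prodB : ∀ x b y → T(WB.e² x(kk b) *z + 0) * (-1^ b * T(o *z WB.e² x(kk b))) * (T((vB x b +z vB x b) *z y) + T(-z((vB x b +z vB x b) *z y)))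
    ≈ -1^ b * (T(exB x(kk b) +z(vB x b +z vB x b) *z y) + T(exB x(kk b) -z(vB x b +z vB x b) *z y))
   prodB x b y = product _ _ _ _
   zero-neg : ∀ J → J -z J ≡ -z(J -z J)
   zero-neg = ringℤ
   flip : ∀ c n → c +n n ≡ J → kk n ≡ -z kk(J +n c)
   flip c n e = E.trans(cong(λ z → + n -z z)(cong +_(E.sym e)))(E.trans(lem(+ c)(+ n))(cong(λ z → -z(z +z + c -z z))(cong +_ e)))where
    lem : ∀ c n → n -z(c +z n) ≡ -z(c +z n +z c -z(c +z n))
    lem = ringℤ
   same : ∀ x y k → exA x k +z((x +z o *z k) +z(x +z o *z k)) *z y ≡ exB y k +z((y +z κ *z k) +z(y +z κ *z k)) *z x
   same x y k = lem o(+ m)x y k where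
    lem : ∀ o m x y k → (o *z k *z k +z(x +z x) *z k) *z m +z o *z(o *z k *z k +z(x +z x) *z k) +z((x +z o *z k) +z(x +z o *z k)) *z y ≡ ((o +z
     m) *z k *z k +z(y +z y) *z k) *z + 0 +z o *z((o +z m) *z k *z k +z(y +z y) *z k) +z((y +z(o +z m) *z k) +z(y +z(o +z m) *z k)) *z x
    lem = ringℤ
   reversed : ∀ x y{k l} → l ≡ -z k → exA x k -z((x +z o *z k) +z(x +z o *z k)) *z y ≡ exB y l -z((y +z κ *z l) +z(y +z κ *z l)) *z x
   reversed x y{k}rfl = lem o(+ m)x y k where
    lem : ∀ o m x y k → (o *z k *z k +z(x +z x) *z k) *z m +z o *z(o *z k *z k +z(x +z x) *z k) -z((x +z o *z k) +z(x +z o *z k)) *z y ≡ ((o +z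
     m) *z(-z k) *z(-z k) +z(y +z y) *z(-z k)) *z + 0 +z o *z((o +z m) *z(-z k) *z(-z k) +z(y +z y) *z(-z k)) -z((y +z(o +z m) *z(-z k))
     +z(y +z(o +z m) *z(-z k))) *z x
    lem = ringℤ
  lateral-lateral : ∀ x y → SA.∑ₚ x(λ p → A.lateral p * row(CA.w p)y) ≈ SB.∑ₚ y(λ p → B.lateral p * row(CB.w p)x)
  lateral-lateral x y = +c((prodA x J y · *ˡ(+c(T-cong(same x y(kk J)))(T-cong(reversed x y(zero-neg(+ J))))))
   · sym(prodB y J x))(conv⁺-cong J(λ c n e → let kn = flip(suc c)n e in _·_(+c(prodA x _ y)(prodA x n y))(crossed{s = -1^ (J +n suc c)}{s'
   = -1^ n}(sign-pair(suc c)n e)(same x y(kk(J +n suc c)))(reversed x y kn)(same x y(kk n))(reversed x y(E.trans(E.sym(Z.neg-involutive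
   _))(cong(λ z → -z z)(E.sym kn)))) · sym(+c(prodB y _ x)(prodB y n x)))))
  private
   plus-kk : ∀ c → kk(J +n c) ≡ + c
   plus-kk c = lem(+ J)(+ c)where
    lem : ∀ J c → J +z c -z J ≡ c
    lem = ringℤ
   minus-kk : ∀ c n → c +n n ≡ J → kk n ≡ -z(+ c)
   minus-kk c n e = E.trans(flip c n e)(cong(λ z → -z z)(plus-kk c))
   centralA : ∀ k y → T(WA.e²(+ 0)(+ k) *z + m) * (-1^ k * T(o *z WA.e²(+ 0)(+ k))) * row(CA.w0 k)y ≈ -1^ k * (T(exA(+ 0)(+ k) +z CA.w0 k
    *z y) + T(exA(+ 0)(+ k) -z CA.w0 k *z y))
   centralA k y = product _ _ _ _
   centralB : ∀ k y → T(WB.e²(+ 0)(+ k) *z + 0) * (-1^ k * T(o *z WB.e²(+ 0)(+ k))) * row(CB.w0 k)y ≈ -1^ k * (T(exB(+ 0)(+ k) +z CB.w0 k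
    *z y) + T(exB(+ 0)(+ k) -z CB.w0 k *z y))
   centralB k y = product _ _ _ _
   -- Both signs of c give the same contribution to the central row.
   doubled : ∀ {x y z c n p p' q1 q1' q2 q2'} → c +n n ≡ J → x * y * z ≈ -1^ c * (T p + T p') → q1 ≡ p → q1' ≡ p → q2 ≡ p' → q2' ≡ p' → -1^ J * ((1# +
    1#) * x * y * z) ≈ -1^ (J +n c) * (T q1 + T q1') + -1^ n * (T q2 + T q2')
   doubled{x}{y}{z}{c}{n}{p}{p'}e h rfl rfl rfl rfl = *ˡ(solve 4(λ t x y z → t :* x :* y :* z := t :* (x :* y :* z))refl _ _ _ _
    · *ˡ h) · solve 4(λ s t p q → s :* (𝟐 :* (t :* (p :+ q))) := s :* t :* (p :+ p) :+ s :* t :* (q :+ q))refl _ _ _ _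
    · +c(*ʳ(sym(^ᵣ-+ (- 1#)J c)))(*ʳ(sym(^ᵣ-+ (- 1#)J c) · sign-pair c n e))
   single : ∀ {x y z p p' q q'} → x * y * z ≈ -1^ 0 * (T p + T p') → q ≡ p → q' ≡ p' → -1^ J * (1# * x * y * z) ≈ -1^ J * (T q + T q')
   single h rfl rfl = *ˡ(solve 3(λ x y z → 𝟏 :* x :* y :* z := x :* y :* z)refl _ _ _ · h · 1* _)
   spread : ∀ (φ : ℕ → |R|) → -1^ J * conv⁺ J(λ k _ → φ k) ≈ conv⁺ J(λ k _ → -1^ J * φ k)
   spread φ = sym(conv⁺-*ˡ J(-1^ J)(λ k _ → φ k))
  central-lateral : ∀ y → -1^ J * A.∑0(λ k → A.central k * row(CA.w0 k)y) ≈ SB.∑ₚ y(λ p → B.lateral p * row(CB.w p)(+ 0))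
  central-lateral y = *ˡ(conv-head J(λ k _ → A.central k * row(CA.w0 k)y)) · distribˡ _ _ _
   · +c(single(centralA 0 y)(l0 o(+ m)y(+ J))(l0' o(+ m)y(+ J)) · sym(prodB y J(+ 0)))(spread(λ k → A.central k * row(CA.w0 k)y) ·
   conv⁺-cong J(λ c n e → _·_(doubled{c = suc c}{n = n}e(centralA(suc c)y)(l1(plus-kk(suc c)))(l1'(plus-kk(suc c)))(l2(minus-kk(suc
   c)n e))(l2'(minus-kk(suc c)n e)))(sym(+c(prodB y _(+ 0))(prodB y n(+ 0))))))where
   l0 : ∀ o m y J → ((o +z m) *z(J -z J) *z(J -z J) +z(y +z y) *z(J -z J)) *z + 0 +z o *z((o +z m) *z(J -z J) *z(J -z J) +z(y +z y) *z(J -z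
    J)) +z((y +z(o +z m) *z(J -z J)) +z(y +z(o +z m) *z(J -z J))) *z + 0 ≡ (o *z + 0 *z + 0 +z(+ 0 +z + 0) *z + 0) *z m +z o *z(o *z + 0 *z +
    0 +z(+ 0 +z + 0) *z + 0) +z(o *z + 0 +z o *z + 0) *z y
   l0 = ringℤ
   l0' : ∀ o m y J → ((o +z m) *z(J -z J) *z(J -z J) +z(y +z y) *z(J -z J)) *z + 0 +z o *z((o +z m) *z(J -z J) *z(J -z J) +z(y +z y) *z(J -z
    J)) -z((y +z(o +z m) *z(J -z J)) +z(y +z(o +z m) *z(J -z J))) *z + 0 ≡ (o *z + 0 *z + 0 +z(+ 0 +z + 0) *z + 0) *z m +z o *z(o *z + 0 *z +
    0 +z(+ 0 +z + 0) *z + 0) -z(o *z + 0 +z o *z + 0) *z y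
   l0' = ringℤ
   l1 : ∀ {k c} → k ≡ c → exB y k +z((y +z κ *z k) +z(y +z κ *z k)) *z + 0 ≡ exA(+ 0)c +z(o *z c +z o *z c) *z y
   l1{c = c}rfl = lem o(+ m)y c where
    lem : ∀ o m y c → ((o +z m) *z c *z c +z(y +z y) *z c) *z + 0 +z o *z((o +z m) *z c *z c +z(y +z y) *z c) +z((y +z(o +z m) *z c) +z(y +z(o
     +z m) *z c)) *z + 0 ≡ (o *z c *z c +z(+ 0 +z + 0) *z c) *z m +z o *z(o *z c *z c +z(+ 0 +z + 0) *z c) +z(o *z c +z o *z c) *z y
    lem = ringℤ
   l1' : ∀ {k c} → k ≡ c → exB y k -z((y +z κ *z k) +z(y +z κ *z k)) *z + 0 ≡ exA(+ 0)c +z(o *z c +z o *z c) *z y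
   l1'{c = c}rfl = lem o(+ m)y c where
    lem : ∀ o m y c → ((o +z m) *z c *z c +z(y +z y) *z c) *z + 0 +z o *z((o +z m) *z c *z c +z(y +z y) *z c) -z((y +z(o +z m) *z c) +z(y +z(o
     +z m) *z c)) *z + 0 ≡ (o *z c *z c +z(+ 0 +z + 0) *z c) *z m +z o *z(o *z c *z c +z(+ 0 +z + 0) *z c) +z(o *z c +z o *z c) *z y
    lem = ringℤ
   l2 : ∀ {k c} → k ≡ (-z c) → exB y k +z((y +z κ *z k) +z(y +z κ *z k)) *z + 0 ≡ exA(+ 0)c -z(o *z c +z o *z c) *z y
   l2{c = c}rfl = lem o(+ m)y c where
    lem : ∀ o m y c → ((o +z m) *z(-z c) *z(-z c) +z(y +z y) *z(-z c)) *z + 0 +z o *z((o +z m) *z(-z c) *z(-z c) +z(y +z y) *z(-z c)) +z((y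
     +z(o +z m) *z(-z c)) +z(y +z(o +z m) *z(-z c))) *z + 0 ≡ (o *z c *z c +z(+ 0 +z + 0) *z c) *z m +z o *z(o *z c *z c +z(+ 0 +z + 0) *z c)
     -z(o *z c +z o *z c) *z y
    lem = ringℤ
   l2' : ∀ {k c} → k ≡ (-z c) → exB y k -z((y +z κ *z k) +z(y +z κ *z k)) *z + 0 ≡ exA(+ 0)c -z(o *z c +z o *z c) *z y
   l2'{c = c}rfl = lem o(+ m)y c where
    lem : ∀ o m y c → ((o +z m) *z(-z c) *z(-z c) +z(y +z y) *z(-z c)) *z + 0 +z o *z((o +z m) *z(-z c) *z(-z c) +z(y +z y) *z(-z c)) -z((y
     +z(o +z m) *z(-z c)) +z(y +z(o +z m) *z(-z c))) *z + 0 ≡ (o *z c *z c +z(+ 0 +z + 0) *z c) *z m +z o *z(o *z c *z c +z(+ 0 +z + 0) *z c)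
     -z(o *z c +z o *z c) *z y
    lem = ringℤ
  lateral-central : ∀ x → SA.∑ₚ x(λ p → A.lateral p * row(CA.w p)(+ 0)) ≈ -1^ J * B.∑0(λ k → B.central k * row(CB.w0 k)x)
  lateral-central x = sym(*ˡ(conv-head J(λ k _ → B.central k * row(CB.w0 k)x)) · distribˡ _ _ _
   · +c(single(centralB 0 x)(l0 o(+ m)x(+ J))(l0' o(+ m)x(+ J)) · sym(prodA x J(+ 0)))(spread(λ k → B.central k * row(CB.w0 k)x) ·
   conv⁺-cong J(λ c n e → _·_(doubled{c = suc c}{n = n}e(centralB(suc c)x)(l1(plus-kk(suc c)))(l1'(plus-kk(suc c)))(l2(minus-kk(suc
   c)n e))(l2'(minus-kk(suc c)n e)))(sym(+c(prodA x _(+ 0))(prodA x n(+ 0)))))))where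
   l0 : ∀ o m y J → (o *z(J -z J) *z(J -z J) +z(y +z y) *z(J -z J)) *z m +z o *z(o *z(J -z J) *z(J -z J) +z(y +z y) *z(J -z J)) +z((y +z o
    *z(J -z J)) +z(y +z o *z(J -z J))) *z + 0 ≡ ((o +z m) *z + 0 *z + 0 +z(+ 0 +z + 0) *z + 0) *z + 0 +z o *z((o +z m) *z + 0 *z + 0 +z(+ 0 +z +
    0) *z + 0) +z((o +z m) *z + 0 +z(o +z m) *z + 0) *z y
   l0 = ringℤ
   l0' : ∀ o m y J → (o *z(J -z J) *z(J -z J) +z(y +z y) *z(J -z J)) *z m +z o *z(o *z(J -z J) *z(J -z J) +z(y +z y) *z(J -z J)) -z((y +z o
    *z(J -z J)) +z(y +z o *z(J -z J))) *z + 0 ≡ ((o +z m) *z + 0 *z + 0 +z(+ 0 +z + 0) *z + 0) *z + 0 +z o *z((o +z m) *z + 0 *z + 0 +z(+ 0 +z +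
    0) *z + 0) -z((o +z m) *z + 0 +z(o +z m) *z + 0) *z y
   l0' = ringℤ
   l1 : ∀ {k c} → k ≡ c → exA x k +z((x +z o *z k) +z(x +z o *z k)) *z + 0 ≡ exB(+ 0)c +z(κ *z c +z κ *z c) *z x
   l1{c = c}rfl = lem o(+ m)x c where
    lem : ∀ o m y c → (o *z c *z c +z(y +z y) *z c) *z m +z o *z(o *z c *z c +z(y +z y) *z c) +z((y +z o *z c) +z(y +z o *z c)) *z + 0 ≡ ((o +z
     m) *z c *z c +z(+ 0 +z + 0) *z c) *z + 0 +z o *z((o +z m) *z c *z c +z(+ 0 +z + 0) *z c) +z((o +z m) *z c +z(o +z m) *z c) *z y
    lem = ringℤ
   l1' : ∀ {k c} → k ≡ c → exA x k -z((x +z o *z k) +z(x +z o *z k)) *z + 0 ≡ exB(+ 0)c +z(κ *z c +z κ *z c) *z x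
   l1'{c = c}rfl = lem o(+ m)x c where
    lem : ∀ o m y c → (o *z c *z c +z(y +z y) *z c) *z m +z o *z(o *z c *z c +z(y +z y) *z c) -z((y +z o *z c) +z(y +z o *z c)) *z + 0 ≡ ((o +z
     m) *z c *z c +z(+ 0 +z + 0) *z c) *z + 0 +z o *z((o +z m) *z c *z c +z(+ 0 +z + 0) *z c) +z((o +z m) *z c +z(o +z m) *z c) *z y
    lem = ringℤ
   l2 : ∀ {k c} → k ≡ (-z c) → exA x k +z((x +z o *z k) +z(x +z o *z k)) *z + 0 ≡ exB(+ 0)c -z(κ *z c +z κ *z c) *z x
   l2{c = c}rfl = lem o(+ m)x c where
    lem : ∀ o m y c → (o *z(-z c) *z(-z c) +z(y +z y) *z(-z c)) *z m +z o *z(o *z(-z c) *z(-z c) +z(y +z y) *z(-z c)) +z((y +z o *z(-z c))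
     +z(y +z o *z(-z c))) *z + 0 ≡ ((o +z m) *z c *z c +z(+ 0 +z + 0) *z c) *z + 0 +z o *z((o +z m) *z c *z c +z(+ 0 +z + 0) *z c) -z((o +z m)
     *z c +z(o +z m) *z c) *z y
    lem = ringℤ
   l2' : ∀ {k c} → k ≡ (-z c) → exA x k -z((x +z o *z k) +z(x +z o *z k)) *z + 0 ≡ exB(+ 0)c -z(κ *z c +z κ *z c) *z x
   l2'{c = c}rfl = lem o(+ m)x c where
    lem : ∀ o m y c → (o *z(-z c) *z(-z c) +z(y +z y) *z(-z c)) *z m +z o *z(o *z(-z c) *z(-z c) +z(y +z y) *z(-z c)) -z((y +z o *z(-z c))
     +z(y +z o *z(-z c))) *z + 0 ≡ ((o +z m) *z c *z c +z(+ 0 +z + 0) *z c) *z + 0 +z o *z((o +z m) *z c *z c +z(+ 0 +z + 0) *z c) -z((o +z m)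
     *z c +z(o +z m) *z c) *z y
    lem = ringℤ
  central-central : -1^ J * A.∑0(λ k → A.central k * row(CA.w0 k)(+ 0)) ≈ -1^ J * B.∑0(λ k → B.central k * row(CB.w0 k)(+ 0))
  central-central = *ˡ(conv-cong J(λ k _ _ → _·_(*-assoc³ _ _ _ _)(*ˡ(centralA k(+ 0)
   · *ˡ(+c(T-cong(l o(+ m)(+ k)))(T-cong(l' o(+ m)(+ k)))) · sym(centralB k(+ 0))) · sym(*-assoc³ _ _ _ _)
   · *ʳ(*ʳ(*ʳ(mult k))))))where
   *-assoc³ : ∀ a b c d → a * b * c * d ≈ a * (b * c * d)
   *-assoc³ = solve 4(λ a b c d → a :* b :* c :* d := a :* (b :* c :* d))refl
   mult : ∀ k → A.mult k ≈ B.mult k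
   mult zero = refl
   mult(suc k) = refl
   l : ∀ o m c → (o *z c *z c +z(+ 0 +z + 0) *z c) *z m +z o *z(o *z c *z c +z(+ 0 +z + 0) *z c) +z(o *z c +z o *z c) *z + 0 ≡ ((o +z m) *z c *z c
    +z(+ 0 +z + 0) *z c) *z + 0 +z o *z((o +z m) *z c *z c +z(+ 0 +z + 0) *z c) +z((o +z m) *z c +z(o +z m) *z c) *z + 0
   l = ringℤ
   l' : ∀ o m c → (o *z c *z c +z(+ 0 +z + 0) *z c) *z m +z o *z(o *z c *z c +z(+ 0 +z + 0) *z c) -z(o *z c +z o *z c) *z + 0 ≡ ((o +z m) *z c *z
    c +z(+ 0 +z + 0) *z c) *z + 0 +z o *z((o +z m) *z c *z c +z(+ 0 +z + 0) *z c) -z((o +z m) *z c +z(o +z m) *z c) *z + 0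
   l' = ringℤ
  transposed : ∀ x y → A.entry(+ x)(+ y) ≈ B.entry(+ y)(+ x)
  transposed zero zero = central-central
  transposed zero(suc y) = central-lateral(+ suc y)
  transposed(suc x)zero = lateral-central(+ suc x)
  transposed(suc x)(suc y) = lateral-lateral(+ suc x)(+ suc y)
open import Data.Sum using (_⊎_)
-- O n x: the element x is a power series divisible by t^n.
record Filt(R : Ring)(χ : Char R) : Set1 where
 open CommutativeRing R hiding (zero)
 open Char χ
 field
  O : ℕ → Carrier → Set
  O-cong : ∀ {n x y} → x ≈ y → O n x → O n y
  O-+ : ∀ {n x y} → O n x → O n y → O n(x + y)
  O-* : ∀ {m n x y} → O m x → O n y → O(m +n n)(x * y)
  O-neg : ∀ {n x} → O n x → O n(- x)
  O-0 : ∀ {n} → O n 0#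
  O-≤ : ∀ {m n x} → m ≤ n → O n x → O m x
  O-T : ∀ n → O n(T(+ n))
  O-ι : ∀ n → O 0(ι(+ n))
module Congruences(R : Ring)(χ : Char R)(𝓕 : Filt R χ)where
 open CommutativeRing R hiding (zero) renaming (Carrier to |R|; *-congˡ to *ˡ; *-identityˡ to 1*; *-cong to *c; trans to infixr 1 _·_)
 open Char χ
 open Filt 𝓕
 open RingSolver R
 open Polynomials R
 open Sums R
 open CharProperties R χ
 O-1 : O 0 1#
 O-1 = O-cong T-0(O-T 0)
 O-*0 : ∀ {n x y} → O n x → O 0 y → O n(x * y)
 O-*0{n}p q = O-≤ (N.≤-reflexive(E.sym(N.+-identityʳ n)))(O-* p q)
 O-∏ : ∀ {A : Set}(φ : A → |R|){xs} → All(λ x → O 0(φ x))xs → O 0(∏ φ xs)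
 O-∏ φ [] = O-1
 O-∏ φ(p ∷ ps) = O-* p(O-∏ φ ps)
 O-T≥ : ∀ m n → O n(T(+ (n +n m)))
 O-T≥ m n = O-≤ (N.m≤m+n n m)(O-T(n +n m))
 O-⟦⟧ : ∀ n → O 0 ⟦ + n ⟧
 O-⟦⟧ n = O-+ O-1(O-neg(O-T≥ n 0))
 infix 4 _≈_[_]
 _≈_[_] : |R| → |R| → ℕ → Set
 x ≈ y [ n ] = O n(x - y)
 ≈[]-rfl : ∀ {n x y} → x ≈ y → x ≈ y [ n ]
 ≈[]-rfl e = O-cong(sym(x≈y⇒x-y≈0 e))O-0
 ≈[]-sym : ∀ {n x y} → x ≈ y [ n ] → y ≈ x [ n ]
 ≈[]-sym p = O-cong(solve 2(λ x y → :- (x :- y) := y :- x)refl _ _)(O-neg p)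
 ≈[]-trans : ∀ {n x y z} → x ≈ y [ n ] → y ≈ z [ n ] → x ≈ z [ n ]
 ≈[]-trans p q = O-cong(solve 3(λ x y z → (x :- y) :+ (y :- z) := x :- z)refl _ _ _)(O-+ p q)
 ≈[]-≤ : ∀ {m n x y} → m ≤ n → x ≈ y [ n ] → x ≈ y [ m ]
 ≈[]-≤ = O-≤
 ≈[]-+ : ∀ {n x y z w} → x ≈ y [ n ] → z ≈ w [ n ] → x + z ≈ y + w [ n ]
 ≈[]-+ p q = O-cong(solve 4(λ x y z w → (x :- y) :+ (z :- w) := x :+ z :- (y :+ w))refl _ _ _ _)(O-+ p q)
 ≈[]-* : ∀ {n x y z w} → O 0 z → O 0 y → x ≈ y [ n ] → z ≈ w [ n ] → x * z ≈ y * w [ n ]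
 ≈[]-* oz oy p q = O-cong(solve 4(λ x y z w → (x :- y) :* z :+ (z :- w) :* y := x :* z :- y :* w)refl _ _ _ _)(O-+ (O-*0 p oz)(O-*0 q oy))
 ≈[]-*ʳ : ∀ {n x y z} → O 0 z → x ≈ y [ n ] → x * z ≈ y * z [ n ]
 ≈[]-*ʳ oz p = O-cong(solve 3(λ x y z → (x :- y) :* z := x :* z :- y :* z)refl _ _ _)(O-*0 p oz)
 ≈[]-intg : ∀ {n x y} → O 0 y → x ≈ y [ n ] → O 0 x
 ≈[]-intg oy p = O-cong(solve 2(λ x y → (x :- y) :+ y := x)refl _ _)(O-+ (O-≤ z≤n p)oy)
 ⟦⟧≈1 : ∀ n m → ⟦ + (n +n m) ⟧ ≈ 1# [ n ]
 ⟦⟧≈1 n m = O-cong(solve 1(λ t → :- t := 𝟏 :- t :- 𝟏)refl _)(O-neg(O-T≥ m n))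
 ≈1-* : ∀ {n x y} → x ≈ 1# [ n ] → y ≈ 1# [ n ] → x * y ≈ 1# [ n ]
 ≈1-* p q = ≈[]-trans(≈[]-* (≈[]-intg O-1 q)O-1 p q)(≈[]-rfl(1* 1#))
 ≈1-∏ : ∀ {A : Set}{n}(φ : A → |R|){xs} → All(λ x → φ x ≈ 1# [ n ])xs → ∏ φ xs ≈ 1# [ n ]
 ≈1-∏ φ [] = ≈[]-rfl refl
 ≈1-∏ φ(p ∷ ps) = ≈1-* p(≈1-∏ φ ps)
 conv-≈[] : ∀ {n}N{φ ψ} → (∀ r k → r +n k ≡ N → φ r k ≈ ψ r k [ n ]) → conv N φ ≈ conv N ψ [ n ]
 conv-≈[] zero h = h 0 0 rfl
 conv-≈[](suc N)h = ≈[]-+ (h 0(suc N)rfl)(conv-≈[] N(λ r k e → h(suc r)k(cong suc e)))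
 -- Units of the ring of power series.
 record Unit(x : |R|) : Set where
  field
   intg : O 0 x
   inverse : |R|
   inverse-intg : O 0 inverse
   inverse-law : x * inverse ≈ 1#
 open Unit public
 Unit-* : ∀ {x y} → Unit x → Unit y → Unit(x * y)
 Unit-* u v = record{intg = O-* (intg u)(intg v); inverse = inverse u * inverse v; inverse-intg = O-* (inverse-intg u)(inverse-intg v); inverse-law
  = _·_(*-interchange _ _ _ _)(*c(inverse-law u)(inverse-law v) · 1* 1#)}
 Unit-1 : Unit 1#
 Unit-1 = record{intg = O-1; inverse = 1#; inverse-intg = O-1; inverse-law = 1* 1#}
 Unit-∏ : ∀ {A : Set}(φ : A → |R|){xs} → All(λ x → Unit(φ x))xs → Unit(∏ φ xs)
 Unit-∏ φ [] = Unit-1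
 Unit-∏ φ(u ∷ us) = Unit-* u(Unit-∏ φ us)
 Unit-⟦⟧ : ∀ n → Unit ⟦ + suc n ⟧
 Unit-⟦⟧ n = record{intg = O-⟦⟧ (suc n); inverse = ι(+ suc n); inverse-intg = O-ι(suc n); inverse-law = ι-law(+ suc n)(λ())}
 Unit-cancel : ∀ {n u x y} → Unit u → x * u ≈ y * u [ n ] → x ≈ y [ n ]
 Unit-cancel{n}{u}{x}{y}v p = O-cong(solve 4(λ x y u w → (x :* u :- y :* u) :* w := (x :- y) :* (u :* w))refl _ _ _ _
  · *ˡ(inverse-law v) · *-identityʳ _)(O-*0 p(inverse-intg v))
module Trunc(R : Ring)(χ : Char R)(𝓕 : Filt R χ)(μ J : ℕ)where
 M : ℤ
 M = + suc μ
 open CommutativeRing R hiding (zero) renaming (Carrier to |R|; *-congˡ to *ˡ; *-congʳ to *ʳ; +-congˡ to +ˡ; *-identityˡ to 1*; -‿cong to -ᶜ; *-cong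
  to *c; reflexive to rfx; trans to infixr 1 _·_)
 open Char χ
 open Filt 𝓕
 open RingSolver R
 open Polynomials R
 open Sums R
 open SignedSums R
 open CharProperties R χ
 open Congruences R χ 𝓕
 open Symm R χ M using (g; s)
 open Evals R χ M
 open Bounded R χ M using (symm)
 open SplitSums R χ ( M +z M ) using (x∏)
 open HallLittlewood R χ ( M +z M ) using (X)
 open ChainSteps R χ M hiding (X)
 open ConfigSteps R χ M J
 open ConfigWeights R χ M J
 open ConfigSums R χ M J
 -- |2i| < M
 record Small(i : ℤ) : Set where
  constructor small
  field
   above below : ℕ
   above-eq : M ≡ (i +z i) +z + suc above
   below-eq : M ≡ -z(i +z i) +z + suc below
 open Small
 Small-neg : ∀ {i} → Small i → Small(-z i)
 Small-neg{i}(small u v e f) = small v u(E.trans f(lem1 i(+ suc v)))(E.trans e(lem2 i(+ suc u)))where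
  lem1 : ∀ i v → -z(i +z i) +z v ≡ (-z i +z -z i) +z v
  lem1 = ringℤ
  lem2 : ∀ i v → (i +z i) +z v ≡ -z(-z i +z -z i) +z v
  lem2 = ringℤ
 Small-0 : Small(+ 0)
 Small-0 = small μ μ rfl rfl
 intg-s⁻ : ∀ n → O 1(s(-z(+ suc n)))
 intg-s⁻ n = O-cong(*ʳ(-ᶜ(+ˡ(T-cong(lem e M) · T-+ e(M -z e)) · solve 2(λ a b → a :+ a :* b := a :* (𝟏 :+ b))refl _ _))
  · *ʳ(sym(s-neg-law{e}(λ()))) · *-assoc _ _ _ · *ˡ(ι-law e(λ())) · *-identityʳ _)(O-*0(O-neg(O-+ (O-T≥ n 1)(O-T≥ μ 1)))(O-ι(suc n)))
  where
  e = + suc n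
  lem : ∀ e M → M ≡ e +z(M -z e)
  lem = ringℤ
 intg-s⁺ : ∀ n → O 0(s(+ n))
 intg-s⁺ n = O-* (O-+ O-1(O-T≥ (suc μ +n n)0))(O-ι n)
 intg-s : ∀ c → O 0(s c)
 intg-s(+ n) = intg-s⁺ n
 intg-s -[1+ n ] = O-≤ z≤n(intg-s⁻ n)
 intg-ι : ∀ c → O 0(⟦ D +z c ⟧ * ι c)
 intg-ι(+ n) = O-* (O-⟦⟧ (suc μ +n suc μ +n n))(O-ι n)
 intg-ι -[1+ n ] = O-cong(*ʳ(-ᶜ(+ˡ(-ᶜ(T-cong(lem e D) · T-+ e(D -z e))) · solve 2(λ a b → a :- a :* b := a :* (𝟏 :- b))refl _ _))
  · *ʳ(-ᶜ(*ˡ(sym(*ˡ(ι-law(-z e)(λ())) · *-identityʳ _)))) · *ʳ(solve 4(λ t c n i → :- (t :* (c :* (n :* i))) := c :* i :* (:- (t :* n)))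
  refl _ _ _ _) · *ʳ(*ˡ(sym(⟦neg⟧ -[1+ n ]))) · *-assoc _ _ _ · *ˡ(ι-law e(λ()))
  · *-identityʳ _)(O-* (O-neg(O-+ (O-T≥ (suc n)0)(O-neg(O-T≥ (suc μ +n suc μ)0))))(O-ι(suc n)))where
  e = + suc n
  c = D +z -[1+ n ]
  lem : ∀ e D → D ≡ e +z(D -z e)
  lem = ringℤ
 intg-pairs : ∀ cs → O 0(pairs g cs)
 intg-pairs [] = O-1
 intg-pairs(c ∷ cs) = O-* (O-∏ (g c)(All.universal(λ d → intg-ι(c +z d))cs))(intg-pairs cs)
 intg-∏s : ∀ cs → O 0(∏ s cs)
 intg-∏s cs = O-∏ s(All.universal intg-s cs)
 intg-Ξ : ∀ cs → O 0(Ξ cs)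
 intg-Ξ cs = O-* (intg-∏s cs)(intg-pairs cs)
 negs-order : ∀ q c → O c(∏ s(negs(run(+ suc q)c)))
 negs-order q zero = O-1
 negs-order q(suc c) = O-* (intg-s⁻ q)(negs-order(q +n(suc μ +n suc μ))c)
 run-order : ∀ x q c l → x ≡ D -z(+ suc q) -z D *z + c → O c(∏ s(run x(c +n l)))
 run-order x q c l rfl = O-cong(*ʳ(∏-↭ s(negs-run(+ suc q)c)) · sym(∏-++ s(run x c)_)
  · rfx(cong(∏ s)(E.sym(run-++ x c l))))(O-*0(negs-order q c)(intg-∏s(run(x +z D *z + c)l)))
 -- |b - J| and J - |b - J|.
 record Shift(p : Pair) : Set where
  constructor shifted
  field
   c r : ℕ
   c+r : c +n r ≡ J
   side : (b p ≡ J +n c × a p ≡ r) ⊎ (b p ≡ r × a p ≡ J +n c)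
 open Shift using (c; r)
 Total⇒Shift : ∀ p → Total p → Shift p
 Total⇒Shift(pair i b a)t with N.≤-total b J
 ... | inj₁ b≤J = shifted(J ℕ.∸ b)b(N.m∸n+n≡m b≤J)(inj₂(rfl , (N.+-cancelˡ-≡ b _ _(E.trans t(E.sym(E.trans(cong(b +n_)(N.+-comm J _))
  (E.trans(E.sym(N.+-assoc b _ J))(cong(_+n J)(N.m+[n∸m]≡n b≤J)))))))))
 ... | inj₂ J≤b = shifted(b ℕ.∸ J)a(N.+-cancelˡ-≡ J _ _(E.trans(E.sym(N.+-assoc J _ a))(E.trans(cong(_+n a)(N.m+[n∸m]≡n J≤b))t)))(inj₁
  (E.sym(N.m+[n∸m]≡n J≤b) , rfl))
 conf-order : ∀ p → Small(i p) → (h : Shift p) → O(c h)(∏ s(conf p))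
 conf-order(pair i b a)sm(shifted c r e(inj₁(rfl , rfl))) = O-cong(*-comm _ _
  · sym(∏-++ s(run(M +z w p)r)(run(M -z w p)(J +n c))))(O-*0(subst(λ n → O c(∏ s(run(M -z w p)n)))(N.+-comm c J)(run-order(M -z w p)
  (Small.below sm)c J(E.trans(lem M i(+ J)(+ c))(cong(λ x → D -z x -z D *z + c)origin))))(intg-∏s(run(M +z w p)r)))where
  p = pair i(J +n c)r
  origin : M +z(i +z i) ≡ + suc(Small.below sm)
  origin = E.trans(cong(λ x → x +z(i +z i))(below-eq sm))(lem' i _)where
   lem' : ∀ i v → -z(i +z i) +z v +z(i +z i) ≡ v
   lem' = ringℤ
  lem : ∀ M i J c → M -z((i +z M *z(J +z c -z J)) +z(i +z M *z(J +z c -z J))) ≡ (M +z M) -z(M +z(i +z i)) -z(M +z M) *z c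
  lem = ringℤ
 conf-order(pair i b a)sm(shifted c r e(inj₂(rfl , rfl))) = O-cong(sym(∏-++ s(run(M +z w p)(J +n c))(run(M -z w p)r)))(O-*0(subst(λ n
  → O c(∏ s(run(M +z w p)n)))(N.+-comm c J)(run-order(M +z w p)(Small.above sm)c J(E.trans(cong(λ J → M +z((i +z M *z(+ r -z J)) +z(i
  +z M *z(+ r -z J))))(cong +_(E.sym e)))(E.trans(lem M i(+ c)(+ r))(cong(λ x → D -z x -z D *z + c)origin)))))(intg-∏s(run(M -z w p)r)))
  where
  p = pair i r(J +n c)
  origin : M -z(i +z i) ≡ + suc(Small.above sm)
  origin = E.trans(cong(λ x → x -z(i +z i))(above-eq sm))(lem' i _)where
   lem' : ∀ i v → (i +z i) +z v -z(i +z i) ≡ v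
   lem' = ringℤ
  lem : ∀ M i c r → M +z((i +z M *z(r -z(c +z r))) +z(i +z M *z(r -z(c +z r)))) ≡ (M +z M) -z(M -z(i +z i)) -z(M +z M) *z c
  lem = ringℤ
 Brackets : ℕ → ℤ → Set
 Brackets l x = ∃ λ q → x ≡ + suc(l +n q)
 Brackets-unit : ∀ {l x} → Brackets l x → Unit ⟦ x ⟧
 Brackets-unit{l}(q , rfl) = Unit-⟦⟧ (l +n q)
 Brackets-≈1 : ∀ {l x} → Brackets l x → ⟦ x ⟧ ≈ 1# [ suc l ]
 Brackets-≈1{l}(q , rfl) = ⟦⟧≈1(suc l)q
 φ-brackets : ∀ {i is}l → Small i → All Small is → Brackets l((i +z i) +z D *z + suc l) × All(λ i′ → Brackets l((i +z i) +z D *z + suc l +z(i′ +z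
  i′)) × Brackets l((i +z i) +z D *z + suc l -z(i′ +z i′)))is
 φ-brackets{i}l(small u v e f)sms = (v +n suc μ +n l +n(μ +n μ) *n l , E.trans(lem0 M(i +z i)(+ l))(E.trans(cong(λ x → x +z M +z(M +z M)
  *z + l)(shift₋ i f))(E.trans(pos0(+ μ)(+ v)(+ l))(cong(λ x → + 1 +z(+ l +z(+ v +z(+ 1 +z + μ) +z + l +z x)))(E.sym(Z.pos-* (μ +n μ)
  l)))))) , All.map(λ{i′} → both i′)sms where
  shift₋ : ∀ {v}i → M ≡ -z(i +z i) +z + suc v → (i +z i) +z M ≡ + suc v
  shift₋ i f = E.trans(cong(λ x → (i +z i) +z x)f)(lem i _)where
   lem : ∀ i v → (i +z i) +z(-z(i +z i) +z v) ≡ v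
   lem = ringℤ
  lem0 : ∀ M i l → i +z(M +z M) *z(+ 1 +z l) ≡ i +z M +z M +z(M +z M) *z l
  lem0 = ringℤ
  pos0 : ∀ μ v l → (+ 1 +z v) +z(+ 1 +z μ) +z((+ 1 +z μ) +z(+ 1 +z μ)) *z l ≡ + 1 +z(l +z(v +z(+ 1 +z μ) +z l +z(μ +z μ) *z l))
  pos0 = ringℤ
  pos1 : ∀ μ v v' l → (+ 1 +z v) +z(+ 1 +z v') +z((+ 1 +z μ) +z(+ 1 +z μ)) *z l ≡ + 1 +z(l +z(v +z(+ 1 +z v') +z l +z(μ +z μ) *z l))
  pos1 = ringℤ
  one : ∀ v'{y}i′ → (i′ +z i′) +z M ≡ + suc v' → y ≡ i′ +z i′ → Brackets l((i +z i) +z D *z + suc l +z y)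
  one v' i′ g rfl = v +n suc v' +n l +n(μ +n μ) *n l , E.trans(lem M(i +z i)(i′ +z i′)(+ l))(E.trans(cong₂(λ x y → x +z y +z(M +z M) *z + l)
   (shift₋ i f)g)(E.trans(pos1(+ μ)(+ v)(+ v')(+ l))(cong(λ x → + 1 +z(+ l +z(+ v +z(+ 1 +z + v') +z + l +z x)))(E.sym(Z.pos-* (μ +n μ)
   l)))))where
   lem : ∀ M i i′ l → i +z(M +z M) *z(+ 1 +z l) +z i′ ≡ (i +z M) +z(i′ +z M) +z(M +z M) *z l
   lem = ringℤ
  both : ∀ i′ → Small i′ → Brackets l((i +z i) +z D *z + suc l +z(i′ +z i′)) × Brackets l((i +z i) +z D *z + suc l -z(i′ +z i′))
  both i′ sm@(small u' v' e' f') = one v' i′ (shift₋ i′ f')rfl , one u'(-z i′)(shift₋ (-z i′)(below-eq(Small-neg sm)))(lem i′)where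
   lem : ∀ i → -z(i +z i) ≡ -z i +z -z i
   lem = ringℤ
 module Shifting(is : List ℤ)(sms : All Small is)where
  φ-unit : ∀ {i}l → Small i → Unit(φ i is(suc l))
  φ-unit l sm with φ-brackets l sm sms
  ... | x , xs = Unit-* (Brackets-unit x)(Unit-∏ _(All.map(λ(y , z) → Unit-* (Brackets-unit y)(Brackets-unit z))xs))
  φ-≈1 : ∀ {i}l → Small i → φ i is(suc l) ≈ 1# [ suc l ]
  φ-≈1 l sm with φ-brackets l sm sms
  ... | x , xs = ≈1-* (Brackets-≈1 x)(≈1-∏ _(All.map(λ(y , z) → ≈1-* (Brackets-≈1 y)(Brackets-≈1 z))xs))
  Φ-unit : ∀ {i}l → Small i → Unit(Φ i is l)
  Φ-unit zero sm = Unit-1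
  Φ-unit(suc l)sm = Unit-* (Φ-unit l sm)(φ-unit l sm)
  Φ-≈ : ∀ {i}l d → Small i → Φ i is(l +n d) ≈ Φ i is l [ l ]
  Φ-≈ {i}l zero sm = ≈[]-rfl(rfx(cong(Φ i is)(N.+-identityʳ l)))
  Φ-≈ {i}l(suc d)sm = ≈[]-trans(≈[]-rfl(rfx(cong(Φ i is)(N.+-suc l d))))(≈[]-trans(≈[]-* (intg(φ-unit(l +n d)sm))(intg(Φ-unit l sm))
   (Φ-≈ l d sm)(≈[]-≤ (N.m≤n⇒m≤1+n(N.m≤m+n l d))(φ-≈1(l +n d)sm)))(≈[]-rfl(*-identityʳ _)))
  Φ-up : ∀ {i}c r → c +n r ≡ J → Small i → Φ i is(J +n c) ≈ Φ i is J [ r ]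
  Φ-up c r rfl sm = ≈[]-≤ (N.m≤n+m r c)(Φ-≈ (c +n r)c sm)
  Φ-down : ∀ {i}c r → c +n r ≡ J → Small i → Φ i is r ≈ Φ i is J [ r ]
  Φ-down{i}c r rfl sm = ≈[]-sym(≈[]-trans(≈[]-rfl(rfx(cong(Φ i is)(N.+-comm c r))))(Φ-≈ r c sm))
  Φ2 : Pair → |R|
  Φ2 p = Φ(-z i p)is(a p) * Φ(i p)is(b p)
  Φ2-unit : ∀ p → Small(i p) → Unit(Φ2 p)
  Φ2-unit p sm = Unit-* (Φ-unit(a p)(Small-neg sm))(Φ-unit(b p)sm)
  base : Pair → Pair
  base p = pair(i p)J J
  Φ2-≈ : ∀ p → Small(i p) → (h : Shift p) → Φ2 p ≈ Φ2(base p) [ r h ]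
  Φ2-≈ (pair i _ _)sm(shifted c r e(inj₁(rfl , rfl))) = ≈[]-* (intg(Φ-unit{i}(J +n c)sm))(intg(Φ-unit{ -z i}J(Small-neg sm)))(Φ-down{ -z
   i}c r e(Small-neg sm))(Φ-up{i}c r e sm)
  Φ2-≈ (pair i _ _)sm(shifted c r e(inj₂(rfl , rfl))) = ≈[]-* (intg(Φ-unit{i}r sm))(intg(Φ-unit{ -z i}J(Small-neg sm)))(Φ-up{ -z i}c r e
   (Small-neg sm))(Φ-down{i}c r e sm)
  moves : ∀ {ps} → All Shift ps → ℕ
  moves [] = 0
  moves(h ∷ hs) = c h +n moves hs
  confs-order : ∀ {ps} → All(λ p → Small(i p))ps → (hs : All Shift ps) → O(moves hs)(∏ s(confs ps))
  confs-order [] [] = O-1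
  confs-order{p ∷ ps}(sm ∷ sms)(h ∷ hs) = O-cong(sym(∏-++ s(conf p)(confs ps)))(O-* (conf-order p sm h)(confs-order sms hs))
  -- A factor t^|k| compensates that the end factors of a configuration agree with those of the
  -- base configuration only up to t^(J - |k|).
  compensate : ∀ {ps x} → All(λ p → Small(i p))ps → (hs : All Shift ps) → O(moves hs)x → x * ∏ Φ2 ps ≈ x * ∏ Φ2(map base ps) [ J ]
  compensate [] [] o = ≈[]-rfl refl
  compensate{p ∷ ps}{x}(sm ∷ sms)(h@(shifted c r e _) ∷ hs)o = O-cong(solve 5(λ x a b p q → x :* (a :- b) :* p :+ ((x :* b) :* p :- (x :* b) :*
   q) := x :* (a :* p) :- x :* (b :* q))refl x(Φ2 p)(Φ2(base p))_ _)(O-+ (O-*0(O-≤ (subst(J ≤_)(lem c r(moves hs))(N.≤-trans(N.≤-reflexive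
   (E.sym e))(N.m≤m+n(c +n r)(moves hs))))(O-* o(Φ2-≈ p sm h)))(O-∏ Φ2(All.map(λ{q}sm → intg(Φ2-unit q sm))sms)))(compensate sms hs(O-*0
   (O-≤ (N.m≤n+m(moves hs)c)o)(intg(Φ2-unit(base p)sm)))))where
   lem : ∀ c r z → c +n r +n z ≡ c +n z +n r
   lem c r z = E.trans(N.+-assoc c r z)(E.trans(cong(c +n_)(N.+-comm r z))(E.sym(N.+-assoc c z r)))
  Φ0 : ℕ → ℕ → |R|
  Φ0 k l = Φ(+ 0)is l * Φ(+ 0)is(J +n k)
  compensate0 : ∀ {ps x k l} → k +n l ≡ J → All(λ p → Small(i p))ps → (hs : All Shift ps) → O(k +n moves hs)x → x * (Φ0 k l * ∏ Φ2 ps) ≈ x * (Φ0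
   0 J * ∏ Φ2(map base ps)) [ J ]
  compensate0{ps}{x}{k}{l}e sms hs o = ≈[]-trans(≈[]-rfl(sym(*-assoc _ _ _)))(≈[]-trans(compensate sms hs(O-*0(O-≤ (N.m≤n+m(moves hs)k)
   o)(intg(Unit-* (Φ-unit l Small-0)(Φ-unit(J +n k)Small-0)))))(O-cong(solve 4(λ x a b p → x :* (a :- b) :* p := (x :* a) :* p :- x :* (b :*
   p))refl x(Φ0 k l)(Φ0 0 J)_)(O-*0(O-≤ (subst(_≤ k +n moves hs +n l)e(N.+-monoˡ-≤ l(N.m≤m+n k(moves hs))))(O-* o(≈[]-trans(≈[]-* (intg
   (Φ-unit(J +n k)Small-0))(intg(Φ-unit J Small-0))(Φ-down{+ 0}k l e Small-0)(Φ-up{+ 0}k l e Small-0))(≈[]-rfl(*ˡ(rfx(cong(Φ(+ 0)is)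
   (E.sym(N.+-identityʳ J)))))))))(O-∏ Φ2(Allₚ.map⁺ (All.map(λ{q}sm → intg(Φ2-unit(base q)sm))sms))))))
  ∑ₚ-≈[] : ∀ {n G H}j → (∀ p → i p ≡ j → Total p → G p ≈ H p [ n ]) → ∑ₚ j G ≈ ∑ₚ j H [ n ]
  ∑ₚ-≈[]{n}{G}{H}j h = ≈[]-+ (h _ rfl rfl)(go J(λ c r e → ≈[]-+ (h _ rfl(t c r e))(h _ rfl(E.trans(N.+-comm r _)(t c r e)))))where
   t : ∀ c r → c +n r ≡ J → (J +n c) +n r ≡ J +n J
   t c r rfl = N.+-assoc(c +n r)c r
   go : ∀ N{φ ψ : ℕ → ℕ → |R|} → (∀ c r → c +n r ≡ N → φ c r ≈ ψ c r [ n ]) → conv⁺ N φ ≈ conv⁺ N ψ [ n ]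
   go zero h = ≈[]-rfl refl
   go(suc N)h = conv-≈[] N(λ r k e → h(suc r)k(cong suc e))
  ∑ₚ*-≈[] : ∀ {n G H}js → (∀ ps → inds ps ≡ js → All Total ps → G ps ≈ H ps [ n ]) → ∑ₚ* js G ≈ ∑ₚ* js H [ n ]
  ∑ₚ*-≈[] [] h = h [] rfl []
  ∑ₚ*-≈[](j ∷ js)h = ∑ₚ-≈[] j(λ p e t → ∑ₚ*-≈[] js(λ ps es ts → h(p ∷ ps)(cong₂ _∷_ e es)(t ∷ ts)))
 D≢0 : D ≢ + 0
 D≢0()
 module Configured(m : ℕ)(is : List ℤ)(sms : All Small is)where
  open Shifting is sms
  Φ• : ℕ → ℕ → List Pair → |R|
  Φ• k l ps = Φ0 k l * ∏ Φ2 ps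
  ps0 : List Pair
  ps0 = base-pairs D≢0 is
  weighted : |R|
  weighted = conv J(λ k l → weight m(+ 0)(+ k) * ∑ₚ* is(λ ps → weights m ps * Ξ(conf0 k l ++ confs ps) * Φ• k l ps))
  smalls : ∀ ps → inds ps ≡ is → All(λ p → Small(i p))ps
  smalls ps rfl = Allₚ.map⁻ sms
  bases : ∀ ps → inds ps ≡ is → map base ps ≡ ps0
  bases ps rfl = map-∘ ps where open import Data.List.Properties using (map-∘)
  intg-X : ∀ x q c → x ≡ + suc q → O 0(X m(run x c))
  intg-X x q c e = power m(subst(λ x → O 0(x∏ (run x c)))(E.sym e)(go q c))where
   go : ∀ q c → O 0(x∏ (run(+ suc q)c))
   go q zero = O-1
   go q(suc c) = O-* (O-T≥ (suc q)0)(go(q +n(suc μ +n suc μ))c)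
   power : ∀ n{x} → O 0 x → O 0(x ^ᵣ n)
   power zero o = O-1
   power(suc n)o = O-* o(power n o)
  intg-weight⁺ : ∀ {i}c → Small i → O 0(weight m i(+ c))
  intg-weight⁺ {i}c(small u v e f) = O-cong(X-run m i c)(intg-X(M +z(i +z i))v c(E.trans(cong(λ x → x +z(i +z i))f)(lem i(+ suc v))))
   where
   lem : ∀ i v → -z(i +z i) +z v +z(i +z i) ≡ v
   lem = ringℤ
  intg-weight : ∀ i k → Small i → O 0(weight m i k)
  intg-weight i(+ c)sm = intg-weight⁺ c sm
  intg-weight i -[1+ c ] sm = O-cong(T-cong(cong(λ x → x *z + m)(lem M i(+ suc c))))(intg-weight⁺ (suc c)(Small-neg sm))where
   lem : ∀ M i c → M *z c *z c +z(-z i +z -z i) *z c ≡ M *z(-z c) *z(-z c) +z(i +z i) *z(-z c)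
   lem = ringℤ
  Ξ-order : ∀ k l{ps} → All(λ p → Small(i p))ps → (hs : All Shift ps) → O(k +n moves hs)(Ξ(conf0 k l ++ confs ps))
  Ξ-order k l{ps}sm hs = O-*0(O-cong(sym(∏-++ s(conf0 k l)(confs ps)))(O-* (O-cong(sym(∏-++ s(run(M -z w0 k)k)(run(M +z w0 k)l)))
   (O-*0(subst(λ n → O k(∏ s(run(M -z w0 k)n)))(N.+-identityʳ k)(run-order(M -z w0 k)μ k 0(lem M(+ k))))(intg-∏s(run(M +z w0 k)l))))
   (confs-order sm hs)))(intg-pairs(conf0 k l ++ confs ps))where
   lem : ∀ M k → M -z(M *z k +z M *z k) ≡ (M +z M) -z M -z(M +z M) *z k
   lem = ringℤ
  symm≈weighted : symm m(elements is) * Φ• 0 J ps0 ≈ weighted [ J ]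
  symm≈weighted = ≈[]-trans(≈[]-rfl(*-comm _ _ · *ˡ(symm-elements m is) · sym(conv-*ˡ J F _)
   · conv-cong J(λ k l _ → _·_(solve 3(λ f w s → f :* (w :* s) := w :* (f :* s))refl _ _ _)(*ˡ(sym(∑ₚ*-*ˡ is F _)
   · ∑ₚ*-cong is(λ ps _ _ → *-comm _ _))))))(conv-≈[] J(λ k l e → ≈[]-*ˡ(intg-weight(+ 0)(+ k)Small-0)(∑ₚ*-≈[] is(λ ps es ts → ≈[]-sym(subst
   (λ qs → weights m ps * Ξ(conf0 k l ++ confs ps) * Φ• k l ps ≈ weights m ps * Ξ(conf0 k l ++ confs ps) * Φ• 0 J qs [ J ])(bases ps es)
   (compensate0 e(smalls ps es)(All.map(λ{p} → Total⇒Shift p)ts)(O-* (O-∏ (weightₚ m)(All.map(λ{p} → intg-weight(i p)(+ b p -z + J))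
   (smalls ps es)))(Ξ-order k l(smalls ps es)(All.map(λ{p} → Total⇒Shift p)ts)))))))))where
   F = Φ• 0 J ps0
   ≈[]-*ˡ : ∀ {n x y z} → O 0 z → x ≈ y [ n ] → z * x ≈ z * y [ n ]
   ≈[]-*ˡ o p = O-cong(solve 3(λ x y z → (x :- y) :* z := z :* x :- z :* y)refl _ _ _)(O-*0 p o)
  Ξ-base : Ξ(conf0 0 J ++ confs ps0) ≈ Ξ(elements is)
  Ξ-base = rfx(cong₂(λ x y → Ξ(run x J ++ y))(lem M)(go is))where
   lem : ∀ M → M +z(M *z + 0 +z M *z + 0) ≡ M
   lem = ringℤ
   lem' : ∀ M i J → (i +z M *z(J -z J)) +z(i +z M *z(J -z J)) ≡ i +z i
   lem' = ringℤ
   go : ∀ js → confs(map(λ i → pair i J J)js) ≡ concatMap chain-pair js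
   go [] = rfl
   go(j ∷ js) = cong₂ _++_(cong(λ x → run(M +z x)J ++ run(M -z x)J)(lem' M j(+ J)))(go js)
  Λ-base : Λ D≢0 0 ps0 ≈ ∏ (λ _ → -1^ J)is * V(+ 0 ∷ map(λ i → i +z i)is)
  Λ-base = *c(*c(one(odd ρ)(lem0 M))(∏-map _ _ is) · 1* _ · ∏-cong(λ i → _·_(*ˡ(T-cong(lem1(odd ρ)M i(+ J))))(*ˡ T-0
   · *-identityʳ _))is)(rfx(cong₂(λ x y → V(x ∷ y))(lem2 M)(go is)))where
   ρ = length ps0
   lem0 : ∀ M → M *z + 0 *z + 0 +z(+ 0 +z + 0) *z + 0 ≡ + 0
   lem0 = ringℤ
   one : ∀ o{e} → e ≡ + 0 → 1# * T(o *z e) ≈ 1#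
   one o rfl = 1* _ · T-cong(Z.*-zeroʳ o) · T-0
   lem1 : ∀ o M i J → o *z(M *z(J -z J) *z(J -z J) +z(i +z i) *z(J -z J)) ≡ + 0
   lem1 = ringℤ
   lem2 : ∀ M → M *z + 0 +z M *z + 0 ≡ + 0
   lem2 = ringℤ
   lem3 : ∀ M i J → (i +z M *z(J -z J)) +z(i +z M *z(J -z J)) ≡ i +z i
   lem3 = ringℤ
   go : ∀ js → map w(map(λ i → pair i J J)js) ≡ map(λ i → i +z i)js
   go [] = rfl
   go(j ∷ js) = cong₂ _∷_(lem3 M j(+ J))(go js)
 off-small : ∀ n q → D ≡ + suc n +z + suc q → Off(+ suc n)
 off-small n q e = off λ{(+ k)h → bad1 k h; -[1+ k ] h → bad2 k(E.trans(E.sym(lem(+ n)(+ q)(+ k)))(E.trans(cong(λ D → + suc n +z D *z -[1+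
  k ])(E.sym e))h))}where
  bad1 : ∀ k → + suc n +z D *z + k ≢ + 0
  bad1 k h with E.trans(cong(λ x → + suc n +z x)(Z.pos-* (suc μ +n suc μ)k))h
  ... | ()
  bad2 : ∀ k → -z(+ 1 +z + q +z(+ suc n +z + suc q) *z + k) ≢ + 0
  bad2 k h with E.trans(cong(λ x → -z(+ suc q +z x))(Z.pos-* (suc n +n suc q)k))h
  ... | ()
  lem : ∀ n q k → (+ 1 +z n) +z((+ 1 +z n) +z(+ 1 +z q)) *z(-z(+ 1 +z k)) ≡ -z(+ 1 +z q +z((+ 1 +z n) +z(+ 1 +z q)) *z k)
  lem = ringℤ
 -- The indices 1, …, ρ are admissible as soon as 2r < M.
 module _(ρ d : ℕ)(μ≡ : μ ≡ ρ +n ρ +n d)where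
  private
   M≡ : ∀ {j e} → suc j +n e ≡ ρ → M ≡ + 1 +z(+ suc j +z + e) +z(+ suc j +z + e) +z + d
   M≡ rfl = cong(λ x → + suc x)μ≡
   down⁺-All : {P : ℤ → Set} → (∀ j e → suc j +n e ≡ ρ → P(+ suc j)) → ∀ t e → t +n e ≡ ρ → All P(down⁺ t)
   down⁺-All f zero e h = []
   down⁺-All f(suc t)e h = f t e h ∷ down⁺-All f t(suc e)(E.trans(N.+-suc t e)h)
   below-All : ∀ {P : ℤ → Set}t → (∀ j e → suc j +n e ≡ t → P(+ suc j)) → ∀ t' e → t' +n e ≡ t → All P(down⁺ t')
   below-All t f zero e h = []
   below-All t f(suc t')e h = f t' e h ∷ below-All t f t'(suc e)(E.trans(N.+-suc t' e)h)
  down-small : All Small(down⁺ ρ)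
  down-small = down⁺-All(λ j e h → small(e +n e +n d)(μ +n suc j +n suc j)(E.trans(M≡ {j}{e}h)(lem1(+ suc j)(+ e)(+ d)))(lem2(+ μ)(+ suc
   j)))ρ 0(N.+-identityʳ ρ)where
   lem1 : ∀ j e d → + 1 +z(j +z e) +z(j +z e) +z d ≡ (j +z j) +z(+ 1 +z(e +z e +z d))
   lem1 = ringℤ
   lem2 : ∀ μ j → + 1 +z μ ≡ -z(j +z j) +z(+ 1 +z(μ +z j +z j))
   lem2 = ringℤ
  admissible : Adm D≢0(down⁺ ρ)
  admissible = down⁺-All(λ j e h → off-small(j +n suc j)(suc j +n suc j +n e +n e +n e +n e +n d +n d +n 1)(E.trans(cong₂ _+z_(M≡ {j}{e}h)(M≡
   {j}{e}h))(lem1(+ j)(+ e)(+ d))) , off-small(j +n suc j +n(suc j +n suc j))(e +n e +n e +n e +n d +n d +n 1)(E.trans(cong₂ _+z_(M≡ {j}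
   {e}h)(M≡ {j}{e}h))(lem2(+ j)(+ e)(+ d))))ρ 0(N.+-identityʳ ρ) , apart ρ 0(N.+-identityʳ ρ)where
   lem1 : ∀ j e d → (+ 1 +z(+ 1 +z j +z e) +z(+ 1 +z j +z e) +z d) +z(+ 1 +z(+ 1 +z j +z e) +z(+ 1 +z j +z e) +z d) ≡ (+ 1 +z(j +z(+ 1 +z j)))
    +z(+ 1 +z((+ 1 +z j) +z(+ 1 +z j) +z e +z e +z e +z e +z d +z d +z + 1))
   lem1 = ringℤ
   lem2 : ∀ j e d → (+ 1 +z(+ 1 +z j +z e) +z(+ 1 +z j +z e) +z d) +z(+ 1 +z(+ 1 +z j +z e) +z(+ 1 +z j +z e) +z d) ≡ (+ 1 +z(j +z(+ 1 +z j) +z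
    ((+ 1 +z j) +z(+ 1 +z j)))) +z(+ 1 +z(e +z e +z e +z e +z d +z d +z + 1))
   lem2 = ringℤ
   -- t = j + 1 + e is the index below t + 1, and e₀ = ρ - t - 1.
   apart1 : ∀ j e e0 → (suc j +n e) +n suc e0 ≡ ρ → Apart' D≢0(+ suc(suc j +n e))(+ suc j)
   apart1 j e e0 rfl = off-small(suc j +n e +n suc(suc j +n e) +n(suc j +n suc j))(e +n e +n 3 +n e0 +n e0 +n e0 +n e0 +n d +n d)(E.trans(cong
    (λ x → + suc x +z + suc x)μ≡)(lem(+ j)(+ e)(+ e0)(+ d))) , subst Off(diff(+ suc j)(+ e))(off-small(e +n suc e)(j +n j +n j +n j +n 7
    +n e +n e +n e0 +n e0 +n e0 +n e0 +n d +n d)(E.trans(cong(λ x → + suc x +z + suc x)μ≡)(lem'(+ j)(+ e)(+ e0)(+ d))))where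
    diff : ∀ j e → (+ 1 +z(e +z(+ 1 +z e))) ≡ ((+ 1 +z(j +z e)) +z(+ 1 +z(j +z e))) -z(j +z j)
    diff = ringℤ
    lem : ∀ j e e0 d → (+ 1 +z((+ 1 +z j +z e +z(+ 1 +z e0)) +z(+ 1 +z j +z e +z(+ 1 +z e0)) +z d)) +z(+ 1 +z((+ 1 +z j +z e +z(+ 1 +z e0)) +z
     (+ 1 +z j +z e +z(+ 1 +z e0)) +z d)) ≡ (+ 1 +z(+ 1 +z j +z e +z(+ 1 +z(+ 1 +z j +z e)) +z((+ 1 +z j) +z(+ 1 +z j)))) +z(+ 1 +z(e +z e +z
     + 3 +z e0 +z e0 +z e0 +z e0 +z d +z d))
    lem = ringℤ
    lem' : ∀ j e e0 d → (+ 1 +z((+ 1 +z j +z e +z(+ 1 +z e0)) +z(+ 1 +z j +z e +z(+ 1 +z e0)) +z d)) +z(+ 1 +z((+ 1 +z j +z e +z(+ 1 +z e0)) +z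
     (+ 1 +z j +z e +z(+ 1 +z e0)) +z d)) ≡ (+ 1 +z(e +z(+ 1 +z e))) +z(+ 1 +z(j +z j +z j +z j +z + 7 +z e +z e +z e0 +z e0 +z e0 +z e0 +z d +z
     d))
    lem' = ringℤ
   apart : ∀ t e0 → t +n e0 ≡ ρ → AllPairs(Apart' D≢0)(down⁺ t)
   apart zero e0 h = []
   apart(suc t)e0 h = below-All t(λ j e h' → subst(λ t → Apart' D≢0(+ suc t)(+ suc j))h'(apart1 j e e0(E.trans(cong(_+n suc e0)h')
    (E.trans(N.+-suc t e0)h))))t 0(N.+-identityʳ t) ∷ apart t(suc e0)(E.trans(N.+-suc t e0)h)
 module Weighted(m ρ d : ℕ)(μ≡ : μ ≡ ρ +n ρ +n d)where
  is : List ℤ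
  is = down⁺ ρ
  adm = admissible ρ d μ≡
  open Configured m is (down-small ρ d μ≡) public
  open Shifting is (down-small ρ d μ≡)
  open ConfigDeterminants R χ J
  module A = Rows M m ρ
  open Rows M m ρ public using (total; central; lateral)
  Θ-at : List ℤ → ℕ → ℕ → List Pair → |R|
  Θ-at js k l ps = Ξ(conf0 k l ++ confs ps) * (Φ(+ 0)js l * Φ(+ 0)js(J +n k)) * ∏ (λ p → Φ(-z i p)js(a p) * Φ(i p)js(b p))ps
  ratio : ∀ k l ps → k +n l ≡ J → inds ps ≡ is → All Total ps → Θ-at is k l ps * Λ D≢0 0 ps0 ≈ multiplicity D≢0 k * (Θ-at is 0 J ps0 * Λ D≢0 k ps)
  ratio k l ps e es ts = go is es adm where
   inds-base : ∀ js → inds(map(λ i → pair i J J)js) ≡ js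
   inds-base [] = rfl
   inds-base(j ∷ js) = cong(j ∷_)(inds-base js)
   go : ∀ js → inds ps ≡ js → Adm D≢0 js → Θ-at js k l ps * Λ D≢0 0(base-pairs D≢0 js) ≈ multiplicity D≢0 k * (Θ-at js 0 J(base-pairs D≢0 js) * Λ
    D≢0 k ps)
   go js rfl adm = ΘΛ D≢0 k l ps e ts adm · *ˡ(*ʳ(rfx(cong(λ ks → Θ-at ks 0 J(base-pairs D≢0 js))(inds-base js))))
  weighted-total : weighted * Λ D≢0 0 ps0 ≈ Ξ(elements is) * Φ• 0 J ps0 * total
  weighted-total = (*-comm _ _ · sym(conv-*ˡ J L _)) · conv-cong J(λ k l e → _·_(sym(*-assoc _ _ _))(sym(∑ₚ*-*ˡ is _ _)
   · ∑ₚ*-cong is(λ ps es ts → term k l ps e es ts) · ∑ₚ*-*ˡ is H _)) · conv-*ˡ J H _ · *ʳ(*ʳ Ξ-base)where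
   L = Λ D≢0 0 ps0
   H = Ξ(conf0 0 J ++ confs ps0) * Φ• 0 J ps0
   mult-eq : ∀ k → multiplicity D≢0 k ≈ A.mult k
   mult-eq zero = refl
   mult-eq(suc k) = refl
   term : ∀ k l ps → k +n l ≡ J → inds ps ≡ is → All Total ps → L * weight m(+ 0)(+ k) * (weights m ps * Ξ(conf0 k l ++ confs ps) * Φ• k l ps) ≈ H
    * (central k * ∏ lateral ps * V(w0 k ∷ map w ps))
   term k l ps e es ts = solve 6(λ l w ws x f g → l :* w :* (ws :* x :* (f :* g)) := w :* ws :* (x :* f :* g :* l))refl _ _ _ _ _ _
    · *ˡ(ratio k l ps e es ts) · *ˡ(*c(mult-eq k)(*c(*-assoc _ _ _)(*ʳ(rfx(cong(λ n → sign D≢0 n(+ 0)k(+ k) * S n)len)))))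
    · solve 7(λ w ws n h g z v → w :* ws :* (n :* (h :* (g :* z :* v))) := h :* (n :* w :* g :* (ws :* z) :* v))refl _ _ _ _ _ _ _
    · *ˡ(*ʳ(*ˡ(sym(∏-* _ _ ps))))where
    X1 = Ξ(conf0 k l ++ confs ps)
    S : ℕ → |R|
    S n = ∏ (λ p → sign D≢0 n(i p)(b p)(+ b p -z + J))ps
    len : length ps ≡ ρ
    len = E.trans(E.sym(length-map i ps))(E.trans(cong length es)(length-down⁺ ρ))
  base-unit : Unit(Φ• 0 J ps0)
  base-unit = Unit-* (Unit-* (Φ-unit J Small-0)(Φ-unit(J +n 0)Small-0))(Unit-∏ Φ2(Allₚ.map⁺ (All.map(λ{i}sm → Φ2-unit(pair i J J)sm)
   (down-small ρ d μ≡))))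
module Duals(R : Ring)(χ : Char R)(𝓕 : Filt R χ)(2-reg : Polynomials.Regular R(CommutativeRing._+_ R(CommutativeRing.1# R)(CommutativeRing.1#
 R)))(m r J : ℕ)where
 open CommutativeRing R hiding (zero) renaming (Carrier to |R|; *-congˡ to *ˡ; *-congʳ to *ʳ; -‿cong to -ᶜ; *-cong to *c; +-cong to +c; trans to
  infixr 1 _·_)
 open RingSolver R
 open Polynomials R
 open Congruences R χ 𝓕
 open Laplace R
 open ConfigDeterminants R χ J
 open Duality m r
 module TA = Trunc R χ 𝓕(r +n r)J
 module TB = Trunc R χ 𝓕(r +n r +n m)J
 module WA = TA.Weighted m r 0(E.sym(N.+-identityʳ(r +n r)))
 module WB = TB.Weighted 0 r m rfl
 open ConfigWeights R χ TA.M J using (-1^; -1^-reg)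
 totals : WA.total ≈ WB.total
 totals = reg-cancel(reg-* (-1^-reg J)(reg-* (-1^-reg r)2-reg))(A.determinant TA.D≢0 WA.adm · det-transpose A.entry is is
  · rows is(naturals(suc r))is(naturals(suc r)) · sym(B.determinant TB.D≢0 WB.adm))where
  is = down(suc r)
  Natural : ℤ → Set
  Natural x = ∃ λ n → x ≡ + n
  naturals : ∀ s → All Natural(down s)
  naturals zero = []
  naturals(suc s) = (s , rfl) ∷ naturals s
  alt-cong-All : ∀ {F G : ℤ → List ℤ → |R|}{P : ℤ → Set}{cs} → All P cs → (∀ c cs → P c → All P cs → F c cs ≈ G c cs) → alt cs F ≈ alt cs G
  alt-cong-All [] h = refl
  alt-cong-All(p ∷ ps)h = +c(h _ _ p ps)(-ᶜ(alt-cong-All ps(λ d ds q qs → h d _ q(p ∷ qs))))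
  rows : ∀ ys → All Natural ys → ∀ xs → All Natural xs → det(map(λ y x → A.entry x y)ys)xs ≈ det(map B.entry ys)xs
  rows [] [] [] _ = refl
  rows [] [](_ ∷ _)_ = refl
  rows(y ∷ ys)((n , rfl) ∷ ns)xs ms = alt-cong-All ms(λ{x xs(k , rfl)ks → *c(transposed k n)(rows ys ns xs ks)})
 module SA = ConfigSums R χ TA.M J
 module SB = ConfigSums R χ TB.M J
 module ZA = Bounded R χ TA.M
 module ZB = Bounded R χ TB.M
 module ΞA = Evals R χ TA.M
 module ΞB = Evals R χ TB.M
 weighted-dual : WA.weighted * (ΞB.Ξ(SB.elements WB.is) * WB.Φ• 0 J WB.ps0) ≈ WB.weighted * (ΞA.Ξ(SA.elements WA.is) * WA.Φ• 0 J WA.ps0)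
 weighted-dual = reg-cancel(ConfigWeights.Λ-reg R χ TA.M J TA.D≢0 0 WA.ps0(subst(ConfigWeights.Adm R χ TA.M J TA.D≢0)(E.sym(inds-base WA.is))
  WA.adm))(solve 3(λ l w b → l :* (w :* b) := w :* l :* b)refl _ _ _ · *ʳ WA.weighted-total
  · solve 3(λ a t b → a :* t :* b := b :* t :* a)refl _ _ _ · *ʳ(*ˡ totals · sym WB.weighted-total) · *ʳ(*ˡ(WB.Λ-base · sym WA.Λ-base))
  · solve 3(λ w l a → w :* l :* a := l :* (w :* a))refl _ _ _)where
  inds-base : ∀ js → ConfigSteps.inds R χ TA.M J(ConfigWeights.base-pairs R χ TA.M J TA.D≢0 js) ≡ js
  inds-base [] = rfl
  inds-base(j ∷ js) = cong(j ∷_)(inds-base js)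
  L = ConfigWeights.Λ R χ TA.M J TA.D≢0 0 WA.ps0
  L' = ConfigWeights.Λ R χ TB.M J TB.D≢0 0 WB.ps0
  a = ΞA.Ξ(SA.elements WA.is) * WA.Φ• 0 J WA.ps0
  b = ΞB.Ξ(SB.elements WB.is) * WB.Φ• 0 J WB.ps0
 symm-dual : ZA.symm m(SA.elements WA.is) * ΞB.Ξ(SB.elements WB.is) ≈ ZB.symm 0(SB.elements WB.is) * ΞA.Ξ(SA.elements WA.is) [ J ]
 symm-dual = Unit-cancel(Unit-* WA.base-unit WB.base-unit)(≈[]-trans(≈[]-rfl(solve 4(λ s x f g → s :* x :* (f :* g) := s :* f :* (x :* g))refl _
  _ _ _))(≈[]-trans(≈[]-*ʳ(Filt.O-* 𝓕(TB.intg-Ξ(SB.elements WB.is))(intg WB.base-unit))WA.symm≈weighted)(≈[]-trans(≈[]-rfl weighted-dual)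
  (≈[]-trans(≈[]-*ʳ(Filt.O-* 𝓕(TA.intg-Ξ(SA.elements WA.is))(intg WA.base-unit))(≈[]-sym WB.symm≈weighted))(≈[]-rfl(solve 4(λ s x f g → s :*
  g :* (x :* f) := s :* x :* (f :* g))refl _ _ _ _))))))
open FormalSeries hiding (conv)
open Laurent
-- The ring of power series inside a ring with a character.
record Embedding(R : Ring)(χ : Char R) : Set where
 open CommutativeRing R
 open Char χ
 field
  embed : Series → Carrier
  embed-cong : ∀ {f g} → f ≗ g → embed f ≈ embed g
  embed-injective : ∀ {f g} → embed f ≈ embed g → f ≗ g
  embed-+ : ∀ f g → embed(f ⊞ g) ≈ embed f + embed g
  embed-* : ∀ f g → embed(f ⊠ g) ≈ embed f * embed g
  embed-neg : ∀ f → embed(⊟ f) ≈ - embed f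
  embed-1 : embed unitS ≈ 1#
  embed-0 : embed zeroS ≈ 0#
  embed-T : ∀ n → embed(tpow n) ≈ T(+ n)
  embed-ι : ∀ n → ∃ λ f → embed f ≈ ι(+ n)
module SeriesOrders(R : Ring)(χ : Char R)(ε : Embedding R χ)where
 open CommutativeRing R hiding (zero) renaming (Carrier to |R|; *-congˡ to *ˡ; *-congʳ to *ʳ; +-congˡ to +ˡ; *-identityˡ to 1*; -‿cong to -ᶜ; *-cong
  to *c; +-cong to +c; reflexive to rfx; trans to infixr 1 _·_)
 open Char χ
 open Embedding ε
 open RingSolver R
 record Order(n : ℕ)(x : |R|) : Set where
  constructor order
  field
   quotient : Series
   factors : x ≈ T(+ n) * embed quotient
 filtration : Filt R χ
 filtration = record{O = Order; O-cong = λ e(order f p) → order f(sym e · p); O-+ = λ(order f p)(order g q) → order(f ⊞ g)(+c p q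
  · sym(distribˡ _ _ _) · *ˡ(sym(embed-+ f g))); O-* = λ{m}{n}(order f p)(order g q) → order(f ⊠ g)(*c p q
  · solve 4(λ a b c d → (a :* b) :* (c :* d) := (a :* c) :* (b :* d))refl _ _ _ _
  · *c(sym(T-+ (+ m)(+ n)))(sym(embed-* f g))); O-neg = λ(order f p) → order(⊟ f)(-ᶜ p
  · solve 2(λ a b → :- (a :* b) := a :* :- b)refl _ _ · *ˡ(sym(embed-neg f))); O-0 = order zeroS(sym(*ˡ embed-0
  · zeroʳ _)); O-≤ = λ{m}{n}m≤n(order f p) → order(tpow(n ∸ m) ⊠ f)(p · *ʳ(rfx(cong(λ k → T(+ k))(E.sym(N.m+[n∸m]≡n m≤n)))
  · T-+ (+ m)(+ (n ∸ m))) · *-assoc _ _ _ · *ˡ(sym(embed-* _ f · *ʳ(embed-T(n ∸ m))))); O-T = λ n → order unitS(sym(*ˡ embed-1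
  · *-identityʳ _)); O-ι = λ n → order(proj₁(embed-ι n))(sym(proj₂(embed-ι n)) · sym(*ʳ T-0 · 1* _))}
 open Congruences R χ filtration
 -- Congruence modulo t^(K+1) means that the coefficients up to t^K agree.
 ≈[]⇒coeffs : ∀ {K f g} → embed f ≈ embed g [ suc K ] → ∀ j → j ≤ K → f j ≡ g j
 ≈[]⇒coeffs{K}{f}{g}(order h p)j j≤K = Z.i-j≡0⇒i≡j(f j)(g j)(E.trans(E.sym difference)(E.trans(embed-injective{f ⊞ ⊟ g}{tpow(suc K) ⊠ h}
  (embed-+ f(⊟ g) · +ˡ(embed-neg g) · p · sym(embed-* _ h · *ʳ(embed-T(suc K))))j)(E.trans(tpow-⊠ (suc K)h j)(shiftS-< (suc K)h j(s≤s
  j≤K)))))where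
  difference : (f ⊞ ⊟ g)j ≡ f j -z g j
  difference = E.trans(cong(λ u → u f(⊟ g)j) ⊞-def)(cong(λ z → f j +z z)(⊟-def g j))
 coeffs⇒≈[] : ∀ {K f g} → (∀ j → j ≤ K → f j ≡ g j) → embed f ≈ embed g [ suc K ]
 coeffs⇒≈[]{K}{f}{g}e = order h(+ˡ(sym(embed-neg g)) · sym(embed-+ f(⊟ g)) · embed-cong pt · embed-* (tpow(suc K))h
  · *ʳ(embed-T(suc K)))where
  d h : Series
  d = f ⊞ ⊟ g
  h j = d(suc K +n j)
  difference : ∀ j → d j ≡ f j -z g j
  difference j = E.trans(cong(λ u → u f(⊟ g)j) ⊞-def)(cong(λ z → f j +z z)(⊟-def g j))
  pt : d ≗ tpow(suc K) ⊠ h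
  pt j with N.≤-total(suc K)j
  ... | inj₁ l = E.trans(cong d(E.sym(N.m+[n∸m]≡n l)))(E.sym(E.trans(tpow-⊠ (suc K)h j)(E.trans(cong(shiftS(suc K)h)(E.sym(N.m+[n∸m]≡n
   l)))(shiftS-+ (suc K)h(j ∸ suc K)))))
  ... | inj₂ l with N.m≤n⇒m<n∨m≡n l
  ... | inj₁(s≤s j≤K) = E.trans(difference j)(E.trans(Z.i≡j⇒i-j≡0(e j j≤K))(E.sym(E.trans(tpow-⊠ (suc K)h j)(shiftS-< (suc K)h j(s≤s
   j≤K)))))
  ... | inj₂ rfl = E.trans(cong d(E.sym(N.+-identityʳ(suc K))))(E.sym(E.trans(tpow-⊠ (suc K)h(suc K))(E.trans(cong(shiftS(suc K)h)
   (E.sym(N.+-identityʳ(suc K))))(shiftS-+ (suc K)h 0))))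
laurentEmbedding : Embedding 𝕃 laurent
laurentEmbedding = record{ embed = emb ; embed-cong = λ e → emb-cong(exact e) ; embed-injective = λ e → pointwise(emb-injective e) ; embed-+ =
 emb-+ ; embed-* = emb-* ; embed-neg = emb-neg ; embed-1 = L.refl ; embed-0 = L.refl ; embed-T = λ n → L.refl ; embed-ι = λ{ zero → zeroS , L.refl ;
 (suc n) → geom n , L.refl } }where
 module L = CommutativeRing 𝕃
2-reg : Polynomials.Regular 𝕃(addF(emb unitS)(emb unitS))
2-reg x(cross-equal e) = cross-equal(𝕊R.trans(𝕊R.*-identityʳ _)(𝕊R.trans(exact zero-num)(𝕊R.sym(𝕊R.zeroˡ _))))where
 open RingSolver 𝕊 using () renaming (solve to solveS; _:+_ to _⊕:_; _:*_ to _⊛:_; _:=_ to _≈:_; 𝟏 to 𝟏S)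
 f = Fraction.num x
 twice : f ⊞ f 𝕊R.≈ zeroS
 twice = 𝕊R.trans(solveS 1(λ a → a ⊕: a ≈: ((𝟏S ⊛: 𝟏S ⊕: 𝟏S ⊛: 𝟏S) ⊛: a) ⊛: 𝟏S)𝕊R.refl f)(𝕊R.trans e(𝕊R.zeroˡ _))
 zero-num : f ≗ zeroS
 zero-num K with Z.i*j≡0⇒i≡0∨j≡0(+ 2)(E.trans(lem(f K))(E.trans(E.sym(cong(λ h → h f f K) ⊞-def))(E.trans(pointwise twice K)(zeroS-def
  K))))where
  open import Data.Integer.Tactic.RingSolver using (ringℤ)
  lem : ∀ a → + 2 *z a ≡ a +z a
  lem = ringℤ
 ... | inj₂ p = E.trans p(E.sym(zeroS-def K))
module ColumnAsymptotics(R : Ring)(χ : Char R)(𝓕 : Filt R χ)(μ J : ℕ)where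
 open CommutativeRing R hiding (zero) renaming (Carrier to |R|; *-congˡ to *ˡ; *-congʳ to *ʳ; +-congˡ to +ˡ; *-identityˡ to 1*; -‿cong to -ᶜ; *-cong
  to *c; +-cong to +c; reflexive to rfx; trans to infixr 1 _·_)
 open Char χ
 open Filt 𝓕
 open RingSolver R
 open Sums R
 open CharProperties R χ
 open Congruences R χ 𝓕
 open Trunc R χ 𝓕 μ J using (M; intg-ι)
 open ConfigWeights R χ M J using (T-^)
 open ChainSteps R χ M using (D; run; Off; avoid)
 open SplitSums R χ D
 open Kernel R χ D
 open HallLittlewood R χ D
 open Symm R χ M using (f≈g; Good; Sep)
 open Bounded R χ M using (full; bounded; h)
 open RowOperators R P
 F iF : ℕ → |R|
 F zero = 1#
 F(suc n) = F n * (1# - P ^ᵣ suc n)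
 iF zero = 1#
 iF(suc n) = iF n * ι(D *z + suc n)
 qfactorials : QFactorials R P
 qfactorials = record{F = F; iF = iF; F-0 = refl; F-suc = λ _ → refl; F-iF = F-iF'}where
  F-iF' : ∀ n → F n * iF n ≈ 1#
  F-iF' zero = 1* 1#
  F-iF'(suc n) = *-interchange _ _ _ _ · *c(F-iF' n)(*ʳ(+ˡ(-ᶜ(T-^ D(suc n)))) · ι-law(D *z + suc n)(λ())) · 1* 1#
 open ColumnOperators R P qfactorials
 intg-^ : ∀ {x}n → O 0 x → O 0(x ^ᵣ n)
 intg-^ zero o = O-1
 intg-^ (suc n)o = O-* o(intg-^ n o)
 intg-P : ∀ n → O 0(P ^ᵣ n)
 intg-P n = intg-^ n(O-T≥ (suc μ +n suc μ)0)
 intg-F : ∀ n → O 0(F n)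
 intg-F zero = O-1
 intg-F(suc n) = O-* (intg-F n)(O-+ O-1(O-neg(intg-P(suc n))))
 intg-iF : ∀ n → O 0(iF n)
 intg-iF zero = O-1
 intg-iF(suc n) = O-* (intg-iF n)(O-ι _)
 intg-wt : ∀ d{x} → O 0 x → O 0(wt d x)
 intg-wt zero o = O-1
 intg-wt(suc d)o = O-* (O-* o(intg-P d))(intg-wt d o)
 intg-bin : ∀ n d → O 0(bin n d)
 intg-bin n d = O-* (O-* (intg-F(n +n d))(intg-iF n))(intg-iF d)
 O-conv : ∀ {n}N{φ} → (∀ r k → O n(φ r k)) → O n(conv N φ)
 O-conv zero o = o 0 0
 O-conv(suc N)o = O-+ (o 0(suc N))(O-conv N(λ r k → o(suc r)k))
 O-*0ˡ : ∀ {n x y} → O 0 x → O n y → O n(x * y)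
 O-*0ˡ = O-*
 E-order : ∀ m d{n x v} → O 0 x → (∀ ns → O n(v ns)) → ∀ ns → O n(E m d x v ns)
 E-order zero d o p ns = O-*0ˡ(O-* (intg-wt d o)(intg-iF d))(p ns)
 E-order(suc m)d o p(k ∷ ns) = O-*0ˡ(O-* (intg-wt d o)(intg-bin k d))(O-conv(k +n d)(λ r k → E-order m r o(λ ν → p(k ∷ ν))ns))
 E-order⁺ : ∀ m d{n x v} → O n x → (∀ ns → O 0(v ns)) → ∀ ns → O n(E m(suc d)x v ns)
 E-order⁺ m d{n}{x}o p = go m p where
  w = O-*0(O-*0 o(intg-P d))(intg-wt d(O-≤ z≤n o))
  go : ∀ m{v} → (∀ ns → O 0(v ns)) → ∀ ns → O n(E m(suc d)x v ns)
  go zero p ns = O-*0(O-*0 w(intg-iF(suc d)))(p ns)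
  go(suc m)p(k ∷ ns) = O-*0(O-*0 w(intg-bin k(suc d)))(O-conv(k +n suc d)(λ r k → E-order m r(O-≤ z≤n o)(λ ν → p(k ∷ ν))ns))
 E-≈[] : ∀ m d{n x v w} → O 0 x → (∀ ns → v ns ≈ w ns [ n ]) → ∀ ns → E m d x v ns ≈ E m d x w ns [ n ]
 E-≈[] m d{x = x}{v}{w}o p ns = O-cong(E-+ m d x v _ ns · +ˡ(E-cong m d refl(λ ns → solve 1(λ a → :- a := (:- 𝟏) :* a)refl(w ns))ns
  · E-* m d x(- 1#)w ns · solve 1(λ a → (:- 𝟏) :* a := :- a)refl _))(E-order m d o p ns)
 E-near : ∀ m{n x v} → O n x → (∀ ns → O 0(v ns)) → ∀ ns → E m 0 x v ns ≈ v ns [ n ]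
 E-near zero o p ns = ≈[]-rfl(*ʳ(1* 1#) · 1* _)
 E-near(suc m){n}{x}{v}o p(k ∷ ns) = ≈[]-trans(≈[]-rfl(*ʳ(1* _ · bin-0 k) · 1* _
  · rfx(cong(λ l → conv l(λ r k → E m r x(λ ν → v(k ∷ ν))ns))(N.+-identityʳ k))))(only k)where
  only : ∀ k → conv k(λ r k → E m r x(λ ν → v(k ∷ ν))ns) ≈ v(k ∷ ns) [ n ]
  only zero = E-near m o(λ ν → p(0 ∷ ν))ns
  only(suc k) = O-cong(solve 3(λ a b c → (a :- c) :+ b := (a :+ b) :- c)refl _ _ _)(O-+ (E-near m o(λ ν → p(suc k ∷ ν))ns)(O-conv k(λ r k →
   E-order⁺ m r o(λ ν → p(k ∷ ν))ns)))
 -- The alphabet c, c + D, …, c + (l - 1) D added to S, smallest element first.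
 stack : ℤ → ℕ → List ℤ → List ℤ
 stack c zero S = S
 stack c(suc l)S = stack(c +z D)l(c ∷ S)
 stack-↭ : ∀ c l S → stack c l S ↭ run c l ++ S
 stack-↭ c zero S = ↭-refl
 stack-↭ c(suc l)S = ↭-trans(stack-↭ (c +z D)l(c ∷ S))(shift c(run(c +z D)l)S)
 Ahead : ℤ → ℤ → Set
 Ahead c y = ∀ j → c +z D *z + j ≢ y
 private
  next : ∀ c D j → c +z D +z D *z j ≡ c +z D *z(+ 1 +z j)
  next = ringℤ
 Ahead-next : ∀ {c y} → Ahead c y → Ahead(c +z D)y
 Ahead-next{c}a j e = a(suc j)(E.trans(E.sym(next c D(+ j)))e)
 Ahead-self : ∀ c → Ahead(c +z D)c
 Ahead-self c j e with E.trans(lem c D(+ j))(Z.i≡j⇒i-j≡0 e)where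
  lem : ∀ c D j → D *z(+ 1 +z j) ≡ c +z D +z D *z j -z c
  lem = ringℤ
 ... | ()
 stack-All : ∀ {Q : ℤ → Set}c l S → (∀ j → Q(c +z D *z + j)) → All Q S → All Q(stack c l S)
 stack-All c zero S q qs = qs
 stack-All{Q}c(suc l)S q qs = stack-All{Q}(c +z D)l(c ∷ S)(λ j → subst Q(E.sym(next c D(+ j)))(q(suc j)))(subst Q(lem c D)(q 0) ∷ qs)
  where
  lem : ∀ c D → c +z D *z + 0 ≡ c
  lem = ringℤ
 Ahead⇒Fresh : ∀ {c S} → All(Ahead c)S → Dist S → Fresh c S
 Ahead⇒Fresh{c}a d = All.map(λ h e → h 0(E.trans(lem0 c D)e))a , All.map(λ h e → h 1(E.trans(lem1 c D)e))a , d where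
  lem0 : ∀ c D → c +z D *z + 0 ≡ c
  lem0 = ringℤ
  lem1 : ∀ c D → c +z D *z + 1 ≡ c +z D
  lem1 = ringℤ
 E-stack : ∀ m l c S → All(Ahead c)S → Dist S → E m 0(T c)(HL m S) ≋ E m 0(T(c +z D *z + l))(HL m(stack c l S))
 E-stack m zero c S a d ns = E-cong m 0(T-cong(lem c D))(λ _ → refl)ns where
  lem : ∀ c D → c ≡ c +z D *z + 0
  lem = ringℤ
 E-stack m(suc l)c S a d ns = sym(E-A m 0(T c)(HL m S)ns · 1* _) · E-cong m 0(sym(T-+ D c)
  · T-cong(Z.+-comm D c))(A-HL m(Ahead⇒Fresh a d))ns · E-stack m l(c +z D)(c ∷ S)(Ahead-self c ∷ All.map(λ{y} → Ahead-next{c}{y})a)(proj₁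
  (Ahead⇒Fresh a d) ∷ d)ns · E-cong m 0(T-cong(next c D(+ l)))(λ _ → refl)ns
 alphabet : List ℤ → List ℤ
 alphabet [] = []
 alphabet(c ∷ cs) = stack c J(alphabet cs)
 stack-Dist : ∀ c l{S} → All(Ahead c)S → Dist S → Dist(stack c l S)
 stack-Dist c zero a d = d
 stack-Dist c(suc l)a d = stack-Dist(c +z D)l(Ahead-self c ∷ All.map(λ{y} → Ahead-next{c}{y})a)(proj₁(Ahead⇒Fresh a d) ∷ d)
 ahead : ∀ c cs → All(λ c' → Off(c -z c'))cs → All(Ahead c)(alphabet cs)
 ahead c [] [] = []
 ahead c(c' ∷ cs)(o ∷ os) = stack-All{Ahead c}c' J(alphabet cs)(λ k j e → avoid o(+ j -z + k)(E.trans(lem c c' D(+ j)(+ k))(Z.i≡j⇒i-j≡0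
  e)))(ahead c cs os)where
  lem : ∀ c c' D j k → c -z c' +z D *z(j -z k) ≡ c +z D *z j -z(c' +z D *z k)
  lem = ringℤ
 Separate : List ℤ → Set
 Separate = AllPairs(λ c c' → Off(c -z c'))
 alphabet-Dist : ∀ cs → Separate cs → Dist(alphabet cs)
 alphabet-Dist [] _ = []
 alphabet-Dist(c ∷ cs)(o ∷ os) = stack-Dist c J(ahead c cs o)(alphabet-Dist cs os)
 Positive : ℤ → Set
 Positive c = ∃ λ q → c ≡ + suc q
 alphabet-Positive : ∀ {cs} → All Positive cs → All Positive(alphabet cs)
 alphabet-Positive [] = []
 alphabet-Positive{c ∷ cs}((q , rfl) ∷ ps) = stack-All{Positive}c J(alphabet cs)(λ j → q +n(suc μ +n suc μ) *n j , cong(λ x → + suc q +z x)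
  (E.sym(Z.pos-* (suc μ +n suc μ)j)))(alphabet-Positive ps)
 alphabet-Good : ∀ {cs} → All Positive cs → Separate cs → Good(alphabet cs)
 alphabet-Good{cs}ps os = All.map(λ{(q , rfl)()})pos , go pos(alphabet-Dist cs os)where
  pos = alphabet-Positive ps
  go : ∀ {S} → All Positive S → Dist S → AllPairs Sep S
  go [] [] = []
  go((q , rfl) ∷ ps)(n ∷ ns) = All.zipWith(λ{((r , rfl) , ne) → ne , λ()})(ps , n) ∷ go ps ns
 intg-HL : ∀ m S → All Positive S → ∀ ns → O 0(HL m S ns)
 intg-HL zero S ps ns = O-1
 intg-HL(suc m)S ps(n ∷ ns) = O-spl S ps(λ I Q pI pQ → O-* (O-* (O-* (intg-δ n(length I))(intg-^ (suc m)(O-∏ T(All.map(λ{(q , rfl) → O-T≥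
  (suc q)0})pI))))(O-∏ _(All.universal(λ a → O-∏ (f a)(All.universal(λ b → O-cong(sym(f≈g a b))(intg-ι(-z a +z b)))Q))I)))(intg-HL m Q
  pQ ns))where
  intg-δ : ∀ a b → O 0(δ a b)
  intg-δ zero zero = O-1
  intg-δ zero(suc b) = O-0
  intg-δ(suc a)zero = O-0
  intg-δ(suc a)(suc b) = intg-δ a b
  O-spl : ∀ S → All Positive S → ∀ {F} → (∀ I Q → All Positive I → All Positive Q → O 0(F I Q)) → O 0(spl S F)
  O-spl [] [] o = o [] [] [] []
  O-spl(x ∷ S)(p ∷ ps)o = O-+ (O-spl S ps(λ I Q a b → o(x ∷ I)Q(p ∷ a)b))(O-spl S ps(λ I Q a b → o I(x ∷ Q)a(p ∷ b)))
 columns : ∀ m → List ℤ → State m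
 columns m [] = HL m []
 columns m(c ∷ cs) = E m 0(T c)(columns m cs)
 columns≈HL : ∀ m{cs} → All Positive cs → Separate cs → ∀ ns → columns m cs ns ≈ HL m(alphabet cs)ns [ J ]
 columns≈HL m{[]}_ _ ns = ≈[]-rfl refl
 columns≈HL m{c ∷ cs}(p@(q , rfl) ∷ ps)(o ∷ os)ns = ≈[]-trans(E-≈[] m 0(O-T≥ (suc q)0)(columns≈HL m ps os)ns)(≈[]-trans(≈[]-rfl(E-stack m
  J c(alphabet cs)(ahead c cs o)(alphabet-Dist cs os)ns))(E-near m(subst(λ x → O J(T x))(E.sym end)(O-T≥ (suc q +n(J +n(μ +n μ) *n J))J))
  (intg-HL m(alphabet(c ∷ cs))(alphabet-Positive(p ∷ ps)))ns))where
  end : c +z D *z + J ≡ + (J +n(suc q +n(J +n(μ +n μ) *n J)))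
  end = E.trans(lem(+ μ)(+ q)(+ J))(cong(λ x → + J +z((+ 1 +z + q) +z(+ J +z x)))(E.sym(Z.pos-* (μ +n μ)J)))where
   lem : ∀ μ q J → (+ 1 +z q) +z((+ 1 +z μ) +z(+ 1 +z μ)) *z J ≡ J +z((+ 1 +z q) +z(J +z(μ +z μ) *z J))
   lem = ringℤ
 -- Sum over all vectors of total at most B.
 ∑≤ : ∀ m → ℕ → State m → |R|
 ∑≤ zero B φ = φ []
 ∑≤ (suc m)B φ = conv B(λ n r → ∑≤ m r(λ ns → φ(n ∷ ns)))
 ∑≤-cong : ∀ m B{φ ψ} → φ ≋ ψ → ∑≤ m B φ ≈ ∑≤ m B ψ
 ∑≤-cong zero B e = e []
 ∑≤-cong(suc m)B e = conv-cong B(λ n r _ → ∑≤-cong m r(λ ns → e(n ∷ ns)))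
 ∑≤-+ : ∀ m B φ ψ → ∑≤ m B(λ ns → φ ns + ψ ns) ≈ ∑≤ m B φ + ∑≤ m B ψ
 ∑≤-+ zero B φ ψ = refl
 ∑≤-+ (suc m)B φ ψ = conv-cong B(λ n r _ → ∑≤-+ m r _ _) · conv-+ B _ _
 ∑≤-*ˡ : ∀ m B c φ → ∑≤ m B(λ ns → c * φ ns) ≈ c * ∑≤ m B φ
 ∑≤-*ˡ zero B c φ = refl
 ∑≤-*ˡ(suc m)B c φ = conv-cong B(λ n r _ → ∑≤-*ˡ m r c _) · conv-*ˡ B c _
 ∑≤-≈[] : ∀ m B{l φ ψ} → (∀ ns → φ ns ≈ ψ ns [ l ]) → ∑≤ m B φ ≈ ∑≤ m B ψ [ l ]
 ∑≤-≈[] zero B e = e []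
 ∑≤-≈[](suc m)B e = conv-≈[] B(λ n r _ → ∑≤-≈[] m r(λ ns → e(n ∷ ns)))
 ∑≤-split : ∀ m B S(G : List ℤ → List ℤ → State m) → ∑≤ m B(λ ns → spl S(λ I Q → G I Q ns)) ≈ spl S(λ I Q → ∑≤ m B(G I Q))
 ∑≤-split m B [] G = refl
 ∑≤-split m B(x ∷ S)G = ∑≤-+ m B _ _ · +c(∑≤-split m B S _)(∑≤-split m B S _)
 conv-δ : ∀ B l k(φ : ℕ → ℕ → |R|) → l +n k ≡ B → conv B(λ n r → δ n l * φ n r) ≈ φ l k
 conv-δ zero zero zero φ e = 1* _
 conv-δ(suc B)zero k φ rfl = +c(1* _)(zeros B) · +-identityʳ _ where
  zeros : ∀ B{ψ : ℕ → ℕ → |R|} → conv B(λ n r → 0# * ψ n r) ≈ 0#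
  zeros B = conv-*ˡ B 0# _ · zeroˡ _
 conv-δ(suc B)(suc l)k φ e = +c(zeroˡ _)(conv-δ B l k(λ n → φ(suc n))(N.suc-injective e)) · +-identityˡ _
 vector-weight : ∀ {k} → (ℕ → |R|) → Vec ℕ k → |R|
 vector-weight w [] = 1#
 vector-weight w(n ∷ ns) = w n * vector-weight w ns
 private
  sum-step : ∀ m k l(w : ℕ → |R|)(W : State m)S → k +n length S ≡ l → ∑≤ (suc m)l(λ{(n ∷ ns) → w n * W ns * HL(suc m)S(n ∷ ns)}) ≈ spl S(λ I
   Q → X(suc m)I * w(length I) * cross f I Q * ∑≤ m(k +n length Q)(λ ns → W ns * HL m Q ns))
  sum-step m k l w W S e = conv-cong l(λ n r _ → _·_(∑≤-cong m r(λ ns → _·_(sym(spl-*ˡ _ _ S))(spl-cong' S(λ I Q → solve 6(λ w W d x c h → w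
   :* W :* (d :* x :* c :* h) := d :* (x :* w :* c) :* (W :* h))refl _ _ _ _ _ _))))(∑≤-split m r S _
   · spl-cong' S(λ I Q → _·_(∑≤-*ˡ m r _ _)(*-assoc _ _ _)))) · conv-split l S
   · spl-cong S(λ I Q p → conv-δ l(length I)(k +n length Q)(λ n r → X(suc m)I * w n * cross f I Q * ∑≤ m r(λ ns → W ns * HL m Q ns))(lengths I
   Q p))where
   open import Data.List.Properties using (length-++)
   lengths : ∀ I Q → S ↭ I ++ Q → length I +n(k +n length Q) ≡ l
   lengths I Q p = E.trans(E.sym(N.+-assoc(length I)k _))(E.trans(cong(_+n length Q)(N.+-comm(length I)k))(E.trans(N.+-assoc k _ _)
    (E.trans(cong(k +n_)(E.sym(E.trans(↭-length p)(length-++ I))))e)))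
   conv-split : ∀ l{G : ℕ → ℕ → List ℤ → List ℤ → |R|}S → conv l(λ n r → spl S(G n r)) ≈ spl S(λ I Q → conv l(λ n r → G n r I Q))
   conv-split l [] = refl
   conv-split l(x ∷ S) = conv-+ l _ _ · +c(conv-split l S)(conv-split l S)
 ∑≤-full : ∀ m k S → ∑≤ m(k +n length S)(λ ns → vector-weight h ns * HL m S ns) ≈ full m S
 ∑≤-full zero k S = 1* 1#
 ∑≤-full(suc m)k S = sum-step m k _ h(vector-weight h)S rfl · spl-cong' S(λ I Q → *ˡ(∑≤-full m k Q))
 ∑≤-bounded : ∀ m k S → ∑≤ (suc m)(k +n length S)(λ{(n ∷ ns) → 1# * vector-weight h ns * HL(suc m)S(n ∷ ns)}) ≈ bounded(suc m)S
 ∑≤-bounded m k S = sum-step m k _(λ _ → 1#)(vector-weight h)S rfl · spl-cong' S(λ I Q → *ˡ(∑≤-full m k Q))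
open import Data.Nat using (_≤ᵇ_)
open import Data.Fin as Fin using (Fin)
open import Data.List using (upTo)
infixr 5 _::_
_::_ : ∀ {A : Set} → A → (ℕ → A) → ℕ → A
(x :: f)zero = x
(x :: f)(suc i) = f i
at : ∀ {A : Set}{k} → A → (Fin k → A) → ℕ → A
at{k = zero}d g i = d
at{k = suc k}d g zero = g Fin.zero
at{k = suc k}d g(suc i) = at d(λ j → g(Fin.suc j))i
_[_≔_] : (ℕ → ℕ) → ℕ → ℕ → ℕ → ℕ
f [ zero ≔ x ] = x :: λ i → f(suc i)
f [ suc k ≔ x ] = f 0 :: ((λ i → f(suc i)) [ k ≔ x ])
[≔]-here : ∀ f k x → (f [ k ≔ x ])k ≡ x
[≔]-here f zero x = rfl
[≔]-here f(suc k)x = [≔]-here(λ i → f(suc i))k x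
[≔]-below : ∀ f k x i → i < k → (f [ k ≔ x ])i ≡ f i
[≔]-below f(suc k)x zero l = rfl
[≔]-below f(suc k)x(suc i)(s≤s l) = [≔]-below(λ i → f(suc i))k x i l
module TupleSums(R : Ring)where
 open CommutativeRing R hiding (zero) renaming (Carrier to |R|; *-congˡ to *ˡ; *-congʳ to *ʳ; +-congˡ to +ˡ; *-identityˡ to 1*; *-cong to *c; +-cong
  to +c; reflexive to rfx; trans to infixr 1 _·_)
 open RingSolver R
 open Sums R
 open Laplace R using (Linear)
 open Linear
 tuples : ∀ {A : Set} → A → ℕ → ((A → |R|) → |R|) → ((ℕ → A) → |R|) → |R|
 tuples d zero S φ = φ(λ _ → d)
 tuples d(suc k)S φ = S(λ x → tuples d k S(λ f → φ(x :: f)))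
 Respects1 : ∀ {A : Set} → ((ℕ → A) → |R|) → Set
 Respects1 φ = ∀ {f g} → (∀ i → f i ≡ g i) → φ f ≈ φ g
 Respects2 : ((ℕ → ℕ → ℕ) → |R|) → Set
 Respects2 φ = ∀ {f g} → (∀ i j → f i j ≡ g i j) → φ f ≈ φ g
 tuples-cong : ∀ {A : Set}{d : A}k{S S'} → (∀ {φ ψ} → (∀ a → φ a ≈ ψ a) → S φ ≈ S' ψ) → ∀ {φ ψ} → (∀ f → φ f ≈ ψ f) → tuples d k S φ ≈ tuples d k
  S' ψ
 tuples-cong zero c e = e _
 tuples-cong(suc k)c e = c(λ x → tuples-cong k c(λ f → e(x :: f)))
 funs-tuples : ∀ {A A' : Set}(h : A → A')d k ys{φ} → Respects1 φ → ∑ (λ g → φ(at d(λ i → h(g i))))(funs k ys) ≈ tuples d k(λ ψ → ∑ (λ y → ψ(h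
  y))ys)φ
 funs-tuples h d zero ys ρ = +-identityʳ _
 funs-tuples h d(suc k)ys{φ}ρ = ∑-concatMap _ _ ys · ∑-cong(λ y → _·_(∑-map _ _(funs k ys))(∑-cong(λ g → ρ λ{zero → rfl; (suc i) → rfl})
  (funs k ys) · funs-tuples h d k ys{λ f → φ(h y :: f)}(λ e → ρ λ{zero → rfl; (suc i) → e i})))ys
 ∑-linear : ∀ {A : Set}(xs : List A) → Linear(λ φ → ∑ φ xs)
 ∑-linear xs = record{S-cong = λ e → ∑-cong e xs; S-+ = λ φ ψ → ∑-+ φ ψ xs; S-*ˡ = λ c φ → ∑-*ˡ c φ xs}
 tuples-linear : ∀ {A : Set}{d : A}k{S} → Linear S → Linear(tuples d k S)
 tuples-linear zero l = record{S-cong = λ e → e _; S-+ = λ φ ψ → refl; S-*ˡ = λ c φ → refl}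
 tuples-linear{d = d}(suc k){S}l = record{S-cong = tuples-cong(suc k)(S-cong l); S-+ = λ φ ψ → _·_(S-cong l(λ x → S-+ (tuples-linear k l)_
  _))(S-+ l _ _); S-*ˡ = λ c φ → _·_(S-cong l(λ x → S-*ˡ(tuples-linear k l)c _))(S-*ˡ l c _)}
 module _(xs : List ℕ)where
  ∑ₓ : (ℕ → |R|) → |R|
  ∑ₓ φ = ∑ φ xs
  lin : ∀ k → Linear(tuples 0 k ∑ₓ)
  lin k = tuples-linear k(∑-linear xs)
  commute1 : ∀ {A : Set}{S : (A → |R|) → |R|} → Linear S → ∀ (φ : A → ℕ → |R|)ys → S(λ a → ∑ (φ a)ys) ≈ ∑ (λ x → S(λ a → φ a x))ys
  commute1 l φ [] = S-cong l(λ _ → sym(zeroˡ 0#)) · S-*ˡ l 0#(λ _ → 0#) · zeroˡ _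
  commute1 l φ(y ∷ ys) = S-+ l _ _ · +ˡ(commute1 l φ ys)
  commute : ∀ {A : Set}{S : (A → |R|) → |R|} → Linear S → ∀ k(φ : A → (ℕ → ℕ) → |R|) → S(λ a → tuples 0 k ∑ₓ(φ a)) ≈ tuples 0 k ∑ₓ(λ f → S(λ a →
   φ a f))
  commute l zero φ = refl
  commute l(suc k)φ = commute1 l _ xs · ∑-cong(λ x → commute l k(λ a f → φ a(x :: f)))xs
  0ᶠ : ℕ → ℕ
  0ᶠ _ = 0
  grid : ℕ → ℕ → ((ℕ → ℕ → ℕ) → |R|) → |R|
  grid m n = tuples 0ᶠ m(tuples 0 n ∑ₓ)
  grid-cong : ∀ m n{φ ψ} → (∀ s → φ s ≈ ψ s) → grid m n φ ≈ grid m n ψ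
  grid-cong m n = tuples-cong m(S-cong(lin n))
  first-row : ∀ m n{ψ} → Respects2 ψ → grid n(suc m)ψ ≈ tuples 0 n ∑ₓ(λ row → grid n m(λ t → ψ(λ j → row j :: t j)))
  first-row m zero ρ = ρ λ{i zero → rfl; i(suc j) → rfl}
  first-row m(suc n){ψ}ρ = ∑-cong(λ x → _·_(S-cong(lin m)(λ f → first-row m n{λ t → ψ((x :: f) :: t)}(λ e → ρ λ{zero j → rfl; (suc i)j → e
   i j})))(commute(lin m)n(λ f row → grid n m(λ t → ψ((x :: f) :: λ j → row j :: t j)))
   · S-cong(lin n)(λ row → S-cong(lin m)(λ f → grid-cong n m(λ t → ρ λ{zero j → rfl; (suc i)j → rfl})))))xs
  zeros : ∀ n{ψ} → Respects2 ψ → ψ(λ _ → 0ᶠ) ≈ grid n 0 ψ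
  zeros zero ρ = refl
  zeros(suc n){ψ}ρ = (ρ λ{zero j → rfl; (suc i)j → rfl}) · zeros n{λ t → ψ(0ᶠ :: t)}(λ e → ρ λ{zero j → rfl; (suc i)j → e i j})
  transpose : ∀ m n{φ} → Respects2 φ → grid m n φ ≈ grid n m(λ t → φ(λ i j → t j i))
  transpose zero n{φ}ρ = zeros n{λ t → φ(λ i j → t j i)}(λ e → ρ(λ i j → e j i))
  transpose(suc m)n{φ}ρ = S-cong(lin n)(λ row → transpose m n{λ s → φ(row :: s)}(λ e → ρ λ{zero j → rfl; (suc i)j → e i j}))
   · S-cong(lin n)(λ row → grid-cong n m(λ t → ρ λ{zero j → rfl; (suc i)j → rfl}))
   · sym(first-row m n{λ t → φ(λ i j → t j i)}(λ e → ρ(λ i j → e j i)))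
  -- The same sum with the last coordinate outermost.
  top : ℕ → ((ℕ → ℕ) → |R|) → |R|
  top zero φ = φ 0ᶠ
  top(suc k)φ = ∑ₓ(λ x → top k(λ f → φ(f [ k ≔ x ])))
  top-cong : ∀ k{φ ψ} → (∀ f → φ f ≈ ψ f) → top k φ ≈ top k ψ
  top-cong zero e = e _
  top-cong(suc k)e = ∑-cong(λ x → top-cong k(λ f → e _))xs
  top-*ˡ : ∀ k c φ → top k(λ f → c * φ f) ≈ c * top k φ
  top-*ˡ zero c φ = refl
  top-*ˡ(suc k)c φ = ∑-cong(λ x → top-*ˡ k c _)xs · ∑-*ˡ c _ xs
  top-head : ∀ k{φ} → Respects1 φ → top(suc k)φ ≈ ∑ₓ(λ x → top k(λ f → φ(x :: f)))
  top-head zero ρ = ∑-cong(λ x → ρ λ{zero → rfl; (suc i) → rfl})xs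
  top-head(suc k){φ}ρ = ∑-cong(λ y → top-head k{λ f → φ(f [ suc k ≔ y ])}(λ e → ρ(update(suc k)y e)))xs · ∑-swap _ xs xs
   · ∑-cong(λ x → ∑-cong(λ y → top-cong k(λ f → ρ λ{zero → rfl; (suc i) → rfl}))xs)xs where
   update : ∀ k y{f g : ℕ → ℕ} → (∀ i → f i ≡ g i) → ∀ i → (f [ k ≔ y ])i ≡ (g [ k ≔ y ])i
   update zero y e zero = rfl
   update zero y e(suc i) = e(suc i)
   update(suc k)y e zero = e 0
   update(suc k)y e(suc i) = update k y(λ i → e(suc i))i
  tuples-top : ∀ k{φ} → Respects1 φ → tuples 0 k ∑ₓ φ ≈ top k φ
  tuples-top zero ρ = refl
  tuples-top(suc k){φ}ρ = ∑-cong(λ x → tuples-top k{λ f → φ(x :: f)}(λ e → ρ λ{zero → rfl; (suc i) → e i}))xs · sym(top-head k ρ)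
 tuples-cong-upTo : ∀ B k{φ ψ} → (∀ f → (∀ i → f i ≤ B) → (∀ i → k ≤ i → f i ≡ 0) → φ f ≈ ψ f) → tuples 0 k(∑ₓ(upTo(suc B)))φ ≈ tuples 0 k(∑ₓ
  (upTo(suc B)))ψ
 tuples-cong-upTo B zero e = e _(λ _ → z≤n)(λ _ _ → rfl)
 tuples-cong-upTo B(suc k)e = ∑-cong-All(All.map(λ{(s≤s x≤B) → tuples-cong-upTo B k(λ f b z → e _(λ{zero → x≤B; (suc i) → b i})(λ{(suc i)
  (s≤s l) → z i l}))})(all-upTo(suc B)))where
  open import Data.List.Relation.Unary.All as All using (All)
  open import Data.List.Relation.Unary.All.Properties using (all-upTo)
 ⌊_⌋ : Bool → |R|
 ⌊ true ⌋ = 1#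
 ⌊ false ⌋ = 0#
 below : ℕ → (ℕ → |R|) → |R|
 below zero φ = 0#
 below(suc n)φ = φ 0 + below n(λ y → φ(suc y))
 ∑-upTo : ∀ n(φ : ℕ → |R|) → ∑ φ(upTo n) ≈ below n φ
 ∑-upTo n φ = go n(λ i → i)φ where
  go : ∀ n h(φ : ℕ → |R|) → ∑ φ(applyUpTo h n) ≈ below n(λ i → φ(h i))
  go zero h φ = refl
  go(suc n)h φ = +ˡ(go n(λ i → h(suc i))φ)
 below-cong : ∀ n{φ ψ} → (∀ y → φ y ≈ ψ y) → below n φ ≈ below n ψ
 below-cong zero e = refl
 below-cong(suc n)e = +c(e 0)(below-cong n(λ y → e(suc y)))
 from : ∀ u r(φ : ℕ → |R|) → ∑ (λ y → ⌊ u ≤ᵇ y ⌋ * φ y)(upTo(suc(u +n r))) ≈ conv r(λ n _ → φ(u +n n))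
 from u r φ = ∑-upTo(suc(u +n r))(λ y → ⌊ u ≤ᵇ y ⌋ * φ y) · go u r φ where
  moved : ∀ u y → (suc u ≤ᵇ suc y) ≡ (u ≤ᵇ y)
  moved zero y = rfl
  moved(suc u)y = rfl
  go : ∀ u r(φ : ℕ → |R|) → below(suc(u +n r))(λ y → ⌊ u ≤ᵇ y ⌋ * φ y) ≈ conv r(λ n _ → φ(u +n n))
  go zero zero φ = +-identityʳ _ · 1* _
  go zero(suc r)φ = +c(1* _)(go zero r(λ y → φ(suc y)))
  go(suc u)r φ = +c(zeroˡ _)(below-cong(suc(u +n r))(λ y → *ʳ{φ(suc y)}(rfx(cong ⌊_⌋ (moved u y))))) · +-identityˡ _
   · go u r(λ y → φ(suc y))
 upto : ∀ U e(φ : ℕ → |R|) → ∑ (λ y → ⌊ y ≤ᵇ U ⌋ * φ y)(upTo(suc(U +n e))) ≈ ∑ φ(upTo(suc U))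
 upto U e φ = ∑-upTo(suc(U +n e))(λ y → ⌊ y ≤ᵇ U ⌋ * φ y) · go U e φ · sym(∑-upTo(suc U)φ)where
  none : ∀ e{ψ : ℕ → |R|} → below e(λ y → 0# * ψ y) ≈ 0#
  none zero = refl
  none(suc e) = +c(zeroˡ _)(none e) · +-identityˡ _
  moved : ∀ y U → (suc y ≤ᵇ suc U) ≡ (y ≤ᵇ U)
  moved zero U = rfl
  moved(suc y)U = rfl
  go : ∀ U e(φ : ℕ → |R|) → below(suc(U +n e))(λ y → ⌊ y ≤ᵇ U ⌋ * φ y) ≈ below(suc U)φ
  go zero e φ = +c(1* _)(below-cong e(λ y → refl) · none e)
  go(suc U)e φ = +c(1* _)(below-cong(suc(U +n e))(λ y → *ʳ{φ(suc y)}(rfx(cong ⌊_⌋ (moved y U)))) · go U e(λ y → φ(suc y)))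
 interval : ∀ u r e(φ : ℕ → |R|) → ∑ (λ y → ⌊ u ≤ᵇ y ⌋ * (⌊ y ≤ᵇ(u +n r) ⌋ * φ y))(upTo(suc(u +n r +n e))) ≈ conv r(λ n _ → φ(u +n n))
 interval u r e φ = ∑-cong(λ y → solve 3(λ a b c → a :* (b :* c) := b :* (a :* c))refl ⌊ u ≤ᵇ y ⌋ ⌊ y ≤ᵇ(u +n r) ⌋ (φ y))(upTo(suc(u +n r +n
  e))) · upto(u +n r)e(λ y → ⌊ u ≤ᵇ y ⌋ * φ y) · from u r φ
 ∏< : ℕ → (ℕ → |R|) → |R|
 ∏< zero φ = 1#
 ∏< (suc k)φ = φ k * ∏< k φ
 ∏<-cong : ∀ k{φ ψ} → (∀ i → i < k → φ i ≈ ψ i) → ∏< k φ ≈ ∏< k ψ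
 ∏<-cong zero e = refl
 ∏<-cong(suc k)e = *c(e k N.≤-refl)(∏<-cong k(λ i l → e i(N.m≤n⇒m≤1+n l)))
 ∏<-* : ∀ k φ ψ → ∏< k(λ i → φ i * ψ i) ≈ ∏< k φ * ∏< k ψ
 ∏<-* zero φ ψ = sym(1* 1#)
 ∏<-* (suc k)φ ψ = *ˡ(∏<-* k φ ψ) · *-interchange _ _ _ _
 ∏<-first : ∀ k φ → ∏< (suc k)φ ≈ φ 0 * ∏< k(λ i → φ(suc i))
 ∏<-first zero φ = refl
 ∏<-first(suc k)φ = *ˡ(∏<-first k φ) · solve 3(λ a b c → a :* (b :* c) := b :* (a :* c))refl _ _ _
 ∏-upTo : ∀ k φ → ∏ φ(upTo k) ≈ ∏< k φ
 ∏-upTo k φ = go k(λ i → i)where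
  go : ∀ k h → ∏ φ(applyUpTo h k) ≈ ∏< k(λ i → φ(h i))
  go zero h = refl
  go(suc k)h = *ˡ(go k(λ i → h(suc i))) · sym(∏<-first k(λ i → φ(h i)))
module ColumnFamilies(R : Ring)(χ : Char R)(𝓕 : Filt R χ)(μ J B : ℕ)where
 open CommutativeRing R hiding (zero) renaming (Carrier to |R|; *-congˡ to *ˡ; *-congʳ to *ʳ; *-identityˡ to 1*; *-cong to *c; reflexive to rfx; trans
  to infixr 1 _·_)
 open Char χ
 open RingSolver R
 open Sums R
 open Laplace R using (Linear)
 open Linear
 open TupleSums R
 open ColumnAsymptotics R χ 𝓕 μ J
 open Trunc R χ 𝓕 μ J using (M)
 open ChainSteps R χ M using (D)
 open HallLittlewood R χ D using (HL)
 open Kernel R χ D using (P)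
 open ColumnOperators R P qfactorials
 Bs : List ℕ
 Bs = upTo(suc B)
 -- The multiplicities c_{i-1} - c_i of a column with parts c_0 ≥ c_1 ≥ …, the last part bounded below by u.
 mults : ∀ k → ℕ → (ℕ → ℕ) → Vec ℕ k
 mults zero u f = []
 mults(suc k)u f = (f k ∸ u) ∷ mults k(f k)f
 desc : ℕ → ℕ → (ℕ → ℕ) → |R|
 desc zero u f = 1#
 desc(suc k)u f = ⌊ u ≤ᵇ f k ⌋ * desc k(f k)f
 local : (ℕ → ℕ) → |R| → ℕ → ℕ → ℕ → |R|
 local c x k u y = (wt(c k ∸ y)x * iF(c k ∸ y)) * (F(c k ∸ u) * iF(c k ∸ c(suc k)))
 lace : (ℕ → ℕ) → |R| → ℕ → ℕ → (ℕ → ℕ) → |R|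
 lace c x zero u f = 1#
 lace c x(suc k)u f = ⌊ u ≤ᵇ f k ⌋ * (⌊ f k ≤ᵇ c k ⌋ * (local c x k u(f k) * lace c x k(f k)f))
 mults-below : ∀ k{u f g} → (∀ i → i < k → f i ≡ g i) → mults k u f ≡ mults k u g
 mults-below zero e = rfl
 mults-below(suc k){u}{f}{g}e = cong₂ _∷_(cong(_∸ u)(e k N.≤-refl))(E.trans(cong(λ y → mults k y f)(e k N.≤-refl))(mults-below k(λ i l →
  e i(N.m≤n⇒m≤1+n l))))
 desc-below : ∀ k{u f g} → (∀ i → i < k → f i ≡ g i) → desc k u f ≈ desc k u g
 desc-below zero e = refl
 desc-below(suc k){u}{f}{g}e = *c(rfx(cong(λ y → ⌊ u ≤ᵇ y ⌋)(e k N.≤-refl)))(rfx(cong(λ y → desc k y f)(e k N.≤-refl))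
  · desc-below k(λ i l → e i(N.m≤n⇒m≤1+n l)))
 lace-below : ∀ c x k{u f g} → (∀ i → i < k → f i ≡ g i) → lace c x k u f ≈ lace c x k u g
 lace-below c x zero e = refl
 lace-below c x(suc k){u}{f}{g}e = rfx(cong(λ y → ⌊ u ≤ᵇ y ⌋ * (⌊ y ≤ᵇ c k ⌋ * (local c x k u y * lace c x k y f)))(e k N.≤-refl))
  · *ˡ(*ˡ(*ˡ(lace-below c x k(λ i l → e i(N.m≤n⇒m≤1+n l)))))
 ∑-desc : ∀ k u r(v : Vec ℕ k → |R|) → u +n r ≡ B → top Bs k(λ f → desc k u f * v(mults k u f)) ≈ ∑≤ k r v
 ∑-desc zero u r v e = 1* _
 ∑-desc(suc k)u r v rfl = ∑-cong(λ y → _·_(top-cong Bs k(λ f → _·_(*c(*c(rfx(cong(λ z → ⌊ u ≤ᵇ z ⌋)([≔]-here f k y)))(rfx(cong(λ z →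
  desc k z(f [ k ≔ y ]))([≔]-here f k y)) · desc-below k{g = f}([≔]-below f k y)))(rfx(cong v(cong₂ _∷_(cong(_∸ u)([≔]-here f k y))(E.trans
  (cong(λ z → mults k z(f [ k ≔ y ]))([≔]-here f k y))(mults-below k{g = f}([≔]-below f k y)))))))(*-assoc _ _ _)))(top-*ˡ Bs k _ _))Bs ·
  from u r _ · conv-cong r(λ n s e → _·_(∑-desc k(u +n n)s(λ ns → v((u +n n ∸ u) ∷ ns))(E.trans(N.+-assoc u n s)(cong(u +n_)e)))(rfx(cong
  (λ z → ∑≤ k s(λ ns → v(z ∷ ns)))(N.m+n∸m≡n u n))))
 ∑-lace : ∀ c x k u d(v : Vec ℕ k → |R|) → c k ≡ u +n d → (∀ i → c i ≤ B) → (∀ i → i < k → c(suc i) ≤ c i) → wt d x * iF d * top Bs k(λ f → lace c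
  x k u f * v(mults k u f)) ≈ E k d x v(mults k(c k)c)
 ∑-lace c x zero u d v e bd p = *ˡ(1* _)
 ∑-lace c x(suc k)u d v e bd p = *ˡ(∑-cong(λ y → _·_(top-cong Bs k(λ f → _·_(*c(rfx(cong(λ z → ⌊ u ≤ᵇ z ⌋ * (⌊ z ≤ᵇ c k ⌋ * (local c x k u z
  * lace c x k z(f [ k ≔ y ]))))([≔]-here f k y)) · *ˡ(*ˡ(*ˡ(lace-below c x k{g = f}([≔]-below f k y)))))(rfx(cong v(cong₂ _∷_(cong(_∸ u)
  ([≔]-here f k y))(E.trans(cong(λ z → mults k z(f [ k ≔ y ]))([≔]-here f k y))(mults-below k{g = f}([≔]-below f k y)))))))(solve 5(λ a b l
  w v → a :* (b :* (l :* w)) :* v := (a :* (b :* l)) :* (w :* v))refl _ _ _ _ _)))(top-*ˡ Bs k _ _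
  · solve 4(λ a b l t → a :* (b :* l) :* t := a :* (b :* (l :* t)))refl _ _ _ _))Bs) · *ˡ sum · *ˡ(conv-cong N term
  · conv-*ˡ N(F N * iF(c k ∸ c(suc k)))_) · (*ˡ(*ˡ(conv-flip N _)) · solve 5(λ w i f j s → w :* i :* (f :* j :* s) := w :* (f :* j :* i) :* s)
  refl _ _ _ _ _) · rfx(cong(λ l → wt d x * (F l * iF n0 * iF d) * conv l(λ r k' → E k r x(λ ν → v(k' ∷ ν))(mults k(c k)c)))(E.sym N≡))where
  n0 = c k ∸ c(suc k)
  N = c k ∸ u
  u≤ : u ≤ c k
  u≤ = N.≤-trans(subst(u ≤_)(E.sym e)(N.m≤m+n u d))(p k N.≤-refl)
  N≡ : n0 +n d ≡ N
  N≡ = E.sym(E.trans(cong(_∸ u)(E.trans(E.sym(N.m∸n+n≡m(p k N.≤-refl)))(E.trans(cong(n0 +n_)(E.trans e(N.+-comm u d)))(E.sym(N.+-assoc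
   n0 d u)))))(N.m+n∸n≡m(n0 +n d)u))
  inner : ℕ → |R|
  inner y = local c x k u y * top Bs k(λ f → lace c x k y f * v((y ∸ u) ∷ mults k y f))
  sum : ∑ (λ y → ⌊ u ≤ᵇ y ⌋ * (⌊ y ≤ᵇ c k ⌋ * inner y))Bs ≈ conv N(λ n _ → inner(u +n n))
  sum = E.subst₂(λ C b → ∑ (λ y → ⌊ u ≤ᵇ y ⌋ * (⌊ y ≤ᵇ C ⌋ * inner y))(upTo(suc b)) ≈ conv N(λ n _ → inner(u +n n)))(N.m+[n∸m]≡n u≤)(E.trans
   (cong(_+n(B ∸ c k))(N.m+[n∸m]≡n u≤))(N.m+[n∸m]≡n(bd k)))(interval u N(B ∸ c k)inner)
  term : ∀ n r → n +n r ≡ N → inner(u +n n) ≈ F N * iF n0 * E k r x(λ ν → v(n ∷ ν))(mults k(c k)c)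
  term n r en = rfx(cong₂(λ a b → (wt a x * iF a) * (F N * iF n0) * top Bs k(λ f → lace c x k(u +n n)f * v(b ∷ mults k(u +n n)f)))(E.trans
   (cong(_∸ (u +n n))ck)(N.m+n∸m≡n(u +n n)r))(N.m+n∸m≡n u n)) · solve 3(λ a b t → a :* b :* t := b :* (a :* t))refl _ _ _
   · *ˡ(∑-lace c x k(u +n n)r(λ ν → v(n ∷ ν))ck bd(λ i l → p i(N.m≤n⇒m≤1+n l)))where
   ck : c k ≡ u +n n +n r
   ck = E.trans(E.sym(N.m+[n∸m]≡n u≤))(E.trans(cong(u +n_)(E.sym en))(E.sym(N.+-assoc u n r)))
 part : ℕ → (ℕ → ℕ) → |R|
 part m c = ∏< m(λ i → ⌊ c(suc i) ≤ᵇ c i ⌋)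
 inside : (ℕ → ℕ) → |R| → ℕ → (ℕ → ℕ) → |R|
 inside c x m f = ∏< m(λ i → ⌊ f i ≤ᵇ c i ⌋ * local c x i(f(suc i))(f i))
 desc-part : ∀ k f → desc k(f k)f ≈ part k f
 desc-part zero f = refl
 desc-part(suc k)f = *ˡ(desc-part k f)
 lace-inside : ∀ c x k f → lace c x k(f k)f ≈ part k f * inside c x k f
 lace-inside c x zero f = sym(1* 1#)
 lace-inside c x(suc k)f = *ˡ(*ˡ(*ˡ(lace-inside c x k f))) · solve 5(λ a b l p q → a :* (b :* (l :* (p :* q))) := (a :* p) :* (b :* l :* q))
  refl _ _ _ _ _
 part-zero : ∀ k → part k(λ _ → 0) ≈ 1#
 part-zero zero = refl
 part-zero(suc k) = 1* _ · part-zero k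
 ≰ᵇ : ∀ m n → ¬ m ≤ n → ⌊ m ≤ᵇ n ⌋ ≈ 0#
 ≰ᵇ m n ¬p with m ≤ᵇ n | N.≤ᵇ⇒≤ m n
 ... | false | _ = refl
 ... | true | f = ⊥-elim(¬p(f _))
 partition? : ∀ k c → (∀ i → i < k → c(suc i) ≤ c i) ⊎ (part k c ≈ 0#)
 partition? zero c = inj₁ λ i()
 partition? (suc k)c with c(suc k)N.≤? c k | partition? k c
 ... | no ¬p | _ = inj₂(*ʳ(≰ᵇ(c(suc k))(c k) ¬p) · zeroˡ _)
 ... | yes p | inj₂ z = inj₂(*ˡ z · zeroʳ _)
 ... | yes p | inj₁ ps = inj₁ λ i l → go i(N.m≤n⇒m<n∨m≡n(N.≤-pred l))where
  go : ∀ i → i < k ⊎ i ≡ k → c(suc i) ≤ c i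
  go i(inj₁ l) = ps i l
  go i(inj₂ rfl) = p
 E-vacuum : ∀ c x k → (∀ i → i < k → c(suc i) ≤ c i) → E k(c k)x(HL k [])(mults k(c k)c) ≈ wt(c k)x * iF(c k) * lace c x k 0(λ _ → 0)
 E-vacuum c x zero p = refl
 E-vacuum c x(suc k)p = *ˡ(conv-cong(n0 +n d)(λ r k' _ → _·_(E-* k r x _(HL k [])ns)(solve 3(λ a b e → a :* b :* 𝟏 :* e := a :* (b :* e))
  refl _ _ _)) · conv-flip(n0 +n d)_ · conv-δ(n0 +n d)0 _(λ _ r → 1# ^ᵣ suc k * E k r x(HL k [])ns)rfl · *ʳ(one(suc k)) · 1* _)
  · rfx(cong(λ l → wt d x * (F l * iF n0 * iF d) * E k l x(HL k [])ns)(N.m∸n+n≡m(p k N.≤-refl)))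
  · *ˡ(E-vacuum c x k(λ i l → p i(N.m≤n⇒m≤1+n l))) · solve 7(λ w f j i v g e → w :* (f :* j :* i) :* (v :* g :* e) := w :* i :* (𝟏 :* (𝟏 :* (v :*
  g :* (f :* j) :* e))))refl _ _ _ _ _ _ _ where
  d = c(suc k)
  n0 = c k ∸ d
  ns = mults k(c k)c
  one : ∀ n → 1# ^ᵣ n ≈ 1#
  one zero = refl
  one(suc n) = 1* _ · one n
 module _(m : ℕ)where
  kernel : (ℕ → ℕ) → ℤ → (ℕ → ℕ) → |R|
  kernel c e c' = part m c * inside c(T e)m c'
  total : (ℕ → ℕ) → ℤ → List ℤ → |R|
  total c e [] = kernel c e(λ _ → 0)
  total c e(e' ∷ es) = tuples 0 m(∑ₓ Bs)(λ c' → kernel c e c' * total c' e' es)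
  total-columns : ∀ c e es → (∀ i → c i ≤ B) → (∀ i → m ≤ i → c i ≡ 0) → total c e es ≈ part m c * columns m(e ∷ es)(mults m 0 c)
  total-columns c e es bd z with partition? m c
  total-columns c e [] bd z | inj₂ q = (*ʳ q · zeroˡ _) · sym(*ʳ q · zeroˡ _)
  total-columns c e(e' ∷ es)bd z | inj₂ q = S-cong(lin Bs m)(λ c' → _·_(*ʳ(*ʳ q · zeroˡ _))(zeroˡ _ · sym(zeroˡ 0#)))
   · S-*ˡ(lin Bs m)0#(λ _ → 0#) · zeroˡ _ · sym(*ʳ q · zeroˡ _)
  total-columns c e [] bd z | inj₁ p = *ˡ(sym(lace-inside c(T e)m(λ _ → 0) · *ʳ(part-zero m) · 1* _) · sym(*ʳ(1* 1#) · 1* _)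
   · rfx(cong(λ d → wt d(T e) * iF d * lace c(T e)m 0(λ _ → 0))(E.sym cm)) · sym(E-vacuum c(T e)m p)
   · rfx(cong(λ d → E m d(T e)(HL m [])(mults m d c))cm))where
   cm = z m N.≤-refl
  total-columns c e(e' ∷ es)bd z | inj₁ p = tuples-cong-upTo B m(λ c' bd' z' → _·_(*ˡ(total-columns c' e' es bd' z'))(solve 4(λ a b p v → a :*
   b :* (p :* v) := a :* (p :* b :* v))refl _ _ _ _ · *ˡ(*ʳ(sym(lace-inside c(T e)m c')
   · rfx(cong(λ u → lace c(T e)m u c')(z' m N.≤-refl)))))) · S-*ˡ(lin Bs m)_ _
   · *ˡ(tuples-top Bs m(λ h → *c(lace-below c(T e)m(λ i _ → h i))(rfx(cong v(mults-below m(λ i _ → h i)))))) · *ˡ(sym(*ʳ(1* 1#)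
   · 1* _)) · *ˡ(∑-lace c(T e)m 0 0 v cm bd p) · *ˡ(rfx(cong(λ d → E m 0(T e)v(mults m d c))cm))where
   cm = z m N.≤-refl
   v = columns m(e' ∷ es)
  kernels : ℤ → List ℤ → (ℕ → ℕ → ℕ) → |R|
  kernels e [] t = kernel(t 0)e(t 1)
  kernels e(e' ∷ es)t = kernel(t 0)e(t 1) * kernels e' es(λ a → t(suc a))
  grid-total : ∀ c e es → grid Bs(length es)m(λ t → kernels e es(c :: t)) ≈ total c e es
  grid-total c e [] = refl
  grid-total c e(e' ∷ es) = S-cong(lin Bs m)(λ c' → _·_(S-*ˡ(tuples-linear(length es)(lin Bs m))_ _)(*ˡ(grid-total c' e' es)))
  -- The sum over all families is a sum over the multiplicities of the first column.
  grid-columns : ∀ (w : Vec ℕ m → |R|)e es → grid Bs(suc(length es))m(λ t → w(mults m 0(t 0)) * kernels e es t) ≈ ∑≤ m B(λ ns → w ns * columns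
   m(e ∷ es)ns)
  grid-columns w e es = tuples-cong-upTo B m(λ c bd z → _·_(S-*ˡ(tuples-linear(length es)(lin Bs m))_ _)(*ˡ(grid-total c e es
   · total-columns c e es bd z · *ʳ(sym(rfx(cong(λ u → desc m u c)(E.sym(z m N.≤-refl))) · desc-part m c)))
   · solve 3(λ w d v → w :* (d :* v) := d :* (w :* v))refl _ _ _)) · tuples-top Bs m(λ h → *c(desc-below m(λ i _ → h i))(rfx(cong φ
   (mults-below m(λ i _ → h i))))) · ∑-desc m 0 B φ rfl where
   φ : Vec ℕ m → |R|
   φ ns = w ns * columns m(e ∷ es)ns
open import Data.Nat using (_<?_)
open import Data.Bool using (if_then_else_; _∧_)
open import Data.Fin using (fromℕ<)
open import Data.List using (foldr; filterᵇ)
at-< : ∀ {A : Set}{k}(d : A)(g : Fin k → A)i(p : i < k) → at d g i ≡ g(fromℕ< p)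
at-< {k = suc k}d g zero p = rfl
at-< {k = suc k}d g(suc i)(s≤s p) = at-< d(λ j → g(Fin.suc j))i p
at-≥ : ∀ {A : Set}{k}(d : A)(g : Fin k → A)i → k ≤ i → at d g i ≡ d
at-≥ {k = zero}d g i p = rfl
at-≥ {k = suc k}d g(suc i)(s≤s p) = at-≥ d(λ j → g(Fin.suc j))i p
ext-at : ∀ {m n}(s : Fam m n)i j → ext s i j ≡ at(λ _ → 0)(λ i → at 0(s i))i j
ext-at{m}{n}s i j with i <? m | j <? n
... | yes p | yes q = E.sym(E.trans(cong(λ f → f j)(at-< (λ _ → 0)(λ i → at 0(s i))i p))(at-< 0(s(fromℕ< p))j q))
... | yes p | no q = E.sym(E.trans(cong(λ f → f j)(at-< (λ _ → 0)(λ i → at 0(s i))i p))(at-≥ 0(s(fromℕ< p))j(N.≮⇒≥ q)))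
... | no p | _ = E.sym(cong(λ f → f j)(at-≥ (λ _ → 0)(λ i → at 0(s i))i(N.≮⇒≥ p)))
ext-last : ∀ {m n}(s : Fam m n)i → ext s i n ≡ 0
ext-last{m}{n}s i with i <? m | n <? n
... | yes p | yes q = ⊥-elim(N.<-irrefl rfl q)
... | yes p | no _ = rfl
... | no _ | _ = rfl
allB-true : ∀ n p → allB(upTo n)p ≡ true → ∀ i → i < n → p i ≡ true
allB-true n p = go n(λ i → i)where
 go : ∀ n h → allB(applyUpTo h n)p ≡ true → ∀ i → i < n → p(h i) ≡ true
 go(suc n)h e i l with p(h 0)in q
 go(suc n)h e zero l | true = q
 go(suc n)h e(suc i)(s≤s l) | true = go n(λ i → h(suc i))e i l
∧-true : ∀ {a b} → a ∧ b ≡ true → (a ≡ true) × (b ≡ true)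
∧-true{true}e = rfl , e
≤ᵇ-true⇒≤ : ∀ m n → (m ≤ᵇ n) ≡ true → m ≤ n
≤ᵇ-true⇒≤ m n e with m ≤ᵇ n | N.≤ᵇ⇒≤ m n
≤ᵇ-true⇒≤ m n rfl | true | f = f _
sum<-cong : ∀ n{f g : ℕ → ℤ} → (∀ i → i < n → f i ≡ g i) → sum< n f ≡ sum< n g
sum<-cong zero e = rfl
sum<-cong(suc n)e = cong₂ _+z_(e 0(s≤s z≤n))(sum<-cong n(λ i l → e(suc i)(s≤s l)))
sum<-+ : ∀ n f g → sum< n(λ i → f i +z g i) ≡ sum< n f +z sum< n g
sum<-+ zero f g = rfl
sum<-+ (suc n)f g = E.trans(cong(λ z → f 0 +z g 0 +z z)(sum<-+ n _ _))(lem(f 0)(g 0)_ _)where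
 lem : ∀ a b c d → a +z b +z(c +z d) ≡ a +z c +z(b +z d)
 lem = ringℤ
sum<-* : ∀ n c f → sum< n(λ i → c *z f i) ≡ c *z sum< n f
sum<-* zero c f = E.sym(Z.*-zeroʳ c)
sum<-* (suc n)c f = E.trans(cong(λ z → c *z f 0 +z z)(sum<-* n c _))(E.sym(Z.*-distribˡ-+ c(f 0)_))
sum<-swap : ∀ m n(f : ℕ → ℕ → ℤ) → sum< m(λ i → sum< n(f i)) ≡ sum< n(λ j → sum< m(λ i → f i j))
sum<-swap zero n f = E.sym(E.trans(sum<-cong n(λ j _ → E.sym(Z.*-zeroʳ(+ 0))))(sum<-* n(+ 0)(λ _ → + 0)))
sum<-swap(suc m)n f = E.trans(cong(λ z → sum< n(f 0) +z z)(sum<-swap m n(λ i → f(suc i))))(E.sym(sum<-+ n(f 0)_))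
sum<-natural : ∀ n{f : ℕ → ℤ} → (∀ i → i < n → ∃ λ k → f i ≡ + k) → ∃ λ k → sum< n f ≡ + k
sum<-natural zero h = 0 , rfl
sum<-natural(suc n){f}h with h 0(s≤s z≤n) | sum<-natural n{λ i → f(suc i)}(λ i l → h(suc i)(s≤s l))
... | a , p | b , q = a +n b , cong₂ _+z_ p q
-- Summation by parts: the linear terms of 𝒜.
abel : ∀ N k a(S : ℕ → ℤ) → sum< (suc k)(λ b → (+ 2 *z(a +z + b) +z + 1 -z N) *z(S b -z S(suc b))) ≡ (+ 2 *z a +z + 1 -z N) *z S 0 +z + 2 *z sum<
 k(λ b → S(suc b)) -z(+ 2 *z(a +z + k) +z + 1 -z N) *z S(suc k)
abel N zero a S = lem a N(S 0)(S 1)where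
 lem : ∀ a N x y → (+ 2 *z(a +z + 0) +z + 1 -z N) *z(x -z y) +z + 0 ≡ (+ 2 *z a +z + 1 -z N) *z x +z + 2 *z + 0 -z(+ 2 *z(a +z + 0) +z + 1 -z N)
  *z y
 lem = ringℤ
abel N(suc k)a S = E.trans(cong(λ z → (+ 2 *z(a +z + 0) +z + 1 -z N) *z(S 0 -z S 1) +z z)(E.trans(sum<-cong(suc k)(λ b _ → cong(λ z → (+ 2
 *z z +z + 1 -z N) *z(S(suc b) -z S(suc(suc b))))(step a(+ b))))(abel N k(a +z + 1)(λ b → S(suc b)))))(lem a N(S 0)(S 1)(sum< k(λ b → S
 (suc(suc b))))(S(suc(suc k)))(+ k))where
 step : ∀ a b → a +z(+ 1 +z b) ≡ a +z + 1 +z b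
 step = ringℤ
 lem : ∀ a N x y z w k → (+ 2 *z(a +z + 0) +z + 1 -z N) *z(x -z y) +z((+ 2 *z(a +z + 1) +z + 1 -z N) *z y +z + 2 *z z -z(+ 2 *z(a +z + 1 +z k)
  +z + 1 -z N) *z w) ≡ (+ 2 *z a +z + 1 -z N) *z x +z + 2 *z(y +z z) -z(+ 2 *z(a +z(+ 1 +z k)) +z + 1 -z N) *z w
 lem = ringℤ
-- The exponent of c^d p^(d(d-1)/2) in terms of that of c, where p = t^(2N).
exponent : ℕ → ℕ → ℕ → ℕ
exponent N c zero = 0
exponent N c(suc d) = c +n(N +n N) *n d +n exponent N c d
exponent-closed : ∀ N c d → + exponent N c d ≡ + N *z(+ d *z + d) +z(+ c -z + N) *z + d
exponent-closed N c zero = lem(+ N)(+ c)where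
 lem : ∀ N c → + 0 ≡ N *z(+ 0 *z + 0) +z(c -z N) *z + 0
 lem = ringℤ
exponent-closed N c(suc d) = E.trans(cong₂(λ x y → + c +z x +z y)(Z.pos-* (N +n N)d)(exponent-closed N c d))(lem(+ N)(+ c)(+ d))where
 lem : ∀ N c d → c +z(N +z N) *z d +z(N *z(d *z d) +z(c -z N) *z d) ≡ N *z((+ 1 +z d) *z(+ 1 +z d)) +z(c -z N) *z(+ 1 +z d)
 lem = ringℤ
colSum-sum< : ∀ {m n}(s : Fam m n)j → + colSum s j ≡ sum< m(λ i → + ext s i j)
colSum-sum< {m}s j = go m(λ i → i)where
 go : ∀ k h → + foldr _+n_ 0(map(λ i → ext s i j)(applyUpTo h k)) ≡ sum< k(λ i → + ext s(h i)j)
 go zero h = rfl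
 go(suc k)h = cong(λ z → + ext s(h 0)j +z z)(go k(λ i → h(suc i)))
exponents : ∀ {m μ}(s : Fam m(suc μ)) → (∀ i a → i < m → a < suc μ → ext s i(suc a) ≤ ext s i a) → twoA s +z + colSum s 0 ≡ sum< (suc μ)(λ a →
 sum< m(λ i → + exponent(suc μ)(1 +n a +n a)(ext s i a ∸ ext s i(suc a))))
exponents{m}{μ}s le = E.sym(E.trans(sum<-cong N step)(E.trans(sum<-+ N(λ a → + N *z sq a)(λ a → co a *z(S a -z S(suc a))))(E.trans(cong₂
 _+z_(E.trans(sum<-* N(+ N)sq)(cong(λ z → + N *z z)(E.trans(E.sym(sum<-swap m N(λ i a → d i a *z d i a)))(E.sym squares))))(abel(+ N)μ
 (+ 0)S))(E.trans(cong(λ z → + N *z Q +z((+ 2 *z + 0 +z + 1 -z + N) *z S 0 +z + 2 *z sum< μ(λ b → S(suc b)) -z(+ 2 *z(+ 0 +z + μ) +z + 1 -z +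
 N) *z z))S-last)(E.trans(lem2(+ N)Q(S 0)(sum< μ(λ b → S(suc b)))(+ μ))(cong(λ z → -z(+ N *z S 0) +z + 2 *z z +z + N *z Q +z S 0)(E.sym
 (sumℤ-applyUpTo(λ j → S(suc j))(λ i → i)μ))))))))where
 N = suc μ
 d : ℕ → ℕ → ℤ
 d i a = + ext s i a -z + ext s i(suc a)
 S : ℕ → ℤ
 S a = + colSum s a
 sq co : ℕ → ℤ
 sq a = sum< m(λ i → d i a *z d i a)
 co a = + 2 *z(+ 0 +z + a) +z + 1 -z + N
 Q = sumℤ(map(λ i → sumℤ(map(λ a → d i a *z d i a)(upTo N)))(upTo m))
 squares : Q ≡ sum< m(λ i → sum< N(λ a → d i a *z d i a))
 squares = E.trans(sumℤ-applyUpTo(λ i → sumℤ(map(λ a → d i a *z d i a)(upTo N)))(λ i → i)m)(sum<-cong m(λ i _ → sumℤ-applyUpTo(λ a → d i a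
  *z d i a)(λ i → i)N))
 d≡ : ∀ i a → i < m → a < N → + (ext s i a ∸ ext s i(suc a)) ≡ d i a
 d≡ i a li la = E.sym(E.trans(Z.m-n≡m⊖n(ext s i a)(ext s i(suc a)))(Z.⊖-≥ (le i a li la)))
 lem1 : ∀ a N → (+ 1 +z a +z a) -z N ≡ + 2 *z(+ 0 +z a) +z + 1 -z N
 lem1 = ringℤ
 diff : ∀ a → sum< m(λ i → d i a) ≡ S a -z S(suc a)
 diff a = E.trans(sum<-cong m(λ i _ → cong(λ z → + ext s i a +z z)(lem3(+ ext s i(suc a)))))(E.trans(sum<-+ m(λ i → + ext s i a)(λ i → -[1+
  0 ] *z + ext s i(suc a)))(E.trans(cong₂ _+z_(E.sym(colSum-sum< s a))(E.trans(sum<-* m -[1+ 0 ](λ i → + ext s i(suc a)))(cong(λ z → -[1+ 0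
  ] *z z)(E.sym(colSum-sum< s(suc a))))))(cong(λ z → S a +z z)(E.sym(lem3(S(suc a)))))))where
  lem3 : ∀ x → -z x ≡ -[1+ 0 ] *z x
  lem3 = ringℤ
 step : ∀ a → a < N → sum< m(λ i → + exponent N(1 +n a +n a)(ext s i a ∸ ext s i(suc a))) ≡ + N *z sq a +z co a *z(S a -z S(suc a))
 step a la = E.trans(sum<-cong m{g = λ i → + N *z(d i a *z d i a) +z co a *z d i a}(λ i li → E.trans(exponent-closed N(1 +n a +n a)(ext s i a ∸
  ext s i(suc a)))(cong₂(λ x y → + N *z(x *z x) +z y *z x)(d≡ i a li la)(lem1(+ a)(+ N)))))(E.trans(sum<-+ m(λ i → + N *z(d i a *z d i a))
  (λ i → co a *z d i a))(cong₂ _+z_(sum<-* m(+ N)(λ i → d i a *z d i a))(E.trans(sum<-* m(co a)(λ i → d i a))(cong(λ z → co a *z z)(diff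
  a)))))
 S-last : S(suc μ) ≡ + 0
 S-last = E.trans(colSum-sum< s(suc μ))(E.trans(sum<-cong m(λ i _ → cong +_(ext-last s i)))(sum<-* m(+ 0)(λ _ → + 0)))
 lem2 : ∀ N Q x y k → N *z Q +z((+ 2 *z + 0 +z + 1 -z N) *z x +z + 2 *z y -z(+ 2 *z(+ 0 +z k) +z + 1 -z N) *z + 0) ≡ -z(N *z x) +z + 2 *z y +z N
  *z Q +z x
 lem2 = ringℤ
module EmbeddedProducts(R : Ring)(χ : Char R)(ε : Embedding R χ)where
 open CommutativeRing R hiding (zero) renaming (*-congˡ to *ˡ; *-congʳ to *ʳ; +-congˡ to +ˡ; *-identityˡ to 1*; -‿cong to -ᶜ; +-cong to +c; reflexive
  to rfx; trans to infixr 1 _·_)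
 open Char χ
 open Embedding ε
 open RingSolver R
 open Sums R
 open CharProperties R χ
 open TupleSums R
 embed-⊛ : ∀ f g → embed(f ⊛ g) ≈ embed f * embed g
 embed-⊛ f g = rfx(cong(λ op → embed(op f g))(E.sym ⊠-def)) · embed-* f g
 embed-⊕ : ∀ f g → embed(f ⊕ g) ≈ embed f + embed g
 embed-⊕ f g = rfx(cong(λ op → embed(op f g))(E.sym ⊞-def)) · embed-+ f g
 embed-one : embed oneS ≈ 1#
 embed-one = rfx(cong embed(E.sym unitS-def)) · embed-1
 embed-prodS : ∀ {A : Set}(f : A → Series)xs → embed(prodS(map f xs)) ≈ ∏ (λ x → embed(f x))xs
 embed-prodS f [] = embed-one
 embed-prodS f(x ∷ xs) = embed-⊛ _ _ · *ˡ(embed-prodS f xs)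
 embed-concatMap : ∀ {A : Set}(rows : A → List Series)xs → embed(prodS(concatMap rows xs)) ≈ ∏ (λ x → embed(prodS(rows x)))xs
 embed-concatMap rows [] = embed-one
 embed-concatMap rows(x ∷ xs) = append(rows x) · *ˡ(embed-concatMap rows xs)where
  append : ∀ fs → embed(prodS(fs ++ concatMap rows xs)) ≈ embed(prodS fs) * embed(prodS(concatMap rows xs))
  append [] = sym(*ʳ embed-one · 1* _)
  append(f ∷ fs) = embed-⊛ f(prodS(fs ++ concatMap rows xs)) · *ˡ(append fs) · sym(*-assoc _ _ _) · *ʳ(sym(embed-⊛ f(prodS fs)))
 embed-mono : ∀ e → embed(monoS(+ 1)e) ≈ T(+ e)
 embed-mono e = rfx(cong embed(E.sym(tpow-def e))) · embed-T e
 embed-mono⁻ : ∀ e → embed(monoS -[1+ 0 ] e) ≈ - T(+ e)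
 embed-mono⁻ e = embed-cong pt · embed-neg(tpow e) · -ᶜ(embed-T e)where
  pt : monoS -[1+ 0 ] e ≗ ⊟ tpow e
  pt K = E.trans(go(K ℕ.≡ᵇ e))(E.sym(E.trans(⊟-def(tpow e)K)(cong(λ f → -z f K)(tpow-def e))))where
   go : ∀ b → (if b then -[1+ 0 ] else + 0) ≡ -z(if b then + 1 else + 0)
   go true = rfl
   go false = rfl
 embed-poch : ∀ α β k → embed(poch(+ 1)α β k) ≈ ∏< k(λ j → ⟦ + (α +n j *n β) ⟧)
 embed-poch α β k = embed-prodS _(upTo k) · ∏-upTo k _ · ∏<-cong k(λ j _ → _·_(embed-⊕ _ _)(+c embed-one(embed-mono⁻ _)))
 embed-poch⁻ : ∀ α β k → embed(poch -[1+ 0 ] α β k) ≈ ∏< k(λ j → 1# + T(+ (α +n j *n β)))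
 embed-poch⁻ α β k = embed-prodS _(upTo k) · ∏-upTo k _ · ∏<-cong k(λ j _ → _·_(embed-⊕ _ _)(+c embed-one(embed-mono _)))
 ⊛-0 : ∀ f g → f 0 ≡ + 1 → g 0 ≡ + 1 → (f ⊛ g)0 ≡ + 1
 ⊛-0 f g p q = E.trans(Z.+-identityʳ _)(cong₂ _*z_ p q)
 prodS-0 : ∀ {A : Set}(f : A → Series)xs → (∀ x → f x 0 ≡ + 1) → prodS(map f xs)0 ≡ + 1
 prodS-0 f [] h = rfl
 prodS-0 f(x ∷ xs)h = ⊛-0(f x)(prodS(map f xs))(h x)(prodS-0 f xs h)
 poch-0 : ∀ c α β k → poch c(suc α)β k 0 ≡ + 1
 poch-0 c α β k = prodS-0 _(upTo k)(λ j → rfl)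
 embed-invS : ∀ f → f 0 ≡ + 1 → embed f * embed(invS f) ≈ 1#
 embed-invS f p = sym(embed-* f(invS f)) · embed-cong(invS-inverse f p) · embed-1
 inverse-unique : ∀ {x y z} → x * y ≈ 1# → x * z ≈ 1# → y ≈ z
 inverse-unique{x}{y}{z}p q = sym(*ˡ q · *-identityʳ _) · solve 3(λ x y z → y :* (x :* z) := x :* y :* z)refl _ _ _ · *ʳ p · 1* _
 embed-shift : ∀ {e k}f → e ≡ + k → embed(shiftZ e f) ≈ T(+ k) * embed f
 embed-shift{k = k}f rfl = embed-cong(λ K → E.trans(pt k K f)(E.sym(tpow-⊠ k f K))) · embed-* _ _ · *ʳ(embed-T k)where
  select : ℤ → Series → ℤ
  select(+ k)f = f k
  select -[1+ _ ] f = + 0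
  shiftZ-select : ∀ e f K → shiftZ e f K ≡ select(+ K -z e)f
  shiftZ-select e f K with(+ K) -z e
  ... | + _ = rfl
  ... | -[1+ _ ] = rfl
  go : ∀ k K f → select(K ℤ.⊖ k)f ≡ shiftS k f K
  go zero K f = rfl
  go(suc k)zero f = rfl
  go(suc k)(suc K)f = E.trans(cong(λ z → select z f)(Z.[1+m]⊖[1+n]≡m⊖n K k))(go k K f)
  pt : ∀ k K f → shiftZ(+ k)f K ≡ shiftS k f K
  pt k K f = E.trans(shiftZ-select(+ k)f K)(E.trans(cong(λ z → select z f)(Z.m-n≡m⊖n K k))(go k K f))
 embed-sum : ∀ {A : Set}(f : A → Series)xs → embed(λ K → sumℤ(map(λ x → f x K)xs)) ≈ ∑ (λ x → embed(f x))xs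
 embed-sum f [] = embed-cong(λ K → E.sym(zeroS-def K)) · embed-0
 embed-sum f(x ∷ xs) = embed-cong(λ K → rfl) · embed-⊕ (f x)_ · +ˡ(embed-sum f xs)
 ∑-filter : ∀ {A : Set}(p : A → Bool)φ xs → ∑ φ(filterᵇ p xs) ≈ ∑ (λ x → if p x then φ x else 0#)xs
 ∑-filter p φ [] = refl
 ∑-filter p φ(x ∷ xs)with p x
 ... | true = +ˡ(∑-filter p φ xs)
 ... | false = ∑-filter p φ xs · sym(+-identityˡ _)
 T-sum< : ∀ n f → T(sum< n f) ≈ ∏< n(λ i → T(f i))
 T-sum< zero f = T-0
 T-sum< (suc n)f = T-+ _ _ · *ˡ(T-sum< n(λ i → f(suc i))) · sym(∏<-first n(λ i → T(f i)))
 ⌊∧⌋ : ∀ a b → ⌊ a ∧ b ⌋ ≈ ⌊ a ⌋ * ⌊ b ⌋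
 ⌊∧⌋ true b = sym(1* _)
 ⌊∧⌋ false b = sym(zeroˡ _)
 ⌊allB⌋ : ∀ xs p → ⌊ allB xs p ⌋ ≈ ∏ (λ x → ⌊ p x ⌋)xs
 ⌊allB⌋ [] p = refl
 ⌊allB⌋ (x ∷ xs)p = ⌊∧⌋ (p x)_ · *ˡ(⌊allB⌋ xs p)
 ⌊valid⌋ : ∀ xs ys(c c' : ℕ → ℕ → Bool) → ⌊ allB xs(λ i → allB ys(λ a → c i a ∧ c' i a)) ⌋ ≈ ∏ (λ i → ∏ (λ a → ⌊ c i a ⌋ * ⌊ c' i a ⌋)ys)xs
 ⌊valid⌋ xs ys c c' = ⌊allB⌋ xs(λ i → allB ys(λ a → c i a ∧ c' i a)) · ∏-cong(λ i → _·_(⌊allB⌋ ys(λ a → c i a ∧ c' i a))(∏-cong(λ a → ⌊∧⌋ (c i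
  a)(c' i a))ys))xs
 embed-grid : ∀ (f : ℕ → ℕ → Series)xs ys → embed(prodS(concatMap(λ i → map(f i)ys)xs)) ≈ ∏ (λ i → ∏ (λ a → embed(f i a))ys)xs
 embed-grid f xs ys = embed-concatMap(λ i → map(f i)ys)xs · ∏-cong(λ i → embed-prodS(f i)ys)xs
module EmbeddedFamilies(R : Ring)(χ : Char R)(ε : Embedding R χ)(μ J B m' : ℕ)where
 open CommutativeRing R hiding (zero) renaming (Carrier to |R|; *-congˡ to *ˡ; *-congʳ to *ʳ; +-congˡ to +ˡ; *-identityˡ to 1*; -‿cong to -ᶜ; *-cong
  to *c; reflexive to rfx; trans to infixr 1 _·_)
 open Char χ
 open Embedding ε
 open RingSolver R
 open Sums R
 open CharProperties R χ
 open TupleSums R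
 open EmbeddedProducts R χ ε
 𝓕 = SeriesOrders.filtration R χ ε
 open ColumnFamilies R χ 𝓕 μ J B
 open ColumnAsymptotics R χ 𝓕 μ J
 open Trunc R χ 𝓕 μ J using (M)
 open ConfigWeights R χ M J using (T-^)
 open ChainSteps R χ M using (D)
 open Kernel R χ D using (P)
 open ColumnOperators R P qfactorials using (wt)
 open Bounded R χ M using (h)
 N m : ℕ
 N = suc μ
 m = suc m'
 embed-qp : ∀ k → embed(qp(2 *n N)k) ≈ F k
 embed-qp k = embed-poch(2 *n N)(2 *n N)k · go k where
  go : ∀ k → ∏< k(λ j → ⟦ + (2 *n N +n j *n(2 *n N)) ⟧) ≈ F k
  go zero = refl
  go(suc k) = *-comm _ _ · *c(go k)(+ˡ(-ᶜ(T-cong(eq k) · sym(T-^ D(suc k)))))where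
   eq : ∀ k → + (2 *n N +n k *n(2 *n N)) ≡ D *z + suc k
   eq k = E.trans(cong(λ z → + (2 *n N) +z z)(Z.pos-* k(2 *n N)))(E.trans(cong(λ z → z +z + k *z z)(Z.pos-* 2 N))(lem(+ N)(+ k)))where
    lem : ∀ N k → + 2 *z N +z k *z(+ 2 *z N) ≡ (N +z N) *z(+ 1 +z k)
    lem = ringℤ
 embed-h : ∀ k → embed(poch -[1+ 0 ] N N k) ≈ h k
 embed-h k = embed-poch⁻ N N k · go k where
  go : ∀ k → ∏< k(λ j → 1# + T(+ (N +n j *n N))) ≈ h k
  go zero = refl
  go(suc k) = *c(+ˡ(T-cong(E.trans(cong(λ z → M +z z)(Z.pos-* k N))(lem M(+ k))) · sym(T-^ M(suc k))))(go k)where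
   lem : ∀ M k → M +z k *z M ≡ M *z(+ 1 +z k)
   lem = ringℤ
 wt-T : ∀ d c → wt d(T(+ c)) ≈ T(+ exponent N c d)
 wt-T zero c = sym T-0
 wt-T(suc d)c = *c(*ˡ(T-^ D d) · sym(T-+ _ _))(wt-T d c) · sym(T-+ _ _)
  · T-cong(cong(λ z → + c +z z +z + exponent N c d)(E.sym(Z.pos-* (N +n N)d)))
 embed-iF : ∀ {f k} → f ≡ qp(2 *n N)k → embed(invS f) ≈ iF k
 embed-iF{k = k}rfl = inverse-unique(embed-invS(qp(2 *n N)k)(poch-0 _ _ _ k))(*ʳ(embed-qp k) · QFactorials.F-iF qfactorials k)
 embed-iFF : ∀ a b → embed(invS(qp(2 *n N)a ⊛ qp(2 *n N)b)) ≈ iF a * iF b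
 embed-iFF a b = inverse-unique(embed-invS _(⊛-0(qp(2 *n N)a)(qp(2 *n N)b)(poch-0 _ _ _ a)(poch-0 _ _ _ b)))(*ʳ(embed-⊛ _ _
  · *c(embed-qp a)(embed-qp b)) · *-interchange _ _ _ _ · *c(QFactorials.F-iF qfactorials a)(QFactorials.F-iF qfactorials b) · 1* 1#)
 starts : ℕ → ℕ → List ℤ
 starts c zero = []
 starts c(suc k) = + suc(suc c) ∷ starts(suc(suc c))k
 -- The value of a family with t a i = s_{i+1}^{(a)}.
 value : (ℕ → ℕ → ℕ) → |R|
 value t = ∏< m'(λ i → h(t 0 i ∸ t 0(suc i))) * ∏< N(λ a → kernel m(t a)(+ (1 +n a +n a))(t(suc a)))
 h-weight : Vec ℕ m → |R|
 h-weight(n ∷ ns) = 1# * vector-weight h ns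
 value-kernels : ∀ t → value t ≈ h-weight(mults m 0(t 0)) * kernels m(+ 1)(starts 1 μ)t
 value-kernels t = *c(go m' · sym(1* _))(∏<-cong N(λ a _ → rfx(cong(λ z → kernel m(t a)(+ z)(t(suc a)))(cong suc rfl)))
  · spread μ 1 t)where
  go : ∀ k → ∏< k(λ i → h(t 0 i ∸ t 0(suc i))) ≈ vector-weight h(mults k(t 0 k)(t 0))
  go zero = refl
  go(suc k) = *ˡ(go k)
  spread : ∀ k c t → ∏< (suc k)(λ a → kernel m(t a)(+ (c +n a +n a))(t(suc a))) ≈ kernels m(+ c)(starts c k)t
  spread zero c t = *-identityʳ _ · rfx(cong(λ z → kernel m(t 0)(+ z)(t 1))(E.trans(N.+-identityʳ _)(N.+-identityʳ c)))
  spread(suc k)c t = ∏<-first(suc k)_ · *c(rfx(cong(λ z → kernel m(t 0)(+ z)(t 1))(E.trans(N.+-identityʳ _)(N.+-identityʳ c))))(∏<-cong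
   (suc k)(λ a _ → rfx(cong(λ z → kernel m(t(suc a))(+ z)(t(suc(suc a))))(moved c a))) · spread k(suc(suc c))(λ a → t(suc a)))where
   moved : ∀ c a → c +n suc a +n suc a ≡ suc(suc c) +n a +n a
   moved c a = E.trans(cong(_+n suc a)(N.+-suc c a))(cong suc(N.+-suc(c +n a)a))
 summand' : Fam m N → Series
 summand' s = shiftZ(twoA s +z + colSum s 0)(calB(2 *n N)s ⊛ prodS(map(λ i → poch -[1+ 0 ] N N(ext s i 0 ∸ ext s(suc i)0))(upTo m')))
 ∏² : (ℕ → ℕ → |R|) → |R|
 ∏² φ = ∏< N(λ a → ∏< m(φ a))
 ∏²-* : ∀ φ ψ → ∏²(λ a i → φ a i * ψ a i) ≈ ∏² φ * ∏² ψ
 ∏²-* φ ψ = ∏<-cong N(λ a _ → ∏<-* m(φ a)(ψ a)) · ∏<-* N(λ a → ∏< m(φ a))(λ a → ∏< m(ψ a))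
 ∏²-cong : ∀ {φ ψ} → (∀ a i → φ a i ≈ ψ a i) → ∏² φ ≈ ∏² ψ
 ∏²-cong e = ∏<-cong N(λ a _ → ∏<-cong m(λ i _ → e a i))
 ∏²-lists : ∀ φ → ∏ (λ i → ∏ (λ a → φ a i)(upTo N))(upTo m) ≈ ∏² φ
 ∏²-lists φ = ∏-swap(λ i a → φ a i)(upTo m)(upTo N) · ∏-upTo N(λ a → ∏ (φ a)(upTo m)) · ∏<-cong N(λ a _ → ∏-upTo m(φ a))
 module Factors(t : ℕ → ℕ → ℕ)where
  cond local-F local-d local-n weight : ℕ → ℕ → |R|
  d n : ℕ → ℕ → ℕ
  d a i = t a i ∸ t(suc a)i
  n a i = t a i ∸ t a(suc i)
  cond a i = ⌊ t a(suc i) ≤ᵇ t a i ⌋ * ⌊ t(suc a)i ≤ᵇ t a i ⌋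
  local-F a i = F(t a i ∸ t(suc a)(suc i))
  local-d a i = iF(d a i)
  local-n a i = iF(n a i)
  weight a i = T(+ exponent N(1 +n a +n a)(d a i))
  H : |R|
  H = ∏< m'(λ i → h(n 0 i))
  value-split : value t ≈ ∏² cond * (H * (∏² weight * ∏²(λ a i → local-F a i * (local-d a i * local-n a i))))
  value-split = *ˡ(∏<-cong N(λ a _ → sym(∏<-* m _ _))) · *ˡ(∏²-cong(λ a i → _·_(*ˡ(*ˡ(*ʳ(*ʳ(wt-T(d a i)(1 +n a +n a))))))(solve 6(λ p q
   w x f y → p :* (q :* (w :* x :* (f :* y))) := p :* q :* (w :* (f :* (x :* y))))refl ⌊ t a(suc i) ≤ᵇ t a i ⌋ ⌊ t(suc a)i ≤ᵇ t a i ⌋ (weight a i)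
   (local-d a i)(local-F a i)(local-n a i)))) · *ˡ(∏²-* cond _ · *ˡ(∏²-* weight(λ a i → local-F a i * (local-d a i * local-n a i))))
   · solve 3(λ a b c → a :* (b :* c) := b :* (a :* c))refl _ _ _
  shifted : (∀ i → t N i ≡ 0) → ∏²(λ a i → local-F a i * (local-d a i * iF(n(suc a)i))) * ∏< m(local-n 0) ≈ ∏²(λ a i → local-F a i * (local-d a
   i * local-n a i))
  shifted z = *ʳ(∏²-* local-F _ · *ˡ(∏²-* local-d(λ a i → iF(n(suc a)i))))
   · solve 4(λ f x y z → f :* (x :* y) :* z := f :* (x :* (z :* y)))refl _ _ _ _ · *ˡ(*ˡ(sym(∏<-first N(λ a → ∏< m(local-n a)))))
   · *ˡ(*ˡ(*ʳ(∏<-cong m(λ i _ → rfx(cong iF(cong₂ _∸_(z i)(z(suc i))))) · ones m) · 1* _)) · sym(∏²-* local-F _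
   · *ˡ(∏²-* local-d local-n))where
   ones : ∀ k → ∏< k(λ _ → 1#) ≈ 1#
   ones zero = refl
   ones(suc k) = 1* _ · ones k
 module _(s : Fam m N)where
  private
   t : ℕ → ℕ → ℕ
   t a i = ext s i a
   open Factors t
   ⌊valid⌋-s : ⌊ valid s ⌋ ≈ ∏² cond
   ⌊valid⌋-s = ⌊valid⌋ (upTo m)(upTo N)(λ i a → ext s(suc i)a ℕ.≤ᵇ ext s i a)(λ i a → ext s i(suc a)ℕ.≤ᵇ ext s i a) · ∏²-lists cond
   prod-calB : embed(calB(2 *n N)s) ≈ ∏²(λ a i → local-F a i * (local-d a i * local-n a i))
   prod-calB = embed-⊛ (prodS(concatMap(λ i → map(f i)(upTo N))(upTo m)))(prodS(map(λ i → invS(q(n 0 i)))(upTo m)))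
    · *c(embed-grid f(upTo m)(upTo N) · ∏²-lists(λ a i → embed(f i a)))(embed-prodS(λ i → invS(q(n 0 i)))(upTo m)
    · ∏-upTo m(λ i → embed(invS(q(n 0 i))))) · *c(∏²-cong(λ a i → _·_(embed-⊛ (q(t a i ∸ t(suc a)(suc i)))(invS(q(d a i) ⊛ q(n(suc a)
    i))))(*c(embed-qp(t a i ∸ t(suc a)(suc i)))(embed-iFF(d a i)(n(suc a)i)))))(∏<-cong m(λ i _ → embed-iF{k = n 0 i}rfl))
    · shifted(λ i → ext-last s i)where
    q : ℕ → Series
    q = qp(2 *n N)
    f : ℕ → ℕ → Series
    f i a = q(ext s i a ∸ ext s(suc i)(suc a)) ⊛ invS(q(ext s i a ∸ ext s i(suc a)) ⊛ q(ext s i(suc a) ∸ ext s(suc i)(suc a)))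
  embed-summand : valid s ≡ true → embed(summand' s) ≈ H * (∏² weight * ∏²(λ a i → local-F a i * (local-d a i * local-n a i)))
  embed-summand v = finish(sum<-natural N(λ a _ → sum<-natural m(λ i _ → exponent N(1 +n a +n a)(d a i) , rfl)))where
   hs = prodS(map(λ i → poch -[1+ 0 ] N N(n 0 i))(upTo m'))
   degree : ℤ
   degree = sum< N(λ a → sum< m(λ i → + exponent N(1 +n a +n a)(d a i)))
   total-exponent : twoA s +z + colSum s 0 ≡ degree
   total-exponent = exponents s(λ i a li la → ≤ᵇ-true⇒≤ (ext s i(suc a))(ext s i a)(proj₂(∧-true(allB-true N(λ a → (ext s(suc i)a ≤ᵇ ext s i
    a) ∧ (ext s i(suc a) ≤ᵇ ext s i a))(allB-true m(λ i → allB(upTo N)(λ a → (ext s(suc i)a ≤ᵇ ext s i a) ∧ (ext s i(suc a) ≤ᵇ ext s i a)))v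
    i li)a la))))
   finish : (∃ λ k → degree ≡ + k) → embed(summand' s) ≈ H * (∏² weight * ∏²(λ a i → local-F a i * (local-d a i * local-n a i)))
   finish(k , q) = embed-shift(calB(2 *n N)s ⊛ hs)(E.trans total-exponent q) · *c(T-cong(E.sym q)
    · T-sum< N(λ a → sum< m(λ i → + exponent N(1 +n a +n a)(d a i))) · ∏<-cong N(λ a _ → T-sum< m(λ i → + exponent N(1 +n a +n a)(d a i))))
    (embed-⊛ (calB(2 *n N)s)hs · *c prod-calB(embed-prodS(λ i → poch -[1+ 0 ] N N(n 0 i))(upTo m')
    · ∏-upTo m'(λ i → embed(poch -[1+ 0 ] N N(n 0 i))) · ∏<-cong m'(λ i _ → embed-h(n 0 i))))
    · solve 3(λ a b c → a :* (b :* c) := c :* (a :* b))refl _ _ _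
  filtered-summand : (if valid s then embed(summand' s)else 0#) ≈ value t
  filtered-summand = go(valid s)rfl · sym(value-split · *ʳ(sym ⌊valid⌋-s))where
   go : ∀ b → valid s ≡ b → (if b then embed(summand' s)else 0#) ≈ ⌊ b ⌋ * (H * (∏² weight * ∏²(λ a i → local-F a i * (local-d a i * local-n a
    i))))
   go true v = embed-summand v · sym(1* _)
   go false _ = sym(zeroˡ _)
 value-respects : Respects2 value
 value-respects{f}{g}e = *c(∏<-cong m'(λ i _ → rfx(cong₂(λ x y → h(x ∸ y))(e 0 i)(e 0(suc i)))))(∏<-cong N(λ a _ → *c(∏<-cong m(λ i _ →
  rfx(cong₂(λ x y → ⌊ x ≤ᵇ y ⌋)(e a(suc i))(e a i))))(∏<-cong m(λ i _ → *c(rfx(cong₂(λ x y → ⌊ x ≤ᵇ y ⌋)(e(suc a)i)(e a i)))(*c(rfx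
  (cong₂(λ x y → wt(x ∸ y)(T(+ (1 +n a +n a))) * iF(x ∸ y))(e a i)(e(suc a)i)))(*c(rfx(cong₂(λ x y → F(x ∸ y))(e a i)(e(suc a)(suc
  i))))(rfx(cong₂(λ x y → iF(x ∸ y))(e a i)(e a(suc i))))))))))
 partial-sums : Series
 partial-sums K = sumℤ(map(λ s → summand' s K)(filterᵇ valid(funs m(funs N Bs))))
 embed-partial-sums : embed partial-sums ≈ ∑≤ m B(λ ns → h-weight ns * columns m(+ 1 ∷ starts 1 μ)ns)
 embed-partial-sums = embed-sum summand'(filterᵇ valid(funs m(funs N Bs))) · ∑-filter valid _(funs m(funs N Bs))
  · ∑-cong(λ s → _·_(filtered-summand s)(value-respects(λ a i → ext-at s i a)))(funs m(funs N Bs))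
  · funs-tuples(at 0)(λ _ → 0)m(funs N Bs){φ}(λ e → value-respects(λ a i → cong(λ f → f a)(e i)))
  · rows m φ(λ e → value-respects(λ a i → e i a)) · transpose Bs m N{φ}(λ e → value-respects(λ a i → e i a))
  · grid-cong Bs N m value-kernels · rfx(cong(λ l → grid Bs(suc l)m(λ t → h-weight(mults m 0(t 0)) * kernels m(+ 1)(starts 1 μ)t))(E.sym
  (length-starts 1 μ))) · grid-columns m h-weight(+ 1)(starts 1 μ)where
  φ : (ℕ → ℕ → ℕ) → |R|
  φ σ = value(λ a i → σ i a)
  rows : ∀ k ψ → Respects2 ψ → tuples(λ _ → 0)k(λ ψ → ∑ (λ y → ψ(at 0 y))(funs N Bs))ψ ≈ grid Bs k N ψ
  rows zero ψ ρ = refl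
  rows(suc k)ψ ρ = ∑-cong(λ y → rows k(λ s → ψ(at 0 y :: s))(λ e → ρ λ{zero j → rfl; (suc i)j → e i j}))(funs N Bs)
   · funs-tuples(λ y → y)0 N Bs{λ row → grid Bs k N(λ s → ψ(row :: s))}(λ e → grid-cong Bs k N(λ s → ρ λ{zero j → e j; (suc i)j → rfl}))
  length-starts : ∀ c k → length(starts c k) ≡ k
  length-starts c zero = rfl
  length-starts c(suc k) = cong suc(length-starts(suc(suc c))k)
module BracketProducts(R : Ring)(χ : Char R)(𝓕 : Filt R χ)(J : ℕ)where
 open CommutativeRing R hiding (zero) renaming (*-congˡ to *ˡ; *-congʳ to *ʳ; +-congˡ to +ˡ; *-identityˡ to 1*; -‿cong to -ᶜ; reflexive to rfx; trans
  to infixr 1 _·_)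
 open Char χ
 open Filt 𝓕
 open RingSolver R
 open Sums R
 open CharProperties R χ
 open Congruences R χ 𝓕
 open TupleSums R
 ∏<-+ : ∀ k l φ → ∏< (k +n l)φ ≈ ∏< k φ * ∏< l(λ j → φ(k +n j))
 ∏<-+ k zero φ = rfx(cong(λ n → ∏< n φ)(N.+-identityʳ k)) · sym(*-identityʳ _)
 ∏<-+ k(suc l)φ = rfx(cong(λ n → ∏< n φ)(N.+-suc k l)) · *ˡ(∏<-+ k l φ) · solve 3(λ a b c → a :* (b :* c) := b :* (a :* c))refl _ _ _
 ∏<-reverse : ∀ k φ → ∏< (suc k)(λ i → φ(k ∸ i)) ≈ ∏< (suc k)φ
 ∏<-reverse zero φ = refl
 ∏<-reverse(suc k)φ = ∏<-first(suc k)(λ i → φ(suc k ∸ i)) · *ˡ(∏<-reverse k φ)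
 O-∏< : ∀ k{φ} → (∀ i → i < k → O 0(φ i)) → O 0(∏< k φ)
 O-∏< zero o = O-1
 O-∏< (suc k)o = O-* (o k N.≤-refl)(O-∏< k(λ i l → o i(N.m≤n⇒m≤1+n l)))
 ∏<-≈[] : ∀ k{n φ ψ} → (∀ i → i < k → O 0(ψ i)) → (∀ i → i < k → φ i ≈ ψ i [ n ]) → ∏< k φ ≈ ∏< k ψ [ n ]
 ∏<-≈[] zero o e = ≈[]-rfl refl
 ∏<-≈[](suc k)o e = ≈[]-* (≈[]-intg(O-∏< k o')ih)(o k N.≤-refl)(e k N.≤-refl)ih where
  o' = λ i l → o i(N.m≤n⇒m≤1+n l)
  ih = ∏<-≈[] k o'(λ i l → e i(N.m≤n⇒m≤1+n l))
 Unit-∏< : ∀ k φ → (∀ i → Unit(φ i)) → Unit(∏< k φ)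
 Unit-∏< zero φ u = Unit-1
 Unit-∏< (suc k)φ u = Unit-* (u k)(Unit-∏< k φ u)
 Unit-^ : ∀ k{x} → Unit x → Unit(x ^ᵣ k)
 Unit-^ zero u = Unit-1
 Unit-^ (suc k)u = Unit-* u(Unit-^ k u)
 stable : ∀ k l φ → (∀ j → O 0(φ j)) → (∀ j → φ(k +n j) ≈ 1# [ J ]) → ∏< (k +n l)φ ≈ ∏< k φ [ J ]
 stable k l φ o e = ≈[]-trans(≈[]-rfl(∏<-+ k l φ · *-comm _ _))(≈[]-trans(≈[]-*ʳ(O-∏< k(λ i _ → o i))(ones l))(≈[]-rfl(1* _)))where
  ones : ∀ l → ∏< l(λ j → φ(k +n j)) ≈ 1# [ J ]
  ones zero = ≈[]-rfl refl
  ones(suc l) = ≈1-* (e l)(ones l)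
 stable-≤ : ∀ {k n}φ → k ≤ n → (∀ j → O 0(φ j)) → (∀ j → φ(k +n j) ≈ 1# [ J ]) → ∏< n φ ≈ ∏< k φ [ J ]
 stable-≤ {k}{n}φ l o e = subst(λ n → ∏< n φ ≈ ∏< k φ [ J ])(N.m+[n∸m]≡n l)(stable k(n ∸ k)φ o e)
 ⟦⟧≈1-≥ : ∀ {n} → J ≤ n → ⟦ + n ⟧ ≈ 1# [ J ]
 ⟦⟧≈1-≥ {n}l = subst(λ n → ⟦ + n ⟧ ≈ 1# [ J ])(N.m+[n∸m]≡n l)(⟦⟧≈1 J(n ∸ J))
 1+T≈1 : ∀ {n} → J ≤ n → 1# + T(+ n) ≈ 1# [ J ]
 1+T≈1{n}l = O-cong(solve 1(λ t → t := 𝟏 :+ t :- 𝟏)refl _)(O-≤ l(O-T n))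
 Unit-1+T : ∀ n → Unit(1# + T(+ suc n))
 Unit-1+T n = record{intg = O-+ O-1(O-T≥ (suc n)0); inverse = ⟦ + suc n ⟧ * ι(+ (suc n +n suc n)); inverse-intg = O-* (O-⟦⟧ (suc n))(O-ι _);
  inverse-law = _·_(sym(*-assoc _ _ _) · *ʳ(solve 1(λ t → (𝟏 :+ t) :* (𝟏 :- t) := 𝟏 :- t :* t)refl _
  · +ˡ(-ᶜ(sym(T-+ (+ suc n)(+ suc n))))))(ι-law _(λ()))}
module ChainProducts(R : Ring)(χ : Char R)(𝓕 : Filt R χ)(μ J : ℕ)where
 open CommutativeRing R hiding (zero) renaming (Carrier to |R|; *-congˡ to *ˡ; *-congʳ to *ʳ; +-congˡ to +ˡ; *-identityˡ to 1*; *-cong to *c;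
  reflexive to rfx; trans to infixr 1 _·_)
 open Char χ
 open Filt 𝓕
 open RingSolver R
 open Sums R
 open CharProperties R χ
 open Congruences R χ 𝓕
 open TupleSums R
 open BracketProducts R χ 𝓕 J
 open Trunc R χ 𝓕 μ J using (M)
 open ChainSteps R χ M
 open ConfigSums R χ M J using (elements; chain-pair)
 open Symm R χ M using (g; s)
 open Evals R χ M
 -- (t^e; t^(2M))_J
 inf : ℤ → |R|
 inf e = ∏< J(λ j → ⟦ e +z D *z + j ⟧)
 inf-cong : ∀ {a b} → a ≡ b → inf a ≈ inf b
 inf-cong e = rfx(cong inf e)
 Positive : ℕ → ℤ → Set
 Positive a x = ∃ λ w → x ≡ + suc(a +n w)
 Positive-D* : ∀ {a x}l → Positive a x → Positive(a +n l)(x +z D *z + l)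
 Positive-D* {a}l(w , rfl) = w +n l +n(μ +n μ) *n l , E.trans(lem(+ a)(+ w)(+ μ)(+ l))(cong(λ z → + 1 +z(+ a +z + l +z(+ w +z + l +z z)))
  (E.sym(Z.pos-* (μ +n μ)l)))where
  lem : ∀ a w μ l → + 1 +z(a +z w) +z((+ 1 +z μ) +z(+ 1 +z μ)) *z l ≡ + 1 +z(a +z l +z(w +z l +z(μ +z μ) *z l))
  lem = ringℤ
 Positive-+ : ∀ {a b x y} → Positive a x → Positive b y → Positive(a +n b)(x +z y)
 Positive-+ {a}{b}(w , rfl)(v , rfl) = suc(w +n v) , lem(+ a)(+ b)(+ w)(+ v)where
  lem : ∀ a b w v → (+ 1 +z(a +z w)) +z(+ 1 +z(b +z v)) ≡ + 1 +z(a +z b +z(+ 1 +z(w +z v)))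
  lem = ringℤ
 Positive-≈1 : ∀ {a x} → J ≤ a → Positive a x → ⟦ x ⟧ ≈ 1# [ J ]
 Positive-≈1{a}l(w , rfl) = ⟦⟧≈1-≥ (N.m≤n⇒m≤1+n(N.≤-trans l(N.m≤m+n a w)))
 Positive-unit : ∀ {a x} → Positive a x → Unit ⟦ x ⟧
 Positive-unit{a}(w , rfl) = Unit-⟦⟧ (a +n w)
 Positive-nz : ∀ {a x} → Positive a x → x ≢ + 0
 Positive-nz(w , rfl)()
 inf-unit : ∀ {a x} → Positive a x → Unit(inf x)
 inf-unit p = Unit-∏< J _(λ j → Positive-unit(Positive-D* j p))
 inf-shift : ∀ {a x} → Positive a x → inf x ≈ ⟦ x ⟧ * inf(D +z x) [ J ]
 inf-shift{a}{x}p = ≈[]-sym(≈[]-trans(≈[]-rfl(*c(⟦⟧-cong(lem0 x D))(∏<-cong J(λ j _ → ⟦⟧-cong(lem x D(+ j))))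
  · sym(∏<-first J _)))(≈[]-trans(≈[]-*ʳ(intg(inf-unit p))(Positive-≈1{a +n J}(N.m≤n+m J a)(Positive-D* J p)))(≈[]-rfl(1* _))))where
  lem0 : ∀ x D → x ≡ x +z D *z + 0
  lem0 = ringℤ
  lem : ∀ x D j → D +z x +z D *z j ≡ x +z D *z(+ 1 +z j)
  lem = ringℤ
 Γ-run⁺ : ∀ {a b}e s l → Positive a e → Positive b s → J ≤ a +n b +n l → Γ e(run s l) * ⟦ e +z s ⟧ ≈ 1# [ J ]
 Γ-run⁺ {a}{b}e s l p q h = ≈[]-trans(≈[]-rfl(Γ-run e s l(λ j _ → Positive-nz(Positive-D* j(Positive-+ p q)))))(Positive-≈1 h(Positive-D* l
  (Positive-+ p q)))
 cross-runs : ∀ {a b}k x s → Positive a x → Positive b s → cross g(run x k)(run s J) * ∏< k(λ j → ⟦ x +z s +z D *z + j ⟧) ≈ 1# [ J ]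
 cross-runs zero x s p q = ≈[]-rfl(1* 1#)
 cross-runs{a}{b}(suc k)x s p q = ≈[]-trans(≈[]-rfl(*ˡ(∏<-first k _ · *c(⟦⟧-cong(lem0(x +z s)D))(∏<-cong k(λ j _ → ⟦⟧-cong(lem x s D(+
  j))))) · *-interchange _ _ _ _))(≈1-* (Γ-run⁺ x s J p q(N.m≤n+m J(a +n b)))(cross-runs k(x +z D)s(subst(Positive(a +n 1))(lem1 x D)
  (Positive-D* 1 p))q))where
  lem0 : ∀ x D → x +z D *z + 0 ≡ x
  lem0 = ringℤ
  lem1 : ∀ x D → x +z D *z + 1 ≡ x +z D
  lem1 = ringℤ
  lem : ∀ x s D j → x +z s +z D *z(+ 1 +z j) ≡ x +z D +z s +z D *z j
  lem = ringℤ
 Ξ-run : ∀ {a}l x → Positive a x → J ≤ a +n l → Ξ(run x l) * (∏< l(λ j → ⟦ x +z D *z + j ⟧) * ∏< l(λ j → ⟦ x +z M +z D *z + j ⟧)) ≈ 1# [ J ]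
 Ξ-run zero x p h = ≈[]-rfl(solve 0(𝟏 :* 𝟏 :* (𝟏 :* 𝟏) := 𝟏)refl)
 Ξ-run{a}(suc l)x p h = ≈[]-trans(≈[]-rfl(*c(Ξ-∷ x(run(x +z D)l))(*c(∏<-first l _
  · *c(⟦⟧-cong(lem0 x D))(∏<-cong l(λ j _ → ⟦⟧-cong(lem x D(+ j)))))(∏<-first l _
  · *c(⟦⟧-cong(lem0(x +z M)D))(∏<-cong l(λ j _ → ⟦⟧-cong(lem' x M D(+ j))))))
  · solve 7(λ z s γ b a m c → z :* (s :* γ) :* ((b :* a) :* (m :* c)) := (γ :* (m :* (s :* b))) :* (z :* (a :* c)))refl _ _ _ _ _ _ _
  · *ʳ(*ˡ(*ˡ(s-law(Positive-nz p) · +ˡ(T-cong(Z.+-comm M x))) · sym(⟦double⟧ (x +z M))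
  · ⟦⟧-cong(lem2 x M)))))(≈1-* (Γ-run⁺ x(x +z D)l p p'(N.≤-trans h(N.≤-trans(N.≤-reflexive(lemℕ a l))(N.+-monoˡ-≤ l(N.m≤n+m(a +n 1)a)))))
  (Ξ-run l(x +z D)p'(N.≤-trans h(N.≤-reflexive(lemℕ a l)))))where
  Ξ' = Ξ(run(x +z D)l)
  A = ∏< l(λ j → ⟦ x +z D +z D *z + j ⟧)
  B = ∏< l(λ j → ⟦ x +z D +z M +z D *z + j ⟧)
  p' : Positive(a +n 1)(x +z D)
  p' = subst(Positive(a +n 1))(lem1 x D)(Positive-D* 1 p)where
   lem1 : ∀ x D → x +z D *z + 1 ≡ x +z D
   lem1 = ringℤ
  lemℕ : ∀ a l → a +n suc l ≡ a +n 1 +n l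
  lemℕ a l = E.sym(N.+-assoc a 1 l)
  lem0 : ∀ x D → x +z D *z + 0 ≡ x
  lem0 = ringℤ
  lem : ∀ x D j → x +z D *z(+ 1 +z j) ≡ x +z D +z D *z j
  lem = ringℤ
  lem' : ∀ x M D j → x +z M +z D *z(+ 1 +z j) ≡ x +z D +z M +z D *z j
  lem' = ringℤ
  lem2 : ∀ x M → (x +z M) +z(x +z M) ≡ x +z(x +z(M +z M))
  lem2 = ringℤ
 chains : List ℤ → List ℤ
 chains = concatMap(λ c → run c J)
 chain-product : List ℤ → |R|
 chain-product cs = ∏ (λ c → inf c * inf(c +z M))cs * pairs(λ c c' → inf(c +z c'))cs
 Ξ-chains : ∀ {cs} → All(Positive 0)cs → Ξ(chains cs) * chain-product cs ≈ 1# [ J ]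
 Ξ-chains [] = ≈[]-rfl(solve 0(𝟏 :* 𝟏 :* (𝟏 :* 𝟏) := 𝟏)refl)
 Ξ-chains{c ∷ cs}(p ∷ ps) = ≈[]-trans(≈[]-rfl(*ʳ(*c(∏-++ s(run c J)_)(pairs-++ g(run c J)_)
  · solve 5(λ a b x y z → (a :* b) :* (x :* y :* z) := (a :* x) :* (b :* y) :* z)refl _ _ _ _ _)
  · solve 7(λ a b z p q r t → (a :* b :* z) :* ((p :* q) :* (r :* t)) := (a :* p) :* ((z :* r) :* (b :* (q :* t))))refl _ _ _ _ _ _ _))(≈1-* (Ξ-run
  J c p(N.m≤n+m J 0))(≈1-* (go ps)(Ξ-chains ps)))where
  go : ∀ {cs} → All(Positive 0)cs → cross g(run c J)(chains cs) * ∏ (λ c' → inf(c +z c'))cs ≈ 1# [ J ]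
  go [] = ≈[]-rfl(*-identityʳ _ · cross-[]ʳ g(run c J))
  go{c' ∷ cs}(q ∷ qs) = ≈[]-trans(≈[]-rfl(*ʳ(cross-++ʳ g(run c J)(run c' J)_) · *-interchange _ _ _ _))(≈1-* (cross-runs J c c' p q)(go qs))
 two : ℤ → List ℤ
 two i = (M +z(i +z i)) ∷ (M -z(i +z i)) ∷ []
 centred : ℕ → List ℤ
 centred r = M ∷ concatMap two(down⁺ r)
 elements-chains : ∀ r → elements(down⁺ r) ≡ chains(centred r)
 elements-chains r = cong(run M J ++_)(go r)where
  go : ∀ r → concatMap chain-pair(down⁺ r) ≡ chains(concatMap two(down⁺ r))
  go zero = rfl
  go(suc r) = E.trans(++-assoc(run _ J)_ _)(cong(λ l → run _ J ++ run _ J ++ l)(go r))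
 d : ℤ → |R|
 d a = inf(D +z(a +z a)) * inf(D -z(a +z a))
 θ : ℕ → |R|
 θ i = inf(M -z(+ i +z + i)) * inf(M +z(+ i +z + i))
 numer : ℕ → |R|
 numer r = inf D ^ᵣ suc r * ∏< (suc r)θ * ∏< (suc r)(λ j → ∏< j(λ i → d(+ j -z + i) * d(+ i +z + j)))
 numer-product : ∀ r → numer r ≈ inf M * chain-product(centred r)
 numer-product zero = *ʳ(*ˡ(*ʳ(*c(inf-cong(Z.+-identityʳ M))(inf-cong(Z.+-identityʳ M)))))
  · solve 2(λ x y → x :* 𝟏 :* (y :* y :* 𝟏) :* (𝟏 :* 𝟏) := y :* ((y :* x) :* 𝟏 :* (𝟏 :* 𝟏)))refl _ _
 numer-product(suc r) = solve 6(λ D D^ θx Θ Ψx Ψ → (D :* D^) :* (θx :* Θ) :* (Ψx :* Ψ) := (D^ :* Θ :* Ψ) :* (D :* θx :* Ψx))refl _ _ _ _ _ _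
  · *c(numer-product r)extra · solve 12(λ M pM P bM B pu pv bMu bMv buv bu bv → M :* ((pM :* P) :* (bM :* B)) :* (pu :* pv :* (bMu :* bMv) :* buv
  :* (bu :* bv)) := M :* ((pM :* (pu :* (pv :* P))) :* ((bMu :* (bMv :* bM)) :* ((buv :* bu) :* (bv :* B)))))refl _ _ _ _ _ _ _ _ _ _ _ _ where
  x = suc r
  u v : ℤ
  u = M +z(+ x +z + x)
  v = M -z(+ x +z + x)
  rest = concatMap two(down⁺ r)
  p : ℤ → |R|
  p c = inf c * inf(c +z M)
  b : ℤ → ℤ → |R|
  b c c' = inf(c +z c')
  ∏-rest : ∀ (f : ℤ → |R|)r → ∏ f(concatMap two(down⁺ r)) ≈ ∏< r(λ i → f(M +z(+ suc i +z + suc i)) * f(M -z(+ suc i +z + suc i)))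
  ∏-rest f zero = refl
  ∏-rest f(suc r) = sym(*-assoc _ _ _) · *ˡ(∏-rest f r)
  e1 : ∀ M x → M +z M +z((x -z + 0) +z(x -z + 0)) ≡ M +z(x +z x) +z M
  e1 = ringℤ
  e2 : ∀ M x → M +z M -z((x -z + 0) +z(x -z + 0)) ≡ M -z(x +z x) +z M
  e2 = ringℤ
  e3 : ∀ M x → M +z M +z((+ 0 +z x) +z(+ 0 +z x)) ≡ M +z(M +z(x +z x))
  e3 = ringℤ
  e4 : ∀ M x → M +z M -z((+ 0 +z x) +z(+ 0 +z x)) ≡ M +z(M -z(x +z x))
  e4 = ringℤ
  e5 : ∀ M x → M +z M ≡ M +z(x +z x) +z(M -z(x +z x))
  e5 = ringℤ
  f1 : ∀ M x i → M +z M +z((x -z i) +z(x -z i)) ≡ M +z(x +z x) +z(M -z(i +z i))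
  f1 = ringℤ
  f2 : ∀ M x i → M +z M -z((x -z i) +z(x -z i)) ≡ M -z(x +z x) +z(M +z(i +z i))
  f2 = ringℤ
  f3 : ∀ M x i → M +z M +z((i +z x) +z(i +z x)) ≡ M +z(x +z x) +z(M +z(i +z i))
  f3 = ringℤ
  f4 : ∀ M x i → M +z M -z((i +z x) +z(i +z x)) ≡ M -z(x +z x) +z(M -z(i +z i))
  f4 = ringℤ
  extra : inf D * θ x * ∏< x(λ i → d(+ x -z + i) * d(+ i +z + x)) ≈ p u * p v * (b M u * b M v) * b u v * (∏ (b u)rest * ∏ (b v)rest)
  extra = *c(*ʳ(inf-cong(e5 M(+ x))))(∏<-first r _ · *c(*c(*c(inf-cong(e1 M(+ x)))(inf-cong(e2 M(+ x))))(*c(inf-cong(e3 M(+ x)))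
   (inf-cong(e4 M(+ x)))))(∏<-cong r(λ i _ → _·_(*c(*c(inf-cong(f1 M(+ x)(+ suc i)))(inf-cong(f2 M(+ x)(+ suc i))))(*c(inf-cong(f3 M
   (+ x)(+ suc i)))(inf-cong(f4 M(+ x)(+ suc i)))))(solve 4(λ a b c d → (a :* b) :* (c :* d) := (c :* a) :* (b :* d))refl _ _ _ _))
   · ∏<-* r _ _ · *c(sym(∏-rest(b u)r))(sym(∏-rest(b v)r)))) · solve 7(λ w v u a c m r → w :* (v :* u) :* (((a :* c) :* m) :* r) := (u :* a)
   :* (v :* c) :* m :* w :* r)refl _ _ _ _ _ _ _
open import Data.Nat.Tactic.RingSolver using () renaming (solve-∀ to ringℕ)
odds : ℕ → ℕ → List ℤ
odds a zero = []
odds a(suc k) = + suc a ∷ odds(suc(suc a))k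
odds-++ : ∀ a k l → odds a(k +n l) ≡ odds a k ++ odds(a +n(k +n k))l
odds-++ a zero l = cong(λ z → odds z l)(E.sym(N.+-identityʳ a))
odds-++ a(suc k)l = cong(+ suc a ∷_)(E.trans(odds-++ (suc(suc a))k l)(cong(λ z → odds(suc(suc a))k ++ odds z l)(lem a k)))where
 lem : ∀ a k → suc(suc a) +n(k +n k) ≡ a +n(suc k +n suc k)
 lem = ringℕ
concatMap-↭ : ∀ {f : ℤ → List ℤ}{xs ys} → xs ↭ ys → concatMap f xs ↭ concatMap f ys
concatMap-↭ P.refl = ↭-refl
concatMap-↭ {f}(prep x p) = ++⁺ˡ(f x)(concatMap-↭ p)
concatMap-↭ {f}(swap x y p) = ↭-trans(shifts(f x)(f y))(++⁺ˡ(f y)(++⁺ˡ(f x)(concatMap-↭ p)))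
concatMap-↭ (P.trans p q) = ↭-trans(concatMap-↭ p)(concatMap-↭ q)
module OddProducts(R : Ring)(χ : Char R)(𝓕 : Filt R χ)(J : ℕ)where
 open CommutativeRing R hiding (zero) renaming (Carrier to |R|; *-congˡ to *ˡ; *-congʳ to *ʳ; +-congˡ to +ˡ; *-identityˡ to 1*; -‿cong to -ᶜ; *-cong
  to *c; reflexive to rfx; trans to infixr 1 _·_)
 open Char χ
 open Filt 𝓕
 open RingSolver R
 open Sums R
 open CharProperties R χ
 open Congruences R χ 𝓕
 open TupleSums R
 open BracketProducts R χ 𝓕 J
 ⟨_⟩ ⟨_⟩⁺ : ℕ → |R|
 ⟨ k ⟩ = ⟦ + (k +n k) ⟧
 ⟨ k ⟩⁺ = 1# + T(+ (k +n k))
 br : ℕ → ℕ → |R|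
 br a k = ∏< k(λ i → ⟨ a +n i ⟩)
 γ : ℕ → |R|
 γ j = ∏< j(λ i → ⟨ j ∸ i ⟩ * ⟨ i +n j ⟩)
 G : ℕ → |R|
 G r = ∏< (suc r)γ
 γ-suc : ∀ r → γ(suc r) ≈ ⟨ suc r ⟩ * br 1(r +n suc r)
 γ-suc r = ∏<-* (suc r)_ _ · *c(∏<-cong(suc r)(λ i l → rfx(cong ⟨_⟩ (N.+-∸-assoc 1(N.≤-pred l))))
  · ∏<-reverse r(λ i → ⟨ suc i ⟩))(∏<-cong(suc r)(λ i _ → rfx(cong ⟨_⟩ (N.+-comm i(suc r))))) · *-assoc _ _ _
  · *ˡ(sym(∏<-+ r(suc r)(λ i → ⟨ 1 +n i ⟩)))
 ⟨double⟩ : ∀ k → ⟨ k ⟩ * ⟨ k ⟩⁺ ≈ ⟨ k +n k ⟩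
 ⟨double⟩ k = solve 1(λ t → (𝟏 :- t) :* (𝟏 :+ t) := 𝟏 :- t :* t)refl _ · +ˡ(-ᶜ(sym(T-+ (+ (k +n k))(+ (k +n k)))))
 br-double : ∀ b L → ∏< L(λ l → ⟨ suc(b +n(l +n l)) ⟩ * ⟨ b +n(l +n l) ⟩) ≈ br b(L +n L)
 br-double b zero = refl
 br-double b(suc L) = (*-assoc _ _ _ · *ˡ(*ˡ(br-double b L))) · *ʳ(rfx(cong ⟨_⟩ (E.sym(N.+-suc b(L +n L)))))
  · rfx(cong(br b)(cong suc(E.sym(N.+-suc L L))))
 far : ∀ {k n} → J ≤ k → k ≤ n → ⟨ n ⟩ ≈ 1# [ J ]
 far{k}{n}l h = ⟦⟧≈1-≥ (N.≤-trans(N.≤-trans l h)(N.m≤m+n n n))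
 module _(L : ℕ)(J≤L : J ≤ L)where
  E O1 : |R|
  E = br 1 L
  O1 = ∏< L(λ l → ⟦ + (1 +n(l +n l)) ⟧)
  W : ℕ → |R|
  W r = ∏< L(λ l → ∏< (suc(r +n r))(λ j → ⟨ suc(suc(l +n l)) +n j ⟩))
  Q : ℕ → |R|
  Q r = ∏< L(λ l → ⟨ suc r +n l ⟩⁺)
  W-suc : ∀ r → W(suc r) ≈ br(suc(r +n suc(suc r)))(L +n L) * W r
  W-suc r = ∏<-cong L(λ l _ → _·_(rfx(cong(λ n → ∏< (suc(suc n))(λ j → ⟨ suc(suc(l +n l)) +n j ⟩))(N.+-suc r r)))(sym(*-assoc _ _ _)
   · *ʳ(*c(rfx(cong ⟨_⟩ (lem1 l r)))(rfx(cong ⟨_⟩ (lem2 l r)))))) · ∏<-* L _ _ · *ʳ(br-double(suc(r +n suc(suc r)))L)where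
   lem1 : ∀ l r → suc(suc(l +n l)) +n suc(suc(r +n r)) ≡ suc(suc(r +n suc(suc r)) +n(l +n l))
   lem1 = ringℕ
   lem2 : ∀ l r → suc(suc(l +n l)) +n suc(r +n r) ≡ suc(r +n suc(suc r)) +n(l +n l)
   lem2 = ringℕ
  Q-suc : ∀ r → ⟨ suc r ⟩⁺ * Q(suc r) ≈ Q r [ J ]
  Q-suc r = ≈[]-trans(≈[]-rfl(*c(rfx(cong ⟨_⟩⁺ (E.sym(N.+-identityʳ(suc r)))))(∏<-cong L(λ l _ → rfx(cong ⟨_⟩⁺ (E.sym(N.+-suc(suc r)l)))))
   · sym(∏<-first L(λ l → ⟨ suc r +n l ⟩⁺))))(≈[]-trans(≈[]-*ʳ(intg(Unit-∏< L _(λ l → Unit-1+T(r +n l +n(suc r +n l)))))(1+T≈1(N.≤-trans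
   J≤L(N.≤-trans(N.m≤n+m L(suc r))(N.m≤m+n _ _)))))(≈[]-rfl(1* _)))
  br-unit : ∀ a k → Unit(br(suc a)k)
  br-unit a k = Unit-∏< k _(λ i → Unit-⟦⟧ (a +n i +n(suc a +n i)))
  br-E : ∀ k → br 1(k +n(L +n L)) ≈ E [ J ]
  br-E k = stable-≤ _(N.≤-trans(N.m≤m+n L L)(N.m≤n+m(L +n L)k))(λ i → intg(Unit-⟦⟧ (i +n suc i)))(λ j → far J≤L(N.m≤n⇒m≤1+n(N.m≤m+n L j)))
  G-W : ∀ r → G r * W r ≈ Q r * E ^ᵣ suc r [ J ]
  G-W zero = ≈[]-rfl((*ʳ(1* 1#) · 1* _) · ∏<-cong L(λ l _ → _·_(*-identityʳ _)(rfx(cong ⟨_⟩ (lem l)) · sym(⟨double⟩ (suc l))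
   · *-comm _ _)) · ∏<-* L _ _ · *ˡ(sym(*-identityʳ _)))where
   lem : ∀ l → suc(suc(l +n l)) +n 0 ≡ suc l +n suc l
   lem = ringℕ
  G-W(suc r) = Unit-cancel(Unit-1+T(r +n suc r))(≈[]-trans(≈[]-rfl(*ʳ(*c(*ʳ(γ-suc r))(W-suc r))
   · solve 6(λ a b g c w p → a :* b :* g :* (c :* w) :* p := (g :* w) :* (((a :* p) :* b) :* c))refl _ _ _ _ _ _
   · *ˡ(*c(*ʳ(⟨double⟩ (suc r)))(rfx(cong(λ z → br(suc z)(L +n L))(N.+-suc r(suc r)))))
   · *ˡ(sym(∏<-+ (suc x)(L +n L)(λ i → ⟨ 1 +n i ⟩)))))(≈[]-trans(≈[]-* (intg(br-unit 0(suc x +n(L +n L))))(O-* (intg(Q-unit r))(intg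
   E^-unit))(G-W r)(br-E(suc x)))(≈[]-trans(≈[]-rfl(solve 3(λ q f e → q :* f :* e := q :* (e :* f))refl _ _ _))(≈[]-trans(≈[]-*ʳ(intg
   (Unit-* (br-unit 0 L)E^-unit))(≈[]-sym(Q-suc r)))(≈[]-rfl(solve 3(λ p q e → p :* q :* e := q :* e :* p)refl _ _ _))))))where
   x = r +n suc r
   Q-unit : ∀ r → Unit(Q r)
   Q-unit r = Unit-∏< L _(λ l → Unit-1+T(r +n l +n(suc r +n l)))
   E^-unit = Unit-^ (suc r)(br-unit 0 L)
 module _(r : ℕ)where
  open Trunc R χ 𝓕 ( r +n r ) J using (M; intg-Ξ)
  open Symm R χ M using (g; s)
  open Evals R χ M
  open ChainSteps R χ M using (Γ; s-law)
  N : ℕ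
  N = suc(r +n r)
  Γ-odds : ∀ e y k → Γ(+ e)(odds y k) * ∏< N(λ j → ⟦ + (e +n suc y +n(j +n j)) ⟧) ≈ ∏< N(λ j → ⟦ + (e +n suc y +n(k +n k) +n(j +n j)) ⟧)
  Γ-odds e y zero = 1* _ · ∏<-cong N(λ j _ → ⟦⟧-cong(cong(λ z → + (z +n(j +n j)))(E.sym(N.+-identityʳ(e +n suc y)))))
  Γ-odds e y(suc k) = *ˡ(∏<-first(r +n r)φ) · solve 5(λ n i G f p → (n :* i) :* G :* (f :* p) := G :* (n :* p) :* (f :* i))refl _ _ _ _ _
   · *c(*ˡ(*ʳ(⟦⟧-cong(cong +_(N.+-comm(N +n N)_)))))(*ʳ(⟦⟧-cong(cong +_(N.+-identityʳ _)))
   · ι-law(+ (e +n suc y))(λ z → nz(Z.+-injective z))) · (*-identityʳ _ · *ˡ(∏<-cong N(λ j _ → ⟦⟧-cong(cong +_(lem1 e y j)))))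
   · Γ-odds e(suc(suc y))k · ∏<-cong N(λ j _ → ⟦⟧-cong(cong +_(lem2 e y k j)))where
   φ : ℕ → |R|
   φ j = ⟦ + (e +n suc y +n(j +n j)) ⟧
   nz : e +n suc y ≢ 0
   nz z with E.trans(E.sym(N.+-suc e y))z
   ... | ()
   lem1 : ∀ e y j → e +n suc y +n(suc j +n suc j) ≡ e +n suc(suc(suc y)) +n(j +n j)
   lem1 = ringℕ
   lem2 : ∀ e y k j → e +n suc(suc(suc y)) +n(k +n k) +n(j +n j) ≡ e +n suc y +n(suc k +n suc k) +n(j +n j)
   lem2 = ringℕ
  window : ℕ → ℕ → |R|
  window a l = ∏< N(λ j → ⟦ + (suc a +n(l +n l) +n suc(suc(suc a) +n(l +n l)) +n(j +n j)) ⟧)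
  Ξ-odds : ∀ k a → J ≤ a +n k → Ξ(odds a k) * ∏< k(λ l → ⟦ + (suc a +n(l +n l)) ⟧ * window a l) ≈ ∏< k(λ l → 1# + T(+ (N +n(suc a +n(l +n
   l))))) [ J ]
  Ξ-odds zero a h = ≈[]-rfl(solve 0(𝟏 :* 𝟏 :* 𝟏 := 𝟏)refl)
  Ξ-odds(suc k)a h = ≈[]-trans(≈[]-rfl(*c(Ξ-∷ (+ suc a)(odds a' k))(∏<-first k ω
   · *c(*c(⟦⟧-cong(cong +_(N.+-identityʳ(suc a))))(∏<-cong N(λ j _ → ⟦⟧-cong(cong +_(lem0 a j)))))(∏<-cong k(λ l _ → *c(⟦⟧-cong(cong +_
   (lem1 a l)))(∏<-cong N(λ j _ → ⟦⟧-cong(cong +_(lem2 a l j))))))) · solve 6(λ z s G b w p → z :* (s :* G) :* (b :* w :* p) := (s :* b) :* ((G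
   :* w) :* (z :* p)))refl _ _ _ _ _ _ · *c(s-law(λ()))(*ʳ(Γ-odds(suc a)a' k))))(≈[]-trans(≈[]-*ˡ(intg(Unit-1+T(r +n r +n suc a)))(≈[]-*
   (O-* (intg-Ξ(odds a' k))(O-∏< k(λ l _ → O-* (O-⟦⟧ _)(O-∏< N(λ j _ → O-⟦⟧ _)))))O-1 w1≈1(Ξ-odds k a'(N.≤-trans h(N.≤-trans(N.≤-reflexive
   (N.+-suc a k))(N.n≤1+n _))))))(≈[]-rfl(*ˡ(1* _) · *c(+ˡ(T-cong(cong(λ z → + (N +n z))(E.sym(N.+-identityʳ(suc a))))))(∏<-cong k(λ l _
   → +ˡ(T-cong(cong(λ z → + (N +n z))(E.sym(lem1 a l)))))) · sym(∏<-first k _))))where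
   ≈[]-*ˡ : ∀ {n x y z} → O 0 z → x ≈ y [ n ] → z * x ≈ z * y [ n ]
   ≈[]-*ˡ o p = O-cong(solve 3(λ x y z → (x :- y) :* z := z :* x :- z :* y)refl _ _ _)(O-*0 p o)
   a' = suc(suc a)
   ω ω' : ℕ → |R|
   ω l = ⟦ + (suc a +n(l +n l)) ⟧ * window a l
   ω' l = ⟦ + (suc a' +n(l +n l)) ⟧ * window a' l
   w0 = ∏< N(λ j → ⟦ + (suc a +n suc a' +n(j +n j)) ⟧)
   w1 = ∏< N(λ j → ⟦ + (suc a +n suc a' +n(k +n k) +n(j +n j)) ⟧)
   lem3 : ∀ a k j → suc a +n suc(suc(suc a)) +n(k +n k) +n(j +n j) ≡ a +n suc k +n(a +n 3 +n k +n(j +n j))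
   lem3 = ringℕ
   w1≈1 : w1 ≈ 1# [ J ]
   w1≈1 = ≈[]-trans(∏<-≈[] N{ψ = λ _ → 1#}(λ _ _ → O-1)(λ j _ → ⟦⟧≈1-≥ (N.≤-trans h(subst(a +n suc k ≤_)(E.sym(lem3 a k j))(N.m≤m+n _ _)))))
    (≈[]-rfl(ones N))where
    ones : ∀ k → ∏< k(λ _ → 1#) ≈ 1#
    ones zero = refl
    ones(suc k) = 1* _ · ones k
   lem0 : ∀ a j → suc a +n 0 +n suc(suc(suc a) +n 0) +n(j +n j) ≡ suc a +n suc(suc(suc a)) +n(j +n j)
   lem0 = ringℕ
   lem1 : ∀ a l → suc a +n(suc l +n suc l) ≡ suc(suc(suc a)) +n(l +n l)
   lem1 = ringℕ
   lem2 : ∀ a l j → suc a +n(suc l +n suc l) +n suc(suc(suc a) +n(suc l +n suc l)) +n(j +n j) ≡ suc(suc(suc a)) +n(l +n l) +n suc(suc(suc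
    (suc(suc a))) +n(l +n l)) +n(j +n j)
   lem2 = ringℕ
  Ξ-odds-G : ∀ L(h : J ≤ L) → Ξ(odds 0 L) * (O1 L h * E L h ^ᵣ suc r) ≈ G r [ J ]
  Ξ-odds-G L h = Unit-cancel(Unit-* Q-unit E^-unit)(≈[]-trans(≈[]-*ˡ'(≈[]-sym(G-W L h r)))(≈[]-trans(≈[]-rfl(solve 5(λ z o e g w → (z :* (o
   :* e)) :* (g :* w) := z :* (o :* w) :* (g :* e))refl _ _ _ _ _))(≈[]-trans(≈[]-*ʳ(O-* (intg-G)(intg E^-unit))(≈[]-trans(≈[]-rfl(*ˡ(sym
   (∏<-* L _ _ · *ˡ(∏<-cong L(λ l _ → ∏<-cong N(λ j _ → ⟦⟧-cong(cong +_(lem1 l j)))))))))(≈[]-trans(Ξ-odds L 0 h)(≈[]-rfl(∏<-cong L(λ l _ →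
   +ˡ(T-cong(cong +_(lem2 r l)))))))))(≈[]-rfl(solve 3(λ q g e → q :* (g :* e) := g :* (q :* e))refl _ _ _)))))where
   Q-unit : Unit(Q L h r)
   Q-unit = Unit-∏< L _(λ l → Unit-1+T(r +n l +n(suc r +n l)))
   E^-unit : Unit(E L h ^ᵣ suc r)
   E^-unit = Unit-^ (suc r)(br-unit L h 0 L)
   intg-G : O 0(G r)
   intg-G = O-∏< (suc r)(λ j _ → O-∏< j(λ i _ → O-* (O-⟦⟧ _)(O-⟦⟧ _)))
   ≈[]-*ˡ' : ∀ {x y} → x ≈ y [ J ] → Ξ(odds 0 L) * (O1 L h * E L h ^ᵣ suc r) * x ≈ Ξ(odds 0 L) * (O1 L h * E L h ^ᵣ suc r) * y [ J ]
   ≈[]-*ˡ' p = O-cong(solve 3(λ x y z → (x :- y) :* z := z :* x :- z :* y)refl _ _ _)(O-*0 p(O-* (intg-Ξ(odds 0 L))(O-* (O-∏< L(λ l _ → O-⟦⟧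
    _))(intg E^-unit))))
   lem1 : ∀ l j → 1 +n(l +n l) +n suc(2 +n(l +n l)) +n(j +n j) ≡ suc(suc(l +n l)) +n j +n(suc(suc(l +n l)) +n j)
   lem1 = ringℕ
   lem2 : ∀ r l → suc(r +n r) +n(1 +n(l +n l)) ≡ suc r +n l +n(suc r +n l)
   lem2 = ringℕ
  open ChainSteps R χ M using (run; D)
  open ChainProducts R χ 𝓕 ( r +n r ) J using (two)
  odds-centred : ∀ t a → a +n(t +n t) ≡ r +n r → odds a(suc(t +n t)) ↭ M ∷ concatMap two(down⁺ t)
  odds-centred zero a e = ↭-reflexive(cong(λ z → + suc z ∷ [])(E.trans(E.sym(N.+-identityʳ a))e))
  odds-centred(suc t)a e = ↭-trans(↭-reflexive(E.trans(cong(odds a)(lem0 t))(cong(+ suc a ∷_)(odds-++ (suc(suc a))(suc(t +n t))1))))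
   (↭-trans(prep _(↭-trans(++-comm(odds(suc(suc a))(suc(t +n t)))_)(prep _(odds-centred t(suc(suc a))(E.trans(lem1 a t)e)))))(↭-trans
   (swap _ _ ↭-refl)(↭-trans(↭-reflexive(cong₂(λ x y → x ∷ y ∷ M ∷ concatMap two(down⁺ t))hi lo))(shifts(_ ∷ _ ∷ [])(M ∷ []){concatMap two
   (down⁺ t)}))))where
   lem0 : ∀ t → suc(suc t +n suc t) ≡ suc(suc(t +n t) +n 1)
   lem0 = ringℕ
   lem1 : ∀ a t → suc(suc a) +n(t +n t) ≡ a +n(suc t +n suc t)
   lem1 = ringℕ
   hi : + suc(suc(suc a) +n(suc(t +n t) +n suc(t +n t))) ≡ M +z(+ suc t +z + suc t)
   hi = E.trans(cong(λ z → + suc z)(lem a t))(cong(λ z → + suc(z +n(suc t +n suc t)))e)where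
    lem : ∀ a t → suc(suc a) +n(suc(t +n t) +n suc(t +n t)) ≡ a +n(suc t +n suc t) +n(suc t +n suc t)
    lem = ringℕ
   lo : + suc a ≡ M -z(+ suc t +z + suc t)
   lo = E.trans(lem(+ a)(+ t))(cong(λ z → + suc z -z(+ suc t +z + suc t))e)where
    lem : ∀ a t → + 1 +z a ≡ + 1 +z(a +z((+ 1 +z t) +z(+ 1 +z t))) -z((+ 1 +z t) +z(+ 1 +z t))
    lem = ringℤ
  runs-odds : ∀ l a → concatMap(λ c → run c l)(odds a N) ↭ odds a(l *n N)
  runs-odds zero a = empty(odds a N)where
   empty : ∀ cs → concatMap(λ c → run c 0)cs ↭ []
   empty [] = ↭-refl
   empty(c ∷ cs) = empty cs
  runs-odds(suc l)a = ↭-trans(heads(odds a N))(↭-trans(++⁺ˡ(odds a N)(↭-trans(↭-reflexive(tails N a))(runs-odds l(a +n(N +n N)))))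
   (↭-reflexive(E.sym(odds-++ a N(l *n N)))))where
   heads : ∀ cs → concatMap(λ c → run c(suc l))cs ↭ cs ++ concatMap(λ c → run(c +z D)l)cs
   heads [] = ↭-refl
   heads(c ∷ cs) = prep c(↭-trans(++⁺ˡ(run(c +z D)l)(heads cs))(shifts(run(c +z D)l)cs))
   tails : ∀ k a → concatMap(λ c → run(c +z D)l)(odds a k) ≡ concatMap(λ c → run c l)(odds(a +n(N +n N))k)
   tails zero a = rfl
   tails(suc k)a = cong(run(+ suc a +z D)l ++_)(tails k(suc(suc a)))
module Centres(R : Ring)(χ : Char R)(𝓕 : Filt R χ)(μ J r d : ℕ)(μ≡ : μ ≡ r +n r +n d)where
 open CommutativeRing R hiding (zero) renaming (*-congˡ to *ˡ; +-congˡ to +ˡ; -‿cong to -ᶜ; *-cong to *c; trans to infixr 1 _·_)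
 open CharProperties R χ
 open Filt 𝓕
 open RingSolver R
 open Sums R
 open SignedSums R
 open Congruences R χ 𝓕
 open TupleSums R
 open Trunc R χ 𝓕 μ J using (M; D≢0; down-small; admissible; small)
 open ConfigWeights R χ M J using (T-^)
 open ConfigSteps R χ M J using (Apart)
 open ConfigSums R χ M J using (elements; chain-pair)
 open ChainSteps R χ M using (D; run; Off; Off-neg)
 open ChainProducts R χ 𝓕 μ J using (centred; two; chains; elements-chains; inf; chain-product; inf-unit; Positive-+)
 open ColumnAsymptotics R χ 𝓕 μ J using (Separate; Positive; alphabet; stack-↭; alphabet-Good)
 open Symm R χ M using (Good; Good-resp-↭; π; ππ)
 open Bounded R χ M using (symm; symm-0)
 open Evals R χ M
 open SplitSums R χ D
 open BracketProducts R χ 𝓕 J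
 centred-positive : All Positive(centred r)
 centred-positive = (μ , rfl) ∷ go(down-small r d μ≡)where
  open Trunc R χ 𝓕 μ J using (Small)
  go : ∀ {is} → All Small is → All Positive(concatMap two is)
  go [] = []
  go{i ∷ is}(small u v e f ∷ ss) = (v , E.trans(cong(λ x → x +z(i +z i))f)(lem1 i(+ suc v))) ∷ (u , E.trans(cong(λ x → x -z(i +z i))e)
   (lem2 i(+ suc u))) ∷ go ss where
   lem1 : ∀ i v → -z(i +z i) +z v +z(i +z i) ≡ v
   lem1 = ringℤ
   lem2 : ∀ i v → (i +z i) +z v -z(i +z i) ≡ v
   lem2 = ringℤ
 centred-separate : Separate(centred r)
 centred-separate = central(proj₁ adm) ∷ lateral(proj₁ adm)(proj₂ adm)where
  adm = admissible r d μ≡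
  Off-≡ : ∀ {x y} → x ≡ y → Off x → Off y
  Off-≡ = subst Off
  Self : ℤ → Set
  Self i = Off(i +z i) × Off((i +z i) +z(i +z i))
  central : ∀ {is} → All Self is → All(λ c → Off(M -z c))(concatMap two is)
  central [] = []
  central{i ∷ is}((o , _) ∷ os) = Off-≡ (lem1 M(i +z i))(Off-neg o) ∷ Off-≡ (lem2 M(i +z i))o ∷ central os where
   lem1 : ∀ M i → -z i ≡ M -z(M +z i)
   lem1 = ringℤ
   lem2 : ∀ M i → i ≡ M -z(M -z i)
   lem2 = ringℤ
  above : ∀ {i is} → All(Apart D≢0 i)is → All(λ c → Off(M +z(i +z i) -z c))(concatMap two is) × All(λ c → Off(M -z(i +z i) -z c))(concatMap
   two is)
  above [] = [] , []
  above{i}{j ∷ is}((p , q) ∷ os)with above{i}os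
  ... | x , y = (Off-≡ (l1 M(i +z i)(j +z j))q ∷ Off-≡ (l2 M(i +z i)(j +z j))p ∷ x) , (Off-≡ (l3 M(i +z i)(j +z j))(Off-neg p) ∷ Off-≡ (l4 M
   (i +z i)(j +z j))(Off-neg q) ∷ y)where
   l1 : ∀ M i j → i -z j ≡ M +z i -z(M +z j)
   l1 = ringℤ
   l2 : ∀ M i j → i +z j ≡ M +z i -z(M -z j)
   l2 = ringℤ
   l3 : ∀ M i j → -z(i +z j) ≡ M -z i -z(M +z j)
   l3 = ringℤ
   l4 : ∀ M i j → -z(i -z j) ≡ M -z i -z(M -z j)
   l4 = ringℤ
  lateral : ∀ {is} → All Self is → AllPairs(Apart D≢0)is → Separate(concatMap two is)
  lateral [] [] = []
  lateral{i ∷ is}((_ , o) ∷ os)(a ∷ as)with above{i}a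
  ... | x , y = (Off-≡ (lem M(i +z i))o ∷ x) ∷ y ∷ lateral os as where
   lem : ∀ M i → i +z i ≡ M +z i -z(M -z i)
   lem = ringℤ
 Separate-↭ : ∀ {xs ys} → xs ↭ ys → Separate xs → Separate ys
 Separate-↭ P.refl s = s
 Separate-↭ (prep x p)(a ∷ s) = All-resp-↭ p a ∷ Separate-↭ p s
 Separate-↭ (swap x y p)((b ∷ a) ∷ (c ∷ s)) = (subst Off(lem x y)(Off-neg b) ∷ All-resp-↭ p c) ∷ (All-resp-↭ p a ∷ Separate-↭ p s)where
  lem : ∀ x y → -z(x -z y) ≡ y -z x
  lem = ringℤ
 Separate-↭ (P.trans p q)s = Separate-↭ q(Separate-↭ p s)
 alphabet-chains : ∀ cs → alphabet cs ↭ chains cs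
 alphabet-chains [] = ↭-refl
 alphabet-chains(c ∷ cs) = ↭-trans(stack-↭ c J(alphabet cs))(++⁺ˡ(run c J)(alphabet-chains cs))
 elements-Good : Good(elements(down⁺ r))
 elements-Good = Good-resp-↭ (↭-trans(alphabet-chains(centred r))(↭-reflexive(E.sym(elements-chains r))))(alphabet-Good centred-positive
  centred-separate)
 symm-↭ : ∀ n{S S'} → S ↭ S' → symm n S ≈ symm n S'
 symm-↭ n = spl-↭ (λ p q → *c(^ᵣ-cong n(∏-↭ _ p))(Ξ-↭ (++⁺ (map⁺ _ p)q)))
 poch-inf : symm 0(elements(down⁺ r)) ≈ inf M [ J ]
 poch-inf = ≈[]-trans(≈[]-rfl(symm-0 _ elements-Good · go(length(elements(down⁺ r)))))(stable-≤ (λ j → ⟦ M +z D *z + j ⟧)(N.≤-trans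
  (N.≤-reflexive(E.sym(length-run M J)))(N.≤-trans(N.m≤m+n(length(run M J))(length(concatMap chain-pair(down⁺ r))))(N.≤-reflexive(E.sym
  (length-++ (run M J))))))(λ j → intg(Positive-unit(Positive-D* j(μ , rfl))))(λ j → Positive-≈1(N.m≤m+n J j)(Positive-D* {0}(J +n j)(μ ,
  rfl))))where
  open ChainProducts R χ 𝓕 μ J using (Positive-D*; Positive-unit; Positive-≈1)
  length-run : ∀ x l → length(run x l) ≡ l
  length-run x zero = rfl
  length-run x(suc l) = cong suc(length-run(x +z D)l)
  open Char χ
  go : ∀ n → poch² π ππ n ≈ ∏< n(λ j → ⟦ M +z D *z + j ⟧)
  go zero = refl
  go(suc n) = *-comm _ _ · *c(+ˡ(-ᶜ(*ˡ(T-^ D n) · sym(T-+ M(D *z + n)))))(go n)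
 intg-chain-product : O 0(chain-product(centred r))
 intg-chain-product = O-* (O-∏ _(All.map(λ p → O-* (intg(inf-unit p))(intg(inf-unit(Positive-+ p(μ , rfl)))))centred-positive))(go
  centred-positive)where
  go : ∀ {cs} → All Positive cs → O 0(pairs(λ c c' → inf(c +z c'))cs)
  go [] = O-1
  go(p ∷ ps) = O-* (O-∏ _(All.map(λ q → intg(inf-unit(Positive-+ p q)))ps))(go ps)
module Assembly(R : Ring)(χ : Char R)(ε : Embedding R χ)(2-reg : Polynomials.Regular R(CommutativeRing._+_ R(CommutativeRing.1# R)
 (CommutativeRing.1# R)))(m' r K : ℕ)where
 open CommutativeRing R hiding (zero) renaming (Carrier to |R|; *-congˡ to *ˡ; *-congʳ to *ʳ; *-identityˡ to 1*; *-cong to *c; reflexive to rfx; trans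
  to infixr 1 _·_)
 open Char χ
 open Embedding ε
 open RingSolver R
 open Sums R
 open CharProperties R χ
 open TupleSums R
 open EmbeddedProducts R χ ε
 open SeriesOrders R χ ε using (filtration; ≈[]⇒coeffs; coeffs⇒≈[])
 𝓕 = filtration
 open Filt 𝓕
 open Congruences R χ 𝓕
 J m μ N L : ℕ
 J = suc K
 m = suc m'
 μ = r +n r
 N = suc μ
 L = J *n N
 J≤L : J ≤ L
 J≤L = N.m≤m*n J N
 open Duals R χ 𝓕 2-reg m r J using (symm-dual; module TA; module TB; module SA; module SB; module ZA; module ΞA; module ΞB)
 module CA = Centres R χ 𝓕 μ J r 0(E.sym(N.+-identityʳ μ))
 module CB = Centres R χ 𝓕(μ +n m)J r m rfl
 open ColumnAsymptotics R χ 𝓕 μ J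
 open OddProducts R χ 𝓕 J hiding (N)
 open BracketProducts R χ 𝓕 J
 module PB = ChainProducts R χ 𝓕(μ +n m)J
 module PA = ChainProducts R χ 𝓕 μ J
 is elA elB cs : List ℤ
 is = down⁺ r
 elA = SA.elements is
 elB = SB.elements is
 cs = odds 0 N
 intg-embed : ∀ f → O 0(embed f)
 intg-embed f = SeriesOrders.order f(sym(*ʳ T-0 · 1* _))
 cs↭ : cs ↭ PA.centred r
 cs↭ = odds-centred r r 0 rfl
 cs-positive : All Positive cs
 cs-positive = All-resp-↭ (↭-sym cs↭)CA.centred-positive
 cs-separate : Separate cs
 cs-separate = CA.Separate-↭ (↭-sym cs↭)CA.centred-separate
 partial-sums≈symm : ∀ k → embed(EmbeddedFamilies.partial-sums R χ ε μ J(k +n length(alphabet cs))m') ≈ ZA.symm m elA [ J ]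
 partial-sums≈symm k = ≈[]-trans(≈[]-rfl(EF.embed-partial-sums · rfx(cong(λ cs → ∑≤ m B(λ ns → EF.h-weight ns * columns m(+ 1 ∷ cs)ns))
  (starts-odds 1 μ))))(≈[]-trans(∑≤-≈[] m B(λ ns → ≈[]-*ˡ(intg-h-weight ns)(columns≈HL m cs-positive cs-separate ns)))(≈[]-rfl(∑≤-bounded m' k
  (alphabet cs) · ZA.bounded≈symm m'(alphabet cs)(alphabet-Good cs-positive cs-separate)
  · CA.symm-↭ m(↭-trans(CA.alphabet-chains cs)(↭-trans(concatMap-↭ {λ c → ChainSteps.run R χ TA.M c J}cs↭)(↭-reflexive(E.sym
  (PA.elements-chains r))))))))where
  B = k +n length(alphabet cs)
  module EF = EmbeddedFamilies R χ ε μ J B m'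
  starts-odds : ∀ c k → EF.starts c k ≡ odds(suc c)k
  starts-odds c zero = rfl
  starts-odds c(suc k) = cong(+ suc(suc c) ∷_)(starts-odds(suc(suc c))k)
  ≈[]-*ˡ : ∀ {n x y z} → O 0 z → x ≈ y [ n ] → z * x ≈ z * y [ n ]
  ≈[]-*ˡ o p = O-cong(solve 3(λ x y z → (x :- y) :* z := z :* x :- z :* y)refl _ _ _)(O-*0 p o)
  intg-h : ∀ n → O 0(ZA.h n)
  intg-h zero = O-1
  intg-h(suc n) = O-* (O-+ O-1(intg-^ (suc n)(O-T≥ N 0)))(intg-h n)
  intg-h-weight : ∀ ns → O 0(EF.h-weight ns)
  intg-h-weight(n ∷ ns) = O-* O-1(go ns)where
   go : ∀ {k}(ns : Vec ℕ k) → O 0(vector-weight ZA.h ns)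
   go [] = O-1
   go(n ∷ ns) = O-* (intg-h n)(go ns)
 denom : |R|
 denom = O1 L J≤L * E L J≤L ^ᵣ suc r
 Ξ-denom : ΞA.Ξ elA * denom ≈ G r [ J ]
 Ξ-denom = ≈[]-trans(≈[]-rfl(*ʳ(ΞA.Ξ-↭ (↭-trans(↭-reflexive(PA.elements-chains r))(↭-trans(concatMap-↭ {λ c → ChainSteps.run R χ TA.M c J}
  (↭-sym cs↭))(runs-odds r J 0))))))(Ξ-odds-G r L J≤L)
 intg-denom : O 0 denom
 intg-denom = O-* (O-∏< L(λ l _ → O-⟦⟧ _))(intg(Unit-^ (suc r)(br-unit L J≤L 0 L)))
 denom-unit : Unit denom
 denom-unit = Unit-* (Unit-∏< L _(λ l → Unit-⟦⟧ (l +n l)))(Unit-^ (suc r)(br-unit L J≤L 0 L))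
 symm-denom : ∀ {x} → O 0 x → x ≈ ZA.symm m elA [ J ] → x * denom ≈ G r * PB.numer r [ J ]
 symm-denom{x}ox x≈ = ≈[]-trans(≈[]-sym(≈[]-trans(≈[]-*ʳ(O-* ox intg-denom)(PB.Ξ-chains CB.centred-positive))(≈[]-rfl(1* _))))(≈[]-trans
  (≈[]-rfl(*ʳ(*ʳ(rfx(cong ΞB.Ξ(E.sym(PB.elements-chains r))))) · solve 4(λ b p x d → (b :* p) :* (x :* d) := (x :* b) :* (p :* d))refl _ _ _
  _))(≈[]-trans(≈[]-*ʳ(O-* CB.intg-chain-product intg-denom)(≈[]-trans(≈[]-*ʳ(TB.intg-Ξ elB)x≈)symm-dual))(≈[]-trans(≈[]-rfl(solve 4(λ s a
  p d → s :* a :* (p :* d) := s :* (p :* (a :* d)))refl _ _ _ _))(≈[]-trans(≈[]-* (O-* CB.intg-chain-product(≈[]-intg intg-G Ξ-denom))(intg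
  (PB.inf-unit{0}{TB.M}(μ +n m , rfl)))CB.poch-inf(≈[]-*ˡ CB.intg-chain-product Ξ-denom))(≈[]-rfl(sym(*-assoc _ _ _)
  · *ʳ(sym(PB.numer-product r)) · *-comm _ _))))))where
  ≈[]-*ˡ : ∀ {n x y z} → O 0 z → x ≈ y [ n ] → z * x ≈ z * y [ n ]
  ≈[]-*ˡ o p = O-cong(solve 3(λ x y z → (x :- y) :* z := z :* x :- z :* y)refl _ _ _)(O-*0 p o)
  intg-G : O 0(G r)
  intg-G = O-∏< (suc r)(λ j _ → O-∏< j(λ i _ → O-* (O-⟦⟧ _)(O-⟦⟧ _)))
 ≈[]-^ : ∀ {x y}k → O 0 y → x ≈ y [ J ] → x ^ᵣ k ≈ y ^ᵣ k [ J ]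
 ≈[]-^ zero o e = ≈[]-rfl refl
 ≈[]-^ (suc k)o e = ≈[]-* (intg-^ k(≈[]-intg o e))o e(≈[]-^ k o e)
 embed-pow : ∀ f k → embed(powS f k) ≈ embed f ^ᵣ k
 embed-pow f zero = embed-one
 embed-pow f(suc k) = embed-⊛ f(powS f k) · *ˡ(embed-pow f k)
 embed-pochInf : ∀ α b k → J ≤ k → embed(pochInf(+ 1)α(suc b)) ≈ ∏< k(λ j → ⟦ + (α +n j *n suc b) ⟧) [ J ]
 embed-pochInf α b k J≤k = ≈[]-trans(coeffs⇒≈[]{K}{pochInf(+ 1)α(suc b)}{poch(+ 1)α(suc b)k}agree)(≈[]-rfl(embed-poch α(suc b)k))
  where
  φ : ℕ → |R|
  φ j = ⟦ + (α +n j *n suc b) ⟧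
  agree : ∀ j → j ≤ K → poch(+ 1)α(suc b)(suc j)j ≡ poch(+ 1)α(suc b)k j
  agree j j≤K = ≈[]⇒coeffs{j}{poch(+ 1)α(suc b)(suc j)}{poch(+ 1)α(suc b)k}(≈[]-trans(≈[]-rfl(embed-poch α(suc b)(suc j)))(≈[]-trans
   (≈[]-sym(Bj.stable-≤ φ(N.≤-trans(s≤s j≤K)J≤k)(λ i → O-⟦⟧ _)(λ i → Bj.⟦⟧≈1-≥ (N.≤-trans(N.m≤m+n(suc j)i)(N.≤-trans(N.m≤m*n(suc j +n i)
   (suc b))(N.m≤n+m _ α))))))(≈[]-rfl(sym(embed-poch α(suc b)k)))))j N.≤-refl where
   module Bj = BracketProducts R χ 𝓕(suc j)
 κ : ℕ
 κ = suc(μ +n m)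
 open PB using (inf; inf-cong; d; θ; numer)
 inf-natural : ∀ α → ∏< J(λ j → ⟦ + (α +n j *n(2 *n κ)) ⟧) ≈ inf(+ α)
 inf-natural α = ∏<-cong J(λ j _ → ⟦⟧-cong(cong(λ z → + α +z z)(E.trans(Z.pos-* j(2 *n κ))(E.trans(cong(λ z → + j *z z)(Z.pos-* 2 κ))(lem
  (+ κ)(+ j))))))where
  lem : ∀ κ j → j *z(+ 2 *z κ) ≡ (κ +z κ) *z j
  lem = ringℤ
 intg-inf : ∀ α → O 0(inf(+ α))
 intg-inf α = O-cong(inf-natural α)(O-∏< J(λ j _ → O-⟦⟧ _))
 embed-inf : ∀ α → embed(pochInf(+ 1)α(2 *n κ)) ≈ inf(+ α) [ J ]
 embed-inf α = ≈[]-trans(embed-pochInf α(μ +n m +n(κ +n 0))J N.≤-refl)(≈[]-rfl(inf-natural α))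
 embed-theta : ∀ α β → α +n β ≡ 2 *n κ → embed(theta α(2 *n κ)) ≈ inf(+ α) * inf(+ β) [ J ]
 embed-theta α β e = ≈[]-trans(≈[]-rfl(embed-⊛ (pochInf(+ 1)α(2 *n κ))(pochInf(+ 1)(2 *n κ ∸ α)(2 *n κ))))(≈[]-* (intg-embed(pochInf(+ 1)
  (2 *n κ ∸ α)(2 *n κ)))(intg-inf α)(embed-inf α)(subst(λ z → embed(pochInf(+ 1)z(2 *n κ)) ≈ inf(+ β) [ J ])(E.sym(E.trans(cong(_∸ α)
  (E.sym e))(N.m+n∸m≡n α β)))(embed-inf β)))
 embed-θ : ∀ i e → i +n e ≡ r → embed(theta(2 *n i +n m +n 1)(2 *n κ)) ≈ θ e [ J ]
 embed-θ i e rfl = ≈[]-trans(embed-theta(2 *n i +n m +n 1)(κ +n(e +n e))(lem1 i e m))(≈[]-rfl(*ʳ(inf-cong(E.sym(E.trans(lem2(+ i)(+ e)(+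
  m))(cong(λ z → z +z + m +z + 1)(E.sym(Z.pos-* 2 i))))))))where
  lem1 : ∀ i e m → 2 *n i +n m +n 1 +n(suc(i +n e +n(i +n e) +n m) +n(e +n e)) ≡ 2 *n suc(i +n e +n(i +n e) +n m)
  lem1 = ringℕ
  lem2 : ∀ i e m → (+ 1 +z(i +z e +z(i +z e) +z m)) -z(e +z e) ≡ + 2 *z i +z m +z + 1
  lem2 = ringℤ
 embed-d : ∀ a → a < κ → 0 < a → embed(theta(2 *n a)(2 *n κ)) ≈ ⟨ a ⟩ * d(+ a) [ J ]
 embed-d(suc a)l _ = ≈[]-trans(embed-theta(2 *n suc a)(2 *n(κ ∸ suc a))(E.trans(E.sym(N.*-distribˡ-+ 2(suc a)(κ ∸ suc a)))(cong(2 *n_)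
  (N.m+[n∸m]≡n(N.<⇒≤ l)))))(≈[]-trans(≈[]-* (intg-inf(2 *n(κ ∸ suc a)))(O-* (O-⟦⟧ (suc a +n suc a))(intg-inf(κ +n κ +n(suc a +n suc a))))
  (≈[]-trans(≈[]-rfl(inf-cong(cong +_(twice(suc a)))))(PB.inf-shift{0}(a +n suc a , rfl)))(≈[]-rfl(inf-cong complement)))(≈[]-rfl(*-assoc
  _ _ _)))where
  twice : ∀ a → 2 *n a ≡ a +n a
  twice a = cong(a +n_)(N.+-identityʳ a)
  complement : + (2 *n(κ ∸ suc a)) ≡ (+ κ +z + κ) -z(+ suc a +z + suc a)
  complement = E.trans(cong +_(twice(κ ∸ suc a)))(E.trans(cong(λ z → z +z z)(E.sym(E.trans(Z.m-n≡m⊖n κ(suc a))(Z.⊖-≥ (N.<⇒≤ l)))))(lem(+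
   κ)(+ suc a)))where
   lem : ∀ κ a → (κ -z a) +z(κ -z a) ≡ (κ +z κ) -z(a +z a)
   lem = ringℤ
 thetas : ℕ → ℕ → Series
 thetas j i = theta(2 *n(j ∸ i))(2 *n κ) ⊛ theta(2 *n(i +n j))(2 *n κ)
 embed-thetas : ∀ j i → j ≤ r → i < j → embed(thetas j i) ≈ ⟨ j ∸ i ⟩ * ⟨ i +n j ⟩ * (d(+ j -z + i) * d(+ i +z + j)) [ J ]
 embed-thetas j i j≤r i<j = ≈[]-trans(≈[]-rfl(embed-⊛ (theta(2 *n(j ∸ i))(2 *n κ))(theta(2 *n(i +n j))(2 *n κ))))(≈[]-trans(≈[]-*
  (intg-embed(theta(2 *n(i +n j))(2 *n κ)))(≈[]-intg(intg-embed _)(≈[]-sym p))p(embed-d(i +n j)(N.≤-<-trans(N.+-mono-≤ (N.≤-trans(N.<⇒≤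
  i<j)j≤r)j≤r)(s≤s(N.m≤m+n μ m)))(N.≤-trans(N.≤-trans(s≤s z≤n)i<j)(N.m≤n+m j i))))(≈[]-rfl(*-interchange _ _ _ _
  · *ˡ(*ʳ(rfx(cong d(E.sym(E.trans(Z.m-n≡m⊖n j i)(Z.⊖-≥ (N.<⇒≤ i<j))))))))))where
  p = embed-d(j ∸ i)(N.≤-<-trans(N.m∸n≤m j i)(N.≤-<-trans j≤r(s≤s(N.≤-trans(N.m≤m+n r r)(N.m≤m+n μ m)))))(N.m<n⇒0<n∸m i<j)
 numers denoms : Series
 numers = powS(pochInf(+ 1)(2 *n κ)(2 *n κ))(suc r) ⊛ prodS(map(λ i → theta(2 *n i +n m +n 1)(2 *n κ))(upTo(suc r))) ⊛ prodS(concatMap(λ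
  j → map(thetas j)(upTo j))(upTo(suc r)))
 denoms = powS(pochInf(+ 1)2 2)r ⊛ pochInf(+ 1)1 1
 embed-numers : embed numers ≈ G r * numer r [ J ]
 embed-numers = ≈[]-trans(≈[]-rfl(embed-⊛ (a ⊛ b)c · *c(embed-⊛ a b · *c(embed-pow _(suc r))(embed-prodS _(upTo(suc r))
  · ∏-upTo(suc r)_))(embed-concatMap(λ j → map(thetas j)(upTo j))(upTo(suc r)) · ∏-upTo(suc r)_
  · ∏<-cong(suc r)(λ j _ → _·_(embed-prodS(thetas j)(upTo j))(∏-upTo j(λ i → embed(thetas j i)))))))(≈[]-trans(≈[]-* (O-∏< (suc r)(λ j _ →
  O-∏< j(λ i _ → intg-embed(thetas j i))))(O-* (intg-^ (suc r)intg-D)(O-∏< (suc r)(λ i l → intg-θ i l)))(≈[]-* (O-∏< (suc r)(λ i _ →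
  intg-embed _))(intg-^ (suc r)intg-D)(≈[]-^ (suc r)intg-D(≈[]-trans(embed-inf(2 *n κ))(≈[]-rfl(inf-cong(cong(λ z → + (κ +n z))
  (N.+-identityʳ κ))))))(≈[]-trans(∏<-≈[](suc r)(λ i l → intg-θ' i)(λ i l → embed-θ i(r ∸ i)(N.m+[n∸m]≡n(N.≤-pred l))))(≈[]-rfl(∏<-reverse r
  θ))))(∏<-≈[](suc r)(λ j l → O-∏< j(λ i l' → intg-pair j i(N.≤-pred l)l'))(λ j l → ∏<-≈[] j(λ i l' → intg-pair j i(N.≤-pred l)l')(λ i l' →
  embed-thetas j i(N.≤-pred l)l'))))(≈[]-rfl(*ˡ(∏<-cong(suc r)(λ j _ → ∏<-* j _ _) · ∏<-* (suc r)γ _)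
  · solve 4(λ p t g d → p :* t :* (g :* d) := g :* (p :* t :* d))refl _ _ _ _)))where
  a = powS(pochInf(+ 1)(2 *n κ)(2 *n κ))(suc r)
  b = prodS(map(λ i → theta(2 *n i +n m +n 1)(2 *n κ))(upTo(suc r)))
  c = prodS(concatMap(λ j → map(thetas j)(upTo j))(upTo(suc r)))
  intg-D : O 0(inf(+ κ +z + κ))
  intg-D = intg-inf(κ +n κ)
  intg-θ : ∀ e → e < suc r → O 0(θ e)
  intg-θ e l = ≈[]-intg(intg-embed _)(≈[]-sym(embed-θ(r ∸ e)e(N.m∸n+n≡m(N.≤-pred l))))
  intg-θ' : ∀ i → O 0(θ(r ∸ i))
  intg-θ' i = intg-θ(r ∸ i)(s≤s(N.m∸n≤m r i))
  intg-pair : ∀ j i → j ≤ r → i < j → O 0(⟨ j ∸ i ⟩ * ⟨ i +n j ⟩ * (d(+ j -z + i) * d(+ i +z + j)))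
  intg-pair j i l l' = ≈[]-intg(intg-embed(thetas j i))(≈[]-sym(embed-thetas j i l l'))
 embed-denoms : embed denoms ≈ denom [ J ]
 embed-denoms = ≈[]-trans(≈[]-rfl(embed-⊛ (powS(pochInf(+ 1)2 2)r)(pochInf(+ 1)1 1)
  · *ʳ(embed-pow(pochInf(+ 1)2 2)r)))(≈[]-trans(≈[]-* (intg-embed(pochInf(+ 1)1 1))(intg-^ r(intg E-unit))(≈[]-^ r(intg E-unit)
  (≈[]-trans(embed-pochInf 2 1 L J≤L)(≈[]-rfl(∏<-cong L(λ j _ → ⟦⟧-cong(cong +_(even j)))))))(≈[]-trans(embed-pochInf 1 0(L +n L)(N.≤-trans
  J≤L(N.m≤m+n L L)))(≈[]-rfl(halves L))))(≈[]-rfl(solve 3(λ p o e → p :* (o :* e) := o :* (e :* p))refl _ _ _)))where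
  E-unit = br-unit L J≤L 0 L
  even : ∀ j → 2 +n j *n 2 ≡ suc j +n suc j
  even = ringℕ
  halves : ∀ l → ∏< (l +n l)(λ j → ⟦ + (1 +n j *n 1) ⟧) ≈ ∏< l(λ i → ⟦ + (1 +n(i +n i)) ⟧) * br 1 l
  halves zero = sym(1* 1#)
  halves(suc l) = rfx(cong(λ n → ∏< n(λ j → ⟦ + (1 +n j *n 1) ⟧))(cong suc(N.+-suc l l)))
   · *c(⟦⟧-cong(cong +_(e1 l)))(*c(⟦⟧-cong(cong +_(e2 l)))(halves l))
   · solve 4(λ a b c d → a :* (b :* (c :* d)) := b :* c :* (a :* d))refl _ _ _ _ where
   e1 : ∀ l → 1 +n suc(l +n l) *n 1 ≡ suc l +n suc l
   e1 = ringℕ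
   e2 : ∀ l → 1 +n(l +n l) *n 1 ≡ 1 +n(l +n l)
   e2 = ringℕ
 quotient-law : embed(numers ⊛ invS denoms) * embed denoms ≈ embed numers
 quotient-law = *ʳ(embed-⊛ numers(invS denoms)) · solve 3(λ a b c → a :* b :* c := a :* (c :* b))refl _ _ _
  · *ˡ(embed-invS denoms(⊛-0(powS(pochInf(+ 1)2 2)r)(pochInf(+ 1)1 1)(pow-0 r)(poch-0(+ 1)0 1 1))) · *-identityʳ _ where
  pow-0 : ∀ k → powS(pochInf(+ 1)2 2)k 0 ≡ + 1
  pow-0 zero = rfl
  pow-0(suc k) = ⊛-0(pochInf(+ 1)2 2)(powS(pochInf(+ 1)2 2)k)(poch-0(+ 1)1 2 1)(pow-0 k)
 bound : ℕ
 bound = length(alphabet cs)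
 coefficient-identity : ∀ k → EmbeddedFamilies.partial-sums R χ ε μ J(k +n bound)m' K ≡ (numers ⊛ invS denoms)K
 coefficient-identity k = ≈[]⇒coeffs{K}{ps}{numers ⊛ invS denoms}(Unit-cancel denom-unit(≈[]-trans(symm-denom(intg-embed ps)(partial-sums≈symm
  k))(≈[]-trans(≈[]-sym embed-numers)(≈[]-trans(≈[]-rfl(sym quotient-law))(O-cong(solve 3(λ a b c → (b :- c) :* a := a :* b :- a :* c)refl _
  _ _)(O-*0 embed-denoms(intg-embed(numers ⊛ invS denoms))))))))K N.≤-refl where
  ps = EmbeddedFamilies.partial-sums R χ ε μ J(k +n bound)m'
private
 lhs-with : (m N B K : ℕ) → ℤ
 lhs-with m N B K = sumℤ(map(λ s → shiftZ(twoA s +z + colSum s 0)(calB(2 *n N)s ⊛ prodS(map(λ i → poch(-z(+ 1))N N(ext s i 0 ∸ ext s(suc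
  i)0))(upTo(m ∸ 1))))K)(filterᵇ valid(funs m(funs N(upTo(suc B))))))
 rhs-with : (m n κ : ℕ) → Series
 rhs-with m n κ = (powS(pochInf(+ 1)(2 *n κ)(2 *n κ))n ⊛ prodS(map(λ i → theta(2 *n i +n m +n 1)(2 *n κ))(upTo n)) ⊛ prodS(concatMap(λ j →
  map(λ i → theta(2 *n(j ∸ i))(2 *n κ) ⊛ theta(2 *n(i +n j))(2 *n κ))(upTo j))(upTo n))) ⊛ invS(powS(pochInf(+ 1)2 2)(n ∸ 1) ⊛ pochInf
  (+ 1)1 1)
bounded-identity : ∀ m' r K → ∃ λ B0 → ∀ B → B0 ≤ B → lhsPartial(suc m')(suc r)B K ≡ rhs(suc m')(suc r)K
bounded-identity m' r K = A.bound , λ B h → E.subst₂(λ N κ → lhs-with(suc m')N B K ≡ rhs-with(suc m')(suc r)κ K)(lem1 r)(lem2 r m')(subst(λ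
 B → lhs-with(suc m')(suc(r +n r))B K ≡ rhs-with(suc m')(suc r)(suc(r +n r +n suc m'))K)(N.m∸n+n≡m h)(A.coefficient-identity(B ∸
 A.bound)))where
 module A = Assembly 𝕃 laurent laurentEmbedding 2-reg m' r K
 lem1 : ∀ r → suc(r +n r) ≡ n′ (suc r)
 lem1 r = E.trans(E.sym(N.+-suc r r))(cong(λ z → r +n suc z)(E.sym(N.+-identityʳ r)))
 lem2 : ∀ r m' → suc(r +n r +n suc m') ≡ suc m' +n n′ (suc r)
 lem2 r m' = E.trans(cong(_+n suc m')(lem1 r))(N.+-comm(n′ (suc r))(suc m'))

theorem1p6 : (m n : ℕ) → 1 ≤ m → 1 ≤ n → (K : ℕ) →
    ∃ λ B₀ → (B : ℕ) → B₀ ≤ B → lhsPartial m n B K ≡ rhs m n K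
theorem1p6 zero _ ()
theorem1p6 (suc m) zero _ ()
theorem1p6 (suc m) (suc n) _ _ K = bounded-identity m n K
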